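{- A graph $G$ is the planar dual of a D3-reducible graph if and only if $G$ can be constructed by gluing together a finite collection of polyhedral graphs, each of which is a wheel graph (the graph of a tetrahedron or of a pyramid).
   Context: All graphs are finite and simple. The D3 reductions are the following two operations on a graph $G$. (D3a) Let $p,q,r$ be three vertices of degree three that induce a triangle in $G$ and whose neighbors outside $\{p,q,r\}$ are three distinct vertices; replace $p,q,r$ by a single new vertex adjacent to exactly those three outside neighbors. (D3b) Let $p,q,r$ be three vertices of degree three that induce a path with middle vertex $q$, and suppose there is a single vertex $s$ adjacent to all three of $p,q,r$; delete $q$ and add a new edge from $p$ to $r$. A graph is D3-reducible if it can be transformed into a graph isomorphic to $K_4$ by a finite sequence of D3 reductions. D3-reducible graphs are planar and 3-vertex-connected, so their planar dual is well defined. A polyhedral graph is a 3-vertex-connected planar graph. Gluing: given two polyhedral graphs $G_1$ and $G_2$ with an explicit isomorphism between a triangular face $uvw$ of $G_1$ and a triangular face $u'v'w'$ of $G_2$, form the disjoint union and identify $u$ with $u'$, $v$ with $v'$, $w$ with $w'$ (keeping the triangle edges, merged). Gluing a collection of polyhedral graphs means performing repeated such gluing steps, where each triangular face of a graph in the collection takes part in at most one gluing step, and a graph is never glued to itself (neither an original graph nor the result of previous gluing steps); gluing $p$ graphs uses $p-1$ steps. A wheel graph consists of a cycle together with one extra vertex adjacent to all cycle vertices (the four-vertex wheel being $K_4$). -}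

module Defs where

open import Data.Nat using (ℕ; zero; suc; _+_; _*_; _≡ᵇ_)
open import Data.Fin using (Fin; zero; suc; toℕ; _≟_)
open import Data.Bool using (Bool; true; false; T; not; _∨_; _∧_; if_then_else_)
open import Data.Bool.Properties using (∨-comm)
open import Data.List using (List; map; allFin)
open import Data.Nat.ListAction using (sum)
open import Data.Product using (Σ; _×_; _,_; proj₁; proj₂)
open import Data.Sum using (_⊎_; inj₁; inj₂)
open import Data.Unit using (⊤; tt)
open import Relation.Nullary using (¬_; yes; no; does)
open import Relation.Binary.PropositionalEquality using (_≡_; _≢_; refl; sym; subst)
open import Relation.Binary.Construct.Closure.ReflexiveTransitive using (Star)
open import Function.Bundles using (_↔_; _⇔_; Inverse)

record Graph : Set where
  field
    n       : ℕ
    adj     : Fin n → Fin n → Bool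
    adj-sym : ∀ u v → adj u v ≡ adj v u
    adj-irr : ∀ v → adj v v ≡ false
open Graph public

V : Graph → Set
V G = Fin (n G)

Adj : (G : Graph) → V G → V G → Set
Adj G u v = T (adj G u v)

Adj-sym : (G : Graph) {u v : V G} → Adj G u v → Adj G v u
Adj-sym G {u} {v} p = subst T (adj-sym G u v) p

deg : (G : Graph) → V G → ℕ
deg G v = sum (map (λ u → if adj G v u then 1 else 0) (allFin (n G)))

dartCount : Graph → ℕ
dartCount G = sum (map (deg G) (allFin (n G)))

record _≅_ (G H : Graph) : Set where
  field
    iso  : V G ↔ V H
    pres : ∀ u v → adj H (Inverse.to iso u) (Inverse.to iso v) ≡ adj G u v

K4adj : Fin 4 → Fin 4 → Bool
K4adj u v = not (does (u ≟ v))

K4-sym : ∀ u v → K4adj u v ≡ K4adj v u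
K4-sym u v with u ≟ v | v ≟ u
... | yes _ | yes _ = refl
... | yes p | no q = Data.Empty.⊥-elim (q (sym p)) where import Data.Empty
... | no q | yes p = Data.Empty.⊥-elim (q (sym p)) where import Data.Empty
... | no _ | no _ = refl

K4-irr : ∀ v → K4adj v v ≡ false
K4-irr v with v ≟ v
... | yes _ = refl
... | no q = Data.Empty.⊥-elim (q refl) where import Data.Empty

K4 : Graph
K4 = record { n = 4 ; adj = K4adj ; adj-sym = K4-sym ; adj-irr = K4-irr }

rimStep : ℕ → ℕ → ℕ → Bool
rimStep r i j = (suc i ≡ᵇ j) ∨ ((i ≡ᵇ 0) ∧ (suc j ≡ᵇ r))

-- Wheel k : hub 0 plus a rim cycle of length 3 + k (Wheel 0 = K4)
wheelAdj : (k : ℕ) → Fin (suc (3 + k)) → Fin (suc (3 + k)) → Bool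
wheelAdj k zero    zero    = false
wheelAdj k zero    (suc _) = true
wheelAdj k (suc _) zero    = true
wheelAdj k (suc i) (suc j) = rimStep (3 + k) (toℕ i) (toℕ j) ∨ rimStep (3 + k) (toℕ j) (toℕ i)

wheel-sym : ∀ k u v → wheelAdj k u v ≡ wheelAdj k v u
wheel-sym k zero    zero    = refl
wheel-sym k zero    (suc _) = refl
wheel-sym k (suc _) zero    = refl
wheel-sym k (suc i) (suc j) = ∨-comm (rimStep (3 + k) (toℕ i) (toℕ j)) _

private
  suc≢ᵇ : ∀ i → (suc i ≡ᵇ i) ≡ false
  suc≢ᵇ zero    = refl
  suc≢ᵇ (suc i) = suc≢ᵇ i

  rim-irr : ∀ k i → rimStep (3 + k) i i ≡ false
  rim-irr k zero    = refl
  rim-irr k (suc i) rewrite suc≢ᵇ i = refl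

wheel-irr : ∀ k v → wheelAdj k v v ≡ false
wheel-irr k zero = refl
wheel-irr k (suc i) rewrite rim-irr k (toℕ i) = refl

Wheel : ℕ → Graph
Wheel k = record { n = suc (3 + k) ; adj = wheelAdj k ; adj-sym = wheel-sym k ; adj-irr = wheel-irr k }

IsWheel : Graph → Set
IsWheel G = Σ ℕ λ k → G ≅ Wheel k

Out3 : {A : Set} → A → A → A → A → Set
Out3 x p q r = x ≢ p × x ≢ q × x ≢ r

record D3a (G H : Graph) : Set where
  field
    p q r a b c : V G
    deg-p : deg G p ≡ 3
    deg-q : deg G q ≡ 3
    deg-r : deg G r ≡ 3
    pq : Adj G p q
    qr : Adj G q r
    pr : Adj G p r
    pa : Adj G p a
    qb : Adj G q b
    rc : Adj G r c
    a-out : Out3 a p q r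
    b-out : Out3 b p q r
    c-out : Out3 c p q r
    a≢b : a ≢ b
    b≢c : b ≢ c
    a≢c : a ≢ c
    φ : V H ↔ ((Σ (V G) λ x → Out3 x p q r) ⊎ ⊤)
    adj-old : ∀ x y → adj H (Inverse.from φ (inj₁ x)) (Inverse.from φ (inj₁ y)) ≡ adj G (proj₁ x) (proj₁ y)
    adj-new : ∀ x → T (adj H (Inverse.from φ (inj₁ x)) (Inverse.from φ (inj₂ tt)))
                    ⇔ (proj₁ x ≡ a ⊎ proj₁ x ≡ b ⊎ proj₁ x ≡ c)

record D3b (G H : Graph) : Set where
  field
    p q r s : V G
    deg-p : deg G p ≡ 3
    deg-q : deg G q ≡ 3
    deg-r : deg G r ≡ 3
    pq : Adj G p q
    qr : Adj G q r
    ¬pr : ¬ Adj G p r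
    p≢r : p ≢ r
    sp : Adj G s p
    sq : Adj G s q
    sr : Adj G s r
    φ : V H ↔ (Σ (V G) λ x → x ≢ q)
    adj-H : ∀ x y → T (adj H (Inverse.from φ x) (Inverse.from φ y))
                    ⇔ (Adj G (proj₁ x) (proj₁ y) ⊎ (proj₁ x ≡ p × proj₁ y ≡ r) ⊎ (proj₁ x ≡ r × proj₁ y ≡ p))

D3Step : Graph → Graph → Set
D3Step G H = D3a G H ⊎ D3b G H

data D3Reducible : Graph → Set where
  done : ∀ {G} → G ≅ K4 → D3Reducible G
  step : ∀ {G H} → D3Step G H → D3Reducible H → D3Reducible G

iter : {A : Set} → (A → A) → ℕ → A → A
iter f zero    x = x
iter f (suc k) x = f (iter f k x)

Dart : Graph → Set
Dart G = Σ (V G × V G) λ e → Adj G (proj₁ e) (proj₂ e)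

rev : (G : Graph) → Dart G → Dart G
rev G ((u , v) , p) = (v , u) , Adj-sym G p

record RotSys (G : Graph) : Set where
  field
    σ     : V G → V G → V G
    σ-adj : ∀ v u → Adj G v u → Adj G v (σ v u)
    σ-inj : ∀ v u u' → Adj G v u → Adj G v u' → σ v u ≡ σ v u' → u ≡ u'
    σ-cyc : ∀ v u w → Adj G v u → Adj G v w → Σ ℕ λ k → iter (σ v) k u ≡ w
open RotSys public

faceStep : {G : Graph} → RotSys G → Dart G → Dart G
faceStep {G} ρ ((u , v) , p) = (v , σ ρ v u) , σ-adj ρ v u (Adj-sym G p)

-- A plane embedding of G with m faces: a rotation system whose face
-- orbits are labelled bijectively by Fin m, G connected, Euler's formula
-- V − E + F = 2 (written 2V + 2F = #darts + 4).
record PlaneEmbedding (G : Graph) (m : ℕ) : Set where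
  field
    rot        : RotSys G
    face       : Dart G → Fin m
    face-orbit : ∀ d d' → (face d ≡ face d')
                          ⇔ (Σ ℕ λ k → proj₁ (iter (faceStep rot) k d) ≡ proj₁ d')
    face-surj  : ∀ f → Σ (Dart G) λ d → face d ≡ f
    connected  : ∀ u v → Star (Adj G) u v
    euler      : 2 * n G + 2 * m ≡ dartCount G + 4
open PlaneEmbedding public

IsDual : Graph → Graph → Set
IsDual G H = Σ (PlaneEmbedding H (n G)) λ E →
  ∀ a b → Adj G a b ⇔ (Σ (Dart H) λ d → face E d ≡ a × face E (rev H d) ≡ b)

TriFace : (G : Graph) → V G → V G → V G → Set
TriFace G x y z = Σ ℕ λ m → Σ (PlaneEmbedding G m) λ E →
  Adj G x y × Adj G y z × Adj G z x ×
  σ (rot E) y x ≡ z × σ (rot E) z y ≡ x × σ (rot E) x z ≡ y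

Tri : Graph → Set₁
Tri G = V G → V G → V G → Set

-- {x,y,z} = {u,v,w} (for triples of distinct vertices)
SameTriple : {A : Set} → A → A → A → A → A → A → Set
SameTriple x y z u v w =
  (x ≡ u ⊎ x ≡ v ⊎ x ≡ w) × (y ≡ u ⊎ y ≡ v ⊎ y ≡ w) × (z ≡ u ⊎ z ≡ v ⊎ z ≡ w)

record GlueOf (G₁ G₂ H : Graph) (u v w : V G₁) (u' v' w' : V G₂) : Set where
  field
    φ : V H ↔ (V G₁ ⊎ (Σ (V G₂) λ t → Out3 t u' v' w'))
    adj₁  : ∀ x y → adj H (Inverse.from φ (inj₁ x)) (Inverse.from φ (inj₁ y)) ≡ adj G₁ x y
    adj₂  : ∀ x y → adj H (Inverse.from φ (inj₂ x)) (Inverse.from φ (inj₂ y)) ≡ adj G₂ (proj₁ x) (proj₁ y)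
    adj₁₂ : ∀ x y → T (adj H (Inverse.from φ (inj₁ x)) (Inverse.from φ (inj₂ y)))
                    ⇔ ((x ≡ u × Adj G₂ u' (proj₁ y)) ⊎ (x ≡ v × Adj G₂ v' (proj₁ y))
                        ⊎ (x ≡ w × Adj G₂ w' (proj₁ y)))

module _ {G₁ G₂ H : Graph} {u v w : V G₁} {u' v' w' : V G₂} (g : GlueOf G₁ G₂ H u v w u' v' w') where
  open GlueOf g

  ι₁ : V G₁ → V H
  ι₁ x = Inverse.from φ (inj₁ x)

  ι₂ : V G₂ → V H
  ι₂ t with t ≟ u' | t ≟ v' | t ≟ w'
  ... | yes _ | _     | _     = Inverse.from φ (inj₁ u)
  ... | no _  | yes _ | _     = Inverse.from φ (inj₁ v)
  ... | no _  | no _  | yes _ = Inverse.from φ (inj₁ w)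
  ... | no a  | no b  | no c  = Inverse.from φ (inj₂ (t , a , b , c))

  glueAvail : Tri G₁ → Tri G₂ → Tri H
  glueAvail A₁ A₂ a b c =
    (Σ (V G₁) λ x → Σ (V G₁) λ y → Σ (V G₁) λ z →
       A₁ x y z × ¬ SameTriple x y z u v w × a ≡ ι₁ x × b ≡ ι₁ y × c ≡ ι₁ z)
    ⊎ (Σ (V G₂) λ x → Σ (V G₂) λ y → Σ (V G₂) λ z →
       A₂ x y z × ¬ SameTriple x y z u' v' w' × a ≡ ι₂ x × b ≡ ι₂ y × c ≡ ι₂ z)

-- Glued G A : G is obtained by gluing a finite collection of wheels,
-- A being the triangular faces of the pieces not yet used in a gluing step.
data Glued : (G : Graph) → Tri G → Set₁ where
  piece : ∀ {G} → IsWheel G → Glued G (TriFace G)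
  glue  : ∀ {G₁ G₂ H A₁ A₂ u v w u' v' w'} →
          Glued G₁ A₁ → Glued G₂ A₂ → A₁ u v w → A₂ u' v' w' →
          (g : GlueOf G₁ G₂ H u v w u' v' w') →
          Glued H (glueAvail g A₁ A₂)

GluedFromWheels : Graph → Set₁
GluedFromWheels G = Σ (Tri G) λ A → Glued G A

module Submission where

-- A reversed step (D3a) glues a tetrahedron to a triangle of the dual.  A reversed step (D3b) splits
-- a cubic vertex of the dual; that vertex lies in a single wheel of the gluing, and splitting it
-- lengthens the rim of this wheel by one.  Hence the duals of D3-reducible graphs are glued from
-- wheels.  Conversely, a gluing can be regrouped so that its wheels arrive one at a time, each as a
-- tetrahedron that is then grown by splitting.  The first direction starts from an arbitrary
-- embedding, so it needs that the triangle of a reduction always bounds a face; otherwise, contracting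
-- the edges of a spanning tree and the dual edges of its complement would leave too few classes for
-- Euler's formula.

open import Defs
open import Data.Bool using (Bool; true; false; T; not; _∨_; _∧_; if_then_else_)
open import Data.Bool.Properties using (∨-comm; ∧-comm; T-irrelevant)
open import Data.Empty using (⊥; ⊥-elim)
open import Data.Fin using (Fin; zero; suc; toℕ; fromℕ; inject₁; opposite; _↑ˡ_; _↑ʳ_; splitAt; punchIn; punchOut; combine; _≟_)
open import Data.Fin.Permutation using (↔⇒≡)
open import Data.Fin.Properties using (all?; any?; pigeonhole; punchInᵢ≢i; punchOut-injective; punchOut-punchIn; combine-injective; ↑ˡ-injective; join-splitAt; opposite-involutive; toℕ-injective; toℕ-fromℕ; toℕ-inject₁; toℕ<n) renaming (suc-injective to fsuc-inj)
open import Data.Fin.Relation.Unary.Top using (view; ‵fromℕ; ‵inject₁; view-fromℕ; view-inject₁)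
open import Data.List using (List; []; _∷_; length; map; allFin; tabulate; _++_)
open import Data.List.Membership.Propositional using (_∈_)
open import Data.List.Membership.Propositional.Properties using (∈-map⁺; ∈-++⁺ˡ; ∈-++⁺ʳ)
open import Data.List.Properties using (map-tabulate; length-++; length-map)
open import Data.List.Relation.Unary.Any using (here; there)
open import Data.Nat using (ℕ; zero; suc; _+_; _*_; _≤_; _<_; z≤n; s≤s; _≡ᵇ_)
open import Data.Nat.ListAction using (sum)
open import Data.Nat.Properties using (+-0-commutativeMonoid; +-comm; +-assoc; +-suc; ≤-trans; ≤-refl; ≤-reflexive; n≤1+n; 1+n≰n; <-irrefl; +-cancelʳ-≡; suc-injective; m≤m+n; +-monoʳ-≤; +-monoˡ-≤; *-monoʳ-≤; *-distribˡ-+; m≤n⇒∃[o]m+o≡n; ≡ᵇ⇒≡; ≡⇒≡ᵇ)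
open import Data.Nat.Solver using (module +-*-Solver)
open import Data.Product using (Σ; ∃; ∃₂; _×_; _,_; proj₁; proj₂; uncurry)
open import Data.Product.Properties using (≡-dec)
open import Data.Sum using (_⊎_; inj₁; inj₂; [_,_]′)
open import Data.Unit using (⊤; tt)
open import Function.Base using (_∘_; id)
open import Function.Bundles using (_↔_; _⇔_; Inverse; Equivalence; mk↔ₛ′; mk⇔)
open import Relation.Binary.Construct.Closure.ReflexiveTransitive using (Star; ε; _◅_; _◅◅_)
open import Relation.Binary.PropositionalEquality using (_≡_; _≢_; refl; sym; trans; cong; cong₂; subst; subst₂; module ≡-Reasoning)
open import Relation.Nullary using (¬_; Dec; yes; no; does)
open import Relation.Nullary.Decidable using (_→-dec_; _×-dec_; _⊎-dec_; ¬?; toWitness)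
open import Algebra.Properties.CommutativeMonoid.Sum +-0-commutativeMonoid using (sum-permute) renaming (sum to vsum)

-- Each direction needs an invariant stronger than its statement. From reductions to gluings, `Fwd`
-- carries `Good`: the faces at a cubic vertex form a triangle that is still available, and distinct
-- cubic vertices have distinct sets of faces. The second clause keeps the first alive, since a
-- gluing step uses up a triangle as an unordered triple and must not take it from another cubic
-- vertex. From gluings to reductions, `Dualable` records conversely that each available triangle
-- consists of the faces at some cubic vertex (`Cov`), so that a tetrahedron can be stacked there.
-- Why a triangle bounds a face differs for the two reductions. In (D3a) all corners are cubic, and
-- any other rotation would put one face on both sides of an edge, a loop in the dual. In (D3b) the
-- vertex `s` may have any degree; there the 3-connectivity of reducible graphs shows that the rest
-- is connected without the triangle, as the counting argument requires. Faces are labels of darts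
-- with values in the vertices of the dual, and reductions are replaced by explicit inverse
-- constructions, so that no quotients occur.

T-ext : ∀ {a b} → (T a → T b) → (T b → T a) → a ≡ b
T-ext {true}  {true}  _ _ = refl
T-ext {true}  {false} f _ = ⊥-elim (f tt)
T-ext {false} {true}  _ g = ⊥-elim (g tt)
T-ext {false} {false} _ _ = refl

T→≡ : ∀ {a} → T a → a ≡ true
T→≡ {true} _ = refl

¬T→≡ : ∀ {a} → ¬ T a → a ≡ false
¬T→≡ {true}  h = ⊥-elim (h tt)
¬T→≡ {false} _ = refl

∧-l : ∀ {a b} → T (a ∧ b) → T a
∧-l {true} _ = tt

∧-r : ∀ {a b} → T (a ∧ b) → T b
∧-r {true} h = h

∧-i : ∀ {a b} → T a → T b → T (a ∧ b)
∧-i {true} _ h = h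

∨-e : ∀ {a b} → T (a ∨ b) → T a ⊎ T b
∨-e {true}  _ = inj₁ tt
∨-e {false} h = inj₂ h

∨-l : ∀ {a b} → T a → T (a ∨ b)
∨-l {true} _ = tt

∨-r : ∀ {a b} → T b → T (a ∨ b)
∨-r {true}  _ = tt
∨-r {false} h = h

not-i : ∀ {a} → ¬ T a → T (not a)
not-i {true}  h = h tt
not-i {false} _ = tt

not-e : ∀ {a} → T (not a) → ¬ T a
not-e {false} _ ()

T? : ∀ a → Dec (T a)
T? true  = yes tt
T? false = no λ ()

infix 7 _==_
_==_ : ∀ {m} → Fin m → Fin m → Bool
x == y = does (x ≟ y)

==→ : ∀ {m} {x y : Fin m} → T (x == y) → x ≡ y
==→ {x = x} {y} h with yes e ← x ≟ y = e

→== : ∀ {m} {x y : Fin m} → x ≡ y → T (x == y)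
→== {x = x} {y} e with x ≟ y
... | yes _ = tt
... | no ¬e = ⊥-elim (¬e e)

==-refl : ∀ {m} (x : Fin m) → (x == x) ≡ true
==-refl x = T→≡ (→== {x = x} refl)

==-no : ∀ {m} {x y : Fin m} → x ≢ y → (x == y) ≡ false
==-no ne = ¬T→≡ (ne ∘ ==→)

adj≢ : (G : Graph) {u v : V G} → Adj G u v → u ≢ v
adj≢ G {u} h refl = subst T (adj-irr G u) h

-- Orbits and the rotation at a single vertex

Reach : {A : Set} → (A → A) → A → A → Set
Reach f x y = Σ ℕ λ k → iter f k x ≡ y

iter-+ : {A : Set} (f : A → A) (k l : ℕ) (x : A) → iter f (k + l) x ≡ iter f k (iter f l x)
iter-+ f zero    l x = refl
iter-+ f (suc k) l x = cong f (iter-+ f k l x)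

iter-suc : {A : Set} (f : A → A) (k : ℕ) (x : A) → iter f k (f x) ≡ f (iter f k x)
iter-suc f zero    x = refl
iter-suc f (suc k) x = cong f (iter-suc f k x)

reach-refl : {A : Set} {f : A → A} {x : A} → Reach f x x
reach-refl = 0 , refl

reach-one : {A : Set} {f : A → A} {x y : A} → f x ≡ y → Reach f x y
reach-one e = 1 , e

reach-≡ : {A : Set} {f : A → A} {x y : A} → x ≡ y → Reach f x y
reach-≡ e = 0 , e

reach-trans : {A : Set} {f : A → A} {x y z : A} → Reach f x y → Reach f y z → Reach f x z
reach-trans {f = f} {x} (k , refl) (l , refl) = l + k , iter-+ f l k x

reach-inv : {A : Set} {f : A → A} (S : A → Set) → (∀ u → S u → S (f u)) →
  ∀ {x y} → S x → Reach f x y → S y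
reach-inv {f = f} S cl {x} sx (k , refl) = go k
  where
  go : ∀ k → S (iter f k x)
  go zero    = sx
  go (suc k) = cl _ (go k)

-- One step of `f` may become any number of steps of `g`, even none. This covers rotations in which
-- a neighbour has been inserted or deleted.
reach-sim : {A B : Set} {f : A → A} {g : B → B} (N : A → Set) → (∀ x → N x → N (f x)) →
  (h : A → B) → (∀ x → N x → Reach g (h x) (h (f x))) →
  ∀ {x y} → N x → Reach f x y → Reach g (h x) (h y)
reach-sim {f = f} {g} N cl h hs {x} nx (k , refl) = proj₂ (go k)
  where
  go : ∀ k → N (iter f k x) × Reach g (h x) (h (iter f k x))
  go zero    = nx , reach-refl
  go (suc k) with nk , rk ← go k = cl _ nk , reach-trans rk (hs _ nk)

-- The conditions of `RotSys` at one vertex, with neighbourhood `N` and rotation `f`. The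
-- constructions check them vertex by vertex, since at most vertices the neighbours are merely
-- renamed.
record LR {A : Set} (N : A → Set) (f : A → A) : Set where
  constructor mkLR
  field
    cl  : ∀ u → N u → N (f u)
    inj : ∀ u u' → N u → N u' → f u ≡ f u' → u ≡ u'
    cyc : ∀ u w → N u → N w → Reach f u w

rotAt : {G : Graph} (ρ : RotSys G) (v : V G) → LR (Adj G v) (σ ρ v)
rotAt ρ v = mkLR (σ-adj ρ v) (σ-inj ρ v) (σ-cyc ρ v)

mkRot : (G : Graph) (s : V G → V G → V G) → (∀ v → LR (Adj G v) (s v)) → RotSys G
mkRot G s h = record
  { σ = s ; σ-adj = λ v → LR.cl (h v) ; σ-inj = λ v → LR.inj (h v) ; σ-cyc = λ v → LR.cyc (h v) }

LR-conj : {A B : Set} {N : A → Set} {N' : B → Set} {f : A → A} {f' : B → B} → LR N f →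
  (g : A → B) (h : B → A) → (∀ u → N u → N' (g u)) → (∀ y → N' y → N (h y)) →
  (∀ u → N u → h (g u) ≡ u) → (∀ y → N' y → g (h y) ≡ y) →
  (∀ y → N' y → f' y ≡ g (f (h y))) → LR N' f'
LR-conj {N = N} {N'} {f} {f'} R g h gN hN hg gh e = mkLR
  (λ y n → subst N' (sym (e y n)) (gN _ (cl _ (hN y n))))
  (λ y y' n n' q → trans (sym (gh y n)) (trans (cong g (inj _ _ (hN y n) (hN y' n')
     (trans (sym (hg _ (cl _ (hN y n)))) (trans (cong h (trans (sym (e y n)) (trans q (e y' n'))))
       (hg _ (cl _ (hN y' n'))))))) (gh y' n')))
  (λ y w n m → subst₂ (Reach f') (gh y n) (gh w m)
     (reach-sim N cl g (λ u nu → reach-one (trans (e (g u) (gN u nu)) (cong (g ∘ f) (hg u nu))))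
       (hN y n) (cyc _ _ (hN y n) (hN w m))))
  where open LR R

LR-3 : {A : Set} {N : A → Set} {f : A → A} (x y z : A) → (∀ w → N w → w ≡ x ⊎ w ≡ y ⊎ w ≡ z) →
  N x → N y → N z → f x ≡ y → f y ≡ z → f z ≡ x → LR N f
LR-3 {N = N} {f} x y z all nx ny nz fx fy fz = mkLR cl' (λ u u' n n' e → trans (sym (f³ u n))
    (trans (cong (f ∘ f) e) (f³ u' n'))) λ u w n m → reach-trans (to u n) (from w m)
  where
  cl' : ∀ u → N u → N (f u)
  cl' u n with all u n
  ... | inj₁ refl        = subst N (sym fx) ny
  ... | inj₂ (inj₁ refl) = subst N (sym fy) nz
  ... | inj₂ (inj₂ refl) = subst N (sym fz) nx
  f³ : ∀ u → N u → f (f (f u)) ≡ u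
  f³ u n with all u n
  ... | inj₁ refl        = trans (cong (f ∘ f) fx) (trans (cong f fy) fz)
  ... | inj₂ (inj₁ refl) = trans (cong (f ∘ f) fy) (trans (cong f fz) fx)
  ... | inj₂ (inj₂ refl) = trans (cong (f ∘ f) fz) (trans (cong f fx) fy)
  to : ∀ u → N u → Reach f u x
  to u n with all u n
  ... | inj₁ refl        = reach-refl
  ... | inj₂ (inj₁ refl) = reach-trans (reach-one fy) (reach-one fz)
  ... | inj₂ (inj₂ refl) = reach-one fz
  from : ∀ u → N u → Reach f x u
  from u n with all u n
  ... | inj₁ refl        = reach-refl
  ... | inj₂ (inj₁ refl) = reach-one fx
  ... | inj₂ (inj₂ refl) = reach-trans (reach-one fx) (reach-one fy)

-- The new neighbour `z` comes between `r` and the old successor of `r`. The step of `f` out of `r`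
-- becomes two steps of `f'`, so everything stays one orbit.
LR-insert : {A B : Set} {N : A → Set} {N' : B → Set} {f : A → A} {f' : B → B} → LR N f →
  (g : A → B) (z : B) (r : A) → N r → N' z → (∀ u → N u → N' (g u)) →
  (∀ y → N' y → y ≡ z ⊎ ∃ λ u → N u × y ≡ g u) →
  (∀ u u' → g u ≡ g u' → u ≡ u') → (∀ u → g u ≢ z) →
  f' (g r) ≡ z → f' z ≡ g (f r) → (∀ u → N u → u ≢ r → f' (g u) ≡ g (f u)) →
  (∀ u → Dec (u ≡ r)) → LR N' f'
LR-insert {A} {B} {N} {N'} {f} {f'} R g z r nr nz gN all gi gz er ez eo dec = mkLR cl' inj' cyc'
  where
  open LR R
  cl' : ∀ y → N' y → N' (f' y)
  cl' y n with all y n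
  ... | inj₁ refl = subst N' (sym ez) (gN _ (cl _ nr))
  ... | inj₂ (u , nu , refl) with dec u
  ... | yes refl = subst N' (sym er) nz
  ... | no ne    = subst N' (sym (eo u nu ne)) (gN _ (cl _ nu))
  inj' : ∀ u u' → N' u → N' u' → f' u ≡ f' u' → u ≡ u'
  inj' y y' n n' e with all y n | all y' n'
  ... | inj₁ refl | inj₁ refl = refl
  ... | inj₁ refl | inj₂ (u , nu , refl) with dec u
  ... | yes refl = ⊥-elim (gz _ (trans (sym ez) (trans e er)))
  ... | no ne    = ⊥-elim (ne (sym (inj _ _ nr nu (gi _ _ (trans (sym ez) (trans e (eo u nu ne)))))))
  inj' y y' n n' e | inj₂ (u , nu , refl) | inj₁ refl with dec u
  ... | yes refl = ⊥-elim (gz _ (trans (sym ez) (trans (sym e) er)))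
  ... | no ne    = ⊥-elim (ne (inj _ _ nu nr (gi _ _ (trans (sym (eo u nu ne)) (trans e ez)))))
  inj' y y' n n' e | inj₂ (u , nu , refl) | inj₂ (u' , nu' , refl) with dec u | dec u'
  ... | yes refl | yes refl = refl
  ... | yes refl | no ne'   = ⊥-elim (gz _ (trans (sym (eo u' nu' ne')) (trans (sym e) er)))
  ... | no ne    | yes refl = ⊥-elim (gz _ (trans (sym (eo u nu ne)) (trans e er)))
  ... | no ne    | no ne'   = cong g (inj _ _ nu nu' (gi _ _ (trans (sym (eo u nu ne)) (trans e (eo u' nu' ne')))))
  st : ∀ u → N u → Reach f' (g u) (g (f u))
  st u nu with dec u
  ... | yes refl = reach-trans (reach-one er) (reach-one ez)
  ... | no ne    = reach-one (eo u nu ne)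
  gg : ∀ u w → N u → N w → Reach f' (g u) (g w)
  gg u w nu nw = reach-sim N cl g st nu (cyc u w nu nw)
  cyc' : ∀ u w → N' u → N' w → Reach f' u w
  cyc' y w n m with all y n | all w m
  ... | inj₁ refl | inj₁ refl = reach-refl
  ... | inj₁ refl | inj₂ (u , nu , refl) = reach-trans (reach-one ez) (gg _ _ (cl _ nr) nu)
  ... | inj₂ (u , nu , refl) | inj₁ refl = reach-trans (gg u r nu nr) (reach-one er)
  ... | inj₂ (u , nu , refl) | inj₂ (u' , nu' , refl) = gg u u' nu nu'

-- Here `f` skips `z`: from `r` it moves on to `p`, the successor of `z`. The retraction `h` sends
-- `z` back to `r`, so the step of `f'` into `z` becomes idle and the step out of `z` becomes the
-- one from `r` to `p`.
LR-delete : {A B : Set} {N : A → Set} {N' : B → Set} {f : A → A} {f' : B → B} → LR N' f' →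
  (g : A → B) (h : B → A) (z : B) (r p : A) → (∀ u → h (g u) ≡ u) → h z ≡ r →
  (∀ u → N u → N' (g u)) → (∀ u → N' (g u) → N u) → N p →
  (∀ y → N' y → y ≡ z ⊎ ∃ λ u → N u × y ≡ g u) →
  f' (g r) ≡ z → f' z ≡ g p → f r ≡ p → (∀ u → N u → u ≢ r → f' (g u) ≡ g (f u)) →
  (∀ u → Dec (u ≡ r)) → N r → (∀ u → g u ≢ z) → LR N f
LR-delete {A} {B} {N} {N'} {f} {f'} R g h z r p hg hz gN Ng np all er ez fr eo dec nr gz = mkLR cl' inj' cyc'
  where
  open LR R
  gi : ∀ {u u'} → g u ≡ g u' → u ≡ u'
  gi e = trans (sym (hg _)) (trans (cong h e) (hg _))
  cl' : ∀ u → N u → N (f u)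
  cl' u nu with dec u
  ... | yes refl = subst N (sym fr) np
  ... | no ne    = Ng _ (subst N' (eo u nu ne) (cl _ (gN u nu)))
  nz : N' z
  nz = subst N' er (cl _ (gN r nr))
  bad : ∀ u → N u → u ≢ r → f u ≡ p → ⊥
  bad u nu ne e = gz u (inj _ _ (gN u nu) nz (trans (eo u nu ne) (trans (cong g e) (sym ez))))
  inj' : ∀ u u' → N u → N u' → f u ≡ f u' → u ≡ u'
  inj' u u' nu nu' e with dec u | dec u'
  ... | yes refl | yes refl = refl
  ... | yes refl | no ne'   = ⊥-elim (bad u' nu' ne' (trans (sym e) fr))
  ... | no ne    | yes refl = ⊥-elim (bad u nu ne (trans e fr))
  ... | no ne    | no ne'   = gi (inj _ _ (gN u nu) (gN u' nu')
          (trans (eo u nu ne) (trans (cong g e) (sym (eo u' nu' ne')))))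
  st : ∀ y → N' y → Reach f (h y) (h (f' y))
  st y n with all y n
  ... | inj₁ refl = reach-one (trans (cong f hz) (trans fr (sym (trans (cong h ez) (hg p)))))
  ... | inj₂ (u , nu , refl) with dec u
  ... | yes refl = reach-≡ (trans (hg u) (sym (trans (cong h er) hz)))
  ... | no ne    = reach-one (trans (cong f (hg u)) (sym (trans (cong h (eo u nu ne)) (hg _))))
  cyc' : ∀ u w → N u → N w → Reach f u w
  cyc' u w nu nw = subst₂ (Reach f) (hg u) (hg w)
    (reach-sim N' cl h st (gN u nu) (cyc _ _ (gN u nu) (gN w nw)))

-- The neighbours are listed instead of counted because each of them plays its own role later. The
-- order of the list says nothing about the cyclic order of an embedding.
record Deg3 (G : Graph) (h x y z : V G) : Set where
  constructor mkD3
  field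
    ax  : Adj G h x
    ay  : Adj G h y
    az  : Adj G h z
    x≢y : x ≢ y
    y≢z : y ≢ z
    x≢z : x ≢ z
    all : ∀ w → Adj G h w → w ≡ x ⊎ w ≡ y ⊎ w ≡ z

deg3-rot : ∀ {G h x y z} → Deg3 G h x y z → Deg3 G h y z x
deg3-rot (mkD3 ax ay az n1 n2 n3 all) = mkD3 ay az ax n2 (n3 ∘ sym) (n1 ∘ sym) λ w a →
  [ inj₂ ∘ inj₂ , [ inj₁ , inj₂ ∘ inj₁ ]′ ]′ (all w a)

deg3-swap : ∀ {G h x y z} → Deg3 G h x y z → Deg3 G h x z y
deg3-swap (mkD3 ax ay az n1 n2 n3 all) = mkD3 ax az ay n3 (n2 ∘ sym) n1 λ w a →
  [ inj₁ , [ inj₂ ∘ inj₂ , inj₂ ∘ inj₁ ]′ ]′ (all w a)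

module _ {G : Graph} (ρ : RotSys G) {h x y z : V G} (d : Deg3 G h x y z) where
  open Deg3 d
  private
    f : V G → V G
    f = σ ρ h
    open LR (rotAt ρ h)

  -- If the rotation fixed `x`, the orbit of `x` would be `x` alone, although it has to reach `y`.
  rot3-cases : f x ≡ y ⊎ f x ≡ z
  rot3-cases with all _ (cl x ax)
  ... | inj₂ e = e
  ... | inj₁ e = ⊥-elim (x≢y (sym (reach-inv (_≡ x) (λ { _ refl → e }) refl (cyc x y ax ay))))

  -- The rotation is a single orbit of length three, so one of its values determines the others.
  rot3 : f x ≡ y → f y ≡ z × f z ≡ x
  rot3 e = fy , fz
    where
    fy : f y ≡ z
    fy with all _ (cl y ay)
    ... | inj₂ (inj₂ q) = q
    ... | inj₂ (inj₁ q) = ⊥-elim (x≢y (inj x y ax ay (trans e (sym q))))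
    ... | inj₁ q with reach-inv (λ u → u ≡ x ⊎ u ≡ y) (λ { _ (inj₁ refl) → inj₂ e ; _ (inj₂ refl) → inj₁ q })
                        (inj₁ refl) (cyc x z ax az)
    ... | inj₁ r = ⊥-elim (x≢z (sym r))
    ... | inj₂ r = ⊥-elim (y≢z (sym r))
    fz : f z ≡ x
    fz with all _ (cl z az)
    ... | inj₁ q = q
    ... | inj₂ (inj₁ q) = ⊥-elim (x≢z (inj x z ax az (trans e (sym q))))
    ... | inj₂ (inj₂ q) = ⊥-elim (y≢z (inj y z ay az (trans fy (sym q))))

-- Counting vertices and darts

b2n : Bool → ℕ
b2n b = if b then 1 else 0

∑ : ∀ {m} → (Fin m → ℕ) → ℕ
∑ {zero}  f = 0
∑ {suc m} f = f zero + ∑ (f ∘ suc)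

∑≡vsum : ∀ {m} (f : Fin m → ℕ) → ∑ f ≡ vsum f
∑≡vsum {zero}  f = refl
∑≡vsum {suc m} f = cong (f zero +_) (∑≡vsum (f ∘ suc))

∑-permute : ∀ {m k} (f : Fin m → ℕ) (π : Fin k ↔ Fin m) → ∑ f ≡ ∑ (f ∘ Inverse.to π)
∑-permute f π = trans (∑≡vsum f) (trans (sum-permute f π) (sym (∑≡vsum (f ∘ Inverse.to π))))

∑-distrib-+ : ∀ {m} (f g : Fin m → ℕ) → ∑ (λ i → f i + g i) ≡ ∑ f + ∑ g
∑-distrib-+ {zero}  f g = refl
∑-distrib-+ {suc m} f g = trans (cong (f zero + g zero +_) (∑-distrib-+ (f ∘ suc) (g ∘ suc)))
  (solve 4 (λ a b x y → a :+ b :+ (x :+ y) := a :+ x :+ (b :+ y)) refl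
    (f zero) (g zero) (∑ (f ∘ suc)) (∑ (g ∘ suc)))
  where open +-*-Solver

∑-cong : ∀ {m} {f g : Fin m → ℕ} → (∀ i → f i ≡ g i) → ∑ f ≡ ∑ g
∑-cong {zero}  e = refl
∑-cong {suc m} e = cong₂ _+_ (e zero) (∑-cong (e ∘ suc))

∑-zero : ∀ m → ∑ {m} (λ _ → 0) ≡ 0
∑-zero zero    = refl
∑-zero (suc m) = ∑-zero m

b2n-∧true : ∀ b → b2n b ≡ b2n (b ∧ true) + 0
b2n-∧true true  = refl
b2n-∧true false = refl

∑≡0 : ∀ {m} (f : Fin m → ℕ) → ∑ f ≡ 0 → ∀ i → f i ≡ 0
∑≡0 {suc m} f e i with f zero in q
∑≡0 {suc m} f e zero    | zero = q
∑≡0 {suc m} f e (suc i) | zero = ∑≡0 (f ∘ suc) e i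

sum-allFin : ∀ {m} (f : Fin m → ℕ) → sum (map f (allFin m)) ≡ ∑ f
sum-allFin {m} f = trans (cong sum (map-tabulate id f)) (go f)
  where
  go : ∀ {k} (g : Fin k → ℕ) → sum (tabulate g) ≡ ∑ g
  go {zero}  g = refl
  go {suc k} g = cong (g zero +_) (go (g ∘ suc))

∑-ind : ∀ {m} (x : Fin m) → ∑ (λ i → b2n (i == x)) ≡ 1
∑-ind {suc m} zero    = cong suc (∑-zero m)
∑-ind {suc m} (suc x) = ∑-ind x

∑-ind∧ : ∀ {m} (b : Bool) (x : Fin m) → ∑ (λ i → b2n (b ∧ i == x)) ≡ b2n b
∑-ind∧ {m} false x = ∑-zero m
∑-ind∧ true  x = ∑-ind x

∑∑ : ∀ {m} → (Fin m → Fin m → Bool) → ℕ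
∑∑ a = ∑ λ x → ∑ λ y → b2n (a x y)

deg≡∑ : (G : Graph) (v : V G) → deg G v ≡ ∑ (λ u → b2n (adj G v u))
deg≡∑ G v = sum-allFin λ u → b2n (adj G v u)

dartCount≡∑∑ : (G : Graph) → dartCount G ≡ ∑∑ (adj G)
dartCount≡∑∑ G = trans (sum-allFin (deg G)) (∑-cong (deg≡∑ G))

opaque
  edgeIs : ∀ {m} → Fin m → Fin m → Fin m → Fin m → Bool
  edgeIs p r x y = (x == p ∧ y == r) ∨ (x == r ∧ y == p)

  edgeIs-sym : ∀ {m} (p r x y : Fin m) → edgeIs p r x y ≡ edgeIs p r y x
  edgeIs-sym p r x y = trans (∨-comm (x == p ∧ y == r) _)
    (cong₂ _∨_ (∧-comm (x == r) _) (∧-comm (x == p) _))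

  edgeIs-e : ∀ {m} {p r x y : Fin m} → T (edgeIs p r x y) → (x ≡ p × y ≡ r) ⊎ (x ≡ r × y ≡ p)
  edgeIs-e {p = p} {r} {x} {y} h with ∨-e {x == p ∧ y == r} h
  ... | inj₁ k = inj₁ (==→ (∧-l {x == p} k) , ==→ (∧-r {x == p} k))
  ... | inj₂ k = inj₂ (==→ (∧-l {x == r} k) , ==→ (∧-r {x == r} k))

  edgeIs-i₁ : ∀ {m} (p r : Fin m) → T (edgeIs p r p r)
  edgeIs-i₁ p r = ∨-l {p == p ∧ r == r} (∧-i {p == p} (→== {x = p} refl) (→== {x = r} refl))

  edgeIs-i₂ : ∀ {m} (p r : Fin m) → T (edgeIs p r r p)
  edgeIs-i₂ p r = subst T (edgeIs-sym p r p r) (edgeIs-i₁ p r)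

  delEdge : ∀ {m} → (Fin m → Fin m → Bool) → Fin m → Fin m → Fin m → Fin m → Bool
  delEdge a p r x y = a x y ∧ not (edgeIs p r x y)

  delEdge-i : ∀ {m} (a : Fin m → Fin m → Bool) {p r x y} → T (a x y) →
    ¬ (x ≡ p × y ≡ r) → ¬ (x ≡ r × y ≡ p) → T (delEdge a p r x y)
  delEdge-i a h n₁ n₂ = ∧-i h (not-i ([ n₁ , n₂ ]′ ∘ edgeIs-e))

  delEdge-e : ∀ {m} (a : Fin m → Fin m → Bool) {p r x y} → T (delEdge a p r x y) →
    T (a x y) × ¬ (x ≡ p × y ≡ r) × ¬ (x ≡ r × y ≡ p)
  delEdge-e a {p} {r} {x} {y} h = ∧-l {a x y} h ,
    (λ { (refl , refl) → not-e (∧-r {a x y} h) (edgeIs-i₁ p r) }) ,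
    (λ { (refl , refl) → not-e (∧-r {a x y} h) (edgeIs-i₂ p r) })

  delEdge-sym : ∀ {m} (a : Fin m → Fin m → Bool) p r → (∀ x y → a x y ≡ a y x) →
    ∀ x y → delEdge a p r x y ≡ delEdge a p r y x
  delEdge-sym a p r s x y = cong₂ (λ b c → b ∧ not c) (s x y) (edgeIs-sym p r x y)

  delEdge-irr : ∀ {m} (a : Fin m → Fin m → Bool) p r x → a x x ≡ false → delEdge a p r x x ≡ false
  delEdge-irr a p r x e rewrite e = refl

  -- Since `p ≢ r`, the darts `(p , r)` and `(r , p)` are different, and the two indicators never
  -- overlap.
  b2n-delEdge : ∀ {m} (a : Fin m → Fin m → Bool) {p r : Fin m} → p ≢ r → T (a p r) → T (a r p) → ∀ x y →
    b2n (a x y) ≡ b2n (delEdge a p r x y) + (b2n (x == p ∧ y == r) + b2n (x == r ∧ y == p))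
  b2n-delEdge a {p} {r} p≢r h h' x y with x ≟ p | y ≟ r | x ≟ r | y ≟ p
  ... | yes refl | yes refl | yes e | _  = ⊥-elim (p≢r e)
  ... | yes refl | yes refl | no _ | _  rewrite T→≡ h = refl
  ... | yes refl | no _ | yes e | _     = ⊥-elim (p≢r e)
  ... | yes refl | no _ | no _ | _      = b2n-∧true (a x y)
  ... | no _ | _ | yes refl | yes refl rewrite T→≡ h' = refl
  ... | no _ | _ | yes refl | no _     = b2n-∧true (a x y)
  ... | no _ | _ | no _ | _            = b2n-∧true (a x y)

∑∑-delEdge : ∀ {m} (a : Fin m → Fin m → Bool) {p r : Fin m} → p ≢ r → T (a p r) → T (a r p) →
  ∑∑ (delEdge a p r) + 2 ≡ ∑∑ a
∑∑-delEdge {m} a {p} {r} p≢r h h' = sym (trans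
  (∑-cong (λ x → trans (∑-cong (b2n-delEdge a p≢r h h' x)) (trans (∑-distrib-+ (d x) (λ y → e₁ x y + e₂ x y))
     (cong (∑ (d x) +_)
       (trans (∑-distrib-+ (e₁ x) (e₂ x)) (cong₂ _+_ (∑-ind∧ (x == p) r) (∑-ind∧ (x == r) p)))))))
  (trans (∑-distrib-+ (∑ ∘ d) (λ x → b2n (x == p) + b2n (x == r))) (cong (∑∑ (delEdge a p r) +_)
     (trans (∑-distrib-+ (λ x → b2n (x == p)) (λ x → b2n (x == r))) (cong₂ _+_ (∑-ind p) (∑-ind r))))))
  where
  d e₁ e₂ : Fin m → Fin m → ℕ
  d x y = b2n (delEdge a p r x y)
  e₁ x y = b2n (x == p ∧ y == r)
  e₂ x y = b2n (x == r ∧ y == p)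

opaque
  mem3 : ∀ {m} → Fin m → Fin m → Fin m → Fin m → Bool
  mem3 p r s x = x == p ∨ (x == r ∨ x == s)

  mem3-e : ∀ {m} {p r s x : Fin m} → T (mem3 p r s x) → x ≡ p ⊎ x ≡ r ⊎ x ≡ s
  mem3-e {p = p} {r} {s} {x} h with ∨-e {x == p} h
  ... | inj₁ k = inj₁ (==→ k)
  ... | inj₂ k with ∨-e {x == r} k
  ... | inj₁ l = inj₂ (inj₁ (==→ l))
  ... | inj₂ l = inj₂ (inj₂ (==→ l))

  mem3-i : ∀ {m} {p r s x : Fin m} → x ≡ p ⊎ x ≡ r ⊎ x ≡ s → T (mem3 p r s x)
  mem3-i {x = x} (inj₁ refl) = ∨-l {x == x} (→== {x = x} refl)
  mem3-i {p = p} {x = x} (inj₂ (inj₁ refl)) = ∨-r {x == p} (∨-l {x == x} (→== {x = x} refl))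
  mem3-i {p = p} {r} {x = x} (inj₂ (inj₂ refl)) = ∨-r {x == p} (∨-r {x == r} (→== {x = x} refl))

  b2n-mem3 : ∀ {m} {p r s : Fin m} → p ≢ r → r ≢ s → p ≢ s → ∀ x →
    b2n (mem3 p r s x) ≡ b2n (x == p) + (b2n (x == r) + b2n (x == s))
  b2n-mem3 {p = p} {r} {s} n₁ n₂ n₃ x with x ≟ p | x ≟ r | x ≟ s
  ... | yes refl | yes e | _ = ⊥-elim (n₁ e)
  ... | yes refl | no _ | yes e = ⊥-elim (n₃ e)
  ... | yes refl | no _ | no _ = refl
  ... | no _ | yes refl | yes e = ⊥-elim (n₂ e)
  ... | no _ | yes _ | no _ = refl
  ... | no _ | no _ | yes _ = refl
  ... | no _ | no _ | no _ = refl

  mem2 : ∀ {m} → Fin m → Fin m → Fin m → Bool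
  mem2 p r x = x == p ∨ x == r

  mem2-e : ∀ {m} {p r x : Fin m} → T (mem2 p r x) → x ≡ p ⊎ x ≡ r
  mem2-e {p = p} {r} {x} h with ∨-e {x == p} h
  ... | inj₁ k = inj₁ (==→ k)
  ... | inj₂ k = inj₂ (==→ k)

  mem2-i : ∀ {m} {p r x : Fin m} → x ≡ p ⊎ x ≡ r → T (mem2 p r x)
  mem2-i {x = x} (inj₁ refl) = ∨-l {x == x} (→== {x = x} refl)
  mem2-i {p = p} {x = x} (inj₂ refl) = ∨-r {x == p} (→== {x = x} refl)

  b2n-mem2 : ∀ {m} {p r : Fin m} → p ≢ r → ∀ x → b2n (mem2 p r x) ≡ b2n (x == p) + b2n (x == r)
  b2n-mem2 {p = p} {r} ne x with x ≟ p | x ≟ r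
  ... | yes refl | yes e = ⊥-elim (ne e)
  ... | yes _ | no _ = refl
  ... | no _ | yes _ = refl
  ... | no _ | no _ = refl

∑-mem3 : ∀ {m} {p r s : Fin m} → p ≢ r → r ≢ s → p ≢ s → ∑ (λ x → b2n (mem3 p r s x)) ≡ 3
∑-mem3 {p = p} {r} {s} n₁ n₂ n₃ = trans (∑-cong (b2n-mem3 n₁ n₂ n₃)) (trans
  (∑-distrib-+ (λ x → b2n (x == p)) (λ x → b2n (x == r) + b2n (x == s)))
  (cong₂ _+_ (∑-ind p) (trans (∑-distrib-+ (λ x → b2n (x == r)) (λ x → b2n (x == s))) (cong₂ _+_ (∑-ind r) (∑-ind s)))))

∑-mem2 : ∀ {m} {p r : Fin m} → p ≢ r → ∑ (λ x → b2n (mem2 p r x)) ≡ 2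
∑-mem2 {p = p} {r} ne = trans (∑-cong (b2n-mem2 ne)) (trans
  (∑-distrib-+ (λ x → b2n (x == p)) (λ x → b2n (x == r))) (cong₂ _+_ (∑-ind p) (∑-ind r)))

-- Explicit graphs that undo the reductions

-- Inverts (D3b); on the dual side it splits a vertex of degree three.
sub : (G : Graph) (p r s : V G) → Graph
sub G p r s = record { n = suc (n G) ; adj = a ; adj-sym = a-sym ; adj-irr = a-irr }
  where
  a : Fin (suc (n G)) → Fin (suc (n G)) → Bool
  a zero    zero    = false
  a zero    (suc y) = mem3 p r s y
  a (suc x) zero    = mem3 p r s x
  a (suc x) (suc y) = delEdge (adj G) p r x y
  a-sym : ∀ x y → a x y ≡ a y x
  a-sym zero    zero    = refl
  a-sym zero    (suc y) = refl
  a-sym (suc x) zero    = refl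
  a-sym (suc x) (suc y) = delEdge-sym (adj G) p r (adj-sym G) x y
  a-irr : ∀ x → a x x ≡ false
  a-irr zero    = refl
  a-irr (suc x) = delEdge-irr (adj G) p r x (adj-irr G x)

-- Inverts (D3a).  The corners of the triangle that replaces t are suc (suc t) at a, zero at b and
-- suc zero at c.
blow : (G : Graph) (t a b c : V G) → Graph
blow G t a b c = record { n = suc (suc (n G)) ; adj = A ; adj-sym = A-sym ; adj-irr = A-irr }
  where
  A : Fin (suc (suc (n G))) → Fin (suc (suc (n G))) → Bool
  A zero          zero          = false
  A zero          (suc zero)    = true
  A (suc zero)    zero          = true
  A (suc zero)    (suc zero)    = false
  A zero          (suc (suc y)) = mem2 t b y
  A (suc zero)    (suc (suc y)) = mem2 t c y
  A (suc (suc x)) zero          = mem2 t b x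
  A (suc (suc x)) (suc zero)    = mem2 t c x
  A (suc (suc x)) (suc (suc y)) = delEdge (delEdge (adj G) t b) t c x y
  A-sym : ∀ x y → A x y ≡ A y x
  A-sym zero          zero          = refl
  A-sym zero          (suc zero)    = refl
  A-sym (suc zero)    zero          = refl
  A-sym (suc zero)    (suc zero)    = refl
  A-sym zero          (suc (suc y)) = refl
  A-sym (suc zero)    (suc (suc y)) = refl
  A-sym (suc (suc x)) zero          = refl
  A-sym (suc (suc x)) (suc zero)    = refl
  A-sym (suc (suc x)) (suc (suc y)) = delEdge-sym _ t c (delEdge-sym _ t b (adj-sym G)) x y
  A-irr : ∀ x → A x x ≡ false
  A-irr zero          = refl
  A-irr (suc zero)    = refl
  A-irr (suc (suc x)) = delEdge-irr _ t c x (delEdge-irr (adj G) t b x (adj-irr G x))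

-- Gluing a tetrahedron to the triangle uvw.
stack : (G : Graph) (u v w : V G) → Graph
stack G u v w = record { n = suc (n G) ; adj = a ; adj-sym = a-sym ; adj-irr = a-irr }
  where
  a : Fin (suc (n G)) → Fin (suc (n G)) → Bool
  a zero    zero    = false
  a zero    (suc y) = mem3 u v w y
  a (suc x) zero    = mem3 u v w x
  a (suc x) (suc y) = adj G x y
  a-sym : ∀ x y → a x y ≡ a y x
  a-sym zero    zero    = refl
  a-sym zero    (suc y) = refl
  a-sym (suc x) zero    = refl
  a-sym (suc x) (suc y) = adj-sym G x y
  a-irr : ∀ x → a x x ≡ false
  a-irr zero    = refl
  a-irr (suc x) = adj-irr G x

-- Three edges at the new vertex bring six darts, and the deleted edge takes two away.
dartCount-sub : (G : Graph) {p r s : V G} → p ≢ r → r ≢ s → p ≢ s → Adj G p r →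
  dartCount (sub G p r s) ≡ dartCount G + 4
dartCount-sub G {p} {r} {s} n₁ n₂ n₃ pr = trans (dartCount≡∑∑ (sub G p r s))
  (trans (cong₂ _+_ (∑-mem3 n₁ n₂ n₃) (trans (∑-distrib-+ (λ x → b2n (mem3 p r s x)) (λ x → ∑ λ y → b2n (d x y))) (cong (_+ ∑∑ d) (∑-mem3 n₁ n₂ n₃))))
  (trans (ar (∑∑ d)) (cong (_+ 4) (trans (∑∑-delEdge (adj G) n₁ pr (Adj-sym G pr)) (sym (dartCount≡∑∑ G))))))
  where
  d : V G → V G → Bool
  d = delEdge (adj G) p r
  ar : ∀ x → 3 + (3 + x) ≡ x + 2 + 4
  ar = solve 1 (λ x → con 3 :+ (con 3 :+ x) := x :+ con 2 :+ con 4) refl where open +-*-Solver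

-- Five edges are new, the three sides of the triangle and the outer edges at two corners; two edges
-- at `t` are deleted, while the one to `a` stays.
dartCount-blow : (G : Graph) {t a b c : V G} → Deg3 G t a b c →
  dartCount (blow G t a b c) ≡ dartCount G + 6
dartCount-blow G {t} {a} {b} {c} d3 = trans (dartCount≡∑∑ (blow G t a b c))
  (trans (cong₂ _+_ (cong suc (∑-mem2 tb)) (cong₂ _+_ (cong suc (∑-mem2 tc))
    (trans (∑-cong (λ x → sym (+-assoc (b2n (mem2 t b x)) (b2n (mem2 t c x)) _)))
    (trans (∑-distrib-+ (λ x → m₁ x + m₂ x) (λ x → ∑ λ y → b2n (d₂ x y)))
      (cong (_+ ∑∑ d₂) (trans (∑-distrib-+ m₁ m₂) (cong₂ _+_ (∑-mem2 tb) (∑-mem2 tc))))))))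
  (trans (ar (∑∑ d₂)) (cong (_+ 6) (trans (cong (_+ 2) e₂) (trans e₁ (sym (dartCount≡∑∑ G)))))))
  where
  open Deg3 d3
  m₁ m₂ : V G → ℕ
  m₁ x = b2n (mem2 t b x)
  m₂ x = b2n (mem2 t c x)
  tb : t ≢ b
  tb = adj≢ G ay
  tc : t ≢ c
  tc = adj≢ G az
  d₁ d₂ : V G → V G → Bool
  d₁ = delEdge (adj G) t b
  d₂ = delEdge d₁ t c
  e₁ : ∑∑ d₁ + 2 ≡ ∑∑ (adj G)
  e₁ = ∑∑-delEdge (adj G) tb ay (Adj-sym G ay)
  h : T (d₁ t c)
  h = delEdge-i (adj G) az (λ { (_ , e) → y≢z (sym e) }) λ { (e , _) → tb e }
  e₂ : ∑∑ d₂ + 2 ≡ ∑∑ d₁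
  e₂ = ∑∑-delEdge d₁ tc h (subst T (delEdge-sym (adj G) t b (adj-sym G) t c) h)
  ar : ∀ x → 3 + (3 + (4 + x)) ≡ x + 2 + 2 + 6
  ar = solve 1 (λ x → con 3 :+ (con 3 :+ (con 4 :+ x)) := x :+ con 2 :+ con 2 :+ con 6) refl where open +-*-Solver

-- Isomorphisms and vertices of degree three

record Iso (G H : Graph) : Set where
  field
    to     : V G → V H
    from   : V H → V G
    tofrom : ∀ x → to (from x) ≡ x
    fromto : ∀ x → from (to x) ≡ x
    adj-to : ∀ u v → adj H (to u) (to v) ≡ adj G u v

  to-inj : ∀ {u v} → to u ≡ to v → u ≡ v
  to-inj e = trans (sym (fromto _)) (trans (cong from e) (fromto _))

  adj-from : ∀ u v → adj G (from u) (from v) ≡ adj H u v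
  adj-from u v = trans (sym (adj-to _ _)) (cong₂ (adj H) (tofrom u) (tofrom v))

iso-refl : ∀ {G} → Iso G G
iso-refl = record { to = id ; from = id ; tofrom = λ _ → refl ; fromto = λ _ → refl ; adj-to = λ _ _ → refl }

iso-sym : ∀ {G H} → Iso G H → Iso H G
iso-sym I = record { to = from ; from = to ; tofrom = fromto ; fromto = tofrom ; adj-to = adj-from }
  where open Iso I

iso-trans : ∀ {G H K} → Iso G H → Iso H K → Iso G K
iso-trans I J = record
  { to = J.to ∘ I.to ; from = I.from ∘ J.from
  ; tofrom = λ x → trans (cong J.to (I.tofrom _)) (J.tofrom x)
  ; fromto = λ x → trans (cong I.from (J.fromto _)) (I.fromto x)
  ; adj-to = λ u v → trans (J.adj-to _ _) (I.adj-to u v) }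
  where module I = Iso I
        module J = Iso J

iso→≅ : ∀ {G H} → Iso G H → G ≅ H
iso→≅ I = record { iso = mk↔ₛ′ to from tofrom fromto ; pres = adj-to }
  where open Iso I

≅→iso : ∀ {G H} → G ≅ H → Iso G H
≅→iso I = record { to = Inverse.to iso ; from = Inverse.from iso
  ; tofrom = λ x → Inverse.inverseˡ iso refl ; fromto = λ x → Inverse.inverseʳ iso refl ; adj-to = pres }
  where open _≅_ I

iso-n : ∀ {G H} → Iso G H → n G ≡ n H
iso-n I = ↔⇒≡ (_≅_.iso (iso→≅ I))

iso-dartCount : ∀ {G H} → Iso G H → dartCount G ≡ dartCount H
iso-dartCount {G} {H} I = trans (dartCount≡∑∑ G) (sym (trans (dartCount≡∑∑ H)
  (trans (∑-permute _ π) (∑-cong λ x → trans (∑-permute _ π) (∑-cong λ y → cong b2n (adj-to x y))))))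
  where open Iso I
        π = _≅_.iso (iso→≅ I)

pick : ∀ {m} (f : Fin m → Bool) {x} → T (f x) →
  ∑ (b2n ∘ f) ≡ suc (∑ λ i → b2n (f i ∧ not (i == x)))
pick f {x} h = trans (∑-cong pw) (trans (∑-distrib-+ (λ i → b2n (i == x)) g) (cong (_+ ∑ g) (∑-ind x)))
  where
  g : _ → ℕ
  g i = b2n (f i ∧ not (i == x))
  lem : ∀ b → b2n b ≡ b2n (b ∧ true)
  lem true  = refl
  lem false = refl
  pw : ∀ i → b2n (f i) ≡ b2n (i == x) + b2n (f i ∧ not (i == x))
  pw i with i ≟ x
  ... | yes refl rewrite T→≡ h = refl
  ... | no _ = lem (f i)

find : ∀ {m k} (f : Fin m → Bool) → ∑ (b2n ∘ f) ≡ suc k → ∃ λ x → T (f x)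
find {suc m} f e with f zero in q
... | true  = zero , subst T (sym q) tt
... | false with x , h ← find (f ∘ suc) e = suc x , h

none : ∀ {m} (f : Fin m → Bool) → ∑ (b2n ∘ f) ≡ 0 → ∀ i → ¬ T (f i)
none f e i h with () ← trans (sym (cong b2n (T→≡ h))) (∑≡0 (b2n ∘ f) e i)

-- Taking `u` and `v` out of the count leaves one neighbour to be found. Taking that one out as well
-- leaves none, so the list is complete.
deg3-with2 : ∀ {G h u v} → deg G h ≡ 3 → Adj G h u → Adj G h v → u ≢ v → ∃ λ w → Deg3 G h u v w
deg3-with2 {G} {h} {u} {v} e hu hv u≢v = w , mkD3 hu hv (∧-l {adj G h w} (∧-l {f₁ w} hw)) u≢v
    (λ q → not-e (∧-r {f₁ w} hw) (→== (sym q)))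
    (λ q → not-e (∧-r {adj G h w} (∧-l {f₁ w} hw)) (→== (sym q))) al
  where
  f₁ f₂ : V G → Bool
  f₁ i = adj G h i ∧ not (i == u)
  f₂ i = f₁ i ∧ not (i == v)
  c₂ : ∑ (b2n ∘ f₁) ≡ 2
  c₂ = suc-injective (trans (sym (pick (adj G h) hu)) (trans (sym (deg≡∑ G h)) e))
  c₁ : ∑ (b2n ∘ f₂) ≡ 1
  c₁ = suc-injective (trans (sym (pick f₁ (∧-i hv (not-i (λ q → u≢v (sym (==→ q))))))) c₂)
  w : V G
  w = proj₁ (find f₂ c₁)
  hw : T (f₂ w)
  hw = proj₂ (find f₂ c₁)
  c₀ : ∑ (λ i → b2n (f₂ i ∧ not (i == w))) ≡ 0
  c₀ = suc-injective (trans (sym (pick f₂ hw)) c₁)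
  al : ∀ z → Adj G h z → z ≡ u ⊎ z ≡ v ⊎ z ≡ w
  al z hz with z ≟ u | z ≟ v | z ≟ w
  ... | yes q | _ | _ = inj₁ q
  ... | no _ | yes q | _ = inj₂ (inj₁ q)
  ... | no _ | no _ | yes q = inj₂ (inj₂ q)
  ... | no a | no b | no c = ⊥-elim (none (λ i → f₂ i ∧ not (i == w)) c₀ z
          (∧-i (∧-i (∧-i hz (not-i (a ∘ ==→))) (not-i (b ∘ ==→))) (not-i (c ∘ ==→))))

deg3-with3 : ∀ {G h u v w} → deg G h ≡ 3 → Adj G h u → Adj G h v → Adj G h w →
  u ≢ v → v ≢ w → u ≢ w → Deg3 G h u v w
deg3-with3 {G} {h} {u} {v} {w} e hu hv hw n₁ n₂ n₃ with deg3-with2 {G} {h} {u} {v} e hu hv n₁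
... | w' , d with Deg3.all d w hw
... | inj₁ q = ⊥-elim (n₃ (sym q))
... | inj₂ (inj₁ q) = ⊥-elim (n₂ (sym q))
... | inj₂ (inj₂ q) = subst (Deg3 G h u v) (sym q) d

Deg3→deg : ∀ {G h x y z} → Deg3 G h x y z → deg G h ≡ 3
Deg3→deg {G} {h} {x} {y} {z} (mkD3 ax ay az n₁ n₂ n₃ all) = trans (deg≡∑ G h)
  (trans (∑-cong (λ i → cong b2n (T-ext (mem3-i ∘ all i) (λ m → back i (mem3-e m))))) (∑-mem3 n₁ n₂ n₃))
  where
  back : ∀ i → i ≡ x ⊎ i ≡ y ⊎ i ≡ z → Adj G h i
  back i (inj₁ refl) = ax
  back i (inj₂ (inj₁ refl)) = ay
  back i (inj₂ (inj₂ refl)) = az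

-- Spanning trees and contraction

-- Connectivity through colourings: whatever is constant along edges is constant. No paths have to
-- be built or transported; a colouring is simply pulled back along each construction.
ConnectedOn : (H : Graph) → (V H → Bool) → Set
ConnectedOn H P = (c : V H → Bool) →
  (∀ u v → T (P u) → T (P v) → Adj H u v → c u ≡ c v) → ∀ u v → T (P u) → T (P v) → c u ≡ c v

-- Ranks decrease strictly towards the root, which gives induction from the root outwards. Their
-- bound `K` gives induction from the leaves inwards.
record Tree (H : Graph) (P : V H → Bool) (root : V H) : Set where
  field
    par   : V H → V H
    rk    : V H → ℕ
    K     : ℕ
    rk≤K  : ∀ v → rk v ≤ K
    par-ok : ∀ v → T (P v) → v ≢ root → Adj H v (par v) × T (P (par v)) × rk (par v) < rk v

module _ (H : Graph) (P : V H → Bool) (root : V H) (Proot : T (P root)) (conn : ConnectedOn H P) where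
  private
    record Partial (S : V H → Bool) : Set where
      field
        S-root : T (S root)
        S⊆P    : ∀ v → T (S v) → T (P v)
        par    : V H → V H
        rk     : V H → ℕ
        K      : ℕ
        rk≤K   : ∀ v → rk v ≤ K
        par-ok : ∀ v → T (S v) → v ≢ root → Adj H v (par v) × T (S (par v)) × rk (par v) < rk v

    Border : (V H → Bool) → V H → V H → Bool
    Border S u w = S u ∧ ((P w ∧ not (S w)) ∧ adj H u w)

    extend : ∀ {S} → Partial S → ∀ u w → T (Border S u w) → Partial (λ v → S v ∨ v == w)
    extend {S} p u w b = record
      { S-root = ∨-l S-root
      ; S⊆P = λ v h → [ S⊆P v , (λ e → subst (T ∘ P) (sym (==→ e)) Pw) ]′ (∨-e {S v} h)
      ; par = par' ; rk = rk' ; K = suc K ; rk≤K = rk'≤ ; par-ok = ok }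
      where
      open Partial p
      Su : T (S u)
      Su = ∧-l b
      PSw : T (P w ∧ not (S w))
      PSw = ∧-l {P w ∧ not (S w)} (∧-r {S u} b)
      Pw : T (P w)
      Pw = ∧-l PSw
      uw : Adj H u w
      uw = ∧-r {P w ∧ not (S w)} (∧-r {S u} b)
      ¬Sw : ∀ {v} → T (S v) → v ≢ w
      ¬Sw s refl = not-e (∧-r {P w} PSw) s
      par' : V H → V H
      par' v = if v == w then u else par v
      rk' : V H → ℕ
      rk' v = if v == w then suc (rk u) else rk v
      rk'≤ : ∀ v → rk' v ≤ suc K
      rk'≤ v with v ≟ w
      ... | yes _ = s≤s (rk≤K u)
      ... | no _  = ≤-trans (rk≤K v) (n≤1+n K)
      rk'-old : ∀ {v} → T (S v) → rk' v ≡ rk v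
      rk'-old {v} s with v ≟ w
      ... | yes e = ⊥-elim (¬Sw s e)
      ... | no _  = refl
      ok : ∀ v → T (S v ∨ v == w) → v ≢ root →
        Adj H v (par' v) × T (S (par' v) ∨ par' v == w) × rk' (par' v) < rk' v
      ok v h ne with v ≟ w
      ... | yes refl = Adj-sym H uw , ∨-l Su , s≤s (≤-reflexive (rk'-old Su))
      ... | no n with ∨-e {S v} h
      ... | inj₂ ()
      ... | inj₁ s with a , q , l ← par-ok v s ne = a , ∨-l q , subst (_< rk v) (sym (rk'-old q)) l

    -- The number `m` counts the vertices still missing from the tree. When no edge leaves `S`
    -- inside `P`, the indicator of `S` is a colouring constant along edges, and connectivity makes
    -- `S` all of `P`.
    grow : ∀ m {S} → Partial S → ∑ (λ i → b2n (P i ∧ not (S i))) ≡ m → Tree H P root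
    grow m {S} p e with any? (λ u → any? (λ w → T? (Border S u w)))
    grow m {S} p e | no ¬b = record { par = par ; rk = rk ; K = K ; rk≤K = rk≤K
        ; par-ok = λ v h ne → let a , q , l = par-ok v (all v h) ne in a , S⊆P _ q , l }
      where
      open Partial p
      closed : ∀ u v → T (P u) → T (P v) → Adj H u v → T (S u) → T (S v)
      closed u v pu pv a su with T? (S v)
      ... | yes sv = sv
      ... | no ns  = ⊥-elim (¬b (u , v , ∧-i su (∧-i (∧-i pv (not-i ns)) a)))
      all : ∀ v → T (P v) → T (S v)
      all v h = subst T (conn S (λ u v pu pv a → T-ext (closed u v pu pv a) (closed v u pv pu (Adj-sym H a)))
        root v Proot h) S-root
    grow m {S} p e | yes (u , w , b) with pick (λ i → P i ∧ not (S i)) {w} (∧-l {P w ∧ not (S w)} (∧-r {S u} b))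
    grow zero    p e | yes (u , w , b) | q with () ← trans (sym e) q
    grow (suc m) {S} p e | yes (u , w , b) | q =
      grow m (extend p u w b) (trans (∑-cong (λ i → cong b2n (lem (P i) (S i) (i == w))))
        (suc-injective (trans (sym q) e)))
      where
      lem : ∀ a b c → (a ∧ not (b ∨ c)) ≡ ((a ∧ not b) ∧ not c)
      lem false b c = refl
      lem true false c = refl
      lem true true c = refl

  spanningTree : Tree H P root
  spanningTree = grow _ {_== root} (record
    { S-root = →== {x = root} refl ; S⊆P = λ v h → subst (T ∘ P) (sym (==→ h)) Proot
    ; par = id ; rk = λ _ → 0 ; K = 0 ; rk≤K = λ _ → z≤n
    ; par-ok = λ v h ne → ⊥-elim (ne (==→ h)) }) refl

Surjective′ : ∀ {N M} → (Fin N → Fin M) → Set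
Surjective′ γ = ∀ i → ∃ λ x → γ x ≡ i

identify : ∀ {M} {a b : Fin (suc M)} → b ≢ a → Fin (suc M) → Fin M
identify {b = b} ne i with b ≟ i
... | yes _ = punchOut ne
... | no n  = punchOut n

identify-≡ : ∀ {M} {a b : Fin (suc M)} (ne : b ≢ a) → identify ne a ≡ identify ne b
identify-≡ {a = a} {b} ne with b ≟ a | b ≟ b
... | yes e | _     = ⊥-elim (ne e)
... | no _  | no n  = ⊥-elim (n refl)
... | no n  | yes _ = refl

identify-surj : ∀ {M} {a b : Fin (suc M)} (ne : b ≢ a) → Surjective′ (identify ne)
identify-surj {b = b} ne i = punchIn b i , lem
  where
  lem : identify ne (punchIn b i) ≡ i
  lem with b ≟ punchIn b i
  ... | yes e = ⊥-elim (punchInᵢ≢i b i (sym e))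
  ... | no n  = punchOut-punchIn b

-- Contracting the pairs of a list one after the other loses at most one class per pair.
mergeAll : ∀ {N} (L : List (Fin N × Fin N)) → Σ ℕ λ M → Σ (Fin N → Fin M) λ γ →
  Surjective′ γ × N ≤ M + length L × (∀ {a b} → (a , b) ∈ L → γ a ≡ γ b)
mergeAll {N} [] = N , id , (λ i → i , refl) , m≤m+n N 0 , λ ()
mergeAll ((a , b) ∷ L) with mergeAll L
... | M , γ , s , le , eq with γ b ≟ γ a
... | yes e = M , γ , s , ≤-trans le (+-monoʳ-≤ M (n≤1+n _)) , λ { (here refl) → sym e ; (there i) → eq i }
mergeAll ((a , b) ∷ L) | zero  , γ , s , le , eq | no ne with () ← γ a
mergeAll ((a , b) ∷ L) | suc M , γ , s , le , eq | no ne =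
  M , identify ne ∘ γ
    , (λ i → let j , e = identify-surj ne i ; x , e' = s j in x , trans (cong (identify ne) e') e)
    , ≤-trans le (≤-reflexive (sym (+-suc M (length L))))
    , λ { (here refl) → identify-≡ ne ; (there i) → cong (identify ne) (eq i) }

support : ∀ {m} → (Fin m → Bool) → List (Fin m)
support {zero}  f = []
support {suc m} f = (if f zero then zero ∷ [] else []) ++ map suc (support (f ∘ suc))

length-support : ∀ {m} (f : Fin m → Bool) → length (support f) ≡ ∑ (b2n ∘ f)
length-support {zero}  f = refl
length-support {suc m} f with f zero
... | true  = cong suc (trans (length-map suc (support (f ∘ suc))) (length-support (f ∘ suc)))
... | false = trans (length-map suc (support (f ∘ suc))) (length-support (f ∘ suc))

∈-support : ∀ {m} (f : Fin m → Bool) {x} → T (f x) → x ∈ support f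
∈-support {suc m} f {zero} h with f zero
... | true = here refl
∈-support {suc m} f {suc x} h = ∈-++⁺ʳ (if f zero then zero ∷ [] else []) (∈-map⁺ suc (∈-support (f ∘ suc) h))

-- Each edge is listed once, smaller end first; this is why `Covers` below allows both directions.
edges : ∀ {m} → (Fin m → Fin m → Bool) → List (Fin m × Fin m)
edges {zero}  a = []
edges {suc m} a = map (λ y → zero , suc y) (support (a zero ∘ suc))
  ++ map (λ e → suc (proj₁ e) , suc (proj₂ e)) (edges λ x y → a (suc x) (suc y))

length-edges : ∀ {m} (a : Fin m → Fin m → Bool) → (∀ x y → a x y ≡ a y x) → (∀ x → a x x ≡ false) →
  2 * length (edges a) ≡ ∑∑ a
length-edges {zero}  a s i = refl
length-edges {suc m} a s i = begin
  2 * length (edges a)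
    ≡⟨ cong (2 *_) (trans (length-++ (map (λ y → zero , suc y) (support r))) (cong₂ _+_
         (trans (length-map _ (support r)) (length-support r)) (length-map _ (edges a')))) ⟩
  2 * (R + length (edges a'))
    ≡⟨ trans (*-distribˡ-+ 2 R (length (edges a'))) (cong (2 * R +_) (length-edges a' (λ x y → s _ _) (λ x → i _))) ⟩
  2 * R + ∑∑ a'
    ≡⟨ solve 2 (λ x y → con 2 :* x :+ y := x :+ (x :+ y)) refl R (∑∑ a') ⟩
  R + (R + ∑∑ a')
    ≡⟨ cong₂ _+_ (cong (λ b → b2n b + R) (sym (i zero)))
         (trans (cong (_+ ∑∑ a') (∑-cong λ x → cong b2n (s zero (suc x))))
           (sym (∑-distrib-+ (λ x → b2n (a (suc x) zero)) λ x → ∑ λ y → b2n (a' x y)))) ⟩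
  ∑∑ a ∎
  where
  open ≡-Reasoning
  open +-*-Solver using (solve; _:*_; _:+_; _:=_; con)
  r : Fin m → Bool
  r = a zero ∘ suc
  R : ℕ
  R = ∑ (b2n ∘ r)
  a' : Fin m → Fin m → Bool
  a' x y = a (suc x) (suc y)

Covers : ∀ {m} → List (Fin m × Fin m) → Fin m → Fin m → Set
Covers L x y = (x , y) ∈ L ⊎ (y , x) ∈ L

edges-cover : ∀ {m} (a : Fin m → Fin m → Bool) → (∀ x y → a x y ≡ a y x) → (∀ x → a x x ≡ false) →
  ∀ x y → T (a x y) → Covers (edges a) x y
edges-cover {suc m} a s i zero zero h with () ← subst T (i zero) h
edges-cover {suc m} a s i zero (suc y) h = inj₁ (∈-++⁺ˡ (∈-map⁺ _ (∈-support (a zero ∘ suc) h)))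
edges-cover {suc m} a s i (suc x) zero h =
  inj₂ (∈-++⁺ˡ (∈-map⁺ _ (∈-support (a zero ∘ suc) (subst T (s (suc x) zero) h))))
edges-cover {suc m} a s i (suc x) (suc y) h with edges-cover (λ x y → a (suc x) (suc y)) (λ x y → s _ _) (λ x → i _) x y h
... | inj₁ e = inj₁ (∈-++⁺ʳ (map (λ y → zero , suc y) (support (a zero ∘ suc))) (∈-map⁺ _ e))
... | inj₂ e = inj₂ (∈-++⁺ʳ (map (λ y → zero , suc y) (support (a zero ∘ suc))) (∈-map⁺ _ e))

extract : {A : Set} {x : A} {L : List A} → x ∈ L →
  Σ (List A) λ L' → length L ≡ suc (length L') × (∀ {y} → y ∈ L → y ≡ x ⊎ y ∈ L')
extract {L = _ ∷ L} (here refl) = L , refl , λ { (here e) → inj₁ e ; (there i) → inj₂ i }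
extract {L = z ∷ L} (there i) with L' , e , f ← extract i =
  z ∷ L' , cong suc e , λ { (here e) → inj₂ (here e) ; (there j) → [ inj₁ , inj₂ ∘ there ]′ (f j) }

-- One class per vertex and one per face; each edge is contracted either in the graph (when tr
-- holds) or in its dual.
contractEdges : (H : Graph) {m : ℕ} (lab : V H → V H → Fin m) (tr : V H → V H → Bool)
  (L : List (V H × V H)) →
  Σ ℕ λ M → Σ (V H → Fin M) λ γV → Σ (Fin m → Fin M) λ γF →
    (∀ i → (∃ λ v → γV v ≡ i) ⊎ (∃ λ f → γF f ≡ i)) × n H + m ≤ M + length L ×
    (∀ {u v} → (u , v) ∈ L → (T (tr u v) → γV u ≡ γV v) × (¬ T (tr u v) → γF (lab u v) ≡ γF (lab v u)))
contractEdges H {m} lab tr L with mergeAll (map e L)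
  where
  e : V H × V H → Fin (n H + m) × Fin (n H + m)
  e (u , v) = if tr u v then (u ↑ˡ m , v ↑ˡ m) else (n H ↑ʳ lab u v , n H ↑ʳ lab v u)
... | M , γ , s , le , eq = M , (λ v → γ (v ↑ˡ m)) , (λ f → γ (n H ↑ʳ f)) , cover ,
    subst (λ k → n H + m ≤ M + k) (length-map _ L) le , prop
  where
  cover : ∀ i → (∃ λ v → γ (v ↑ˡ m) ≡ i) ⊎ (∃ λ f → γ (n H ↑ʳ f) ≡ i)
  cover i with s i
  ... | x , q with splitAt (n H) x | join-splitAt (n H) m x
  ... | inj₁ v | j = inj₁ (v , trans (cong γ j) q)
  ... | inj₂ f | j = inj₂ (f , trans (cong γ j) q)
  prop : ∀ {u v} → (u , v) ∈ L → (T (tr u v) → γ (u ↑ˡ m) ≡ γ (v ↑ˡ m)) ×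
    (¬ T (tr u v) → γ (n H ↑ʳ lab u v) ≡ γ (n H ↑ʳ lab v u))
  prop {u} {v} i with tr u v | eq (∈-map⁺ _ i)
  ... | true  | q = (λ _ → q) , λ n → ⊥-elim (n tt)
  ... | false | q = (λ ()) , λ _ → q

-- Trees, dual edges and Euler's inequality

module _ {H : Graph} {P : V H → Bool} {root : V H} (t : Tree H P root) where
  open Tree t

  opaque
    isPar : V H → V H → Bool
    isPar u v = P u ∧ (not (u == root) ∧ par u == v)

    inTree : V H → V H → Bool
    inTree u v = isPar u v ∨ isPar v u

    isPar-e : ∀ {u v} → T (isPar u v) → T (P u) × u ≢ root × par u ≡ v
    isPar-e {u} {v} h = ∧-l {P u} h , (λ e → not-e (∧-l {not (u == root)} (∧-r {P u} h)) (→== e)) ,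
      ==→ (∧-r {not (u == root)} (∧-r {P u} h))

    inTree-e : ∀ {u v} → T (inTree u v) → T (isPar u v) ⊎ T (isPar v u)
    inTree-e {u} {v} = ∨-e {isPar u v}

    inTree-par : ∀ {u} → T (P u) → u ≢ root → T (inTree u (par u))
    inTree-par {u} p ne = ∨-l (∧-i p (∧-i (not-i (ne ∘ ==→)) (→== {x = par u} refl)))

    inTree-sym : ∀ u v → inTree u v ≡ inTree v u
    inTree-sym u v = ∨-comm (isPar u v) _

  tree-ind : (Q : V H → Set) → Q root → (∀ v → T (P v) → v ≢ root → Q (par v) → Q v) →
    ∀ v → T (P v) → Q v
  tree-ind Q q0 qs v pv = go (suc (rk v)) v pv ≤-refl
    where
    go : ∀ k v → T (P v) → rk v < k → Q v
    go zero v pv ()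
    go (suc k) v pv (s≤s le) with v ≟ root
    ... | yes refl = q0
    ... | no ne with a , pp , lt ← par-ok v pv ne = qs v pv ne (go k (par v) pp (≤-trans lt le))

-- The function `g` is an arbitrary invariant of faces, as `(v , σ ρ v u)` is the dart that follows
-- `(u , v)` on its face. An edge with `Flip` has the same value on both of its sides.
module Walk {H : Graph} (ρ : RotSys H) {A : Set} (g : V H → V H → A)
  (g-step : ∀ u v → Adj H u v → g v (σ ρ v u) ≡ g u v) where

  Flip : V H → V H → Set
  Flip v x = g v x ≡ g x v

  -- The two sides of the edge `v w` are connected by turning around `v`, which crosses all other
  -- edges at `v` and no value changes there.
  around : ∀ v w → Adj H v w → (∀ x → Adj H v x → x ≢ w → Flip v x) → Flip v w
  around v w a fl = sym (go (proj₁ r) (σ ρ v w) (σ-adj ρ v w a) (proj₂ r) (g-step w v (Adj-sym H a)))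
    where
    r : Reach (σ ρ v) (σ ρ v w) w
    r = σ-cyc ρ v (σ ρ v w) w (σ-adj ρ v w a) a
    go : ∀ k x → Adj H v x → iter (σ ρ v) k x ≡ w → ∀ {c} → g v x ≡ c → c ≡ g v w
    go k x ax e q with x ≟ w
    go k x ax e q | yes refl = sym q
    go zero x ax e q | no ne = ⊥-elim (ne e)
    go (suc k) x ax e q | no ne = go k (σ ρ v x) (σ-adj ρ v x ax) (trans (iter-suc (σ ρ v) k x) e)
      (trans (g-step x v (Adj-sym H ax)) (trans (sym (fl x ax ne)) q))

  out-const : ∀ v → (∀ x → Adj H v x → Flip v x) → ∀ x y → Adj H v x → Adj H v y → g v x ≡ g v y
  out-const v fl x y ax ay = sym (proj₂ (reach-inv (λ u → Adj H v u × g v u ≡ g v x)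
    (λ u (au , e) → σ-adj ρ v u au , trans (g-step u v (Adj-sym H au)) (trans (sym (fl u au)) e))
    (ax , refl) (σ-cyc ρ v x y ax ay)))

  module _ {P : V H → Bool} {root : V H} (t : Tree H P root) where
    open Tree t

    -- Only edges off the tree are assumed to flip. Edges from the root to vertices outside `P` are
    -- exempt, because one of them may be contracted as an additional tree edge.
    module _ (fl : ∀ v x → T (P v) → Adj H v x → ¬ T (inTree t v x) → v ≢ root ⊎ T (P x) → Flip v x) where
      private
        -- Induction from the leaves. At a child `x` of `v` every edge except the one to its parent
        -- flips, so `around` makes that one flip too. The fuel `k` bounds how far the rank can
        -- still grow.
        child : ∀ k v → K ≤ k + rk v → T (P v) → v ≢ root → ∀ x → Adj H v x → x ≢ par v → Flip v x
        child k v le pv ne x a nx with T? (inTree t v x)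
        ... | no nt = fl v x pv a nt (inj₁ ne)
        ... | yes e with inTree-e t e
        ... | inj₁ h = ⊥-elim (nx (sym (proj₂ (proj₂ (isPar-e t h)))))
        ... | inj₂ h with isPar-e t h
        ... | px , nr , refl with par-ok x px nr | k
        ... | _ , _ , lt | zero  = ⊥-elim (1+n≰n (≤-trans lt (≤-trans (rk≤K x) le)))
        ... | a' , _ , lt | suc k = sym (around x v a'
                (child k x (≤-trans le (≤-trans (≤-reflexive (sym (+-suc k (rk v)))) (+-monoʳ-≤ k lt))) px nr))

      walk : ∀ v → T (P v) → v ≢ root → ∀ x → Adj H v x → Flip v x
      walk v pv ne x a with x ≟ par v
      ... | no nx = child K v (m≤m+n K (rk v)) pv ne x a nx
      ... | yes refl = around v (par v) a (child K v (m≤m+n K (rk v)) pv ne)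

      walk-P : ∀ v x → T (P v) → T (P x) → Adj H v x → Flip v x
      walk-P v x pv px a with v ≟ root
      ... | no ne = walk v pv ne x a
      ... | yes refl = sym (walk x px (λ e → adj≢ H a (sym e)) v (Adj-sym H a))

two-classes : ∀ {M} (a : Fin M) (P : Fin M → Set) → (∀ i → i ≡ a ⊎ P i) → (∀ i j → P i → P j → i ≡ j) → M ≤ 2
two-classes {0} a P _ _ = z≤n
two-classes {1} a P _ _ = s≤s z≤n
two-classes {2} a P _ _ = s≤s (s≤s z≤n)
two-classes {suc (suc (suc _))} a P h same with h zero | h (suc zero) | h (suc (suc zero))
... | inj₁ refl | inj₁ () | _
... | inj₁ refl | inj₂ _ | inj₁ ()
... | inj₁ _ | inj₂ p | inj₂ q with () ← same _ _ p q
... | inj₂ p | inj₁ refl | inj₁ ()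
... | inj₂ p | inj₁ _ | inj₂ q with () ← same _ _ p q
... | inj₂ p | inj₂ q | _ with () ← same _ _ p q

edgeList : (H : Graph) → List (V H × V H)
edgeList H = edges (adj H)

2*edgeList : (H : Graph) → 2 * length (edgeList H) ≡ dartCount H
2*edgeList H = trans (length-edges (adj H) (adj-sym H) (adj-irr H)) (sym (dartCount≡∑∑ H))

edgeList-cover : (H : Graph) → ∀ u v → Adj H u v → Covers (edgeList H) u v
edgeList-cover H = edges-cover (adj H) (adj-sym H) (adj-irr H)

ColConn : Graph → Set
ColConn H = ConnectedOn H (λ _ → true)

-- This says that the genus is not negative. Tree edges are contracted in the graph and merge all
-- vertices; the other edges are contracted in the dual and, by `Walk`, merge all faces. At most two
-- classes remain, while each edge accounts for the loss of at most one.
euler-≤ : (H : Graph) (ρ : RotSys H) {m : ℕ} (lab : V H → V H → Fin m) →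
  (∀ u v → Adj H u v → lab v (σ ρ v u) ≡ lab u v) →
  (∀ f → ∃₂ λ u v → Adj H u v × lab u v ≡ f) → ColConn H → V H → n H + m ≤ 2 + length (edgeList H)
euler-≤ H ρ lab st sj conn root = go
  where
  t : Tree H (λ _ → true) root
  t = spanningTree H (λ _ → true) root tt conn
  tr : V H → V H → Bool
  tr = inTree t
  tr-sym : ∀ u v → tr u v ≡ tr v u
  tr-sym = inTree-sym t
  go : n H + _ ≤ 2 + length (edgeList H)
  go with contractEdges H lab tr (edgeList H)
  ... | M , γV , γF , cover , le , eq = ≤-trans le (+-monoˡ-≤ (length (edgeList H)) M≤2)
    where
    module W = Walk ρ (λ u v → γF (lab u v)) (λ u v a → cong γF (st u v a))
    flip₀ : ∀ v x → T true → Adj H v x → ¬ T (tr v x) → v ≢ root ⊎ T true → W.Flip v x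
    flip₀ v x _ a nt _ with edgeList-cover H v x a
    ... | inj₁ i = proj₂ (eq i) nt
    ... | inj₂ i = sym (proj₂ (eq i) (nt ∘ subst T (tr-sym x v)))
    flip : ∀ v x → Adj H v x → W.Flip v x
    flip v x = W.walk-P t flip₀ v x tt tt
    γV-const : ∀ v → γV v ≡ γV root
    γV-const v = tree-ind t (λ v → γV v ≡ γV root) refl (λ v _ ne q →
      trans (vp v ne) q) v tt
      where
      vp : ∀ v → v ≢ root → γV v ≡ γV (Tree.par t v)
      vp v ne with edgeList-cover H v _ (proj₁ (Tree.par-ok t v tt ne))
      ... | inj₁ i = proj₁ (eq i) (inTree-par t tt ne)
      ... | inj₂ i = sym (proj₁ (eq i) (subst T (inTree-sym t v _) (inTree-par t tt ne)))
    to-root : ∀ v → ∀ u → Adj H v u → ∃ λ x → Adj H root x × γF (lab v u) ≡ γF (lab root x)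
    to-root v = tree-ind t (λ v → ∀ u → Adj H v u → ∃ λ x → Adj H root x × γF (lab v u) ≡ γF (lab root x))
      (λ u a → u , a , refl)
      (λ v _ ne ih u a → let pa = proj₁ (Tree.par-ok t v tt ne)
                             x , ax , e = ih v (Adj-sym H pa)
                         in x , ax , trans (W.out-const v (flip v) u _ a pa) (trans (flip v _ pa) e)) v tt
    F-const : ∀ u v u' v' → Adj H u v → Adj H u' v' → γF (lab u v) ≡ γF (lab u' v')
    F-const u v u' v' a a' with to-root u v a | to-root u' v' a'
    ... | x , ax , e | y , ay , e' = trans e (trans (W.out-const root (flip root) x y ax ay) (sym e'))
    M≤2 : M ≤ 2
    M≤2 = two-classes (γV root) (λ i → ∃₂ λ u v → Adj H u v × γF (lab u v) ≡ i)
      (λ i → [ (λ (v , e) → inj₁ (trans (sym e) (γV-const v)))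
             , (λ (f , e) → let u , v , a , q = sj f in inj₂ (u , v , a , trans (cong γF q) e)) ]′ (cover i))
      (λ { _ _ (u , v , a , refl) (u' , v' , a' , refl) → F-const u v u' v' a a' })

-- Plane embeddings

-- A plane embedding of H whose faces are the vertices of the dual graph G: lab u v is the face of
-- the dart (u , v).  Values of lab and of the rotation off the edges of H are junk.
record LE (H G : Graph) : Set where
  field
    ro       : RotSys H
    lab      : V H → V H → V G
    lab-step : ∀ u v → Adj H u v → lab v (σ ro v u) ≡ lab u v
    lab-surj : ∀ f → ∃₂ λ u v → Adj H u v × lab u v ≡ f
    conn     : ColConn H
    eul      : 2 * n H + 2 * n G ≡ dartCount H + 4
    dual→    : ∀ a b → Adj G a b → ∃₂ λ u v → Adj H u v × lab u v ≡ a × lab v u ≡ b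
    dual←    : ∀ u v → Adj H u v → Adj G (lab u v) (lab v u)

  rt : V H → V H → V H
  rt = σ ro

  turn : ∀ {v u w} → Adj H v u → rt v u ≡ w → lab v w ≡ lab u v
  turn {v} {u} a e = trans (cong (lab v) (sym e)) (lab-step u v (Adj-sym H a))

  loopless : ∀ {u v} → Adj H u v → lab u v ≢ lab v u
  loopless a e = adj≢ G (dual← _ _ a) e

dartStep : {H : Graph} → RotSys H → V H × V H → V H × V H
dartStep ρ (u , v) = v , σ ρ v u

-- A map that is injective on a closed part of a finite type permutes this part. Orbits are
-- therefore periodic, and reachability is decidable and can be followed backwards.
module FiniteOrbit {A : Set} {N : ℕ} (enc : A → Fin N) (enc-inj : ∀ {x y} → enc x ≡ enc y → x ≡ y)
  (f : A → A) (P : A → Set) (P-cl : ∀ x → P x → P (f x))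
  (f-inj : ∀ x y → P x → P y → f x ≡ f y → x ≡ y) where

  P-iter : ∀ k x → P x → P (iter f k x)
  P-iter zero    x p = p
  P-iter (suc k) x p = P-cl _ (P-iter k x p)

  cancel : ∀ i k x → P x → iter f i x ≡ iter f (i + k) x → x ≡ iter f k x
  cancel zero    k x p e = e
  cancel (suc i) k x p e = cancel i k x p (f-inj _ _ (P-iter i x p) (P-iter (i + k) x p) e)

  period : ∀ x → P x → ∃ λ p → iter f (suc p) x ≡ x
  period x px with pigeonhole (≤-refl {suc N}) (λ i → enc (iter f (toℕ i) x))
  ... | i , j , lt , e with m≤n⇒∃[o]m+o≡n lt
  ... | o , q = o , sym (cancel (toℕ i) (suc o) x px
          (trans (enc-inj e) (cong (λ k → iter f k x) (trans (sym q) (sym (+-suc (toℕ i) o))))))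

  bounded : ∀ x p → iter f (suc p) x ≡ x → ∀ k → ∃ λ (i : Fin (suc p)) → iter f (toℕ i) x ≡ iter f k x
  bounded x p e zero = zero , refl
  bounded x p e (suc k) with bounded x p e k
  ... | i , q with view i
  ... | ‵fromℕ = zero , trans (sym e) (cong f (trans (cong (λ m → iter f m x) (sym (toℕ-fromℕ p))) q))
  ... | ‵inject₁ j = suc j , cong f (trans (cong (λ m → iter f m x) (sym (toℕ-inject₁ j))) q)

  reach? : (∀ x y → Dec (x ≡ y)) → ∀ x → P x → ∀ y → Dec (Reach f x y)
  reach? dec x px y with period x px
  ... | p , e with any? (λ (i : Fin (suc p)) → dec (iter f (toℕ i) x) y)
  ... | yes (i , q) = yes (toℕ i , q)
  ... | no no-i = no λ (k , q) → let i , r = bounded x p e k in no-i (i , trans r q)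

  reach-back : ∀ x y → P x → P y → Reach f x (f y) → Reach f x y
  reach-back x y px py (suc k , q) = k , f-inj _ _ (P-iter k x px) py q
  reach-back x y px py (zero , refl) with period (f y) px
  ... | p , e = p , f-inj _ _ (P-iter p _ px) py e

module _ {H G : Graph} (E : LE H G) where
  open LE E
  private
    stp : V H × V H → V H × V H
    stp = dartStep ro
    P : V H × V H → Set
    P (u , v) = Adj H u v
    lem : ∀ {u v u' v'} → Adj H u v → Adj H u' v' → v ≡ v' → rt v u ≡ rt v' u' → (u , v) ≡ (u' , v')
    lem {v = v} a a' refl e = cong (_, v) (σ-inj ro v _ _ (Adj-sym H a) (Adj-sym H a') e)
    code-inj : ∀ {x y : V H × V H} → combine (proj₁ x) (proj₂ x) ≡ combine (proj₁ y) (proj₂ y) → x ≡ y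
    code-inj {x} {y} e = let a , b = combine-injective (proj₁ x) (proj₂ x) (proj₁ y) (proj₂ y) e in cong₂ _,_ a b
    stp-adj : ∀ x → P x → P (stp x)
    stp-adj (u , v) a = σ-adj ro v u (Adj-sym H a)
    stp-inj : ∀ x y → P x → P y → stp x ≡ stp y → x ≡ y
    stp-inj (u , v) (u' , v') a a' e = lem a a' (cong proj₁ e) (cong proj₂ e)
    module O = FiniteOrbit {V H × V H} (λ (u , v) → combine u v) (λ {x} {y} → code-inj {x} {y}) stp P stp-adj stp-inj

  lab-reach : ∀ {d d'} → P d → Reach stp d d' → lab (proj₁ d) (proj₂ d) ≡ lab (proj₁ d') (proj₂ d')
  lab-reach {u , v} a r = sym (proj₂ (reach-inv (λ (x , y) → Adj H x y × lab x y ≡ lab u v)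
    (λ (x , y) (b , e) → σ-adj ro y x (Adj-sym H b) , trans (lab-step x y b) e) (a , refl) r))

  -- If two orbits had the same label, splitting the label would break Euler's inequality.
  lab-orbit : ∀ {u v u' v'} → Adj H u v → Adj H u' v' → lab u v ≡ lab u' v' → Reach stp (u , v) (u' , v')
  lab-orbit {u} {v} {u'} {v'} a a' e with O.reach? (≡-dec _≟_ _≟_) (u , v) a (u' , v')
  ... | yes r = r
  ... | no nr = ⊥-elim (1+n≰n (≤-trans (n≤1+n _) (≤-trans (≤-reflexive (sym
          (trans (solve 2 (λ x y → con 2 :* (x :+ (con 1 :+ y)) := con 2 :+ (con 2 :* x :+ con 2 :* y)) refl (n H) (n G))
            (cong (2 +_) eul)))) ineq)))
    where
    open +-*-Solver
    R? : ∀ d → Dec (Reach stp (u , v) d)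
    R? = O.reach? (≡-dec _≟_ _≟_) (u , v) a
    -- The orbit of `(u , v)` gets the fresh label `zero`, and its former label stays in use at
    -- `(u' , v')`; so `suc (n G)` labels occur.
    lab' : V H → V H → Fin (suc (n G))
    lab' x y = if does (R? (x , y)) then zero else suc (lab x y)
    st : ∀ x y → Adj H x y → lab' y (rt y x) ≡ lab' x y
    st x y b with R? (x , y) | R? (y , rt y x)
    ... | yes r | yes _ = refl
    ... | yes r | no n = ⊥-elim (n (reach-trans r (reach-one refl)))
    ... | no n | yes r = ⊥-elim (n (O.reach-back _ _ a b r))
    ... | no _ | no _  = cong suc (lab-step x y b)
    at : ∀ {x y} → Reach stp (u , v) (x , y) → lab' x y ≡ zero
    at {x} {y} r with R? (x , y)
    ... | yes _ = refl
    ... | no n = ⊥-elim (n r)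
    off : ∀ {x y} → ¬ Reach stp (u , v) (x , y) → lab' x y ≡ suc (lab x y)
    off {x} {y} n with R? (x , y)
    ... | yes r = ⊥-elim (n r)
    ... | no _ = refl
    sj : ∀ f → ∃₂ λ x y → Adj H x y × lab' x y ≡ f
    sj zero = u , v , a , at reach-refl
    sj (suc f) with lab-surj f
    ... | x , y , b , refl with R? (x , y)
    ... | no n  = x , y , b , off n
    ... | yes r = u' , v' , a' , trans (off nr) (cong suc (trans (sym e) (lab-reach a r)))
    ineq : 2 * (n H + suc (n G)) ≤ dartCount H + 4
    ineq = ≤-trans (*-monoʳ-≤ 2 (euler-≤ H ro lab' st sj conn u))
      (≤-reflexive (trans (*-distribˡ-+ 2 2 (length (edgeList H)))
        (trans (+-comm 4 _) (cong (_+ 4) (2*edgeList H)))))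

  connectedStar : V H → ∀ u v → Star (Adj H) u v
  connectedStar root u v = up u ◅◅ down v
    where
    t : Tree H (λ _ → true) root
    t = spanningTree H (λ _ → true) root tt conn
    up : ∀ v → Star (Adj H) v root
    up v = tree-ind t (λ v → Star (Adj H) v root) ε
      (λ v p ne s → proj₁ (Tree.par-ok t v p ne) ◅ s) v tt
    down : ∀ v → Star (Adj H) root v
    down v = tree-ind t (λ v → Star (Adj H) root v) ε
      (λ v p ne s → s ◅◅ (Adj-sym H (proj₁ (Tree.par-ok t v p ne)) ◅ ε)) v tt

  private
    face' : Dart H → V G
    face' ((u , v) , _) = lab u v

    iter-dart : ∀ k d → proj₁ (iter (faceStep ro) k d) ≡ iter stp k (proj₁ d)
    iter-dart zero    d = refl
    iter-dart (suc k) d = cong stp (iter-dart k d)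

  toPlane : PlaneEmbedding H (n G)
  toPlane = record
    { rot = ro ; face = face'
    ; face-orbit = λ d d' → mk⇔
        (λ e → let k , q = lab-orbit (proj₂ d) (proj₂ d') e in k , trans (iter-dart k d) q)
        (λ (k , q) → lab-reach (proj₂ d) (k , trans (sym (iter-dart k d)) q))
    ; face-surj = λ f → let u , v , a , e = lab-surj f in ((u , v) , a) , e
    ; connected = λ u v → connectedStar u u v ; euler = eul }

  toIsDual : IsDual G H
  toIsDual = toPlane , λ a b → mk⇔
    (λ h → let u , v , x , e , e' = dual→ a b h in ((u , v) , x) , e , e')
    (λ { (((u , v) , x) , refl , refl) → dual← u v x })

fromIsDual : ∀ {H G} → Dart H → IsDual G H → LE H G
fromIsDual {H} {G} d₀ (E , D) = record
  { ro = rot E ; lab = lab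
  ; lab-step = λ u v a → trans (lab≡ (σ-adj (rot E) v u (Adj-sym H a)))
      (trans (sym (Equivalence.from (face-orbit E _ _) (1 , refl))) (sym (lab≡ a)))
  ; lab-surj = λ f → let d , e = face-surj E f in
      proj₁ (proj₁ d) , proj₂ (proj₁ d) , proj₂ d , trans (lab≡ (proj₂ d)) e
  ; conn = λ c h u v _ _ → walk c h (connected E u v)
  ; eul = euler E
  ; dual→ = λ a b h → let d , e , e' = Equivalence.to (D a b) h in
      proj₁ (proj₁ d) , proj₂ (proj₁ d) , proj₂ d , trans (lab≡ (proj₂ d)) e , trans (lab≡ (Adj-sym H (proj₂ d))) e'
  ; dual← = λ u v a → subst₂ (Adj G) (sym (lab≡ a)) (sym (lab≡ (Adj-sym H a)))
      (Equivalence.from (D _ _) (((u , v) , a) , refl , refl)) }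
  where
  lab : V H → V H → V G
  lab u v with T? (adj H u v)
  ... | yes a = face E ((u , v) , a)
  -- A default value for pairs that are not darts; `d₀` only has to provide some face.
  ... | no _  = face E d₀
  lab≡ : ∀ {u v} (a : Adj H u v) → lab u v ≡ face E ((u , v) , a)
  lab≡ {u} {v} a with T? (adj H u v)
  ... | yes a' = cong (λ z → face E ((u , v) , z)) (T-irrelevant a' a)
  ... | no n   = ⊥-elim (n a)
  walk : ∀ (c : V H → Bool) → (∀ u v → T true → T true → Adj H u v → c u ≡ c v) →
    ∀ {u v} → Star (Adj H) u v → c u ≡ c v
  walk c h ε = refl
  walk c h (a ◅ s) = trans (h _ _ tt tt a) (walk c h s)

module _ {H G : Graph} (E : LE H G) where
  open LE E
  private
    pre : ∀ v w → Adj H v w → ∃ λ u → Adj H v u × rt v u ≡ w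
    pre v w a with σ-cyc ro v (rt v w) w (σ-adj ro v w a) a
    ... | k , e = iter (rt v) k w , go k , trans (sym (iter-suc (rt v) k w)) e
      where
      go : ∀ k → Adj H v (iter (rt v) k w)
      go zero    = a
      go (suc k) = σ-adj ro v _ (go k)

    rt⁻ : V H → V H → V H
    rt⁻ v w with T? (adj H v w)
    ... | yes a = proj₁ (pre v w a)
    ... | no _  = w

    rt⁻-ok : ∀ {v w} → Adj H v w → Adj H v (rt⁻ v w) × rt v (rt⁻ v w) ≡ w
    rt⁻-ok {v} {w} a with T? (adj H v w)
    ... | yes a' = proj₂ (pre v w a')
    ... | no n   = ⊥-elim (n a)

    rt⁻-rt : ∀ {v w} → Adj H v w → rt⁻ v (rt v w) ≡ w
    rt⁻-rt {v} {w} a = let b , e = rt⁻-ok (σ-adj ro v w a) in σ-inj ro v _ _ b a e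

    rev-cyc : ∀ v u w → Adj H v u → Reach (rt v) u w → Reach (rt⁻ v) w u
    rev-cyc v u w a r = proj₂ (reach-inv (λ y → Adj H v y × Reach (rt⁻ v) y u)
      (λ y (b , s) → σ-adj ro v y b , reach-trans (reach-one (rt⁻-rt b)) s) (a , reach-refl) r)

  -- Reversing the orientation exchanges the two sides of every dart. It reduces each case
  -- distinction on the cyclic order at a cubic vertex to one of its two cases.
  mirror : LE H G
  mirror = record
    { ro = mkRot H rt⁻ λ v → mkLR (λ u a → proj₁ (rt⁻-ok a))
        (λ u u' a a' e → trans (sym (proj₂ (rt⁻-ok a))) (trans (cong (rt v) e) (proj₂ (rt⁻-ok a'))))
        (λ u w a b → rev-cyc v w u b (σ-cyc ro v w u b a))
    ; lab = λ u v → lab v u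
    ; lab-step = λ u v a → let b , e = rt⁻-ok (Adj-sym H a) in
        trans (sym (lab-step (rt⁻ v u) v (Adj-sym H b))) (cong (lab v) e)
    ; lab-surj = λ f → let u , v , a , e = lab-surj f in v , u , Adj-sym H a , e
    ; conn = conn ; eul = eul
    ; dual→ = λ a b h → let u , v , x , e , e' = dual→ a b h in v , u , Adj-sym H x , e , e'
    ; dual← = λ u v a → dual← v u (Adj-sym H a) }

  mirror-rt : ∀ {v w} → Adj H v w → LE.rt mirror v (rt v w) ≡ w
  mirror-rt = rt⁻-rt

  rt-mirror : ∀ {v w} → Adj H v w → Adj H v (LE.rt mirror v w) × rt v (LE.rt mirror v w) ≡ w
  rt-mirror = rt⁻-ok

transportLE : ∀ {H H' G G'} → Iso H H' → Iso G G' → LE H G → LE H' G'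
transportLE {H} {H'} {G} {G'} I J E = record
  { ro = mkRot H' (λ v u → I.to (rt (I.from v) (I.from u))) λ v →
      LR-conj (rotAt ro (I.from v)) I.to I.from
        (λ u a → subst (λ z → Adj H' z (I.to u)) (I.tofrom v) (up a)) (λ y a → down a)
        (λ u _ → I.fromto u) (λ y _ → I.tofrom y) λ _ _ → refl
  ; lab = λ u v → J.to (lab (I.from u) (I.from v))
  ; lab-step = λ u v a → cong J.to (trans (cong (lab (I.from v)) (I.fromto _)) (lab-step _ _ (down a)))
  ; lab-surj = λ f → let u , v , a , e = lab-surj (J.from f) in I.to u , I.to v , up a ,
      trans (labto u v) (trans (cong J.to e) (J.tofrom f))
  ; conn = λ c h u v _ _ → trans (sym (cong c (I.tofrom u)))
      (trans (conn (c ∘ I.to) (λ x y _ _ a → h _ _ tt tt (up a)) (I.from u) (I.from v) tt tt) (cong c (I.tofrom v)))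
  ; eul = subst₂ (λ x y → 2 * x + 2 * y ≡ dartCount H' + 4) (iso-n I) (iso-n J)
      (trans eul (cong (_+ 4) (iso-dartCount I)))
  ; dual→ = λ a b h → let u , v , x , e , e' = dual→ (J.from a) (J.from b) (subst T (sym (J.adj-from a b)) h) in
      I.to u , I.to v , up x , trans (labto u v) (trans (cong J.to e) (J.tofrom a)) ,
      trans (labto v u) (trans (cong J.to e') (J.tofrom b))
  ; dual← = λ u v a → subst T (sym (J.adj-to _ _)) (dual← _ _ (down a)) }
  where
  open LE E
  module I = Iso I
  module J = Iso J
  up : ∀ {u v} → Adj H u v → Adj H' (I.to u) (I.to v)
  up {u} {v} a = subst T (sym (I.adj-to u v)) a
  down : ∀ {u v} → Adj H' u v → Adj H (I.from u) (I.from v)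
  down {u} {v} a = subst T (sym (I.adj-from u v)) a
  labto : ∀ u v → J.to (lab (I.from (I.to u)) (I.from (I.to v))) ≡ J.to (lab u v)
  labto u v = cong J.to (cong₂ lab (I.fromto u) (I.fromto v))

-- Triangles of cubic vertices are faces

-- The vertex `z` may have any degree; connectedness of the rest makes up for what is unknown about
-- its rotation. A spanning tree of the rest, together with the edges `x x'`, `x y` and `y z`, is
-- the part contracted in the graph, whereas `x z` is left out of the list altogether.
module Jordan {H G : Graph} (E : LE H G) {x y z x' y' : V H} (dx : Deg3 H x y z x') (dy : Deg3 H y x z y')
  (conn : ConnectedOn H (λ v → not (mem3 x y z v))) where
  open LE E hiding (conn)
  private
    module X = Deg3 dx
    module Y = Deg3 dy
    xz : Adj H x z
    xz = X.ay
    yz : Adj H y z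
    yz = Y.ay
    in-tri : ∀ {v} → T (mem3 x y z v) → v ≡ x ⊎ v ≡ y ⊎ v ≡ z
    in-tri = mem3-e
    P : V H → Bool
    P v = not (mem3 x y z v)
    Px≢ : ∀ {v} → T (P v) → v ≢ x × v ≢ y × v ≢ z
    Px≢ h = (λ e → not-e h (mem3-i (inj₁ e))) , (λ e → not-e h (mem3-i (inj₂ (inj₁ e)))) ,
      λ e → not-e h (mem3-i (inj₂ (inj₂ e)))
    mkP : ∀ {v} → v ≢ x → v ≢ y → v ≢ z → T (P v)
    mkP a b c = not-i λ h → [ a , [ b , c ]′ ]′ (mem3-e h)
    Px' : T (P x')
    Px' = mkP (λ e → adj≢ H X.az (sym e)) (X.x≢z ∘ sym) (X.y≢z ∘ sym)
    Py' : T (P y')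
    Py' = mkP (Y.x≢z ∘ sym) (λ e → adj≢ H Y.az (sym e)) (Y.y≢z ∘ sym)
    t : Tree H P x'
    t = spanningTree H P x' Px' conn
    tr : V H → V H → Bool
    tr u v = inTree t u v ∨ (edgeIs x x' u v ∨ (edgeIs x y u v ∨ edgeIs y z u v))
    tr-sym : ∀ u v → tr u v ≡ tr v u
    tr-sym u v = cong₂ _∨_ (inTree-sym t u v) (cong₂ _∨_ (edgeIs-sym x x' u v)
      (cong₂ _∨_ (edgeIs-sym x y u v) (edgeIs-sym y z u v)))

    shorter : Σ (List (V H × V H)) λ L' → length (edgeList H) ≡ suc (length L') ×
      (∀ {u v} → Adj H u v → ¬ T (edgeIs x z u v) → Covers L' u v)
    shorter with edgeList-cover H x z xz
    ... | inj₁ i with extract i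
    ... | L' , e , f = L' , e , λ {u} {v} a ne → lem ne (edgeList-cover H u v a)
      where
      lem : ∀ {u v} → ¬ T (edgeIs x z u v) → Covers (edgeList H) u v → Covers L' u v
      lem ne (inj₁ j) = [ (λ { refl → ⊥-elim (ne (edgeIs-i₁ x z)) }) , inj₁ ]′ (f j)
      lem ne (inj₂ j) = [ (λ { refl → ⊥-elim (ne (edgeIs-i₂ x z)) }) , inj₂ ]′ (f j)
    shorter | inj₂ i with extract i
    ... | L' , e , f = L' , e , λ {u} {v} a ne → lem ne (edgeList-cover H u v a)
      where
      lem : ∀ {u v} → ¬ T (edgeIs x z u v) → Covers (edgeList H) u v → Covers L' u v
      lem ne (inj₁ j) = [ (λ { refl → ⊥-elim (ne (edgeIs-i₂ x z)) }) , inj₁ ]′ (f j)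
      lem ne (inj₂ j) = [ (λ { refl → ⊥-elim (ne (edgeIs-i₁ x z)) }) , inj₂ ]′ (f j)

  -- If the triangle is not a face then the dual stays connected without its edges and without the
  -- edges of a spanning tree, although the edge xz was counted neither in the tree nor in the dual.
  private
   face-of-triangle′ : rt x z ≡ y → rt y x ≡ z × rt z y ≡ x
   face-of-triangle′ rxz with contractEdges H lab tr (proj₁ shorter)
   ... | M , γV , γF , cover , le , eq = main
     where
     L' = proj₁ shorter
     g : V H → V H → Fin M
     g u v = γF (lab u v)
     module W = Walk ro g (λ u v a → cong γF (lab-step u v a))
     listed : ∀ {u v} → Adj H u v → ¬ T (edgeIs x z u v) → ¬ T (tr u v) → W.Flip u v
     listed {u} {v} a n nt with proj₂ (proj₂ shorter) a n
     ... | inj₁ i = proj₂ (eq i) nt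
     ... | inj₂ i = sym (proj₂ (eq i) (nt ∘ subst T (tr-sym v u)))
     treeV : ∀ {u v} → Adj H u v → ¬ T (edgeIs x z u v) → T (tr u v) → γV u ≡ γV v
     treeV {u} {v} a n h with proj₂ (proj₂ shorter) a n
     ... | inj₁ i = proj₁ (eq i) h
     ... | inj₂ i = sym (proj₁ (eq i) (subst T (tr-sym u v) h))
     notxz : ∀ {u v} → T (P u) → ¬ T (edgeIs x z u v)
     notxz pu h with Px≢ pu | edgeIs-e h
     ... | n , _ | inj₁ (e , _) = n e
     ... | _ , _ , n | inj₂ (e , _) = n e
     fl : ∀ v w → T (P v) → Adj H v w → ¬ T (inTree t v w) → v ≢ x' ⊎ T (P w) → W.Flip v w
     fl v w pv a nt c = listed a (notxz pv) λ h → [ nt , [ e₁ c , [ e₂ , e₃ ]′ ∘ ∨-e ]′ ∘ ∨-e ]′ (∨-e {inTree t v w} h)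
       where
       ne = Px≢ pv
       e₁ : v ≢ x' ⊎ T (P w) → ¬ T (edgeIs x x' v w)
       e₁ c h with edgeIs-e h | c
       ... | inj₁ (e , _) | _ = proj₁ ne e
       ... | inj₂ (e , _) | inj₁ n = n e
       ... | inj₂ (_ , e) | inj₂ pw = proj₁ (Px≢ pw) e
       e₂ : ¬ T (edgeIs x y v w)
       e₂ h with edgeIs-e h
       ... | inj₁ (e , _) = proj₁ ne e
       ... | inj₂ (e , _) = proj₁ (proj₂ ne) e
       e₃ : ¬ T (edgeIs y z v w)
       e₃ h with edgeIs-e h
       ... | inj₁ (e , _) = proj₁ (proj₂ ne) e
       ... | inj₂ (e , _) = proj₂ (proj₂ ne) e
     flip-root : ∀ w → Adj H x' w → w ≢ x → W.Flip x' w
     flip-root w a ne with T? (P w)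
     ... | yes pw = W.walk-P t fl x' w Px' pw a
     ... | no npw = listed a (notxz Px') λ h → [ inT , [ e₁ , [ e₂ , e₃ ]′ ∘ ∨-e ]′ ∘ ∨-e ]′ (∨-e {inTree t x' w} h)
       where
       inT : ¬ T (inTree t x' w)
       inT h with inTree-e t h
       ... | inj₁ k = proj₁ (proj₂ (isPar-e t k)) refl
       ... | inj₂ k = npw (proj₁ (isPar-e t k))
       e₁ : ¬ T (edgeIs x x' x' w)
       e₁ h with edgeIs-e h
       ... | inj₁ (e , _) = proj₁ (Px≢ Px') e
       ... | inj₂ (_ , e) = ne e
       e₂ : ¬ T (edgeIs x y x' w)
       e₂ h with edgeIs-e h
       ... | inj₁ (e , _) = proj₁ (Px≢ Px') e
       ... | inj₂ (e , _) = proj₁ (proj₂ (Px≢ Px')) e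
       e₃ : ¬ T (edgeIs y z x' w)
       e₃ h with edgeIs-e h
       ... | inj₁ (e , _) = proj₁ (proj₂ (Px≢ Px')) e
       ... | inj₂ (e , _) = proj₂ (proj₂ (Px≢ Px')) e
     -- Outside the triangle every edge flips. This includes the contracted edge from `x'` to `x`,
     -- as it is the only one left when turning around `x'`.
     flip-out : ∀ v → T (P v) → ∀ w → Adj H v w → W.Flip v w
     flip-out v pv w a with v ≟ x'
     ... | no ne = W.walk t fl v pv ne w a
     ... | yes refl with w ≟ x
     ... | no ne = flip-root w a ne
     ... | yes refl = W.around x' x a flip-root
     c₀ : Fin M
     c₀ = g x' x
     out : ∀ {v} → T (P v) → ∀ {w} → Adj H v w → g v w ≡ c₀
     out {v} pv {w} a = tree-ind t (λ v → ∀ w → Adj H v w → g v w ≡ c₀)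
       (λ w a → W.out-const x' (flip-out x' Px') w x a (Adj-sym H X.az))
       (λ v pv ne ih w a → let pa , pp , _ = Tree.par-ok t v pv ne in
          trans (W.out-const v (flip-out v pv) w _ a pa) (trans (flip-out v pv _ pa) (ih v (Adj-sym H pa)))) v pv w a
     into : ∀ {v} → T (P v) → ∀ {w} → Adj H w v → g w v ≡ c₀
     into {v} pv {w} a = trans (sym (flip-out v pv w (Adj-sym H a))) (out pv (Adj-sym H a))
     vx : γV x ≡ γV x'
     vx = treeV X.az (λ h → [ X.y≢z ∘ sym ∘ proj₂ , (λ e → adj≢ H X.ay (proj₁ e)) ]′ (edgeIs-e h))
       (∨-r {inTree t x x'} (∨-l (edgeIs-i₁ x x')))
     vy : γV x ≡ γV y
     vy = treeV X.ax (λ h → [ X.x≢y ∘ proj₂ , (λ e → adj≢ H X.ay (proj₁ e)) ]′ (edgeIs-e h))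
       (∨-r {inTree t x y} (∨-r {edgeIs x x' x y} (∨-l (edgeIs-i₁ x y))))
     vz : γV y ≡ γV z
     vz = treeV yz (λ h → [ (λ e → adj≢ H X.ax (sym (proj₁ e))) , X.x≢y ∘ proj₁ ]′ (edgeIs-e h))
       (∨-r {inTree t y z} (∨-r {edgeIs x x' y z} (∨-r {edgeIs x y y z} (edgeIs-i₁ y z))))
     vP : ∀ v → T (P v) → γV v ≡ γV x'
     vP = tree-ind t (λ v → γV v ≡ γV x') refl λ v pv ne ih → let pa , pp , _ = Tree.par-ok t v pv ne in
       trans (treeV pa (notxz pv) (∨-l (inTree-par t pv ne))) ih
     vAll : ∀ v → γV v ≡ γV x'
     vAll v with T? (mem3 x y z v)
     ... | no n = vP v (not-i n)
     ... | yes h with in-tri h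
     ... | inj₁ refl = vx
     ... | inj₂ (inj₁ refl) = trans (sym vy) vx
     ... | inj₂ (inj₂ refl) = trans (sym vz) (trans (sym vy) vx)
     -- If the six darts of the triangle share the class of the outside, a single face class
     -- remains. Two classes and a list without `x z` give `n H + n G ≤ 2 + length L'`, which is one
     -- less than Euler's formula demands.
     absurd : g x y ≡ c₀ → g y x ≡ c₀ → g x z ≡ c₀ → g z x ≡ c₀ → g y z ≡ c₀ → g z y ≡ c₀ → ⊥
     absurd xy yx xz' zx yz' zy = 1+n≰n {4 + 2 * length L'} (≤-trans (n≤1+n _) (≤-trans (≤-reflexive (sym six))
         (≤-trans (*-monoʳ-≤ 2 (≤-trans le (+-monoˡ-≤ (length L') M≤2))) (≤-reflexive (*-distribˡ-+ 2 2 (length L'))))))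
       where
       open +-*-Solver
       ed : ∀ u v → Adj H u v → g u v ≡ c₀
       ed u v a with T? (mem3 x y z u) | T? (mem3 x y z v)
       ... | no n | _ = out (not-i n) a
       ... | yes _ | no n = into (not-i n) a
       ... | yes h | yes k with in-tri h | in-tri k
       ... | inj₁ refl | inj₁ refl = ⊥-elim (adj≢ H a refl)
       ... | inj₁ refl | inj₂ (inj₁ refl) = xy
       ... | inj₁ refl | inj₂ (inj₂ refl) = xz'
       ... | inj₂ (inj₁ refl) | inj₁ refl = yx
       ... | inj₂ (inj₁ refl) | inj₂ (inj₁ refl) = ⊥-elim (adj≢ H a refl)
       ... | inj₂ (inj₁ refl) | inj₂ (inj₂ refl) = yz'
       ... | inj₂ (inj₂ refl) | inj₁ refl = zx
       ... | inj₂ (inj₂ refl) | inj₂ (inj₁ refl) = zy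
       ... | inj₂ (inj₂ refl) | inj₂ (inj₂ refl) = ⊥-elim (adj≢ H a refl)
       M≤2 : M ≤ 2
       M≤2 = two-classes (γV x') (_≡ c₀)
         (λ i → [ (λ (v , e) → inj₁ (trans (sym e) (vAll v)))
                , (λ (f , e) → let u , v , a , q = lab-surj f in
                    inj₂ (trans (sym e) (trans (cong γF (sym q)) (ed u v a)))) ]′ (cover i))
         (λ i j e e' → trans e (sym e'))
       six : 2 * (n H + n G) ≡ 6 + 2 * length L'
       six = trans (*-distribˡ-+ 2 (n H) (n G)) (trans eul (trans (cong (_+ 4) (trans (sym (2*edgeList H))
         (cong (2 *_) (proj₁ (proj₂ shorter)))))
         (solve 1 (λ l → con 2 :* (con 1 :+ l) :+ con 4 := con 6 :+ con 2 :* l) refl (length L'))))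
     turn' : ∀ {v u w} → Adj H v u → rt v u ≡ w → g v w ≡ g u v
     turn' a e = cong γF (turn a e)
     yx≡c₀ : g y x ≡ c₀
     yx≡c₀ = trans (sym (turn' X.ax (proj₁ (rot3 ro (deg3-rot (deg3-rot (deg3-swap dx))) rxz)))) (into Px' X.az)
     xz≡c₀ : g x z ≡ c₀
     xz≡c₀ = turn' X.az (proj₂ (rot3 ro (deg3-rot (deg3-rot (deg3-swap dx))) rxz))
     xy≡zx : g x y ≡ g z x
     xy≡zx = turn' X.ay rxz
     main : rt y x ≡ z × rt z y ≡ x
     -- The face through `z x` continues along `x y`. If it leaves the triangle at `y` or at `z`, it
     -- runs into the outside, and then every dart of the triangle falls into the class `c₀`.
     main with rot3-cases ro dy
     ... | inj₂ e = ⊥-elim (absurd xy yx≡c₀ xz≡c₀ (trans (sym xy≡zx) xy)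
             (trans (turn' Y.az (proj₁ r)) (out Py' (Adj-sym H Y.az))) (trans (sym (turn' yz (proj₂ r))) yx≡c₀))
       where
       r = rot3 ro (deg3-swap dy) e
       xy : g x y ≡ c₀
       xy = trans (sym (turn' Y.ax e)) (into Py' Y.az)
     ... | inj₁ e with T? (P (rt z y)) | T? (mem3 x y z (rt z y))
     ... | no n | no n' = ⊥-elim (n (not-i n'))
     ... | yes p | _ = ⊥-elim (absurd (trans (sym (turn' Y.ax e)) yzc) yx≡c₀ xz≡c₀
             (trans (sym xy≡zx) (trans (sym (turn' Y.ax e)) yzc)) yzc
             (trans (sym (turn' yz (proj₁ (rot3 ro dy e)))) (into Py' Y.az)))
       where
       yzc : g y z ≡ c₀
       yzc = trans (sym (turn' (Adj-sym H yz) refl)) (into p (σ-adj ro z y (Adj-sym H yz)))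
     ... | no _ | yes h with in-tri h
     ... | inj₁ q = e , q
     ... | inj₂ (inj₁ q) = ⊥-elim (adj≢ H X.ax (reach-inv (_≡ y) (λ { _ refl → q }) refl
             (σ-cyc ro z y x (Adj-sym H yz) (Adj-sym H xz))))
     ... | inj₂ (inj₂ q) = ⊥-elim (adj≢ H (σ-adj ro z y (Adj-sym H yz)) (sym q))

  -- Opaque, like several lemmas below, so that conversion checking never unfolds the counting proof.
  opaque
    face-of-triangle : rt x z ≡ y → rt y x ≡ z × rt z y ≡ x
    face-of-triangle = face-of-triangle′

face-of-triangle⁻ : ∀ {H G} (E : LE H G) {x y z x' y'} → Deg3 H x y z x' → Deg3 H y x z y' →
  ConnectedOn H (λ v → not (mem3 x y z v)) → LE.rt E x y ≡ z → LE.rt E z x ≡ y × LE.rt E y z ≡ x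
face-of-triangle⁻ {H} E {x} {y} {z} dx dy c e = flip-z , flip-y
  where
  open LE E hiding (conn)
  r = Jordan.face-of-triangle (mirror E) dx dy c (trans (cong (LE.rt (mirror E) x) (sym e)) (mirror-rt E (Deg3.ax dx)))
  flip-y : rt y z ≡ x
  flip-y = trans (cong (rt y) (sym (proj₁ r))) (proj₂ (rt-mirror E (Deg3.ax dy)))
  flip-z : rt z x ≡ y
  flip-z = trans (cong (rt z) (sym (proj₂ r))) (proj₂ (rt-mirror E (Adj-sym H (Deg3.ay dy))))

private
  -- With three cubic corners no counting is necessary: each of the other choices of rotations at
  -- `q` and `r` leads one face along both sides of some edge, which would be a loop of the dual.
  face-of-cubic-triangle′ : ∀ {H G} (E : LE H G) {p q r a b c} → Deg3 H p q r a → Deg3 H q p r b → Deg3 H r p q c →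
    LE.rt E p q ≡ r → LE.rt E r p ≡ q × LE.rt E q r ≡ p
  face-of-cubic-triangle′ {H} E {p} {q} {r} {a} {b} {c} dp dq dr e with rot3-cases (LE.ro E) dr | rot3-cases (LE.ro E) dq
  ... | inj₂ rp | inj₂ qp = ⊥-elim (loopless (Adj-sym H (Deg3.az dr))
          (trans (sym (turn (Deg3.az dr) (proj₁ R))) (trans (sym (turn (Deg3.ay dq) (proj₂ Q)))
            (trans (sym (turn (Deg3.ax dp) e)) (sym (turn (Deg3.ax dr) rp))))))
    where
    open LE E
    R = rot3 ro (deg3-swap dr) rp
    Q = rot3 ro (deg3-swap dq) qp
  ... | inj₂ rp | inj₁ qp = ⊥-elim (loopless (Deg3.az dp)
          (trans (turn (Deg3.ay dp) (proj₁ P)) (trans (turn (Deg3.ay dr) (proj₂ R)) (trans (turn (Deg3.ax dq) qp)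
            (turn (Deg3.az dp) (proj₂ P))))))
    where
    open LE E
    R = rot3 ro (deg3-swap dr) rp
    P = rot3 ro dp e
  ... | inj₁ rp | inj₂ qp = rp , proj₂ (rot3 (LE.ro E) (deg3-swap dq) qp)
  ... | inj₁ rp | inj₁ qp = ⊥-elim (loopless (Deg3.az dq)
          (trans (turn (Deg3.ay dq) (proj₁ Q)) (trans (turn (Deg3.ax dr) rp) (trans (turn (Deg3.ax dp) e)
            (turn (Deg3.az dq) (proj₂ Q))))))
    where
    open LE E
    Q = rot3 ro dq qp

opaque
  face-of-cubic-triangle : ∀ {H G} (E : LE H G) {p q r a b c} → Deg3 H p q r a → Deg3 H q p r b → Deg3 H r p q c →
    LE.rt E p q ≡ r → LE.rt E r p ≡ q × LE.rt E q r ≡ p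
  face-of-cubic-triangle = face-of-cubic-triangle′

-- Local structure and 3-connectivity of the inverse constructions

delEdge²-i : ∀ {m} (f : Fin m → Fin m → Bool) {t b c x y} → T (f x y) →
  ¬ (x ≡ t × (y ≡ b ⊎ y ≡ c)) → ¬ (y ≡ t × (x ≡ b ⊎ x ≡ c)) → T (delEdge (delEdge f t b) t c x y)
delEdge²-i f h n₁ n₂ = delEdge-i _ (delEdge-i f h (λ (e , q) → n₁ (e , inj₁ q)) λ (q , e) → n₂ (e , inj₁ q))
  (λ (e , q) → n₁ (e , inj₂ q)) λ (q , e) → n₂ (e , inj₂ q)

delEdge²-e : ∀ {m} (f : Fin m → Fin m → Bool) {t b c x y} → T (delEdge (delEdge f t b) t c x y) →
  T (f x y) × ¬ (x ≡ t × (y ≡ b ⊎ y ≡ c)) × ¬ (y ≡ t × (x ≡ b ⊎ x ≡ c))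
delEdge²-e f h = let h₁ , n₁ , n₂ = delEdge-e _ h ; h₂ , n₃ , n₄ = delEdge-e f h₁ in
  h₂ , (λ { (e , inj₁ q) → n₃ (e , q) ; (e , inj₂ q) → n₁ (e , q) }) ,
  λ { (e , inj₁ q) → n₄ (q , e) ; (e , inj₂ q) → n₂ (q , e) }

other3 : ∀ {m} {p r s : Fin m} → p ≢ r → r ≢ s → p ≢ s → ∀ x y →
  ∃ λ w → (w ≡ p ⊎ w ≡ r ⊎ w ≡ s) × w ≢ x × w ≢ y
other3 {p = p} {r} {s} n₁ n₂ n₃ x y with p ≟ x | p ≟ y | r ≟ x | r ≟ y
... | no a | no b | _ | _ = p , inj₁ refl , a , b
... | _ | _ | no a | no b = r , inj₂ (inj₁ refl) , a , b
... | yes refl | _ | yes e | _ = ⊥-elim (n₁ (sym e))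
... | _ | yes refl | _ | yes e = ⊥-elim (n₁ (sym e))
... | yes refl | _ | no _ | yes refl = s , inj₂ (inj₂ refl) , n₃ ∘ sym , n₂ ∘ sym
... | no _ | yes refl | yes refl | no _ = s , inj₂ (inj₂ refl) , n₂ ∘ sym , n₃ ∘ sym

other2 : ∀ {m} {r s : Fin m} → r ≢ s → ∀ x → ∃ λ w → (w ≡ r ⊎ w ≡ s) × w ≢ x
other2 {r = r} {s} n x with r ≟ x
... | no a = r , inj₁ refl , a
... | yes refl = s , inj₂ refl , n ∘ sym

-- 3-connectivity in the style of `ConnectedOn`. The removed vertices `x` and `y` may coincide, so
-- that the removal of a single vertex is included.
Conn3 : Graph → Set
Conn3 H = ∀ x y (c : V H → Bool) →
  (∀ u v → u ≢ x → u ≢ y → v ≢ x → v ≢ y → Adj H u v → c u ≡ c v) →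
  ∀ u v → u ≢ x → u ≢ y → v ≢ x → v ≢ y → c u ≡ c v

conn3-swap : ∀ {H} {c : V H → Bool} {x y} →
  (∀ u v → u ≢ x → u ≢ y → v ≢ x → v ≢ y → c u ≡ c v) → ∀ u v → u ≢ y → u ≢ x → v ≢ y → v ≢ x → c u ≡ c v
conn3-swap h u v a b c d = h u v b a d c

suc≢ : ∀ {m} {x y : Fin m} → x ≢ y → Fin.suc x ≢ suc y
suc≢ n refl = n refl

module Sub {H : Graph} {p r s p' r' : V H} (dp : Deg3 H p r s p') (dr : Deg3 H r p s r') where
  private
    module P = Deg3 dp
    module R = Deg3 dr
  S : Graph
  S = sub H p r s
  p≢r : p ≢ r
  p≢r = adj≢ H P.ax
  r≢s : r ≢ s
  r≢s = P.x≢y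
  p≢s : p ≢ s
  p≢s = adj≢ H P.ay

  old-i : ∀ {x y} → Adj H x y → ¬ (x ≡ p × y ≡ r) → ¬ (x ≡ r × y ≡ p) → Adj S (suc x) (suc y)
  old-i = delEdge-i (adj H)

  old-e : ∀ {x y} → Adj S (suc x) (suc y) → Adj H x y × ¬ (x ≡ p × y ≡ r) × ¬ (x ≡ r × y ≡ p)
  old-e = delEdge-e (adj H)

  deg-q : Deg3 S zero (suc p) (suc r) (suc s)
  deg-q = mkD3 (mem3-i (inj₁ refl)) (mem3-i (inj₂ (inj₁ refl))) (mem3-i (inj₂ (inj₂ refl)))
    (suc≢ p≢r) (suc≢ r≢s) (suc≢ p≢s)
    λ { zero () ; (suc w) h → [ inj₁ ∘ cong suc , [ inj₂ ∘ inj₁ ∘ cong suc , inj₂ ∘ inj₂ ∘ cong suc ]′ ]′ (mem3-e h) }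

  deg-p : Deg3 S (suc p) zero (suc s) (suc p')
  deg-p = mkD3 (mem3-i (inj₁ refl)) (old-i P.ay (λ (_ , e) → r≢s (sym e)) (λ (e , _) → p≢r e))
    (old-i P.az (λ (_ , e) → P.x≢z (sym e)) (λ (e , _) → p≢r e)) (λ ()) (suc≢ P.y≢z) (λ ())
    λ { zero _ → inj₁ refl
      ; (suc w) h → let a , n , _ = old-e h in
          [ (λ e → ⊥-elim (n (refl , e))) , [ inj₂ ∘ inj₁ ∘ cong suc , inj₂ ∘ inj₂ ∘ cong suc ]′ ]′ (P.all w a) }

  deg-r : Deg3 S (suc r) zero (suc s) (suc r')
  deg-r = mkD3 (mem3-i (inj₂ (inj₁ refl))) (old-i R.ay (λ (e , _) → p≢r (sym e)) (λ (_ , e) → p≢s (sym e)))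
    (old-i R.az (λ (e , _) → p≢r (sym e)) (λ (_ , e) → R.x≢z (sym e))) (λ ()) (suc≢ R.y≢z) (λ ())
    λ { zero _ → inj₁ refl
      ; (suc w) h → let a , _ , n = old-e h in
          [ (λ e → ⊥-elim (n (refl , e))) , [ inj₂ ∘ inj₁ ∘ cong suc , inj₂ ∘ inj₂ ∘ cong suc ]′ ]′ (R.all w a) }

  module _ {h : V H} (h≢p : h ≢ p) (h≢r : h ≢ r) (h≢s : h ≢ s) where
    deg-old : ∀ {x y z} → Deg3 H h x y z → Deg3 S (suc h) (suc x) (suc y) (suc z)
    deg-old (mkD3 ax ay az n₁ n₂ n₃ all) = mkD3 (up ax) (up ay) (up az) (suc≢ n₁) (suc≢ n₂) (suc≢ n₃)
      λ { zero k → ⊥-elim ([ h≢p , [ h≢r , h≢s ]′ ]′ (mem3-e k))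
        ; (suc w) k → [ inj₁ ∘ cong suc , [ inj₂ ∘ inj₁ ∘ cong suc , inj₂ ∘ inj₂ ∘ cong suc ]′ ]′ (all w (proj₁ (old-e k))) }
      where
      up : ∀ {x} → Adj H h x → Adj S (suc h) (suc x)
      up a = old-i a (h≢p ∘ proj₁) (h≢r ∘ proj₁)

    nbr-old : ∀ x → Adj S (suc h) x → ∃ λ x' → x ≡ suc x' × Adj H h x'
    nbr-old zero k = ⊥-elim ([ h≢p , [ h≢r , h≢s ]′ ]′ (mem3-e k))
    nbr-old (suc x) k = x , refl , proj₁ (old-e k)

    deg-old⁻ : ∀ {x y z} → Deg3 S (suc h) x y z →
      ∃₂ λ x' y' → ∃ λ z' → x ≡ suc x' × y ≡ suc y' × z ≡ suc z' × Deg3 H h x' y' z'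
    deg-old⁻ {x} {y} {z} (mkD3 ax ay az n₁ n₂ n₃ all) with nbr-old x ax | nbr-old y ay | nbr-old z az
    ... | x' , refl , ax' | y' , refl , ay' | z' , refl , az' = x' , y' , z' , refl , refl , refl ,
      mkD3 ax' ay' az' (n₁ ∘ cong suc) (n₂ ∘ cong suc) (n₃ ∘ cong suc)
        λ w a → [ inj₁ ∘ fsuc-inj , [ inj₂ ∘ inj₁ ∘ fsuc-inj , inj₂ ∘ inj₂ ∘ fsuc-inj ]′ ]′
          (all (suc w) (old-i a (h≢p ∘ proj₁) (h≢r ∘ proj₁)))

  private
    -- When the new vertex is removed, `p` is no longer joined to `r`. Connectivity of `H` is
    -- therefore used without `p`, where the edge `p r` is absent anyway, and `p` is attached
    -- afterwards through `s` or `p'`, whichever differs from `y`. If the new vertex is removed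
    -- twice, `y` is `p` itself.
    cut-q : Conn3 H → ∀ Y y → (∀ {u} → u ≢ y → suc u ≢ Y) → y ≡ p ⊎ Y ≡ suc y → (c : V S → Bool) →
      (∀ u v → u ≢ zero → u ≢ Y → v ≢ zero → v ≢ Y → Adj S u v → c u ≡ c v) →
      ∀ u v → u ≢ zero → u ≢ Y → v ≢ zero → v ≢ Y → c u ≡ c v
    cut-q C Y y Y≢ Yy c h = go
      where
      W = other2 P.y≢z y
      w = proj₁ W
      w≢r : w ≢ r
      w≢r = [ (λ e q → r≢s (trans (sym q) e)) , (λ e q → P.x≢z (trans (sym q) e)) ]′ (proj₁ (proj₂ W))
      pw : Adj H p w
      pw = [ (λ e → subst (Adj H p) (sym e) P.ay) , (λ e → subst (Adj H p) (sym e) P.az) ]′ (proj₁ (proj₂ W))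
      base : ∀ u → u ≢ p → u ≢ y → c (suc u) ≡ c (suc w)
      base u n₁ n₂ = C p y (c ∘ suc)
        (λ u v a b a' b' q → h _ _ (λ ()) (Y≢ b) (λ ()) (Y≢ b') (old-i q (a ∘ proj₁) (a' ∘ proj₂)))
        u w n₁ n₂ (λ e → adj≢ H pw (sym e)) (proj₂ (proj₂ W))
      toW : ∀ u → u ≢ zero → u ≢ Y → c u ≡ c (suc w)
      toW zero n _ = ⊥-elim (n refl)
      toW (suc u) _ n with u ≟ p
      ... | yes refl = h _ _ (λ ()) n (λ ()) (Y≢ (proj₂ (proj₂ W))) (old-i pw (w≢r ∘ proj₂) (p≢r ∘ proj₁))
      ... | no ne = base u ne (λ e → [ (λ q → ne (trans e q)) , (λ q → n (trans (cong suc e) (sym q))) ]′ Yy)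
      go : ∀ u v → u ≢ zero → u ≢ Y → v ≢ zero → v ≢ Y → c u ≡ c v
      go u v a b a' b' = trans (toW u a b) (sym (toW v a' b'))

  -- If both removed vertices are old, the path through the new vertex replaces the edge `p r`, and
  -- the new vertex keeps at least one of its three neighbours.
  conn3 : Conn3 H → Conn3 S
  conn3 C (suc x) (suc y) c h u v u₁ u₂ v₁ v₂ = trans (toW u u₁ u₂) (sym (toW v v₁ v₂))
    where
    edge : ∀ u v → u ≢ x → u ≢ y → v ≢ x → v ≢ y → Adj H u v → c (suc u) ≡ c (suc v)
    edge u v u₁ u₂ v₁ v₂ a with T? (edgeIs p r u v)
    ... | no n = h _ _ (suc≢ u₁) (suc≢ u₂) (suc≢ v₁) (suc≢ v₂) (∧-edge a n)
      where
      ∧-edge : ∀ {u v} → Adj H u v → ¬ T (edgeIs p r u v) → Adj S (suc u) (suc v)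
      ∧-edge a n = old-i a (λ { (refl , refl) → n (edgeIs-i₁ p r) }) (λ { (refl , refl) → n (edgeIs-i₂ p r) })
    ... | yes e with edgeIs-e e
    ... | inj₁ (refl , refl) = trans (h (suc u) zero (suc≢ u₁) (suc≢ u₂) (λ ()) (λ ()) (mem3-i (inj₁ refl)))
                                 (h zero (suc v) (λ ()) (λ ()) (suc≢ v₁) (suc≢ v₂) (mem3-i (inj₂ (inj₁ refl))))
    ... | inj₂ (refl , refl) = trans (h (suc u) zero (suc≢ u₁) (suc≢ u₂) (λ ()) (λ ()) (mem3-i (inj₂ (inj₁ refl))))
                                 (h zero (suc v) (λ ()) (λ ()) (suc≢ v₁) (suc≢ v₂) (mem3-i (inj₁ refl)))
    W = other3 p≢r r≢s p≢s x y
    w = proj₁ W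
    toW : ∀ u → u ≢ suc x → u ≢ suc y → c u ≡ c (suc w)
    toW zero _ _ = h zero (suc w) (λ ()) (λ ()) (suc≢ (proj₁ (proj₂ (proj₂ W)))) (suc≢ (proj₂ (proj₂ (proj₂ W))))
      (mem3-i (proj₁ (proj₂ W)))
    toW (suc u) n₁ n₂ = C x y (c ∘ suc) edge u w (n₁ ∘ cong suc) (n₂ ∘ cong suc)
      (proj₁ (proj₂ (proj₂ W))) (proj₂ (proj₂ (proj₂ W)))
  conn3 C zero zero c h = cut-q C zero p (λ _ ()) (inj₁ refl) c h
  conn3 C zero (suc y) c h = cut-q C (suc y) y suc≢ (inj₂ refl) c h
  conn3 C (suc x) zero c h = conn3-swap {S} {c} (cut-q C (suc x) x suc≢ (inj₂ refl) c λ u v a b a' b' → h u v b a b' a')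

module Blow {H : Graph} {t a b c : V H} (d : Deg3 H t a b c) where
  private module D = Deg3 d
  B : Graph
  B = blow H t a b c
  a≢t : a ≢ t
  a≢t e = adj≢ H D.ax (sym e)
  b≢t : b ≢ t
  b≢t e = adj≢ H D.ay (sym e)
  c≢t : c ≢ t
  c≢t e = adj≢ H D.az (sym e)

  pt : V H → V B
  pt x = suc (suc x)

  pt≢ : ∀ {x y} → x ≢ y → pt x ≢ pt y
  pt≢ n refl = n refl

  old-i : ∀ {x y} → Adj H x y → ¬ (x ≡ t × (y ≡ b ⊎ y ≡ c)) → ¬ (y ≡ t × (x ≡ b ⊎ x ≡ c)) → Adj B (pt x) (pt y)
  old-i = delEdge²-i (adj H)

  old-e : ∀ {x y} → Adj B (pt x) (pt y) → Adj H x y × ¬ (x ≡ t × (y ≡ b ⊎ y ≡ c)) × ¬ (y ≡ t × (x ≡ b ⊎ x ≡ c))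
  old-e = delEdge²-e (adj H)

  pa : Adj B (pt t) (pt a)
  pa = old-i D.ax (λ { (_ , inj₁ e) → D.x≢y e ; (_ , inj₂ e) → D.x≢z e }) (λ (e , _) → a≢t e)

  deg-q : Deg3 B zero (pt t) (suc zero) (pt b)
  deg-q = mkD3 (mem2-i (inj₁ refl)) tt (mem2-i (inj₂ refl)) (λ ()) (λ ()) (pt≢ (b≢t ∘ sym))
    λ { zero () ; (suc zero) _ → inj₂ (inj₁ refl)
      ; (suc (suc w)) h → [ inj₁ ∘ cong pt , inj₂ ∘ inj₂ ∘ cong pt ]′ (mem2-e h) }

  deg-r : Deg3 B (suc zero) zero (pt t) (pt c)
  deg-r = mkD3 tt (mem2-i (inj₁ refl)) (mem2-i (inj₂ refl)) (λ ()) (pt≢ (c≢t ∘ sym)) (λ ())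
    λ { zero _ → inj₁ refl ; (suc zero) ()
      ; (suc (suc w)) h → [ inj₂ ∘ inj₁ ∘ cong pt , inj₂ ∘ inj₂ ∘ cong pt ]′ (mem2-e h) }

  deg-p : Deg3 B (pt t) zero (suc zero) (pt a)
  deg-p = mkD3 (mem2-i (inj₁ refl)) (mem2-i (inj₁ refl)) pa (λ ()) (λ ()) (λ ())
    λ { zero _ → inj₁ refl ; (suc zero) _ → inj₂ (inj₁ refl)
      ; (suc (suc w)) h → let x , n , _ = old-e h in inj₂ (inj₂ (cong pt
          ([ id , [ (λ e → ⊥-elim (n (refl , inj₁ e))) , (λ e → ⊥-elim (n (refl , inj₂ e))) ]′ ]′ (D.all w x)))) }

  -- κ h x is the neighbour of an old vertex h that takes over from its neighbour x.
  κ : V H → V H → V B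
  κ h x = if x == t then (if h == b then zero else (if h == c then suc zero else pt t)) else pt x

  κ⁻ : V B → V H
  κ⁻ zero          = t
  κ⁻ (suc zero)    = t
  κ⁻ (suc (suc x)) = x

  κ-old : ∀ {h x} → x ≢ t → κ h x ≡ pt x
  κ-old {h} {x} n with x ≟ t
  ... | yes e = ⊥-elim (n e)
  ... | no _  = refl

  κ-b : κ b t ≡ zero
  κ-b rewrite ==-refl t | ==-refl b = refl

  κ-c : κ c t ≡ suc zero
  κ-c rewrite ==-refl t | ==-no (D.y≢z ∘ sym) | ==-refl c = refl

  κ⁻-κ : ∀ h x → κ⁻ (κ h x) ≡ x
  κ⁻-κ h x with x ≟ t
  ... | no _ = refl
  ... | yes refl with h ≟ b | h ≟ c
  ... | yes _ | _    = refl
  ... | no _ | yes _ = refl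
  ... | no _ | no _  = refl

  module _ {h : V H} (h≢t : h ≢ t) where
    κ-adj : ∀ {x} → Adj H h x → Adj B (pt h) (κ h x)
    κ-adj {x} k with x ≟ t
    ... | no n = old-i k (h≢t ∘ proj₁) (n ∘ proj₁)
    ... | yes refl with h ≟ b | h ≟ c
    ... | yes e | _    = mem2-i (inj₂ e)
    ... | no _ | yes e = mem2-i (inj₂ e)
    ... | no n | no n' = old-i k (h≢t ∘ proj₁) (λ (_ , e) → [ n , n' ]′ e)

    κ⁻-adj : ∀ {y} → Adj B (pt h) y → Adj H h (κ⁻ y)
    κ⁻-adj {zero} k = [ ⊥-elim ∘ h≢t , (λ { refl → Adj-sym H D.ay }) ]′ (mem2-e k)
    κ⁻-adj {suc zero} k = [ ⊥-elim ∘ h≢t , (λ { refl → Adj-sym H D.az }) ]′ (mem2-e k)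
    κ⁻-adj {suc (suc y)} k = proj₁ (old-e k)

    κ-κ⁻ : ∀ {y} → Adj B (pt h) y → κ h (κ⁻ y) ≡ y
    κ-κ⁻ {zero} k = [ ⊥-elim ∘ h≢t , (λ { refl → κ-b }) ]′ (mem2-e k)
    κ-κ⁻ {suc zero} k = [ ⊥-elim ∘ h≢t , (λ { refl → κ-c }) ]′ (mem2-e k)
    κ-κ⁻ {suc (suc y)} k with y ≟ t
    ... | no n = refl
    ... | yes refl with h ≟ b | h ≟ c
    ... | yes e | _    = ⊥-elim (proj₂ (proj₂ (old-e k)) (refl , inj₁ e))
    ... | no _ | yes e = ⊥-elim (proj₂ (proj₂ (old-e k)) (refl , inj₂ e))
    ... | no _ | no _  = refl

    deg-old : ∀ {x y z} → Deg3 H h x y z → Deg3 B (pt h) (κ h x) (κ h y) (κ h z)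
    deg-old (mkD3 ax ay az n₁ n₂ n₃ all) = mkD3 (κ-adj ax) (κ-adj ay) (κ-adj az) (κ≢ n₁) (κ≢ n₂) (κ≢ n₃)
      λ w k → [ inj₁ ∘ lift k , [ inj₂ ∘ inj₁ ∘ lift k , inj₂ ∘ inj₂ ∘ lift k ]′ ]′ (all (κ⁻ w) (κ⁻-adj {w} k))
      where
      κ≢ : ∀ {x y} → x ≢ y → κ h x ≢ κ h y
      κ≢ n e = n (trans (sym (κ⁻-κ h _)) (trans (cong κ⁻ e) (κ⁻-κ h _)))
      lift : ∀ {w x} → Adj B (pt h) w → κ⁻ w ≡ x → w ≡ κ h x
      lift {w} k e = trans (sym (κ-κ⁻ {w} k)) (cong (κ h) e)

    deg-old⁻ : ∀ {x y z} → Deg3 B (pt h) x y z → Deg3 H h (κ⁻ x) (κ⁻ y) (κ⁻ z)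
    deg-old⁻ {x} {y} {z} (mkD3 ax ay az n₁ n₂ n₃ all) = mkD3 (κ⁻-adj {x} ax) (κ⁻-adj {y} ay) (κ⁻-adj {z} az)
      (κ⁻≢ x y ax ay n₁) (κ⁻≢ y z ay az n₂) (κ⁻≢ x z ax az n₃)
      λ w k → [ inj₁ ∘ low w x , [ inj₂ ∘ inj₁ ∘ low w y , inj₂ ∘ inj₂ ∘ low w z ]′ ]′ (all (κ h w) (κ-adj k))
      where
      κ⁻≢ : ∀ x y → Adj B (pt h) x → Adj B (pt h) y → x ≢ y → κ⁻ x ≢ κ⁻ y
      κ⁻≢ x y k l n e = n (trans (sym (κ-κ⁻ {x} k)) (trans (cong (κ h) e) (κ-κ⁻ {y} l)))
      low : ∀ w x → κ h w ≡ x → w ≡ κ⁻ x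
      low w x e = trans (sym (κ⁻-κ h w)) (cong κ⁻ e)

  cor : Fin 3 → V B
  cor zero             = pt t
  cor (suc zero)       = zero
  cor (suc (suc zero)) = suc zero

  nb : Fin 3 → V H
  nb zero             = a
  nb (suc zero)       = b
  nb (suc (suc zero)) = c

  data CView : V B → Set where
    corner : ∀ i → CView (cor i)
    old    : ∀ u → u ≢ t → CView (pt u)

  cview : ∀ x → CView x
  cview zero = corner (suc zero)
  cview (suc zero) = corner (suc (suc zero))
  cview (suc (suc x)) with x ≟ t
  ... | yes refl = corner zero
  ... | no n = old x n

  cor-adj : ∀ i j → i ≢ j → Adj B (cor i) (cor j)
  cor-adj zero zero n = ⊥-elim (n refl)
  cor-adj zero (suc zero) _ = mem2-i (inj₁ refl)
  cor-adj zero (suc (suc zero)) _ = mem2-i (inj₁ refl)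
  cor-adj (suc zero) zero _ = mem2-i (inj₁ refl)
  cor-adj (suc zero) (suc zero) n = ⊥-elim (n refl)
  cor-adj (suc zero) (suc (suc zero)) _ = tt
  cor-adj (suc (suc zero)) zero _ = mem2-i (inj₁ refl)
  cor-adj (suc (suc zero)) (suc zero) _ = tt
  cor-adj (suc (suc zero)) (suc (suc zero)) n = ⊥-elim (n refl)

  cor-nb : ∀ i → Adj B (cor i) (pt (nb i))
  cor-nb zero = pa
  cor-nb (suc zero) = mem2-i (inj₂ refl)
  cor-nb (suc (suc zero)) = mem2-i (inj₂ refl)

  nb≢t : ∀ i → nb i ≢ t
  nb≢t zero = a≢t
  nb≢t (suc zero) = b≢t
  nb≢t (suc (suc zero)) = c≢t

  nb≢ : ∀ i j → i ≢ j → nb i ≢ nb j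
  nb≢ zero zero n = ⊥-elim (n refl)
  nb≢ zero (suc zero) _ = D.x≢y
  nb≢ zero (suc (suc zero)) _ = D.x≢z
  nb≢ (suc zero) zero _ = D.x≢y ∘ sym
  nb≢ (suc zero) (suc zero) n = ⊥-elim (n refl)
  nb≢ (suc zero) (suc (suc zero)) _ = D.y≢z
  nb≢ (suc (suc zero)) zero _ = D.x≢z ∘ sym
  nb≢ (suc (suc zero)) (suc zero) _ = D.y≢z ∘ sym
  nb≢ (suc (suc zero)) (suc (suc zero)) n = ⊥-elim (n refl)

  cor≢old : ∀ i {u} → u ≢ t → pt u ≢ cor i
  cor≢old zero n refl = n refl
  cor≢old (suc zero) n ()
  cor≢old (suc (suc zero)) n ()

  cor≢ : ∀ i j → i ≢ j → cor i ≢ cor j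
  cor≢ i j n e = adj≢ B (cor-adj i j n) e

  κ⁻-cor : ∀ i → κ⁻ (cor i) ≡ t
  κ⁻-cor zero = refl
  κ⁻-cor (suc zero) = refl
  κ⁻-cor (suc (suc zero)) = refl

  module _ (C : Conn3 H) (col : V B → Bool) where
    private
      Const : V B → V B → Set
      Const X Y = ∀ u v → u ≢ X → u ≢ Y → v ≢ X → v ≢ Y → Adj B u v → col u ≡ col v

      -- If a corner is removed, connectivity of `H` is used without `t`. Another corner is attached
      -- through its outer neighbour or, if that one is removed too, through the third corner, whose
      -- outer neighbour is a different vertex.
      with-corner : ∀ i Y → Const (cor i) Y → ∀ u v → u ≢ cor i → u ≢ Y → v ≢ cor i → v ≢ Y → col u ≡ col v
      with-corner i Y h u v a₁ a₂ b₁ b₂ = trans (toW (cview u) a₁ a₂) (sym (toW (cview v) b₁ b₂))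
        where
        y = κ⁻ Y
        Y≢ : ∀ {u} → u ≢ t → u ≢ y → pt u ≢ Y
        Y≢ n n' refl = n' refl
        W = other3 D.x≢y D.y≢z D.x≢z t y
        w = proj₁ W
        base : ∀ u → u ≢ t → u ≢ y → col (pt u) ≡ col (pt w)
        base u n₁ n₂ = C t y (col ∘ pt) (λ u v x₁ x₂ y₁ y₂ k → h _ _ (cor≢old i x₁) (Y≢ x₁ x₂) (cor≢old i y₁) (Y≢ y₁ y₂)
            (old-i k (x₁ ∘ proj₁) (y₁ ∘ proj₁))) u w n₁ n₂ (proj₁ (proj₂ (proj₂ W))) (proj₂ (proj₂ (proj₂ W)))
        direct : ∀ j → cor j ≢ cor i → cor j ≢ Y → nb j ≢ y → col (cor j) ≡ col (pt w)
        direct j n₁ n₂ n₃ = trans (h _ _ n₁ n₂ (cor≢old i (nb≢t j)) (Y≢ (nb≢t j) n₃) (cor-nb j)) (base (nb j) (nb≢t j) n₃)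
        toW : ∀ {u} → CView u → u ≢ cor i → u ≢ Y → col u ≡ col (pt w)
        toW (old u n) n₁ n₂ with cview Y
        ... | corner j = base u n (λ e → n (trans e (κ⁻-cor j)))
        ... | old y' m = base u n (n₂ ∘ cong pt)
        toW (corner j) n₁ n₂ with nb j ≟ y
        ... | no ne = direct j n₁ n₂ ne
        ... | yes e with other3 {p = zero} {suc zero} {suc (suc zero)} (λ ()) (λ ()) (λ ()) i j
        ... | k , _ , k≢i , k≢j = trans (h _ _ n₁ n₂ (cor≢ k i k≢i) k≢Y (cor-adj j k (k≢j ∘ sym)))
              (direct k (cor≢ k i k≢i) k≢Y (λ q → nb≢ k j k≢j (trans q (sym e))))
          where
          k≢Y : cor k ≢ Y
          k≢Y refl = nb≢t j (trans e (κ⁻-cor k))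

      -- If both removed vertices are old, the triangle is intact, and contracting it to `t` leads
      -- back to `H`.
      no-corner : ∀ x y → x ≢ t → y ≢ t → Const (pt x) (pt y) →
        ∀ u v → u ≢ pt x → u ≢ pt y → v ≢ pt x → v ≢ pt y → col u ≡ col v
      no-corner x y x≢t y≢t h u v a₁ a₂ b₁ b₂ = trans (toT (cview u) a₁ a₂) (sym (toT (cview v) b₁ b₂))
        where
        corT : ∀ i → col (cor i) ≡ col (pt t)
        corT i with i ≟ zero
        ... | yes refl = refl
        ... | no n = h _ _ (cor≢old i x≢t ∘ sym) (cor≢old i y≢t ∘ sym) (pt≢ (x≢t ∘ sym)) (pt≢ (y≢t ∘ sym)) (cor-adj i zero n)
        tn : ∀ i → nb i ≢ x → nb i ≢ y → col (pt t) ≡ col (pt (nb i))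
        tn i n₁ n₂ = trans (sym (corT i)) (h _ _ (cor≢old i x≢t ∘ sym) (cor≢old i y≢t ∘ sym) (pt≢ n₁) (pt≢ n₂) (cor-nb i))
        edge : ∀ u v → u ≢ x → u ≢ y → v ≢ x → v ≢ y → Adj H u v → col (pt u) ≡ col (pt v)
        edge u v u₁ u₂ v₁ v₂ k with u ≟ t | v ≟ t
        ... | no n | no n' = h _ _ (pt≢ u₁) (pt≢ u₂) (pt≢ v₁) (pt≢ v₂) (old-i k (n ∘ proj₁) (n' ∘ proj₁))
        ... | yes refl | yes refl = refl
        ... | yes refl | no _ = tv (D.all v k)
          where
          tv : v ≡ a ⊎ v ≡ b ⊎ v ≡ c → col (pt t) ≡ col (pt v)
          tv (inj₁ refl) = tn zero v₁ v₂
          tv (inj₂ (inj₁ refl)) = tn (suc zero) v₁ v₂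
          tv (inj₂ (inj₂ refl)) = tn (suc (suc zero)) v₁ v₂
        ... | no _ | yes refl = sym (tu (D.all u (Adj-sym H k)))
          where
          tu : u ≡ a ⊎ u ≡ b ⊎ u ≡ c → col (pt t) ≡ col (pt u)
          tu (inj₁ refl) = tn zero u₁ u₂
          tu (inj₂ (inj₁ refl)) = tn (suc zero) u₁ u₂
          tu (inj₂ (inj₂ refl)) = tn (suc (suc zero)) u₁ u₂
        toT : ∀ {u} → CView u → u ≢ pt x → u ≢ pt y → col u ≡ col (pt t)
        toT (corner i) _ _ = corT i
        toT (old u _) n₁ n₂ = C x y (col ∘ pt) edge u t (n₁ ∘ cong pt) (n₂ ∘ cong pt) (x≢t ∘ sym) (y≢t ∘ sym)

    conn3-col : ∀ X Y → Const X Y → ∀ u v → u ≢ X → u ≢ Y → v ≢ X → v ≢ Y → col u ≡ col v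
    conn3-col X Y h with cview X | cview Y
    ... | corner i | _ = with-corner i Y h
    ... | old x n | corner j = conn3-swap {B} {col} (with-corner j (pt x) λ u v a b a' b' → h u v b a b' a')
    ... | old x n | old y m = no-corner x y n m h

  conn3 : Conn3 H → Conn3 B
  conn3 C X Y col h = conn3-col C col X Y h

-- The reductions and their inverses

-- Up to isomorphism a (D3b) step leads from `sub H p̂ r̂ ŝ` to `H`. With the analogous fact for
-- (D3a), an induction over reductions only meets the explicit graphs `sub` and `blow`.
module FromD3b {G H : Graph} (D : D3b G H) where
  open D3b D
  private
    module Φ = Inverse φ
    dq : Deg3 G q p r s
    dq = deg3-with3 deg-q (Adj-sym G pq) qr (Adj-sym G sq) p≢r (λ e → adj≢ G sr (sym e)) (λ e → adj≢ G sp (sym e))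
    p≢q : p ≢ q
    p≢q = adj≢ G pq
    r≢q : r ≢ q
    r≢q e = adj≢ G qr (sym e)
    s≢q : s ≢ q
    s≢q = adj≢ G sq
    P = deg3-with2 {G} {p} deg-p pq (Adj-sym G sp) (s≢q ∘ sym)
    R = deg3-with2 {G} {r} deg-r (Adj-sym G qr) (Adj-sym G sr) (s≢q ∘ sym)
    p₃ r₃ : V G
    p₃ = proj₁ P
    r₃ = proj₁ R
    module P = Deg3 (proj₂ P)
    module R = Deg3 (proj₂ R)
    hat : ∀ x → x ≢ q → V H
    hat x o = Φ.from (x , o)
    hat-inj : ∀ {x y o o'} → hat x o ≡ hat y o' → x ≡ y
    hat-inj {x} {y} {o} {o'} e = cong proj₁ (trans (sym (Φ.inverseˡ refl)) (trans (cong Φ.to e) (Φ.inverseˡ {x = y , o'} refl)))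
    hat-≡ : ∀ {x y o o'} → x ≡ y → hat x o ≡ hat y o'
    hat-≡ refl = refl
    adj-e : ∀ {x y o o'} → Adj H (hat x o) (hat y o') → Adj G x y ⊎ (x ≡ p × y ≡ r) ⊎ (x ≡ r × y ≡ p)
    adj-e {x} {y} {o} {o'} = Equivalence.to (adj-H (x , o) (y , o'))
    adj-i : ∀ {x y o o'} → Adj G x y ⊎ (x ≡ p × y ≡ r) ⊎ (x ≡ r × y ≡ p) → Adj H (hat x o) (hat y o')
    adj-i {x} {y} {o} {o'} = Equivalence.from (adj-H (x , o) (y , o'))
    onto : ∀ w → ∃₂ λ x o → w ≡ hat x o
    onto w = proj₁ (Φ.to w) , proj₂ (Φ.to w) , sym (Φ.inverseʳ refl)

  p̂ r̂ ŝ p̂' r̂' : V H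
  p̂ = hat p p≢q
  r̂ = hat r r≢q
  ŝ = hat s s≢q
  p̂' = hat p₃ (P.x≢z ∘ sym)
  r̂' = hat r₃ (R.x≢z ∘ sym)

  dp : Deg3 H p̂ r̂ ŝ p̂'
  dp = mkD3 (adj-i (inj₂ (inj₁ (refl , refl)))) (adj-i (inj₁ P.ay)) (adj-i (inj₁ P.az))
    (λ e → adj≢ G sr (sym (hat-inj e))) (P.y≢z ∘ hat-inj)
    (λ e → ¬pr (subst (Adj G p) (sym (hat-inj e)) P.az)) al
    where
    al : ∀ w → Adj H p̂ w → w ≡ r̂ ⊎ w ≡ ŝ ⊎ w ≡ p̂'
    al w a with onto w
    ... | x , o , refl with adj-e a
    ... | inj₂ (inj₁ (_ , e)) = inj₁ (hat-≡ e)
    ... | inj₂ (inj₂ (e , _)) = ⊥-elim (p≢r e)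
    ... | inj₁ k = [ ⊥-elim ∘ o , [ inj₂ ∘ inj₁ ∘ hat-≡ , inj₂ ∘ inj₂ ∘ hat-≡ ]′ ]′ (P.all x k)

  dr : Deg3 H r̂ p̂ ŝ r̂'
  dr = mkD3 (adj-i (inj₂ (inj₂ (refl , refl)))) (adj-i (inj₁ R.ay)) (adj-i (inj₁ R.az))
    (λ e → adj≢ G sp (sym (hat-inj e))) (R.y≢z ∘ hat-inj)
    (λ e → ¬pr (Adj-sym G (subst (Adj G r) (sym (hat-inj e)) R.az))) al
    where
    al : ∀ w → Adj H r̂ w → w ≡ p̂ ⊎ w ≡ ŝ ⊎ w ≡ r̂'
    al w a with onto w
    ... | x , o , refl with adj-e a
    ... | inj₂ (inj₁ (e , _)) = ⊥-elim (p≢r (sym e))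
    ... | inj₂ (inj₂ (_ , e)) = inj₁ (hat-≡ e)
    ... | inj₁ k = [ ⊥-elim ∘ o , [ inj₂ ∘ inj₁ ∘ hat-≡ , inj₂ ∘ inj₂ ∘ hat-≡ ]′ ]′ (R.all x k)

  private
    S : Graph
    S = sub H p̂ r̂ ŝ
    to : V G → V S
    to x with x ≟ q
    ... | yes _ = zero
    ... | no o  = suc (hat x o)
    from : V S → V G
    from zero    = q
    from (suc y) = proj₁ (Φ.to y)
    to-q : to q ≡ zero
    to-q with q ≟ q
    ... | yes _ = refl
    ... | no n  = ⊥-elim (n refl)
    to-old : ∀ {x} o → to x ≡ suc (hat x o)
    to-old {x} o with x ≟ q
    ... | yes e = ⊥-elim (o e)
    ... | no _  = refl
    q-old : ∀ x (o : x ≢ q) → mem3 p̂ r̂ ŝ (hat x o) ≡ adj G q x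
    q-old x o = T-ext
      (λ h → [ (λ e → subst (Adj G q) (sym (hat-inj e)) (Deg3.ax dq)) , [ (λ e → subst (Adj G q) (sym (hat-inj e)) (Deg3.ay dq))
              , (λ e → subst (Adj G q) (sym (hat-inj e)) (Deg3.az dq)) ]′ ]′ (mem3-e h))
      (λ a → mem3-i ([ inj₁ ∘ hat-≡ , [ inj₂ ∘ inj₁ ∘ hat-≡ , inj₂ ∘ inj₂ ∘ hat-≡ ]′ ]′ (Deg3.all dq x a)))
    adj-to : ∀ x y → adj S (to x) (to y) ≡ adj G x y
    adj-to x y with x ≟ q | y ≟ q
    ... | yes refl | yes refl = sym (adj-irr G q)
    ... | yes refl | no o = q-old y o
    ... | no o | yes refl = trans (q-old x o) (adj-sym G q x)
    ... | no o | no o' = T-ext down up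
      where
      down : T (delEdge (adj H) p̂ r̂ (hat x o) (hat y o')) → Adj G x y
      down h with delEdge-e (adj H) h
      ... | a , n , n' = [ id , [ (λ (e , e') → ⊥-elim (n (hat-≡ e , hat-≡ e')))
                              , (λ (e , e') → ⊥-elim (n' (hat-≡ e , hat-≡ e'))) ]′ ]′ (adj-e a)
      up : Adj G x y → T (delEdge (adj H) p̂ r̂ (hat x o) (hat y o'))
      up a = delEdge-i (adj H) (adj-i (inj₁ a))
        (λ (e , e') → ¬pr (subst₂ (Adj G) (hat-inj e) (hat-inj e') a))
        (λ (e , e') → ¬pr (Adj-sym G (subst₂ (Adj G) (hat-inj e) (hat-inj e') a)))

  iso : Iso G S
  iso = record { to = to ; from = from ; tofrom = tf ; fromto = ft ; adj-to = adj-to }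
    where
    tf : ∀ y → to (from y) ≡ y
    tf zero    = to-q
    tf (suc y) = trans (to-old (proj₂ (Φ.to y))) (cong suc (Φ.inverseʳ refl))
    ft : ∀ x → from (to x) ≡ x
    ft x with x ≟ q
    ... | yes e = sym e
    ... | no o  = cong proj₁ (Φ.inverseˡ {x = x , o} refl)

module FromD3a {G H : Graph} (D : D3a G H) where
  open D3a D
  private
    module Φ = Inverse φ
    dp : Deg3 G p q r a
    dp = deg3-with3 deg-p pq pr pa (adj≢ G qr) (proj₂ (proj₂ a-out) ∘ sym) (proj₁ (proj₂ a-out) ∘ sym)
    dq : Deg3 G q p r b
    dq = deg3-with3 deg-q (Adj-sym G pq) qr qb (adj≢ G pr) (proj₂ (proj₂ b-out) ∘ sym) (proj₁ b-out ∘ sym)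
    dr : Deg3 G r p q c
    dr = deg3-with3 deg-r (Adj-sym G pr) (Adj-sym G qr) rc (adj≢ G pq) (proj₁ (proj₂ c-out) ∘ sym) (proj₁ c-out ∘ sym)
    Out : V G → Set
    Out x = Out3 x p q r
    hat : ∀ x → Out x → V H
    hat x o = Φ.from (inj₁ (x , o))
    hat-inj : ∀ {x y o o'} → hat x o ≡ hat y o' → x ≡ y
    hat-inj {x} {y} {o} {o'} e with trans (sym (Φ.inverseˡ {x = inj₁ (x , o)} refl)) (trans (cong Φ.to e) (Φ.inverseˡ {x = inj₁ (y , o')} refl))
    ... | refl = refl
    hat-≡ : ∀ {x y o o'} → x ≡ y → hat x o ≡ hat y o'
    hat-≡ refl = refl

  t â b̂ ĉ : V H
  t = Φ.from (inj₂ tt)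
  â = hat a a-out
  b̂ = hat b b-out
  ĉ = hat c c-out

  private
    hat≢t : ∀ {x o} → hat x o ≢ t
    hat≢t {x} {o} e with trans (sym (Φ.inverseˡ {x = inj₁ (x , o)} refl)) (trans (cong Φ.to e) (Φ.inverseˡ {x = inj₂ tt} refl))
    ... | ()
    new-e : ∀ {x o} → Adj H t (hat x o) → x ≡ a ⊎ x ≡ b ⊎ x ≡ c
    new-e {x} {o} h = Equivalence.to (adj-new (x , o)) (Adj-sym H h)
    new-i : ∀ {x o} → x ≡ a ⊎ x ≡ b ⊎ x ≡ c → Adj H t (hat x o)
    new-i {x} {o} h = Adj-sym H (Equivalence.from (adj-new (x , o)) h)
    onto : ∀ w → w ≡ t ⊎ ∃₂ λ x o → w ≡ hat x o
    onto w with Φ.to w in e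
    ... | inj₁ (x , o) = inj₂ (x , o , trans (sym (Φ.inverseʳ refl)) (cong Φ.from e))
    ... | inj₂ _ = inj₁ (trans (sym (Φ.inverseʳ refl)) (cong Φ.from e))

  deg-t : Deg3 H t â b̂ ĉ
  deg-t = mkD3 (new-i (inj₁ refl)) (new-i (inj₂ (inj₁ refl))) (new-i (inj₂ (inj₂ refl)))
    (a≢b ∘ hat-inj) (b≢c ∘ hat-inj) (a≢c ∘ hat-inj) al
    where
    al : ∀ w → Adj H t w → w ≡ â ⊎ w ≡ b̂ ⊎ w ≡ ĉ
    al w k with onto w
    ... | inj₁ refl = ⊥-elim (adj≢ H k refl)
    ... | inj₂ (x , o , refl) = [ inj₁ ∘ hat-≡ , [ inj₂ ∘ inj₁ ∘ hat-≡ , inj₂ ∘ inj₂ ∘ hat-≡ ]′ ]′ (new-e k)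

  private
    module Bl = Blow deg-t
    B : Graph
    B = Bl.B
    to : V G → V B
    to x with x ≟ p | x ≟ q | x ≟ r
    ... | yes _ | _ | _ = Bl.pt t
    ... | no _ | yes _ | _ = zero
    ... | no _ | no _ | yes _ = suc zero
    ... | no n₁ | no n₂ | no n₃ = Bl.pt (hat x (n₁ , n₂ , n₃))
    low : (Σ (V G) Out) ⊎ ⊤ → V G
    low (inj₁ (x , _)) = x
    low (inj₂ _) = p
    from : V B → V G
    from zero = q
    from (suc zero) = r
    from (suc (suc y)) = low (Φ.to y)
    data PView : V G → Set where
      isp : PView p
      isq : PView q
      isr : PView r
      old : ∀ x → Out x → PView x
    pview : ∀ x → PView x
    pview x with x ≟ p | x ≟ q | x ≟ r
    ... | yes refl | _ | _ = isp
    ... | no _ | yes refl | _ = isq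
    ... | no _ | no _ | yes refl = isr
    ... | no n₁ | no n₂ | no n₃ = old x (n₁ , n₂ , n₃)
    to-p : to p ≡ Bl.pt t
    to-p with p ≟ p
    ... | yes _ = refl
    ... | no n = ⊥-elim (n refl)
    to-q : to q ≡ zero
    to-q with q ≟ p | q ≟ q
    ... | yes e | _ = ⊥-elim (adj≢ G pq (sym e))
    ... | no _ | yes _ = refl
    ... | no _ | no n = ⊥-elim (n refl)
    to-r : to r ≡ suc zero
    to-r with r ≟ p | r ≟ q | r ≟ r
    ... | yes e | _ | _ = ⊥-elim (adj≢ G pr (sym e))
    ... | no _ | yes e | _ = ⊥-elim (adj≢ G qr (sym e))
    ... | no _ | no _ | yes _ = refl
    ... | no _ | no _ | no n = ⊥-elim (n refl)
    to-old : ∀ {x} o → to x ≡ Bl.pt (hat x o)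
    to-old {x} (n₁ , n₂ , n₃) with x ≟ p | x ≟ q | x ≟ r
    ... | yes e | _ | _ = ⊥-elim (n₁ e)
    ... | no _ | yes e | _ = ⊥-elim (n₂ e)
    ... | no _ | no _ | yes e = ⊥-elim (n₃ e)
    ... | no _ | no _ | no _ = refl
    A≡ : V G → V G → Set
    A≡ x y = adj B (to x) (to y) ≡ adj G x y
    flip : ∀ {x y} → A≡ x y → A≡ y x
    flip {x} {y} e = trans (adj-sym B (to y) (to x)) (trans e (adj-sym G x y))
    same : ∀ x → A≡ x x
    same x = trans (adj-irr B (to x)) (sym (adj-irr G x))
    at : ∀ {x y x' y'} → to x ≡ x' → to y ≡ y' → adj B x' y' ≡ adj G x y → A≡ x y
    at refl refl e = e
    p-old : ∀ {x} → Out x → A≡ p x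
    p-old {x} o = at to-p (to-old o) (T-ext
      (λ h → let k , n , _ = Bl.old-e h in
         [ (λ e → subst (Adj G p) (sym e) pa) , [ (λ e → ⊥-elim (n (refl , inj₁ (hat-≡ e)))) , (λ e → ⊥-elim (n (refl , inj₂ (hat-≡ e)))) ]′ ]′ (new-e k))
      (λ k → [ ⊥-elim ∘ proj₁ (proj₂ o) , [ ⊥-elim ∘ proj₂ (proj₂ o) , (λ e → subst (λ z → Adj B (Bl.pt t) (Bl.pt z)) (sym (hat-≡ {o = o} {a-out} e)) Bl.pa) ]′ ]′ (Deg3.all dp x k)))
    q-old : ∀ {x} → Out x → A≡ q x
    q-old {x} o = at to-q (to-old o) (T-ext
      (λ h → [ ⊥-elim ∘ hat≢t , (λ e → subst (Adj G q) (sym (hat-inj e)) qb) ]′ (mem2-e h))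
      (λ k → [ ⊥-elim ∘ proj₁ o , [ ⊥-elim ∘ proj₂ (proj₂ o) , (λ e → mem2-i (inj₂ (hat-≡ e))) ]′ ]′ (Deg3.all dq x k)))
    r-old : ∀ {x} → Out x → A≡ r x
    r-old {x} o = at to-r (to-old o) (T-ext
      (λ h → [ ⊥-elim ∘ hat≢t , (λ e → subst (Adj G r) (sym (hat-inj e)) rc) ]′ (mem2-e h))
      (λ k → [ ⊥-elim ∘ proj₁ o , [ ⊥-elim ∘ proj₁ (proj₂ o) , (λ e → mem2-i (inj₂ (hat-≡ e))) ]′ ]′ (Deg3.all dr x k)))
    old-old : ∀ {x y} → Out x → Out y → A≡ x y
    old-old {x} {y} o o' = at (to-old o) (to-old o') (trans (T-ext (λ h → proj₁ (Bl.old-e h))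
      (λ k → Bl.old-i k (hat≢t ∘ proj₁) (hat≢t ∘ proj₁))) (adj-old (x , o) (y , o')))
    adj-to : ∀ {x y} → PView x → PView y → A≡ x y
    adj-to isp isp = same p
    adj-to isq isq = same q
    adj-to isr isr = same r
    adj-to isp isq = at to-p to-q (trans (T→≡ (Deg3.ax Bl.deg-p)) (sym (T→≡ pq)))
    adj-to isp isr = at to-p to-r (trans (T→≡ (Deg3.ay Bl.deg-p)) (sym (T→≡ pr)))
    adj-to isq isr = at to-q to-r (trans (T→≡ (Deg3.ay Bl.deg-q)) (sym (T→≡ qr)))
    adj-to isq isp = flip {p} {q} (adj-to isp isq)
    adj-to isr isp = flip {p} {r} (adj-to isp isr)
    adj-to isr isq = flip {q} {r} (adj-to isq isr)
    adj-to isp (old y o) = p-old o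
    adj-to isq (old y o) = q-old o
    adj-to isr (old y o) = r-old o
    adj-to (old x o) isp = flip {p} {x} (p-old o)
    adj-to (old x o) isq = flip {q} {x} (q-old o)
    adj-to (old x o) isr = flip {r} {x} (r-old o)
    adj-to (old x o) (old y o') = old-old o o'

  iso : Iso G B
  iso = record { to = to ; from = from ; tofrom = tf ; fromto = ft ; adj-to = λ x y → adj-to (pview x) (pview y) }
    where
    tf : ∀ y → to (from y) ≡ y
    tf zero = to-q
    tf (suc zero) = to-r
    tf (suc (suc y)) with Φ.to y in e
    ... | inj₁ (x , o) = trans (to-old o) (cong Bl.pt (trans (cong Φ.from (sym e)) (Φ.inverseʳ refl)))
    ... | inj₂ _ = trans to-p (cong Bl.pt (trans (cong Φ.from (sym e)) (Φ.inverseʳ refl)))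
    ft′ : ∀ {x} → PView x → from (to x) ≡ x
    ft′ isp = trans (cong from to-p) (cong low (Φ.inverseˡ {x = inj₂ tt} refl))
    ft′ isq = cong from to-q
    ft′ isr = cong from to-r
    ft′ (old x o) = trans (cong from (to-old o)) (cong low (Φ.inverseˡ {x = inj₁ (x , o)} refl))
    ft : ∀ x → from (to x) ≡ x
    ft x = ft′ (pview x)

toD3b : ∀ {H p r s p' r'} → Deg3 H p r s p' → Deg3 H r p s r' → D3b (sub H p r s) H
toD3b {H} {p} {r} {s} dp dr = record
  { p = suc p ; q = zero ; r = suc r ; s = suc s
  ; deg-p = Deg3→deg S.deg-p ; deg-q = Deg3→deg S.deg-q ; deg-r = Deg3→deg S.deg-r
  ; pq = Deg3.ax S.deg-p ; qr = Deg3.ay S.deg-q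
  ; ¬pr = λ h → proj₁ (proj₂ (S.old-e h)) (refl , refl) ; p≢r = suc≢ S.p≢r
  ; sp = Adj-sym S.S {suc p} {suc s} (Deg3.ay S.deg-p) ; sq = Adj-sym S.S {zero} {suc s} (Deg3.az S.deg-q)
  ; sr = Adj-sym S.S {suc r} {suc s} (Deg3.ay S.deg-r)
  ; φ = mk↔ₛ′ (λ x → suc x , λ ()) back (λ { (zero , n) → ⊥-elim (n refl) ; (suc x , n) → refl }) (λ _ → refl)
  ; adj-H = λ { (zero , n) _ → ⊥-elim (n refl) ; (suc _ , _) (zero , n) → ⊥-elim (n refl)
              ; (suc x , _) (suc y , _) → mk⇔ (dn x y) (up x y) } }
  where
  module S = Sub dp dr
  back : (Σ (V S.S) λ x → x ≢ zero) → V H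
  back (zero , n) = ⊥-elim (n refl)
  back (suc x , _) = x
  dn : ∀ x y → Adj H x y → Adj S.S (suc x) (suc y) ⊎ (suc x ≡ suc p × suc y ≡ suc r) ⊎ (suc x ≡ suc r × suc y ≡ suc p)
  dn x y a with T? (edgeIs p r x y)
  ... | no n = inj₁ (S.old-i a (λ { (refl , refl) → n (edgeIs-i₁ p r) }) (λ { (refl , refl) → n (edgeIs-i₂ p r) }))
  ... | yes e = inj₂ ([ (λ (e , q) → inj₁ (cong suc e , cong suc q)) , (λ (e , q) → inj₂ (cong suc e , cong suc q)) ]′ (edgeIs-e e))
  up : ∀ x y → Adj S.S (suc x) (suc y) ⊎ (suc x ≡ suc p × suc y ≡ suc r) ⊎ (suc x ≡ suc r × suc y ≡ suc p) → Adj H x y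
  up x y (inj₁ a) = proj₁ (S.old-e a)
  up x y (inj₂ (inj₁ (refl , refl))) = Deg3.ax dp
  up x y (inj₂ (inj₂ (refl , refl))) = Deg3.ax dr

toD3a : ∀ {H t a b c} → Deg3 H t a b c → D3a (blow H t a b c) H
toD3a {H} {t} {a} {b} {c} d = record
  { p = Bl.pt t ; q = zero ; r = suc zero ; a = Bl.pt a ; b = Bl.pt b ; c = Bl.pt c
  ; deg-p = Deg3→deg Bl.deg-p ; deg-q = Deg3→deg Bl.deg-q ; deg-r = Deg3→deg Bl.deg-r
  ; pq = Deg3.ax Bl.deg-p ; qr = tt ; pr = Deg3.ay Bl.deg-p
  ; pa = Bl.pa ; qb = Deg3.az Bl.deg-q ; rc = Deg3.az Bl.deg-r
  ; a-out = out Bl.a≢t ; b-out = out Bl.b≢t ; c-out = out Bl.c≢t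
  ; a≢b = Bl.pt≢ (Deg3.x≢y d) ; b≢c = Bl.pt≢ (Deg3.y≢z d) ; a≢c = Bl.pt≢ (Deg3.x≢z d)
  ; φ = mk↔ₛ′ to from tf ft
  ; adj-old = λ { (zero , _ , n , _) _ → ⊥-elim (n refl) ; (suc zero , _ , _ , n) _ → ⊥-elim (n refl)
                ; (suc (suc _) , _) (zero , _ , n , _) → ⊥-elim (n refl)
                ; (suc (suc _) , _) (suc zero , _ , _ , n) → ⊥-elim (n refl)
                ; (suc (suc x) , n , _) (suc (suc y) , n' , _) → T-ext
                    (λ k → Bl.old-i k (λ (e , _) → n (cong Bl.pt e)) (λ (e , _) → n' (cong Bl.pt e))) (λ k → proj₁ (Bl.old-e k)) }
  ; adj-new = λ { (zero , _ , n , _) → ⊥-elim (n refl) ; (suc zero , _ , _ , n) → ⊥-elim (n refl)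
                ; (suc (suc x) , n , _) → mk⇔
                    (λ k → [ inj₁ ∘ cong Bl.pt , [ inj₂ ∘ inj₁ ∘ cong Bl.pt , inj₂ ∘ inj₂ ∘ cong Bl.pt ]′ ]′ (Deg3.all d x (Adj-sym H k)))
                    (λ { (inj₁ refl) → Adj-sym H (Deg3.ax d) ; (inj₂ (inj₁ refl)) → Adj-sym H (Deg3.ay d)
                       ; (inj₂ (inj₂ refl)) → Adj-sym H (Deg3.az d) }) } }
  where
  module Bl = Blow d
  Out : V Bl.B → Set
  Out x = Out3 x (Bl.pt t) zero (suc zero)
  out : ∀ {x} → x ≢ t → Out (Bl.pt x)
  out n = Bl.pt≢ n , (λ ()) , λ ()
  to : V H → Σ (V Bl.B) Out ⊎ ⊤
  to x with x ≟ t
  ... | yes _ = inj₂ tt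
  ... | no n  = inj₁ (Bl.pt x , out n)
  from : Σ (V Bl.B) Out ⊎ ⊤ → V H
  from (inj₁ (zero , _ , n , _)) = ⊥-elim (n refl)
  from (inj₁ (suc zero , _ , _ , n)) = ⊥-elim (n refl)
  from (inj₁ (suc (suc x) , _)) = x
  from (inj₂ _) = t
  tf : ∀ y → to (from y) ≡ y
  tf (inj₁ (zero , _ , n , _)) = ⊥-elim (n refl)
  tf (inj₁ (suc zero , _ , _ , n)) = ⊥-elim (n refl)
  tf (inj₁ (suc (suc x) , n , _)) with x ≟ t
  ... | yes e = ⊥-elim (n (cong Bl.pt e))
  ... | no _ = refl
  tf (inj₂ _) with t ≟ t
  ... | yes _ = refl
  ... | no n = ⊥-elim (n refl)
  ft : ∀ x → from (to x) ≡ x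
  ft x with x ≟ t
  ... | yes e = sym e
  ... | no _ = refl

conn3-iso : ∀ {G H} → Iso G H → Conn3 H → Conn3 G
conn3-iso {G} I C x y c h u v u₁ u₂ v₁ v₂ = trans (sym (cong c (fromto u))) (trans
  (C (to x) (to y) (c ∘ from) (λ u v a b a' b' k → h _ _ (back a) (back b) (back a') (back b') (subst T (sym (adj-from u v)) k))
    (to u) (to v) (u₁ ∘ to-inj) (u₂ ∘ to-inj) (v₁ ∘ to-inj) (v₂ ∘ to-inj)) (cong c (fromto v)))
  where
  open Iso I
  back : ∀ {u z} → u ≢ to z → from u ≢ z
  back n refl = n (sym (tofrom _))

conn3-D3 : ∀ {H} → D3Reducible H → Conn3 H
conn3-D3 (done i) = conn3-iso (≅→iso i) λ x y c h u v u₁ u₂ v₁ v₂ → K4-conn c u v λ n → h u v u₁ u₂ v₁ v₂ (not-i (n ∘ ==→))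
  where
  K4-conn : ∀ (c : V K4 → Bool) u v → (u ≢ v → c u ≡ c v) → c u ≡ c v
  K4-conn c u v h with u ≟ v
  ... | yes refl = refl
  ... | no n = h n
conn3-D3 (step (inj₁ a) d) = conn3-iso (FromD3a.iso a) (Blow.conn3 (FromD3a.deg-t a) (conn3-D3 d))
conn3-D3 (step (inj₂ b) d) = conn3-iso (FromD3b.iso b) (Sub.conn3 (FromD3b.dp b) (FromD3b.dr b) (conn3-D3 d))

-- Inverse reductions of embeddings

if-yes : ∀ {A : Set} {m} {x y : Fin m} {a b : A} → x ≡ y → (if x == y then a else b) ≡ a
if-yes {x = x} refl rewrite ==-refl x = refl

if-no : ∀ {A : Set} {m} {x y : Fin m} {a b : A} → x ≢ y → (if x == y then a else b) ≡ b
if-no n rewrite ==-no n = refl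

-- Unlike _≟_, splitting on same? leaves the conditionals of the goal alone.
same? : ∀ {m} (x y : Fin m) → x ≡ y ⊎ x ≢ y
same? x y with x ≟ y
... | yes e = inj₁ e
... | no n  = inj₂ n

LR-deg3 : ∀ {G h x y z} {f : V G → V G} → Deg3 G h x y z → f x ≡ y → f y ≡ z → f z ≡ x → LR (Adj G h) f
LR-deg3 d e₁ e₂ e₃ = LR-3 _ _ _ (Deg3.all d) (Deg3.ax d) (Deg3.ay d) (Deg3.az d) e₁ e₂ e₃

opaque
  -- The three darts form a closed orbit, and by `lab-orbit` no label belongs to two orbits.
  face3-darts : ∀ {H G} (E : LE H G) {p r s u v} → Adj H p r → Adj H r s → Adj H s p →
    LE.rt E r p ≡ s → LE.rt E s r ≡ p → LE.rt E p s ≡ r → Adj H u v → LE.lab E u v ≡ LE.lab E p r →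
    (u ≡ p × v ≡ r) ⊎ (u ≡ r × v ≡ s) ⊎ (u ≡ s × v ≡ p)
  face3-darts {H} E {p} {r} {s} pr rs sp e₁ e₂ e₃ a q = reach-inv
    (λ d → (proj₁ d ≡ p × proj₂ d ≡ r) ⊎ (proj₁ d ≡ r × proj₂ d ≡ s) ⊎ (proj₁ d ≡ s × proj₂ d ≡ p))
    (λ { _ (inj₁ (refl , refl)) → inj₂ (inj₁ (refl , e₁)) ; _ (inj₂ (inj₁ (refl , refl))) → inj₂ (inj₂ (refl , e₂))
       ; _ (inj₂ (inj₂ (refl , refl))) → inj₁ (refl , e₃) })
    (inj₁ (refl , refl)) (lab-orbit E pr a (sym q))

-- The face in question consists of the darts `p r`, `r s` and `s p`, each followed by the next.
record TriangleAt {H G : Graph} (E : LE H G) (p r s : V H) : Set where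
  constructor mkTri
  field
    at-r : LE.rt E r p ≡ s
    at-s : LE.rt E s r ≡ p
    at-p : LE.rt E p s ≡ r

-- The new vertex `q`, called `zero`, is placed on the edge `p r` and joined to `s` through the
-- triangular face. The part of the face at `p` keeps the label `T`; the part with the corners `q`,
-- `r`, `s` is the new face `zero`, with neighbours `T`, `Y` and `B`. It takes over the side `r s`,
-- so the edge between `T` and `Y` disappears from the dual; `X≢Y`, together with `B≢Y`, ensures
-- that no other side of `T` borders on `Y`.
module SubUp {H G : Graph} (E : LE H G) {p r s p' r' : V H} (dp : Deg3 H p r s p') (dr : Deg3 H r p s r')
  (tri : TriangleAt E p r s) (X≢Y : LE.lab E p s ≢ LE.lab E s r) where
  open LE E
  open TriangleAt tri
  open Sub dp dr
  private
    module P = Deg3 dp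
    module R = Deg3 dr
    pr : Adj H p r
    pr = P.ax
    rs : Adj H r s
    rs = R.ay
    sp : Adj H s p
    sp = Adj-sym H P.ay
  Tf Bf Yf : V G
  Tf = lab p r
  Bf = lab r p
  Yf = lab s r

  rt° : V S → V S → V S
  rt° zero    zero    = zero
  rt° zero    (suc y) = if y == p then suc s else (if y == s then suc r else suc p)
  rt° (suc x) zero    = if x == p then suc p' else (if x == r then suc s else suc p)
  rt° (suc x) (suc y) = if x == p then (if y == s then zero else suc s) else
    (if x == r then (if y == s then suc r' else zero) else
    (if x == s then (if y == r then zero else suc (rt s y)) else suc (rt x y)))

  lab° : V S → V S → V (sub G Tf Yf Bf)
  lab° zero    zero    = zero
  lab° zero    (suc y) = if y == p then suc Bf else (if y == r then zero else suc Tf)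
  lab° (suc x) zero    = if x == p then suc Tf else (if x == r then suc Bf else zero)
  lab° (suc x) (suc y) = if x == r ∧ y == s then zero else suc (lab x y)

  private
    r≢p : r ≢ p
    r≢p = p≢r ∘ sym
    s≢p : s ≢ p
    s≢p = p≢s ∘ sym
    s≢r : s ≢ r
    s≢r = r≢s ∘ sym
    rot-p : rt p r ≡ p' × rt p p' ≡ s
    rot-p = rot3 ro (deg3-rot (deg3-rot (deg3-swap dp))) at-p
    rot-r : rt r s ≡ r' × rt r r' ≡ p
    rot-r = rot3 ro dr at-r

  -- These are the faces on the two sides of the edge from `r` to `r'`, and the dual has no loops.
  B≢Y : Bf ≢ Yf
  B≢Y e = loopless R.az (trans (turn R.ay (proj₁ rot-r)) (trans (sym e) (turn R.az (proj₂ rot-r))))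

  lab-qp : lab° zero (suc p) ≡ suc Bf
  lab-qp = if-yes {x = p} refl
  lab-qr : lab° zero (suc r) ≡ zero
  lab-qr = trans (if-no r≢p) (if-yes {x = r} refl)
  lab-qs : lab° zero (suc s) ≡ suc Tf
  lab-qs = trans (if-no s≢p) (if-no s≢r)
  lab-pq : lab° (suc p) zero ≡ suc Tf
  lab-pq = if-yes {x = p} refl
  lab-rq : lab° (suc r) zero ≡ suc Bf
  lab-rq = trans (if-no r≢p) (if-yes {x = r} refl)
  lab-sq : lab° (suc s) zero ≡ zero
  lab-sq = trans (if-no s≢p) (if-no s≢r)
  lab-rs : lab° (suc r) (suc s) ≡ zero
  lab-rs rewrite ==-refl r | ==-refl s = refl
  lab-oo : ∀ {x y} → ¬ (x ≡ r × y ≡ s) → lab° (suc x) (suc y) ≡ suc (lab x y)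
  lab-oo {x} {y} n with x ≟ r | y ≟ s
  ... | yes e | yes e' = ⊥-elim (n (e , e'))
  ... | yes _ | no _ = refl
  ... | no _ | _ = refl

  private
    lab-o₁ : ∀ {x y} → x ≢ r → lab° (suc x) (suc y) ≡ suc (lab x y)
    lab-o₁ n = lab-oo (n ∘ proj₁)
    lab-o₂ : ∀ {x y} → y ≢ s → lab° (suc x) (suc y) ≡ suc (lab x y)
    lab-o₂ n = lab-oo (n ∘ proj₂)

  rt-qp : rt° zero (suc p) ≡ suc s
  rt-qp = if-yes {x = p} refl
  rt-qs : rt° zero (suc s) ≡ suc r
  rt-qs = trans (if-no s≢p) (if-yes {x = s} refl)
  rt-qr : rt° zero (suc r) ≡ suc p
  rt-qr = trans (if-no r≢p) (if-no r≢s)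
  rt-pq : rt° (suc p) zero ≡ suc p'
  rt-pq = if-yes {x = p} refl
  rt-ps : rt° (suc p) (suc s) ≡ zero
  rt-ps = trans (if-yes {x = p} refl) (if-yes {x = s} refl)
  rt-pp' : rt° (suc p) (suc p') ≡ suc s
  rt-pp' = trans (if-yes {x = p} refl) (if-no (P.y≢z ∘ sym))
  rt-rq : rt° (suc r) zero ≡ suc s
  rt-rq = trans (if-no r≢p) (if-yes {x = r} refl)
  rt-rs : rt° (suc r) (suc s) ≡ suc r'
  rt-rs = trans (if-no r≢p) (trans (if-yes {x = r} refl) (if-yes {x = s} refl))
  rt-rr' : rt° (suc r) (suc r') ≡ zero
  rt-rr' = trans (if-no r≢p) (trans (if-yes {x = r} refl) (if-no (R.y≢z ∘ sym)))
  rt-sq : rt° (suc s) zero ≡ suc p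
  rt-sq = trans (if-no s≢p) (if-no s≢r)
  rt-sr : rt° (suc s) (suc r) ≡ zero
  rt-sr = trans (if-no s≢p) (trans (if-no s≢r) (trans (if-yes {x = s} refl) (if-yes {x = r} refl)))
  rt-so : ∀ {y} → y ≢ r → rt° (suc s) (suc y) ≡ suc (rt s y)
  rt-so n = trans (if-no s≢p) (trans (if-no s≢r) (trans (if-yes {x = s} refl) (if-no n)))
  rt-oo : ∀ {x y} → x ≢ p → x ≢ r → x ≢ s → rt° (suc x) (suc y) ≡ suc (rt x y)
  rt-oo a b c = trans (if-no a) (trans (if-no b) (if-no c))

  data PRS : V H → Set where
    isp : PRS p
    isr : PRS r
    iss : PRS s
    oth : ∀ {x} → x ≢ p → x ≢ r → x ≢ s → PRS x

  prs : ∀ x → PRS x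
  prs x with x ≟ p | x ≟ r | x ≟ s
  ... | yes refl | _ | _ = isp
  ... | no _ | yes refl | _ = isr
  ... | no _ | no _ | yes refl = iss
  ... | no a | no b | no c = oth a b c

  private
    pred : V H → V S → V H
    pred x zero    = x
    pred x (suc y) = y

    nbr-s : ∀ {u} → Adj H s u → Adj S (suc s) (suc u)
    nbr-s a = old-i a (s≢p ∘ proj₁) (s≢r ∘ proj₁)

    LRs : ∀ v → LR (Adj S v) (rt° v)
    LRs zero = LR-deg3 (deg3-swap deg-q) rt-qp rt-qs rt-qr
    LRs (suc x) with prs x
    ... | isp = LR-deg3 (deg3-swap deg-p) rt-pq rt-pp' rt-ps
    ... | isr = LR-deg3 deg-r rt-rq rt-rs rt-rr'
    ... | iss = LR-insert (rotAt ro s) suc zero r (Adj-sym H rs) (mem3-i (inj₂ (inj₂ refl))) (λ u → nbr-s)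
          (λ { zero _ → inj₁ refl ; (suc y) k → inj₂ (y , proj₁ (old-e k) , refl) })
          (λ { _ _ refl → refl }) (λ _ ()) rt-sr (trans rt-sq (cong suc (sym at-s))) (λ u _ n → rt-so n) (_≟ r)
    ... | oth a b c = LR-conj (rotAt ro x) suc (pred x) (λ u k → old-i k (a ∘ proj₁) (b ∘ proj₁))
          (λ { zero k → ⊥-elim (nq k) ; (suc y) k → proj₁ (old-e k) }) (λ _ _ → refl)
          (λ { zero k → ⊥-elim (nq k) ; (suc y) k → refl }) λ { zero k → ⊥-elim (nq k) ; (suc y) k → rt-oo a b c }
      where
      nq : ¬ T (mem3 p r s x)
      nq k = [ a , [ b , c ]′ ]′ (mem3-e k)

    step° : ∀ u v → Adj S u v → lab° v (rt° v u) ≡ lab° u v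
    go : ∀ {u v w} → rt° v u ≡ w → lab° v w ≡ lab° u v → lab° v (rt° v u) ≡ lab° u v
    go {v = v} e h = trans (cong (lab° v) e) h
    step° zero zero ()
    step° (suc x) zero k with mem3-e k
    ... | inj₁ refl = go {suc p} {zero} rt-qp (trans lab-qs (sym lab-pq))
    ... | inj₂ (inj₁ refl) = go {suc r} {zero} rt-qr (trans lab-qp (sym lab-rq))
    ... | inj₂ (inj₂ refl) = go {suc s} {zero} rt-qs (trans lab-qr (sym lab-sq))
    step° zero (suc x) k with mem3-e k
    ... | inj₁ refl = go {zero} {suc p} rt-pq (trans (lab-o₁ p≢r) (trans (cong suc (turn pr (proj₁ rot-p))) (sym lab-qp)))
    ... | inj₂ (inj₁ refl) = go {zero} {suc r} rt-rq (trans lab-rs (sym lab-qr))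
    ... | inj₂ (inj₂ refl) = go {zero} {suc s} rt-sq (trans (lab-o₁ s≢r)
            (trans (cong suc (trans (turn (Adj-sym H rs) at-s) (turn (Adj-sym H pr) at-r))) (sym lab-qs)))
    step° (suc y) (suc x) k with prs x
    ... | oth a b c = go {suc y} {suc x} (rt-oo a b c) (trans (lab-o₁ b) (trans (cong suc (lab-step y x (proj₁ (old-e k)))) (sym (lab-o₂ c))))
    ... | iss with same? y r
    ... | inj₁ refl = go {suc r} {suc s} rt-sr (trans lab-sq (sym lab-rs))
    ... | inj₂ n = go {suc y} {suc s} (rt-so n) (trans (lab-o₁ s≢r) (trans (cong suc (lab-step y s (proj₁ (old-e k)))) (sym (lab-o₁ n))))
    step° (suc y) (suc x) k | isp with P.all y (Adj-sym H (proj₁ (old-e k)))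
    ... | inj₁ refl = ⊥-elim (proj₂ (proj₂ (old-e k)) (refl , refl))
    ... | inj₂ (inj₁ refl) = go {suc s} {suc p} rt-ps (trans lab-pq (trans (cong suc (turn P.ay at-p)) (sym (lab-o₁ s≢r))))
    ... | inj₂ (inj₂ refl) = go {suc p'} {suc p} rt-pp' (trans (lab-o₁ p≢r) (trans (cong suc (turn P.az (proj₂ rot-p))) (sym (lab-o₂ p≢s))))
    step° (suc y) (suc x) k | isr with R.all y (Adj-sym H (proj₁ (old-e k)))
    ... | inj₁ refl = ⊥-elim (proj₁ (proj₂ (old-e k)) (refl , refl))
    ... | inj₂ (inj₁ refl) = go {suc s} {suc r} rt-rs (trans (lab-o₂ (R.y≢z ∘ sym)) (trans (cong suc (turn R.ay (proj₁ rot-r))) (sym (lab-o₁ s≢r))))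
    ... | inj₂ (inj₂ refl) = go {suc r'} {suc r} rt-rr' (trans lab-rq (trans (cong suc (turn R.az (proj₂ rot-r))) (sym (lab-o₂ r≢s))))

    conn° : ColConn S
    conn° c h u v _ _ = trans (all u) (sym (all v))
      where
      ed : ∀ x y → Adj H x y → c (suc x) ≡ c (suc y)
      ed x y k with T? (edgeIs p r x y)
      ... | no n = h _ _ tt tt (old-i {x} {y} k (λ { (refl , refl) → n (edgeIs-i₁ p r) }) (λ { (refl , refl) → n (edgeIs-i₂ p r) }))
      ... | yes e with edgeIs-e e
      ... | inj₁ (refl , refl) = trans (h (suc p) zero tt tt (mem3-i (inj₁ refl))) (h zero (suc r) tt tt (mem3-i (inj₂ (inj₁ refl))))
      ... | inj₂ (refl , refl) = trans (h (suc r) zero tt tt (mem3-i (inj₂ (inj₁ refl)))) (h zero (suc p) tt tt (mem3-i (inj₁ refl)))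
      all : ∀ u → c u ≡ c (suc p)
      all zero = h zero (suc p) tt tt (mem3-i (inj₁ refl))
      all (suc u) = conn (c ∘ suc) (λ x y _ _ → ed x y) u p tt tt

    G° : Graph
    G° = sub G Tf Yf Bf

    -- Of the three darts with the face `T`, one belongs to the deleted edge `p r`, one is the
    -- exceptional dart `r s`, and the last has the face `X` behind it.
    T≢Y : ∀ {u v} → Adj S (suc u) (suc v) → ¬ (u ≡ r × v ≡ s) → ¬ (lab u v ≡ Tf × lab v u ≡ Yf)
    T≢Y k n (e , e') with face3-darts E pr rs sp at-r at-s at-p (proj₁ (old-e k)) e
    ... | inj₁ (refl , refl) = proj₁ (proj₂ (old-e k)) (refl , refl)
    ... | inj₂ (inj₁ q) = n q
    ... | inj₂ (inj₂ (refl , refl)) = X≢Y e'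

    oo : ∀ {u v} → Adj S (suc u) (suc v) → ¬ (u ≡ r × v ≡ s) → ¬ (v ≡ r × u ≡ s) → Adj G° (suc (lab u v)) (suc (lab v u))
    oo {u} {v} k n n' = delEdge-i (adj G) (dual← u v (proj₁ (old-e k))) (T≢Y k n)
      λ (e , e') → T≢Y (Adj-sym S {suc u} {suc v} k) n' (e' , e)

    dual°← : ∀ u v → Adj S u v → Adj G° (lab° u v) (lab° v u)
    at° : ∀ u v {a b} → lab° u v ≡ a → lab° v u ≡ b → Adj G° a b → Adj G° (lab° u v) (lab° v u)
    at° u v refl refl h = h
    dual°← zero zero ()
    dual°← zero (suc x) k with mem3-e k
    ... | inj₁ refl = at° zero (suc p) lab-qp lab-pq (delEdge-i (adj G) (Adj-sym G (dual← p r pr))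
            (λ (e , _) → loopless pr (sym e)) (λ (e , _) → B≢Y e))
    ... | inj₂ (inj₁ refl) = at° zero (suc r) lab-qr lab-rq (mem3-i (inj₂ (inj₂ refl)))
    ... | inj₂ (inj₂ refl) = at° zero (suc s) lab-qs lab-sq (mem3-i (inj₁ refl))
    dual°← (suc x) zero k = Adj-sym G° {lab° zero (suc x)} {lab° (suc x) zero} (dual°← zero (suc x) k)
    dual°← (suc u) (suc v) k with T? (edgeIs r s u v)
    ... | no n = at° (suc u) (suc v) (lab-oo n₁) (lab-oo n₂) (oo k n₁ n₂)
      where
      n₁ : ¬ (u ≡ r × v ≡ s)
      n₁ (refl , refl) = n (edgeIs-i₁ r s)
      n₂ : ¬ (v ≡ r × u ≡ s)
      n₂ (refl , refl) = n (edgeIs-i₂ r s)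
    ... | yes e with edgeIs-e e
    ... | inj₁ (refl , refl) = at° (suc r) (suc s) lab-rs (lab-o₁ s≢r) (mem3-i (inj₂ (inj₁ refl)))
    ... | inj₂ (refl , refl) = at° (suc s) (suc r) (lab-o₁ s≢r) lab-rs (mem3-i (inj₂ (inj₁ refl)))

    Wit : V G° → V G° → Set
    Wit a b = ∃₂ λ u v → Adj S u v × lab° u v ≡ a × lab° v u ≡ b
    rev-wit : ∀ {a b} → Wit a b → Wit b a
    rev-wit (u , v , k , e , e') = v , u , Adj-sym S {u} {v} k , e' , e
    wit0 : ∀ {y} → T (mem3 Tf Yf Bf y) → Wit zero (suc y)
    wit0 k with mem3-e k
    ... | inj₁ refl = suc s , zero , mem3-i (inj₂ (inj₂ refl)) , lab-sq , lab-qs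
    ... | inj₂ (inj₁ refl) = suc r , suc s , Deg3.ay deg-r , lab-rs , lab-o₁ s≢r
    ... | inj₂ (inj₂ refl) = zero , suc r , mem3-i (inj₂ (inj₁ refl)) , lab-qr , lab-rq
    dual°→ : ∀ a b → Adj G° a b → Wit a b
    dual°→ zero zero ()
    dual°→ zero (suc y) k = wit0 k
    dual°→ (suc y) zero k = rev-wit (wit0 k)
    dual°→ (suc a) (suc b) k with delEdge-e (adj G) k
    ... | k' , n , n' with dual→ a b k'
    ... | u , v , l , refl , refl with T? (edgeIs p r u v) | T? (edgeIs r s u v)
    ... | no m | no m' = suc u , suc v , old-i l (λ { (refl , refl) → m (edgeIs-i₁ p r) }) (λ { (refl , refl) → m (edgeIs-i₂ p r) }) ,
            lab-oo (λ { (refl , refl) → m' (edgeIs-i₁ r s) }) , lab-oo (λ { (refl , refl) → m' (edgeIs-i₂ r s) })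
    ... | yes e | _ with edgeIs-e e
    ... | inj₁ (refl , refl) = suc p , zero , mem3-i (inj₁ refl) , lab-pq , lab-qp
    ... | inj₂ (refl , refl) = zero , suc p , mem3-i (inj₁ refl) , lab-qp , lab-pq
    dual°→ (suc a) (suc b) k | k' , n , n' | u , v , l , refl , refl | no _ | yes e with edgeIs-e e
    ... | inj₁ (refl , refl) = ⊥-elim (n (turn (Adj-sym H pr) at-r , refl))
    ... | inj₂ (refl , refl) = ⊥-elim (n' (refl , turn (Adj-sym H pr) at-r))

    surj° : ∀ f → ∃₂ λ u v → Adj S u v × lab° u v ≡ f
    surj° zero = zero , suc r , mem3-i (inj₂ (inj₁ refl)) , lab-qr
    surj° (suc f) with lab-surj f
    ... | u , v , l , refl with T? (edgeIs p r u v) | T? (edgeIs r s u v)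
    ... | no m | no m' = suc u , suc v , old-i l (λ { (refl , refl) → m (edgeIs-i₁ p r) }) (λ { (refl , refl) → m (edgeIs-i₂ p r) }) ,
            lab-oo (λ { (refl , refl) → m' (edgeIs-i₁ r s) })
    ... | yes e | _ with edgeIs-e e
    ... | inj₁ (refl , refl) = suc p , zero , mem3-i (inj₁ refl) , lab-pq
    ... | inj₂ (refl , refl) = zero , suc p , mem3-i (inj₁ refl) , lab-qp
    surj° (suc f) | u , v , l , refl | no _ | yes e with edgeIs-e e
    ... | inj₁ (refl , refl) = suc p , zero , mem3-i (inj₁ refl) , trans lab-pq (cong suc (sym (turn (Adj-sym H pr) at-r)))
    ... | inj₂ (refl , refl) = suc s , suc r , Adj-sym S {suc r} {suc s} (Deg3.ay deg-r) , lab-o₁ s≢r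

  up : LE S (sub G Tf Yf Bf)
  up = record
    { ro = mkRot S rt° LRs ; lab = lab° ; lab-step = step° ; lab-surj = surj° ; conn = conn°
    ; eul = trans (solve 2 (λ x y → con 2 :* (con 1 :+ x) :+ con 2 :* (con 1 :+ y) := con 2 :* x :+ con 2 :* y :+ con 4) refl (n H) (n G))
        (trans (cong (_+ 4) eul) (cong (_+ 4) (sym (dartCount-sub H p≢r r≢s p≢s pr))))
    ; dual→ = dual°→ ; dual← = dual°← }
    where open +-*-Solver

  tri° : TriangleAt up zero (suc r) (suc s)
  tri° = mkTri rt-rq rt-sr rt-qs

module BlowUp {H G : Graph} (E : LE H G) {t a b c : V H} (d : Deg3 H t a b c)
  (ta : LE.rt E t a ≡ c) where
  open LE E
  open Blow d
  private
    module D = Deg3 d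
    tc : rt t c ≡ b
    tc = proj₁ (rot3 ro (deg3-swap d) ta)
    tb : rt t b ≡ a
    tb = proj₂ (rot3 ro (deg3-swap d) ta)

  private
    around-p : V B → V B
    around-p zero          = pt a
    around-p (suc zero)    = zero
    around-p (suc (suc _)) = suc zero

  rt° : V B → V B → V B
  rt° zero zero                = zero
  rt° zero (suc zero)          = pt b
  rt° zero (suc (suc y))       = if y == t then suc zero else pt t
  rt° (suc zero) zero          = pt t
  rt° (suc zero) (suc zero)    = zero
  rt° (suc zero) (suc (suc y)) = if y == t then pt c else zero
  rt° (suc (suc x)) y          = if x == t then around-p y
                                 else κ x (rt x (κ⁻ y))

  G° : Graph
  G° = stack G (lab t a) (lab t b) (lab t c)

  lab° : V B → V B → V G°
  lab° zero zero                = zero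
  lab° zero (suc zero)          = zero
  lab° zero (suc (suc y))       = if y == t then suc (lab t a) else suc (lab t y)
  lab° (suc zero) zero          = suc (lab t b)
  lab° (suc zero) (suc zero)    = zero
  lab° (suc zero) (suc (suc y)) = if y == t then zero else suc (lab t y)
  lab° (suc (suc x)) zero          = if x == t then zero else suc (lab x t)
  lab° (suc (suc x)) (suc zero)    = if x == t then suc (lab t c) else suc (lab x t)
  lab° (suc (suc x)) (suc (suc y)) = suc (lab x y)

  lab-from : ∀ {x} → x ≢ t → ∀ y → lab° (pt x) y ≡ suc (lab x (κ⁻ y))
  lab-from n zero          = if-no n
  lab-from n (suc zero)    = if-no n
  lab-from n (suc (suc y)) = refl

  lab-into : ∀ {x} → x ≢ t → ∀ y → lab° y (pt x) ≡ suc (lab (κ⁻ y) x)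
  lab-into n zero          = if-no n
  lab-into n (suc zero)    = if-no n
  lab-into n (suc (suc y)) = refl

  lab-qp : lab° zero (pt t) ≡ suc (lab t a)
  lab-qp = if-yes {x = t} refl
  lab-rp : lab° (suc zero) (pt t) ≡ zero
  lab-rp = if-yes {x = t} refl
  lab-pq : lab° (pt t) zero ≡ zero
  lab-pq = if-yes {x = t} refl
  lab-pr : lab° (pt t) (suc zero) ≡ suc (lab t c)
  lab-pr = if-yes {x = t} refl

  rt-p : ∀ y → rt° (pt t) y ≡ around-p y
  rt-p y = if-yes {x = t} refl
  rt-qp : rt° zero (pt t) ≡ suc zero
  rt-qp = if-yes {x = t} refl
  rt-qb : rt° zero (pt b) ≡ pt t
  rt-qb = if-no b≢t
  rt-rp : rt° (suc zero) (pt t) ≡ pt c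
  rt-rp = if-yes {x = t} refl
  rt-rc : rt° (suc zero) (pt c) ≡ zero
  rt-rc = if-no c≢t

  private
    LRs : ∀ v → LR (Adj B v) (rt° v)
    LRs v with cview v
    ... | corner zero = LR-deg3 (deg3-swap deg-p) (rt-p zero) (rt-p (pt a)) (rt-p (suc zero))
    ... | corner (suc zero) = LR-deg3 deg-q rt-qp refl rt-qb
    ... | corner (suc (suc zero)) = LR-deg3 deg-r refl rt-rp rt-rc
    ... | old x n = LR-conj (rotAt ro x) (κ x) κ⁻ (λ u → κ-adj n) (λ y → κ⁻-adj n {y}) (λ u _ → κ⁻-κ x u)
          (λ y → κ-κ⁻ n {y}) λ y _ → if-no n

    at : ∀ u v {w} → rt° v u ≡ w → lab° v w ≡ lab° u v → lab° v (rt° v u) ≡ lab° u v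
    at u v e h = trans (cong (lab° v) e) h

    step° : ∀ u v → Adj B u v → lab° v (rt° v u) ≡ lab° u v
    step° u v k with cview v
    ... | old x n = at u (pt x) (if-no n) (trans (lab-from n (κ x (rt x (κ⁻ u)))) (trans (cong (λ z → suc (lab x z)) (κ⁻-κ x _))
            (trans (cong suc (lab-step (κ⁻ u) x (Adj-sym H (κ⁻-adj n {u} (Adj-sym B {u} {pt x} k))))) (sym (lab-into n u)))))
    ... | corner zero with Deg3.all deg-p u (Adj-sym B {u} {pt t} k)
    ... | inj₁ refl = at zero (pt t) (rt-p zero) (sym lab-qp)
    ... | inj₂ (inj₁ refl) = at (suc zero) (pt t) (rt-p (suc zero)) (trans lab-pq (sym lab-rp))
    ... | inj₂ (inj₂ refl) = at (pt a) (pt t) (rt-p (pt a)) (trans lab-pr (cong suc (turn D.ax ta)))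
    step° u v k | corner (suc zero) with Deg3.all deg-q u (Adj-sym B {u} {zero} k)
    ... | inj₁ refl = at (pt t) zero rt-qp (sym lab-pq)
    ... | inj₂ (inj₁ refl) = lab-into b≢t zero
    ... | inj₂ (inj₂ refl) = at (pt b) zero rt-qb (trans lab-qp (trans (cong suc (turn D.ay tb)) (sym (lab-from b≢t zero))))
    step° u v k | corner (suc (suc zero)) with Deg3.all deg-r u (Adj-sym B {u} {suc zero} k)
    ... | inj₁ refl = lab-rp
    ... | inj₂ (inj₁ refl) = at (pt t) (suc zero) rt-rp (trans (lab-into c≢t (suc zero)) (sym lab-pr))
    ... | inj₂ (inj₂ refl) = at (pt c) (suc zero) rt-rc (trans (cong suc (turn D.az tc)) (sym (lab-from c≢t (suc zero))))

    pq : Adj B (pt t) zero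
    pq = Deg3.ax deg-p
    rq : Adj B (suc zero) zero
    rq = tt
    pr : Adj B (pt t) (suc zero)
    pr = Deg3.ay deg-p

    Wit : V G° → V G° → Set
    Wit f g = ∃₂ λ u v → Adj B u v × lab° u v ≡ f × lab° v u ≡ g
    rev-wit : ∀ {f g} → Wit f g → Wit g f
    rev-wit (u , v , k , e , e') = v , u , Adj-sym B {u} {v} k , e' , e

    wit-old : ∀ x y → Adj H x y → Wit (suc (lab x y)) (suc (lab y x))
    wit-old x y k with x ≟ t
    ... | no n = pt x , κ x y , κ-adj n k , trans (lab-from n (κ x y)) (cong (λ z → suc (lab x z)) (κ⁻-κ x y)) ,
          trans (lab-into n (κ x y)) (cong (λ z → suc (lab z x)) (κ⁻-κ x y))
    ... | yes refl = κ y x , pt y , Adj-sym B {pt y} {κ y x} (κ-adj ne (Adj-sym H k)) ,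
          trans (lab-into ne (κ y x)) (cong (λ z → suc (lab z y)) (κ⁻-κ y x)) ,
          trans (lab-from ne (κ y x)) (cong (λ z → suc (lab y z)) (κ⁻-κ y x))
      where
      ne : y ≢ x
      ne e = adj≢ H k (sym e)

    wit0 : ∀ {f} → T (mem3 (lab t a) (lab t b) (lab t c) f) → Wit zero (suc f)
    wit0 k with mem3-e k
    ... | inj₁ refl = pt t , zero , pq , lab-pq , lab-qp
    ... | inj₂ (inj₁ refl) = zero , suc zero , tt , refl , refl
    ... | inj₂ (inj₂ refl) = suc zero , pt t , Adj-sym B {pt t} {suc zero} pr , lab-rp , lab-pr

    dual°→ : ∀ f g → Adj G° f g → Wit f g
    dual°→ zero zero ()
    dual°→ zero (suc g) k = wit0 k
    dual°→ (suc f) zero k = rev-wit (wit0 k)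
    dual°→ (suc f) (suc g) k with dual→ f g k
    ... | u , v , l , refl , refl = wit-old u v l

    at° : ∀ u v {f g} → lab° u v ≡ f → lab° v u ≡ g → Adj G° f g → Adj G° (lab° u v) (lab° v u)
    at° u v refl refl h = h

    dual-cor : ∀ i j → i ≢ j → Adj G° (lab° (cor i) (cor j)) (lab° (cor j) (cor i))
    dual-cor zero zero n = ⊥-elim (n refl)
    dual-cor (suc zero) (suc zero) n = ⊥-elim (n refl)
    dual-cor (suc (suc zero)) (suc (suc zero)) n = ⊥-elim (n refl)
    dual-cor zero (suc zero) _ = at° (pt t) zero lab-pq lab-qp (mem3-i (inj₁ refl))
    dual-cor (suc zero) zero _ = at° zero (pt t) lab-qp lab-pq (mem3-i (inj₁ refl))
    dual-cor (suc zero) (suc (suc zero)) _ = mem3-i (inj₂ (inj₁ refl))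
    dual-cor (suc (suc zero)) (suc zero) _ = mem3-i (inj₂ (inj₁ refl))
    dual-cor (suc (suc zero)) zero _ = at° (suc zero) (pt t) lab-rp lab-pr (mem3-i (inj₂ (inj₂ refl)))
    dual-cor zero (suc (suc zero)) _ = at° (pt t) (suc zero) lab-pr lab-rp (mem3-i (inj₂ (inj₂ refl)))

    dual°← : ∀ u v → Adj B u v → Adj G° (lab° u v) (lab° v u)
    dual°← u v k with cview u | cview v
    ... | old x n | _ = at° (pt x) v (lab-from n v) (lab-into n v) (dual← x (κ⁻ v) (κ⁻-adj n {v} k))
    ... | corner i | old x n = at° (cor i) (pt x) (lab-into n (cor i)) (lab-from n (cor i))
            (dual← (κ⁻ (cor i)) x (Adj-sym H (κ⁻-adj n {cor i} (Adj-sym B {cor i} {pt x} k))))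
    ... | corner i | corner j = dual-cor i j λ { refl → adj≢ B {cor i} {cor i} k refl }

    surj° : ∀ f → ∃₂ λ u v → Adj B u v × lab° u v ≡ f
    surj° zero = pt t , zero , pq , lab-pq
    surj° (suc f) with lab-surj f
    ... | x , y , k , refl with wit-old x y k
    ... | u , v , l , e , _ = u , v , l , e

    conn° : ColConn B
    conn° col h u v _ _ = trans (all u) (sym (all v))
      where
      corners : ∀ i → col (cor i) ≡ col (pt t)
      corners i with i ≟ zero
      ... | yes refl = refl
      ... | no n = h _ _ tt tt (cor-adj i zero n)
      κ-col : ∀ x y → col (κ x y) ≡ col (pt y)
      κ-col x y with same? y t
      ... | inj₂ n = cong col (κ-old {x} n)
      ... | inj₁ refl with κ x t | κ⁻-κ x t
      ... | z | e with cview z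
      ... | corner i = corners i
      ... | old y n = ⊥-elim (n e)
      ed : ∀ x y → Adj H x y → col (pt x) ≡ col (pt y)
      ed x y k with same? x t
      ... | inj₂ n = trans (h (pt x) (κ x y) tt tt (κ-adj n k)) (κ-col x y)
      ... | inj₁ refl = sym (trans (h (pt y) (κ y x) tt tt (κ-adj (λ e → adj≢ H k (sym e)) (Adj-sym H k))) (κ-col y x))
      all : ∀ u → col u ≡ col (pt t)
      all u with cview u
      ... | corner i = corners i
      ... | old x _ = conn (col ∘ pt) (λ x y _ _ → ed x y) x t tt tt

  up : LE B G°
  up = record
    { ro = mkRot B rt° LRs ; lab = lab° ; lab-step = step° ; lab-surj = surj° ; conn = conn°
    ; eul = trans (solve 2 (λ x y → con 2 :* (con 2 :+ x) :+ con 2 :* (con 1 :+ y) := con 2 :* x :+ con 2 :* y :+ con 6) refl (n H) (n G))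
        (trans (cong (_+ 6) eul) (trans (solve 1 (λ x → x :+ con 4 :+ con 6 := x :+ con 6 :+ con 4) refl (dartCount H))
          (cong (_+ 4) (sym (dartCount-blow H d)))))
    ; dual→ = dual°→ ; dual← = dual°← }
    where open +-*-Solver

  tri° : TriangleAt up (pt t) zero (suc zero)
  tri° = mkTri rt-qp refl (rt-p (suc zero))

-- Undoing the constructions on arbitrary embeddings

exchange : ∀ {m} → Fin (suc m) → Fin (suc m) → Fin (suc m)
exchange f x = if x == f then zero else (if x == zero then f else x)

exchange² : ∀ {m} (f x : Fin (suc m)) → exchange f (exchange f x) ≡ x
exchange² f x with same? x f | same? x zero
... | inj₁ refl | _ = trans (cong (exchange x) (if-yes {x = x} refl)) (lem x)
  where
  lem : ∀ {m} (x : Fin (suc m)) → exchange x zero ≡ x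
  lem zero    = refl
  lem (suc x) = refl
... | inj₂ n | inj₁ refl = trans (cong (exchange f) (if-no n)) (if-yes {x = f} refl)
... | inj₂ n | inj₂ n' = trans (cong (exchange f) e) e
  where
  e : exchange f x ≡ x
  e = trans (if-no n) (if-no n')

-- A copy of `G` in which the number of vertices is visibly a successor and `f` has become `zero`.
-- Deleting `f` is then restriction along `suc`.
record Pointed (G : Graph) (f : V G) : Set where
  field
    m   : ℕ
    a   : Fin (suc m) → Fin (suc m) → Bool
    sy  : ∀ x y → a x y ≡ a y x
    irr : ∀ x → a x x ≡ false
  G′ : Graph
  G′ = record { n = suc m ; adj = a ; adj-sym = sy ; adj-irr = irr }
  field
    iso   : Iso G G′
    to-f  : Iso.to iso f ≡ zero

relabel : (G : Graph) (f : V G) → Pointed G f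
relabel record { n = suc m ; adj = a ; adj-sym = s ; adj-irr = i } f = record
  { m = m ; a = λ x y → a (exchange f x) (exchange f y) ; sy = λ x y → s _ _ ; irr = λ x → i _
  ; iso = record { to = exchange f ; from = exchange f ; tofrom = exchange² f ; fromto = exchange² f
                 ; adj-to = λ u v → cong₂ a (exchange² f u) (exchange² f v) }
  ; to-f = if-yes {x = f} refl }

-- A retraction onto the vertices other than `zero`. In `BlowDown` the value `f` at `zero` is
-- arbitrary; in `SubDown` it merges the face `zero` into the face `T`.
dropZero : ∀ {m} → Fin m → Fin (suc m) → Fin m
dropZero f zero    = f
dropZero f (suc x) = x

dropZero-suc : ∀ {m} {f : Fin m} {x : Fin (suc m)} → x ≢ zero → x ≡ suc (dropZero f x)
dropZero-suc {x = zero}  n = ⊥-elim (n refl)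
dropZero-suc {x = suc x} n = refl

-- Converse of `BlowUp`. The corners of the new triangle are cubic, so in any embedding the triangle
-- bounds a face. Under the name `zero` this face is removed from `G`, and `G` is recovered by
-- stacking.
module BlowDown {H : Graph} {t a b c : V H} (d : Deg3 H t a b c) {m : ℕ} {A : Fin (suc m) → Fin (suc m) → Bool}
  {sy : ∀ x y → A x y ≡ A y x} {irr : ∀ x → A x x ≡ false} where
  G : Graph
  G = record { n = suc m ; adj = A ; adj-sym = sy ; adj-irr = irr }
  open Blow d

  module _ (E : LE B G) (pr-q : LE.rt E (pt t) (suc zero) ≡ zero)
    (inner : LE.lab E (pt t) zero ≡ zero) where
    open LE E
    private
      module D = Deg3 d
      pq : Adj B (pt t) zero
      pq = Deg3.ax deg-p
      qr : Adj B zero (suc zero)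
      qr = tt
      rp : Adj B (suc zero) (pt t)
      rp = Adj-sym B {pt t} {suc zero} (Deg3.ay deg-p)
      pr : Adj B (pt t) (suc zero)
      pr = Deg3.ay deg-p
      swap12 : ∀ {h x y z} → Deg3 B h x y z → Deg3 B h y x z
      swap12 = deg3-swap ∘ deg3-rot
      F = face-of-cubic-triangle E (swap12 deg-p) (swap12 deg-r) deg-q pr-q
      rt-qp : rt zero (pt t) ≡ suc zero
      rt-qp = proj₁ F
      rt-rq : rt (suc zero) zero ≡ pt t
      rt-rq = proj₂ F
      rot-p : rt (pt t) zero ≡ pt a × rt (pt t) (pt a) ≡ suc zero
      rot-p = rot3 ro (swap12 deg-p) pr-q
      rot-q : rt zero (suc zero) ≡ pt b × rt zero (pt b) ≡ pt t
      rot-q = rot3 ro deg-q rt-qp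
      rot-r : rt (suc zero) (pt t) ≡ pt c × rt (suc zero) (pt c) ≡ zero
      rot-r = rot3 ro deg-r rt-rq
    inner-q : lab zero (suc zero) ≡ zero
    inner-q = trans (turn (Adj-sym B {pt t} {zero} pq) rt-qp) inner
    inner-r : lab (suc zero) (pt t) ≡ zero
    inner-r = trans (turn {suc zero} {zero} {pt t} tt rt-rq) inner-q
    private
      is-inner : ∀ {u v} → Adj B u v → lab u v ≡ zero →
        (u ≡ pt t × v ≡ zero) ⊎ (u ≡ zero × v ≡ suc zero) ⊎ (u ≡ suc zero × v ≡ pt t)
      is-inner k e = face3-darts E pq qr rp rt-qp rt-rq pr-q k (trans e (sym inner))

      -- A value for the label `zero`: the face across the edge `p q`, which differs from the inner
      -- one because the dual has no loops.
      u₀ : Fin m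
      u₀ with lab zero (pt t) in e
      ... | zero  = ⊥-elim (loopless {zero} {pt t} (Adj-sym B {pt t} {zero} pq) (trans e (sym inner)))
      ... | suc f = f

      dz : Fin (suc m) → Fin m
      dz = dropZero u₀

    lab' : V H → V H → Fin m
    lab' x y = dz (lab (κ y x) (κ x y))

    G' : Graph
    G' = record { n = m ; adj = λ f g → A (suc f) (suc g) ; adj-sym = λ f g → sy (suc f) (suc g) ; adj-irr = λ f → irr (suc f) }

    private
      old-nz : ∀ {x} → x ≢ t → ∀ y → Adj B (pt x) y → lab (pt x) y ≢ zero × lab y (pt x) ≢ zero
      old-nz {x} nx y k = (λ e → no₁ (is-inner k e)) , λ e → no₂ (is-inner (Adj-sym B {pt x} {y} k) e)
        where
        no₁ : ¬ ((pt x ≡ pt t × y ≡ zero) ⊎ (pt x ≡ zero × y ≡ suc zero) ⊎ (pt x ≡ suc zero × y ≡ pt t))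
        no₁ (inj₁ (refl , _)) = nx refl
        no₁ (inj₂ (inj₁ (() , _)))
        no₁ (inj₂ (inj₂ (() , _)))
        no₂ : ¬ ((y ≡ pt t × pt x ≡ zero) ⊎ (y ≡ zero × pt x ≡ suc zero) ⊎ (y ≡ suc zero × pt x ≡ pt t))
        no₂ (inj₁ (_ , ()))
        no₂ (inj₂ (inj₁ (_ , ())))
        no₂ (inj₂ (inj₂ (_ , refl))) = nx refl

      old-lab : ∀ {x} → x ≢ t → ∀ y → Adj B (pt x) y → lab (pt x) y ≡ suc (lab' x (κ⁻ y)) × lab y (pt x) ≡ suc (lab' (κ⁻ y) x)
      old-lab {x} nx y k =
        trans (dropZero-suc (proj₁ (old-nz nx y k))) (cong (suc ∘ dz) (sym (cong₂ lab (κ-old {κ⁻ y} nx) (κ-κ⁻ nx {y} k)))) ,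
        trans (dropZero-suc (proj₂ (old-nz nx y k))) (cong (suc ∘ dz) (sym (cong₂ lab (κ-κ⁻ nx {y} k) (κ-old {κ⁻ y} nx))))

    lab-old : ∀ {h x} → h ≢ t → Adj B (pt h) x → lab (pt h) x ≡ suc (lab' h (κ⁻ x))
    lab-old {h} {x} nh k = proj₁ (old-lab nh x k)

    lab-pa : lab (pt t) (pt a) ≡ suc (lab' t a)
    lab-pa = trans (proj₂ (old-lab a≢t (pt t) (Adj-sym B {pt t} {pt a} pa))) refl
    lab-qb : lab zero (pt b) ≡ suc (lab' t b)
    lab-qb = proj₂ (old-lab b≢t zero (Adj-sym B {zero} {pt b} (Deg3.az deg-q)))
    lab-rc : lab (suc zero) (pt c) ≡ suc (lab' t c)
    lab-rc = proj₂ (old-lab c≢t (suc zero) (Adj-sym B {suc zero} {pt c} (Deg3.az deg-r)))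
    lab-qp : lab zero (pt t) ≡ suc (lab' t a)
    lab-qp = trans (sym (turn pq (proj₁ rot-p))) lab-pa
    lab-rq : lab (suc zero) zero ≡ suc (lab' t b)
    lab-rq = trans (sym (turn {zero} {suc zero} qr (proj₁ rot-q))) lab-qb
    lab-pr : lab (pt t) (suc zero) ≡ suc (lab' t c)
    lab-pr = trans (sym (turn {suc zero} {pt t} rp (proj₁ rot-r))) lab-rc

    private

      rt' : V H → V H → V H
      rt' x y = if x == t then (if y == a then c else (if y == c then b else a)) else κ⁻ (rt (pt x) (κ x y))

      rt'-t : ∀ y → rt' t y ≡ (if y == a then c else (if y == c then b else a))
      rt'-t y = if-yes {x = t} refl
      rt'-a : rt' t a ≡ c
      rt'-a = trans (rt'-t a) (if-yes {x = a} refl)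
      rt'-c : rt' t c ≡ b
      rt'-c = trans (rt'-t c) (trans (if-no (D.x≢z ∘ sym)) (if-yes {x = c} refl))
      rt'-b : rt' t b ≡ a
      rt'-b = trans (rt'-t b) (trans (if-no (D.x≢y ∘ sym)) (if-no D.y≢z))

      LRs : ∀ v → LR (Adj H v) (rt' v)
      LRs v with same? v t
      ... | inj₁ refl = LR-deg3 (deg3-swap d) rt'-a rt'-c rt'-b
      ... | inj₂ nv = LR-conj (rotAt ro (pt v)) κ⁻ (κ v) (λ u → κ⁻-adj nv {u}) (λ y → κ-adj nv) (λ u → κ-κ⁻ nv {u})
            (λ y _ → κ⁻-κ v y) λ y _ → if-no nv

      into-a : lab' a t ≡ lab' t c
      into-a = fsuc-inj (trans (sym (proj₁ (old-lab a≢t (pt t) (Adj-sym B {pt t} {pt a} pa))))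
        (trans (sym (turn pa (proj₂ rot-p))) lab-pr))
      into-b : lab' b t ≡ lab' t a
      into-b = fsuc-inj (trans (sym (proj₁ (old-lab b≢t zero (Adj-sym B {zero} {pt b} (Deg3.az deg-q)))))
        (trans (sym (turn {zero} {pt b} (Deg3.az deg-q) (proj₂ rot-q))) lab-qp))
      into-c : lab' c t ≡ lab' t b
      into-c = fsuc-inj (trans (sym (proj₁ (old-lab c≢t (suc zero) (Adj-sym B {suc zero} {pt c} (Deg3.az deg-r)))))
        (trans (sym (turn {suc zero} {pt c} (Deg3.az deg-r) (proj₂ rot-r))) lab-rq))

      step' : ∀ u v → Adj H u v → lab' v (rt' v u) ≡ lab' u v
      step' u v k with same? v t
      ... | inj₂ nv = trans (cong (lab' v) (if-no nv)) (fsuc-inj (trans (sym (proj₁ (old-lab nv w kw)))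
            (trans (lab-step (κ v u) (pt v) (Adj-sym B {pt v} {κ v u} (κ-adj nv (Adj-sym H k))))
              (trans (proj₂ (old-lab nv (κ v u) (κ-adj nv (Adj-sym H k)))) (cong (λ z → suc (lab' z v)) (κ⁻-κ v u))))))
        where
        w = rt (pt v) (κ v u)
        kw : Adj B (pt v) w
        kw = σ-adj ro (pt v) (κ v u) (κ-adj nv (Adj-sym H k))
      ... | inj₁ refl with D.all u (Adj-sym H k)
      ... | inj₁ refl = trans (cong (lab' t) rt'-a) (sym into-a)
      ... | inj₂ (inj₁ refl) = trans (cong (lab' t) rt'-b) (sym into-b)
      ... | inj₂ (inj₂ refl) = trans (cong (lab' t) rt'-c) (sym into-c)

      Hdart : ∀ u v → Adj B u v → ∀ {x} → (∃ λ i → u ≡ pt i × i ≢ t) ⊎ (∃ λ i → v ≡ pt i × i ≢ t) → lab u v ≡ suc x →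
        Adj H (κ⁻ u) (κ⁻ v) × lab' (κ⁻ u) (κ⁻ v) ≡ x
      Hdart u v k (inj₁ (i , refl , ni)) e = κ⁻-adj ni {v} k , fsuc-inj (trans (sym (proj₁ (old-lab ni v k))) e)
      Hdart u v k (inj₂ (i , refl , ni)) e = Adj-sym H (κ⁻-adj ni {u} (Adj-sym B {u} {pt i} k)) ,
        fsuc-inj (trans (sym (proj₂ (old-lab ni u (Adj-sym B {u} {pt i} k)))) e)

      surj' : ∀ f → ∃₂ λ u v → Adj H u v × lab' u v ≡ f
      surj' f with lab-surj (suc f)
      ... | u , v , k , e with cview u | cview v
      ... | old x n | _ = x , κ⁻ v , Hdart (pt x) v k (inj₁ (x , refl , n)) e
      ... | corner i | old y n = κ⁻ (cor i) , y , Hdart (cor i) (pt y) k (inj₂ (y , refl , n)) e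
      ... | corner i | corner j = cc i j k e
        where
        cc : ∀ i j → Adj B (cor i) (cor j) → lab (cor i) (cor j) ≡ suc f → ∃₂ λ u v → Adj H u v × lab' u v ≡ f
        cc zero zero k e = ⊥-elim (adj≢ B {pt t} {pt t} k refl)
        cc (suc zero) (suc zero) ()
        cc (suc (suc zero)) (suc (suc zero)) ()
        cc zero (suc zero) k e with () ← trans (sym inner) e
        cc (suc zero) (suc (suc zero)) k e with () ← trans (sym inner-q) e
        cc (suc (suc zero)) zero k e with () ← trans (sym inner-r) e
        cc (suc zero) zero k e = t , a , D.ax , fsuc-inj (trans (sym lab-qp) e)
        cc (suc (suc zero)) (suc zero) k e = t , b , D.ay , fsuc-inj (trans (sym lab-rq) e)
        cc zero (suc (suc zero)) k e = t , c , D.az , fsuc-inj (trans (sym lab-pr) e)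

      dual'→ : ∀ f g → A (suc f) (suc g) ≡ true → ∃₂ λ u v → Adj H u v × lab' u v ≡ f × lab' v u ≡ g
      dual'→ f g h with dual→ (suc f) (suc g) (subst T (sym h) tt)
      ... | u , v , k , e , e' with cview u | cview v
      ... | old x n | _ = let l , q = Hdart (pt x) v k (inj₁ (x , refl , n)) e in x , κ⁻ v , l , q ,
              proj₂ (Hdart v (pt x) (Adj-sym B {pt x} {v} k) (inj₂ (x , refl , n)) e')
      ... | corner i | old y n = let l , q = Hdart (cor i) (pt y) k (inj₂ (y , refl , n)) e in κ⁻ (cor i) , y , l , q ,
              proj₂ (Hdart (pt y) (cor i) (Adj-sym B {cor i} {pt y} k) (inj₁ (y , refl , n)) e')
      ... | corner i | corner j = ⊥-elim (cc i j k e e')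
        where
        cc : ∀ i j → Adj B (cor i) (cor j) → lab (cor i) (cor j) ≡ suc f → lab (cor j) (cor i) ≡ suc g → ⊥
        cc zero zero k e e' = adj≢ B {pt t} {pt t} k refl
        cc (suc zero) (suc zero) ()
        cc (suc (suc zero)) (suc (suc zero)) ()
        cc zero (suc zero) k e e' with () ← trans (sym inner) e
        cc (suc zero) (suc (suc zero)) k e e' with () ← trans (sym inner-q) e
        cc (suc (suc zero)) zero k e e' with () ← trans (sym inner-r) e
        cc (suc zero) zero k e e' with () ← trans (sym inner) e'
        cc (suc (suc zero)) (suc zero) k e e' with () ← trans (sym inner-q) e'
        cc zero (suc (suc zero)) k e e' with () ← trans (sym inner-r) e'

      dual-old : ∀ x y → x ≢ t → Adj H x y → Adj G' (lab' x y) (lab' y x)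
      dual-old x y n k = subst₂ (λ f g → T (A f g))
        (trans (proj₁ l) (cong (λ z → suc (lab' x z)) (κ⁻-κ x y))) (trans (proj₂ l) (cong (λ z → suc (lab' z x)) (κ⁻-κ x y)))
        (dual← (pt x) (κ x y) (κ-adj n k))
        where l = old-lab n (κ x y) (κ-adj n k)

      dual'← : ∀ x y → Adj H x y → Adj G' (lab' x y) (lab' y x)
      dual'← x y k with same? x t
      ... | inj₂ n = dual-old x y n k
      ... | inj₁ refl = Adj-sym G' {lab' y x} {lab' x y} (dual-old y x (λ e → adj≢ H k (sym e)) (Adj-sym H k))

      conn' : ColConn H
      conn' col h u v _ _ = conn (col ∘ κ⁻) ed (pt u) (pt v) tt tt
        where
        ed : ∀ u v → T true → T true → Adj B u v → col (κ⁻ u) ≡ col (κ⁻ v)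
        ed u v _ _ k with cview u | cview v
        ... | old x n | _ = h _ _ tt tt (κ⁻-adj n {v} k)
        ... | corner i | old y n = sym (h _ _ tt tt (κ⁻-adj n {cor i} (Adj-sym B {cor i} {pt y} k)))
        ... | corner i | corner j = cong col (trans (κ⁻-cor i) (sym (κ⁻-cor j)))

    down : LE H G'
    down = record
      { ro = mkRot H rt' LRs ; lab = lab' ; lab-step = step' ; lab-surj = surj' ; conn = conn'
      ; eul = +-cancelʳ-≡ 6 _ _ (trans
          (solve 2 (λ x y → con 2 :* x :+ con 2 :* y :+ con 6 := con 2 :* (con 2 :+ x) :+ con 2 :* (con 1 :+ y)) refl (n H) m)
          (trans eul (trans (cong (_+ 4) (dartCount-blow H d))
            (solve 1 (λ x → x :+ con 6 :+ con 4 := x :+ con 4 :+ con 6) refl (dartCount H)))))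
      ; dual→ = λ f g h → dual'→ f g (T→≡ h) ; dual← = dual'← }
      where open +-*-Solver

    stacked : Iso G (stack G' (lab' t a) (lab' t b) (lab' t c))
    stacked = record { to = id ; from = id ; tofrom = λ _ → refl ; fromto = λ _ → refl ; adj-to = ad }
      where
      S = stack G' (lab' t a) (lab' t b) (lab' t c)
      spoke : ∀ f → mem3 (lab' t a) (lab' t b) (lab' t c) f ≡ A zero (suc f)
      spoke f = T-ext fw bw
        where
        fw : T (mem3 (lab' t a) (lab' t b) (lab' t c) f) → T (A zero (suc f))
        fw h with mem3-e h
        ... | inj₁ refl = subst₂ (λ x y → T (A x y)) inner lab-qp (dual← (pt t) zero pq)
        ... | inj₂ (inj₁ refl) = subst₂ (λ x y → T (A x y)) inner-q lab-rq (dual← zero (suc zero) qr)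
        ... | inj₂ (inj₂ refl) = subst₂ (λ x y → T (A x y)) inner-r lab-pr (dual← (suc zero) (pt t) rp)
        bw : T (A zero (suc f)) → T (mem3 (lab' t a) (lab' t b) (lab' t c) f)
        bw h with dual→ zero (suc f) h
        ... | u , v , k , e , e' with is-inner k e
        ... | inj₁ (refl , refl) = mem3-i (inj₁ (fsuc-inj (trans (sym e') lab-qp)))
        ... | inj₂ (inj₁ (refl , refl)) = mem3-i (inj₂ (inj₁ (fsuc-inj (trans (sym e') lab-rq))))
        ... | inj₂ (inj₂ (refl , refl)) = mem3-i (inj₂ (inj₂ (fsuc-inj (trans (sym e') lab-pr))))
      ad : ∀ x y → adj S x y ≡ A x y
      ad zero zero = sym (irr zero)
      ad zero (suc y) = spoke y
      ad (suc x) zero = trans (spoke x) (sy zero (suc x))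
      ad (suc x) (suc y) = refl

-- Converse of `SubUp`. Deleting the new vertex merges the faces `zero` and `T` on the two sides of
-- its edge to `s`; that both of them are triangles takes `Jordan` twice, and this is where
-- 3-connectivity enters.
module SubDown {H : Graph} {p r s p' r' : V H} (dp : Deg3 H p r s p') (dr : Deg3 H r p s r') (C : Conn3 H)
  {m : ℕ} {A : Fin (suc m) → Fin (suc m) → Bool}
  {sy : ∀ x y → A x y ≡ A y x} {irr : ∀ x → A x x ≡ false} where
  G : Graph
  G = record { n = suc m ; adj = A ; adj-sym = sy ; adj-irr = irr }
  open Sub dp dr

  module _ (E : LE S G) (qs-r : LE.rt E zero (suc s) ≡ suc r)
    (inner : LE.lab E zero (suc r) ≡ zero) where
    open LE E
    private
      module P = Deg3 dp
      module R = Deg3 dr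
      r≢p : r ≢ p
      r≢p = p≢r ∘ sym
      s≢p : s ≢ p
      s≢p = p≢s ∘ sym
      s≢r : s ≢ r
      s≢r = r≢s ∘ sym
      qp : Adj S zero (suc p)
      qp = Deg3.ax deg-q
      pq : Adj S (suc p) zero
      pq = Deg3.ax deg-p
      qr : Adj S zero (suc r)
      qr = Deg3.ay deg-q
      rq : Adj S (suc r) zero
      rq = Deg3.ax deg-r
      qs : Adj S zero (suc s)
      qs = Deg3.az deg-q
      sq : Adj S (suc s) zero
      sq = mem3-i (inj₂ (inj₂ refl))
      rs : Adj S (suc r) (suc s)
      rs = Deg3.ay deg-r
      sr : Adj S (suc s) (suc r)
      sr = Adj-sym S {suc r} {suc s} rs
      ps : Adj S (suc p) (suc s)
      ps = Deg3.ay deg-p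
      sp : Adj S (suc s) (suc p)
      sp = Adj-sym S {suc p} {suc s} ps
      pp' : Adj S (suc p) (suc p')
      pp' = Deg3.az deg-p
      rr' : Adj S (suc r) (suc r')
      rr' = Deg3.az deg-r

      -- Both triangles at the new vertex contain `p` or `r`. Outside of them the deleted edge `p r`
      -- is not missed, and what remains is `H` without `x` and `s`.
      off-triangle : ∀ {x} → p ≡ x ⊎ r ≡ x → ConnectedOn S (λ v → not (mem3 zero (suc x) (suc s) v))
      off-triangle {x} _ c h zero v pu = ⊥-elim (not-e pu (mem3-i (inj₁ refl)))
      off-triangle {x} _ c h (suc u) zero pu pv = ⊥-elim (not-e pv (mem3-i (inj₁ refl)))
      off-triangle {x} w c h (suc u) (suc v) pu pv = C x s (c ∘ suc)
        (λ u v u₁ u₂ v₁ v₂ k → h _ _ (mk u₁ u₂) (mk v₁ v₂) (old-i k (ne w u₁ v₁) (ne' w u₁ v₁)))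
        u v (λ { refl → not-e pu (mem3-i (inj₂ (inj₁ refl))) }) (λ { refl → not-e pu (mem3-i (inj₂ (inj₂ refl))) })
            (λ { refl → not-e pv (mem3-i (inj₂ (inj₁ refl))) }) (λ { refl → not-e pv (mem3-i (inj₂ (inj₂ refl))) })
        where
        mk : ∀ {u} → u ≢ x → u ≢ s → T (not (mem3 zero (suc x) (suc s) (suc u)))
        mk a b = not-i λ k → [ (λ ()) , [ (λ { refl → a refl }) , (λ { refl → b refl }) ]′ ]′ (mem3-e k)
        ne : ∀ {u v} → p ≡ x ⊎ r ≡ x → u ≢ x → v ≢ x → ¬ (u ≡ p × v ≡ r)
        ne (inj₁ refl) a b (e , _) = a e
        ne (inj₂ refl) a b (_ , e) = b e
        ne' : ∀ {u v} → p ≡ x ⊎ r ≡ x → u ≢ x → v ≢ x → ¬ (u ≡ r × v ≡ p)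
        ne' (inj₁ refl) a b (_ , e) = b e
        ne' (inj₂ refl) a b (e , _) = a e

      rot-q : rt zero (suc r) ≡ suc p × rt zero (suc p) ≡ suc s
      rot-q = rot3 ro (deg3-swap (deg3-rot (deg3-rot deg-q))) qs-r

      J₁ : rt (suc r) zero ≡ suc s × rt (suc s) (suc r) ≡ zero
      J₁ = Jordan.face-of-triangle E {zero} {suc r} {suc s} (deg3-rot deg-q) deg-r (off-triangle (inj₂ refl)) qs-r
      J₂ : rt (suc s) zero ≡ suc p × rt (suc p) (suc s) ≡ zero
      J₂ = face-of-triangle⁻ E {zero} {suc p} {suc s} (deg3-swap deg-q) deg-p (off-triangle (inj₁ refl)) (proj₂ rot-q)

      rot-p : rt (suc p) zero ≡ suc p' × rt (suc p) (suc p') ≡ suc s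
      rot-p = rot3 ro (deg3-swap (deg3-rot deg-p)) (proj₂ J₂)
      rot-r : rt (suc r) (suc s) ≡ suc r' × rt (suc r) (suc r') ≡ zero
      rot-r = rot3 ro deg-r (proj₁ J₁)

    rt-sr : rt (suc s) (suc r) ≡ zero
    rt-sr = proj₂ J₁

    inner-r : lab (suc r) (suc s) ≡ zero
    inner-r = trans (turn rq (proj₁ J₁)) inner
    inner-s : lab (suc s) zero ≡ zero
    inner-s = trans (turn sr (proj₂ J₁)) inner-r

    private
      is-inner : ∀ {u v} → Adj S u v → lab u v ≡ zero →
        (u ≡ zero × v ≡ suc r) ⊎ (u ≡ suc r × v ≡ suc s) ⊎ (u ≡ suc s × v ≡ zero)
      is-inner k e = face3-darts E qr rs sq (proj₁ J₁) (proj₂ J₁) qs-r k (trans e (sym inner))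

      t₀ : Σ (Fin m) λ f → lab (suc p) zero ≡ suc f
      t₀ with lab (suc p) zero in e
      ... | suc f = f , refl
      ... | zero with is-inner {suc p} {zero} pq e
      ... | inj₁ (() , _)
      ... | inj₂ (inj₁ (_ , ()))
      ... | inj₂ (inj₂ (refl , _)) = ⊥-elim (s≢p refl)

    Tf : Fin m
    Tf = proj₁ t₀
    lab-pq : lab (suc p) zero ≡ suc Tf
    lab-pq = proj₂ t₀
    lab-qs : lab zero (suc s) ≡ suc Tf
    lab-qs = trans (turn {zero} {suc p} qp (proj₂ rot-q)) lab-pq
    lab-sp : lab (suc s) (suc p) ≡ suc Tf
    lab-sp = trans (turn {suc s} {zero} sq (proj₁ J₂)) lab-qs

    private
      is-T : ∀ {u v} → Adj S u v → lab u v ≡ suc Tf →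
        (u ≡ suc p × v ≡ zero) ⊎ (u ≡ zero × v ≡ suc s) ⊎ (u ≡ suc s × v ≡ suc p)
      is-T k e = face3-darts E pq qs sp (proj₂ rot-q) (proj₁ J₂) (proj₂ J₂) k (trans e (sym lab-pq))

      dz : Fin (suc m) → Fin m
      dz = dropZero Tf

    -- The path from `p` over the new vertex to `r` becomes an edge, whose darts inherit the labels
    -- of the first dart of the path and of its reverse.
    lab' : V H → V H → Fin m
    lab' x y = dz (if edgeIs p r x y then lab (suc x) zero else lab (suc x) (suc y))

    private

      lab'-o : ∀ {x y} → ¬ (x ≡ p × y ≡ r) → ¬ (x ≡ r × y ≡ p) → lab' x y ≡ dz (lab (suc x) (suc y))
      lab'-o {x} {y} a b with edgeIs p r x y in e
      ... | false = refl
      ... | true = ⊥-elim ([ a , b ]′ (edgeIs-e (subst T (sym e) tt)))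
      lab'-pr : lab' p r ≡ Tf
      lab'-pr rewrite T→≡ (edgeIs-i₁ p r) = cong dz lab-pq
      lab'-rp : lab' r p ≡ dz (lab (suc r) zero)
      lab'-rp rewrite T→≡ (edgeIs-i₂ p r) = refl
      lab'-rs : lab' r s ≡ Tf
      lab'-rs = trans (lab'-o (λ (e , _) → r≢p e) (λ (_ , e) → s≢p e)) (cong dz inner-r)

      nz : ∀ {u v} → Adj S u v → ¬ ((u ≡ zero × v ≡ suc r) ⊎ (u ≡ suc r × v ≡ suc s) ⊎ (u ≡ suc s × v ≡ zero)) →
        lab u v ≡ suc (dz (lab u v))
      nz k n = dropZero-suc (λ e → n (is-inner k e))

    lab-oo : ∀ {x y} → Adj S (suc x) (suc y) → ¬ (x ≡ r × y ≡ s) → lab (suc x) (suc y) ≡ suc (lab' x y)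
    lab-oo {x} {y} k ne = trans (nz k (λ { (inj₁ (() , _)) ; (inj₂ (inj₁ (refl , refl))) → ne (refl , refl) ; (inj₂ (inj₂ (_ , ()))) }))
      (cong suc (sym (lab'-o (proj₁ (proj₂ (old-e k))) (proj₂ (proj₂ (old-e k))))))

    lab-rq : lab (suc r) zero ≡ suc (lab' r p)
    lab-rq = trans (nz {suc r} {zero} rq (λ { (inj₁ (() , _)) ; (inj₂ (inj₁ (_ , ()))) ; (inj₂ (inj₂ (e , _))) → r≢s (fsuc-inj e) }))
      (cong suc (sym lab'-rp))
    lab-qp : lab zero (suc p) ≡ suc (lab' r p)
    lab-qp = trans (turn {zero} {suc r} qr (proj₁ rot-q)) lab-rq
    lab-ps : lab (suc p) (suc s) ≡ suc (lab' p s)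
    lab-ps = lab-oo ps (λ (e , _) → p≢r e)
    lab-sr : lab (suc s) (suc r) ≡ suc (lab' s r)
    lab-sr = lab-oo sr (λ (e , _) → s≢r e)
    lab-pp' : lab (suc p) (suc p') ≡ suc (lab' r p)
    lab-pp' = trans (turn {suc p} {zero} pq (proj₁ rot-p)) lab-qp
    lab-rr' : lab (suc r) (suc r') ≡ suc (lab' s r)
    lab-rr' = trans (turn rs (proj₁ rot-r)) lab-sr
    T≡ : lab' p r ≡ Tf
    T≡ = lab'-pr

    private
      pr₀ : V S → V H
      pr₀ zero    = p
      pr₀ (suc x) = x

      rt' : V H → V H → V H
      rt' x y = if x == p then (if y == r then p' else (if y == s then r else s)) else
        (if x == r then (if y == p then s else (if y == s then r' else p)) else
        (if x == s then (if y == r then p else pr₀ (rt (suc s) (suc y))) else pr₀ (rt (suc x) (suc y))))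

      rt'-p : ∀ y → rt' p y ≡ (if y == r then p' else (if y == s then r else s))
      rt'-p y = if-yes {x = p} refl
      rt'-r : ∀ y → rt' r y ≡ (if y == p then s else (if y == s then r' else p))
      rt'-r y = trans (if-no r≢p) (if-yes {x = r} refl)
      rt'-s : ∀ y → rt' s y ≡ (if y == r then p else pr₀ (rt (suc s) (suc y)))
      rt'-s y = trans (if-no s≢p) (trans (if-no s≢r) (if-yes {x = s} refl))
      pr-s : rt' p r ≡ p'
      pr-s = trans (rt'-p r) (if-yes {x = r} refl)
      ps-r : rt' p s ≡ r
      ps-r = trans (rt'-p s) (trans (if-no s≢r) (if-yes {x = s} refl))
      pp'-s : rt' p p' ≡ s
      pp'-s = trans (rt'-p p') (trans (if-no (P.x≢z ∘ sym)) (if-no (P.y≢z ∘ sym)))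
      rp-s : rt' r p ≡ s
      rp-s = trans (rt'-r p) (if-yes {x = p} refl)
      rs-r' : rt' r s ≡ r'
      rs-r' = trans (rt'-r s) (trans (if-no s≢p) (if-yes {x = s} refl))
      rr'-p : rt' r r' ≡ p
      rr'-p = trans (rt'-r r') (trans (if-no (R.x≢z ∘ sym)) (if-no (R.y≢z ∘ sym)))
      sr-p : rt' s r ≡ p
      sr-p = trans (rt'-s r) (if-yes {x = r} refl)
      rt'-so : ∀ {y} → y ≢ r → rt' s y ≡ pr₀ (rt (suc s) (suc y))
      rt'-so {y} ne = trans (rt'-s y) (if-no ne)
      rt'-oo : ∀ {x y} → x ≢ p → x ≢ r → x ≢ s → rt' x y ≡ pr₀ (rt (suc x) (suc y))
      rt'-oo a b c = trans (if-no a) (trans (if-no b) (if-no c))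

      nbr-s : ∀ {u} → Adj H s u → Adj S (suc s) (suc u)
      nbr-s a = old-i a (s≢p ∘ proj₁) (s≢r ∘ proj₁)

      suc-pr : ∀ {x : V S} → x ≢ zero → suc (pr₀ x) ≡ x
      suc-pr {zero} ne = ⊥-elim (ne refl)
      suc-pr {suc x} ne = refl

      s-nz : ∀ {u} → Adj H s u → u ≢ r → rt (suc s) (suc u) ≢ zero
      s-nz k ne e = ne (fsuc-inj (σ-inj ro (suc s) _ _ (nbr-s k) sr (trans e (sym (proj₂ J₁)))))

      data PRS : V H → Set where
        isp : PRS p
        isr : PRS r
        iss : PRS s
        oth : ∀ {x} → x ≢ p → x ≢ r → x ≢ s → PRS x
      prs : ∀ x → PRS x
      prs x with x ≟ p | x ≟ r | x ≟ s
      ... | yes refl | _ | _ = isp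
      ... | no _ | yes refl | _ = isr
      ... | no _ | no _ | yes refl = iss
      ... | no a | no b | no c = oth a b c

      no-q : ∀ {x} → x ≢ p → x ≢ r → x ≢ s → ∀ {u} → Adj S (suc x) u → u ≢ zero
      no-q a b c k refl = [ a , [ b , c ]′ ]′ (mem3-e k)

      LRs : ∀ v → LR (Adj H v) (rt' v)
      LRs v with prs v
      ... | isp = LR-deg3 (deg3-swap dp) pr-s pp'-s ps-r
      ... | isr = LR-deg3 dr rp-s rs-r' rr'-p
      ... | iss = LR-delete (rotAt ro (suc s)) suc (λ { zero → r ; (suc y) → y }) zero r p (λ _ → refl) refl
            (λ u → nbr-s) (λ u k → proj₁ (old-e k)) (Adj-sym H P.ay)
            (λ { zero _ → inj₁ refl ; (suc y) k → inj₂ (y , proj₁ (old-e k) , refl) })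
            (proj₂ J₁) (proj₁ J₂) sr-p (λ u k ne → sym (trans (cong suc (rt'-so ne)) (suc-pr (s-nz k ne))))
            (_≟ r) (Adj-sym H R.ay) (λ _ ())
      ... | oth a b c = LR-conj (rotAt ro (suc v)) pr₀ suc
            (λ { zero k → ⊥-elim (no-q a b c k refl) ; (suc u) k → proj₁ (old-e k) })
            (λ u k → old-i k (a ∘ proj₁) (b ∘ proj₁)) (λ u k → suc-pr (no-q a b c {u} k)) (λ _ _ → refl)
            (λ y _ → rt'-oo a b c)

      go : ∀ {u v w} → rt' v u ≡ w → lab' v w ≡ lab' u v → lab' v (rt' v u) ≡ lab' u v
      go {v = v} e h = trans (cong (lab' v) e) h

      lab'-old : ∀ {x y f} → Adj S (suc x) (suc y) → lab (suc x) (suc y) ≡ suc f → lab' x y ≡ f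
      lab'-old k e = trans (lab'-o (proj₁ (proj₂ (old-e k))) (proj₂ (proj₂ (old-e k)))) (cong dz e)

      same-lab : ∀ {x y z w} → Adj S (suc x) (suc y) → Adj S (suc z) (suc w) → lab (suc x) (suc y) ≡ lab (suc z) (suc w) →
        lab' x y ≡ lab' z w
      same-lab k l e = trans (lab'-o (proj₁ (proj₂ (old-e k))) (proj₂ (proj₂ (old-e k)))) (trans (cong dz e)
        (sym (lab'-o (proj₁ (proj₂ (old-e l))) (proj₂ (proj₂ (old-e l))))))

      step' : ∀ u v → Adj H u v → lab' v (rt' v u) ≡ lab' u v
      step' u v k with prs v
      ... | isp with P.all u (Adj-sym H k)
      ... | inj₁ refl = go pr-s (lab'-old pp' lab-pp')
      ... | inj₂ (inj₁ refl) = go ps-r (trans lab'-pr (sym (lab'-old sp lab-sp)))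
      ... | inj₂ (inj₂ refl) = go pp'-s (same-lab ps (Adj-sym S {suc p} {suc p'} pp') (turn pp' (proj₂ rot-p)))
      step' u v k | isr with R.all u (Adj-sym H k)
      ... | inj₁ refl = go rp-s (trans lab'-rs (sym lab'-pr))
      ... | inj₂ (inj₁ refl) = go rs-r' (lab'-old rr' lab-rr')
      ... | inj₂ (inj₂ refl) = go rr'-p (trans lab'-rp (trans (cong dz (turn rr' (proj₂ rot-r)))
              (sym (lab'-o (proj₁ (proj₂ (old-e r'r))) (proj₂ (proj₂ (old-e r'r)))))))
        where r'r = Adj-sym S {suc r} {suc r'} rr'
      step' u v k | iss with same? u r
      ... | inj₁ refl = go sr-p (trans (lab'-old sp lab-sp) (sym lab'-rs))
      ... | inj₂ ne = go (rt'-so ne) (same-lab {s} {_} {u} {s}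
              (subst (Adj S (suc s)) (sym e) (σ-adj ro (suc s) (suc u) su)) us
              (trans (cong (lab (suc s)) e) (lab-step (suc u) (suc s) us)))
        where
        su = nbr-s (Adj-sym H k)
        us = Adj-sym S {suc s} {suc u} su
        e = suc-pr (s-nz (Adj-sym H k) ne)
      step' u v k | oth a b c = go {u} {v} (rt'-oo a b c) (same-lab {v} {_} {u} {v} (subst (Adj S (suc v)) (sym e) vw) uv
              (trans (cong (lab (suc v)) e) (lab-step (suc u) (suc v) uv)))
        where
        vu : Adj S (suc v) (suc u)
        vu = old-i (Adj-sym H k) (a ∘ proj₁) (b ∘ proj₁)
        uv = Adj-sym S {suc v} {suc u} vu
        vw = σ-adj ro (suc v) (suc u) vu
        e = suc-pr (no-q a b c {rt (suc v) (suc u)} vw)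

      conn' : ColConn H
      conn' c h u v _ _ = conn c° ed (suc u) (suc v) tt tt
        where
        c° : V S → Bool
        c° zero = c p
        c° (suc x) = c x
        spoke : ∀ x → Adj S zero (suc x) → c p ≡ c x
        spoke x k with mem3-e k
        ... | inj₁ refl = refl
        ... | inj₂ (inj₁ refl) = h _ _ tt tt P.ax
        ... | inj₂ (inj₂ refl) = h _ _ tt tt P.ay
        ed : ∀ x y → T true → T true → Adj S x y → c° x ≡ c° y
        ed zero zero _ _ ()
        ed zero (suc y) _ _ k = spoke y k
        ed (suc x) zero _ _ k = sym (spoke x k)
        ed (suc x) (suc y) _ _ k = h _ _ tt tt (proj₁ (old-e k))

    T≢Y : Tf ≢ lab' s r
    T≢Y e with is-T sr (trans lab-sr (cong suc (sym e)))
    ... | inj₁ (_ , ())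
    ... | inj₂ (inj₁ (() , _))
    ... | inj₂ (inj₂ (_ , q)) = r≢p (fsuc-inj q)

    B≢Y : lab' r p ≢ lab' s r
    B≢Y e = loopless rr' (trans lab-rr' (trans (cong suc (sym e)) (trans (sym lab-rq) (turn rr' (proj₂ rot-r)))))

    -- The edge between `T` and `Y` is put back: the merged face borders on `Y` across `r s`, where
    -- the face `zero` did before.
    G' : Graph
    G' = record
      { n = m ; adj = λ f g → A (suc f) (suc g) ∨ edgeIs Tf (lab' s r) f g
      ; adj-sym = λ f g → cong₂ _∨_ (sy (suc f) (suc g)) (edgeIs-sym Tf (lab' s r) f g)
      ; adj-irr = λ f → trans (cong (_∨ edgeIs Tf (lab' s r) f f) (irr (suc f)))
          (¬T→≡ λ h → [ (λ (e , e') → T≢Y (trans (sym e) e')) , (λ (e , e') → T≢Y (trans (sym e') e)) ]′ (edgeIs-e h)) }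

    private
      Wit : Fin m → Fin m → Set
      Wit f g = ∃₂ λ u v → Adj H u v × lab' u v ≡ f × lab' v u ≡ g

      ¬zs : ∀ {x : Fin (suc m)} {f : Fin m} → x ≡ zero → x ≡ suc f → ⊥
      ¬zs refl ()

      surj' : ∀ f → ∃₂ λ u v → Adj H u v × lab' u v ≡ f
      surj' f with lab-surj (suc f)
      ... | suc u , suc v , k , e = u , v , proj₁ (old-e k) , lab'-old k e
      ... | zero , suc v , k , e with mem3-e k
      ... | inj₁ refl = r , p , R.ax , fsuc-inj (trans (sym lab-qp) e)
      ... | inj₂ (inj₁ refl) = ⊥-elim (¬zs inner e)
      ... | inj₂ (inj₂ refl) = p , r , P.ax , trans lab'-pr (fsuc-inj (trans (sym lab-qs) e))
      surj' f | suc u , zero , k , e with mem3-e k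
      ... | inj₁ refl = p , r , P.ax , trans lab'-pr (fsuc-inj (trans (sym lab-pq) e))
      ... | inj₂ (inj₁ refl) = r , p , R.ax , fsuc-inj (trans (sym lab-rq) e)
      ... | inj₂ (inj₂ refl) = ⊥-elim (¬zs inner-s e)

      dual'→ : ∀ f g → Adj G' f g → Wit f g
      dual'→ f g h with ∨-e {A (suc f) (suc g)} h
      ... | inj₂ h' with edgeIs-e h'
      ... | inj₁ (refl , refl) = r , s , R.ay , lab'-rs , refl
      ... | inj₂ (refl , refl) = s , r , Adj-sym H R.ay , refl , lab'-rs
      dual'→ f g h | inj₁ h' with dual→ (suc f) (suc g) h'
      ... | suc u , suc v , k , e , e' = u , v , proj₁ (old-e k) , lab'-old k e , lab'-old (Adj-sym S {suc u} {suc v} k) e'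
      ... | zero , suc v , k , e , e' with mem3-e k
      ... | inj₁ refl = r , p , R.ax , fsuc-inj (trans (sym lab-qp) e) , trans lab'-pr (fsuc-inj (trans (sym lab-pq) e'))
      ... | inj₂ (inj₁ refl) = ⊥-elim (¬zs inner e)
      ... | inj₂ (inj₂ refl) = ⊥-elim (¬zs inner-s e')
      dual'→ f g h | inj₁ h' | suc u , zero , k , e , e' with mem3-e k
      ... | inj₁ refl = p , r , P.ax , trans lab'-pr (fsuc-inj (trans (sym lab-pq) e)) , fsuc-inj (trans (sym lab-qp) e')
      ... | inj₂ (inj₁ refl) = ⊥-elim (¬zs inner e')
      ... | inj₂ (inj₂ refl) = ⊥-elim (¬zs inner-s e)

      adjA : ∀ {f g f' g'} → f ≡ suc f' → g ≡ suc g' → T (A f g) → T (A (suc f') (suc g'))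
      adjA refl refl h = h

      dual'← : ∀ u v → Adj H u v → Adj G' (lab' u v) (lab' v u)
      dual'← u v k with T? (edgeIs p r u v)
      ... | yes e with edgeIs-e e
      ... | inj₁ (refl , refl) = ∨-l (adjA (trans lab-pq (cong suc (sym lab'-pr))) lab-qp (dual← (suc p) zero pq))
      ... | inj₂ (refl , refl) = ∨-l (adjA lab-qp (trans lab-pq (cong suc (sym lab'-pr))) (dual← zero (suc p) qp))
      dual'← u v k | no ne with T? (edgeIs r s u v)
      ... | yes e with edgeIs-e e
      ... | inj₁ (refl , refl) = ∨-r {A (suc (lab' r s)) (suc (lab' s r))}
              (subst (λ z → T (edgeIs Tf (lab' s r) z (lab' s r))) (sym lab'-rs) (edgeIs-i₁ Tf (lab' s r)))
      ... | inj₂ (refl , refl) = ∨-r {A (suc (lab' s r)) (suc (lab' r s))}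
              (subst (λ z → T (edgeIs Tf (lab' s r) (lab' s r) z)) (sym lab'-rs) (edgeIs-i₂ Tf (lab' s r)))
      dual'← u v k | no ne | no ne' = ∨-l (adjA (lab-oo k' (λ { (refl , refl) → ne' (edgeIs-i₁ r s) }))
              (lab-oo (Adj-sym S {suc u} {suc v} k') (λ { (refl , refl) → ne' (edgeIs-i₂ r s) })) (dual← (suc u) (suc v) k'))
        where
        k' : Adj S (suc u) (suc v)
        k' = old-i k (λ { (refl , refl) → ne (edgeIs-i₁ p r) }) (λ { (refl , refl) → ne (edgeIs-i₂ p r) })

    down : LE H G'
    down = record
      { ro = mkRot H rt' LRs ; lab = lab' ; lab-step = step' ; lab-surj = surj' ; conn = conn'
      ; eul = +-cancelʳ-≡ 4 _ _ (trans
          (solve 2 (λ x y → con 2 :* x :+ con 2 :* y :+ con 4 := con 2 :* (con 1 :+ x) :+ con 2 :* (con 1 :+ y)) refl (n H) m)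
          (trans eul (cong (_+ 4) (dartCount-sub H p≢r r≢s p≢s P.ax))))
      ; dual→ = dual'→ ; dual← = dual'← }
      where open +-*-Solver

    tri : TriangleAt down p r s
    tri = mkTri rp-s sr-p ps-r

    -- If `X` and `Y` coincided, `T` and `Y` would already be adjacent in `G`, across `p s`, and
    -- deleting their edge from `G'` would not give back `G`.
    module _ (X≢Y : lab' p s ≢ lab' s r) where
      split : Iso G (sub G' Tf (lab' s r) (lab' r p))
      split = record { to = id ; from = id ; tofrom = λ _ → refl ; fromto = λ _ → refl ; adj-to = ad }
        where
        Z = sub G' Tf (lab' s r) (lab' r p)
        spoke : ∀ f → mem3 Tf (lab' s r) (lab' r p) f ≡ A zero (suc f)
        spoke f = T-ext fw bw
          where
          fw : T (mem3 Tf (lab' s r) (lab' r p) f) → T (A zero (suc f))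
          fw h with mem3-e h
          ... | inj₁ refl = subst₂ (λ x y → T (A x y)) inner-s lab-qs (dual← (suc s) zero sq)
          ... | inj₂ (inj₁ refl) = subst₂ (λ x y → T (A x y)) inner-r lab-sr (dual← (suc r) (suc s) rs)
          ... | inj₂ (inj₂ refl) = subst₂ (λ x y → T (A x y)) inner lab-rq (dual← zero (suc r) qr)
          bw : T (A zero (suc f)) → T (mem3 Tf (lab' s r) (lab' r p) f)
          bw h with dual→ zero (suc f) h
          ... | u , v , k , e , e' with is-inner k e
          ... | inj₁ (refl , refl) = mem3-i (inj₂ (inj₂ (fsuc-inj (trans (sym e') lab-rq))))
          ... | inj₂ (inj₁ (refl , refl)) = mem3-i (inj₂ (inj₁ (fsuc-inj (trans (sym e') lab-sr))))
          ... | inj₂ (inj₂ (refl , refl)) = mem3-i (inj₁ (fsuc-inj (trans (sym e') lab-qs)))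
        ¬TY : ¬ T (A (suc Tf) (suc (lab' s r)))
        ¬TY h with dual→ (suc Tf) (suc (lab' s r)) h
        ... | u , v , k , e , e' with is-T k e
        ... | inj₁ (refl , refl) = B≢Y (fsuc-inj (trans (sym lab-qp) e'))
        ... | inj₂ (inj₁ (refl , refl)) = ¬zs inner-s e'
        ... | inj₂ (inj₂ (refl , refl)) = X≢Y (fsuc-inj (trans (sym lab-ps) e'))
        oo : ∀ f g → delEdge (adj G') Tf (lab' s r) f g ≡ A (suc f) (suc g)
        oo f g = T-ext fw bw
          where
          fw : T (delEdge (adj G') Tf (lab' s r) f g) → T (A (suc f) (suc g))
          fw h with delEdge-e (adj G') h
          ... | h' , n₁ , n₂ with ∨-e {A (suc f) (suc g)} h'
          ... | inj₁ x = x
          ... | inj₂ x = ⊥-elim ([ n₁ , n₂ ]′ (edgeIs-e x))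
          bw : T (A (suc f) (suc g)) → T (delEdge (adj G') Tf (lab' s r) f g)
          bw h = delEdge-i (adj G') (∨-l h) (λ { (refl , refl) → ¬TY h })
            (λ { (refl , refl) → ¬TY (subst T (sy (suc (lab' s r)) (suc Tf)) h) })
        ad : ∀ x y → adj Z x y ≡ A x y
        ad zero zero = sym (irr zero)
        ad zero (suc y) = spoke y
        ad (suc x) zero = trans (spoke x) (sy zero (suc x))
        ad (suc x) (suc y) = oo x y

-- Wheels

sub-iso : ∀ {G G'} (I : Iso G G') {x y z x' y' z'} → Iso.to I x ≡ x' → Iso.to I y ≡ y' → Iso.to I z ≡ z' →
  Iso (sub G x y z) (sub G' x' y' z')
sub-iso {G} {G'} I ex ey ez = record
  { to = to° ; from = from° ; tofrom = λ { zero → refl ; (suc u) → cong suc (tofrom u) }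
  ; fromto = λ { zero → refl ; (suc u) → cong suc (fromto u) } ; adj-to = ad ex ey ez }
  where
  open Iso I
  to° : Fin (suc (n G)) → Fin (suc (n G'))
  to° zero    = zero
  to° (suc u) = suc (to u)
  from° : Fin (suc (n G')) → Fin (suc (n G))
  from° zero    = zero
  from° (suc u) = suc (from u)
  spoke : ∀ {x y z} u → mem3 (to x) (to y) (to z) (to u) ≡ mem3 x y z u
  spoke u = T-ext (λ h → mem3-i ([ inj₁ ∘ to-inj , [ inj₂ ∘ inj₁ ∘ to-inj , inj₂ ∘ inj₂ ∘ to-inj ]′ ]′ (mem3-e h)))
    (λ h → mem3-i ([ inj₁ ∘ cong to , [ inj₂ ∘ inj₁ ∘ cong to , inj₂ ∘ inj₂ ∘ cong to ]′ ]′ (mem3-e h)))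
  ad : ∀ {x y z x' y' z'} → to x ≡ x' → to y ≡ y' → to z ≡ z' → ∀ u v →
    adj (sub G' x' y' z') (to° u) (to° v) ≡ adj (sub G x y z) u v
  ad refl refl refl zero zero = refl
  ad refl refl refl zero (suc v) = spoke v
  ad refl refl refl (suc u) zero = spoke u
  ad refl refl refl (suc u) (suc v) = T-ext
    (λ h → let a , n₁ , n₂ = delEdge-e (adj G') h in delEdge-i (adj G) (subst T (adj-to u v) a)
       (λ { (refl , refl) → n₁ (refl , refl) }) (λ { (refl , refl) → n₂ (refl , refl) }))
    (λ h → let a , n₁ , n₂ = delEdge-e (adj G) h in delEdge-i (adj G') (subst T (sym (adj-to u v)) a)
       (λ (e , e') → n₁ (to-inj e , to-inj e')) (λ (e , e') → n₂ (to-inj e , to-inj e')))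

next : ∀ {m} → Fin (suc m) → Fin (suc m)
next i with view i
... | ‵fromℕ     = zero
... | ‵inject₁ j = suc j

prev : ∀ {m} → Fin (suc m) → Fin (suc m)
prev zero    = fromℕ _
prev (suc j) = inject₁ j

next-last : ∀ m → next (fromℕ m) ≡ zero
next-last m rewrite view-fromℕ m = refl

next-inject₁ : ∀ {m} (j : Fin m) → next (inject₁ j) ≡ suc j
next-inject₁ j rewrite view-inject₁ j = refl

next-prev : ∀ {m} (i : Fin (suc m)) → next (prev i) ≡ i
next-prev zero    = next-last _
next-prev (suc j) = next-inject₁ j

prev-next : ∀ {m} (i : Fin (suc m)) → prev (next i) ≡ i
prev-next i with view i
... | ‵fromℕ     = refl
... | ‵inject₁ j = refl

Rim : ∀ {m} → Fin (suc m) → Fin (suc m) → Set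
Rim i j = next i ≡ j ⊎ next j ≡ i

rimStep-e : ∀ {m} (i j : Fin (suc m)) → T (rimStep (suc m) (toℕ i) (toℕ j)) → Rim i j
rimStep-e {m} i j h with ∨-e {suc (toℕ i) ≡ᵇ toℕ j} h
... | inj₁ k with view i
... | ‵fromℕ = ⊥-elim (<-irrefl (trans (sym (≡ᵇ⇒≡ (suc (toℕ (fromℕ m))) (toℕ j) k)) (cong suc (toℕ-fromℕ m))) (toℕ<n j))
... | ‵inject₁ i' = inj₁ (toℕ-injective (trans (cong suc (sym (toℕ-inject₁ i'))) (≡ᵇ⇒≡ _ (toℕ j) k)))
rimStep-e {m} zero j h | inj₂ k = inj₂ (subst (λ z → next z ≡ zero) (sym (toℕ-injective (trans (suc-injective (≡ᵇ⇒≡ (suc (toℕ j)) _ k)) (sym (toℕ-fromℕ m))))) (next-last m))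

wheel-e : ∀ k i j → Adj (Wheel k) (suc i) (suc j) → Rim i j
wheel-e k i j h with ∨-e {rimStep (3 + k) (toℕ i) (toℕ j)} h
... | inj₁ x = rimStep-e i j x
... | inj₂ x = [ inj₂ , inj₁ ]′ (rimStep-e j i x)

wheel-i : ∀ k i j → Rim i j → Adj (Wheel k) (suc i) (suc j)
wheel-i k i j (inj₁ e) = lem i j e
  where
  lem : ∀ i j → next i ≡ j → Adj (Wheel k) (suc i) (suc j)
  lem i j e with view i
  lem i j refl | ‵fromℕ = ∨-r {rimStep (3 + k) (toℕ (fromℕ (2 + k))) 0} (∨-r {1 ≡ᵇ toℕ (fromℕ (2 + k))}
    (≡⇒≡ᵇ (suc (toℕ (fromℕ (2 + k)))) (3 + k) (cong suc (toℕ-fromℕ (2 + k)))))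
  lem i j refl | ‵inject₁ i' = ∨-l (∨-l (≡⇒≡ᵇ (suc (toℕ (inject₁ i'))) (suc (toℕ i')) (cong suc (toℕ-inject₁ i'))))
wheel-i k i j (inj₂ e) = Adj-sym (Wheel k) {suc j} {suc i} (wheel-i k j i (inj₁ e))

rimIso : ∀ k (ρ ρ⁻ : Fin (3 + k) → Fin (3 + k)) → (∀ i → ρ (ρ⁻ i) ≡ i) → (∀ i → ρ⁻ (ρ i) ≡ i) →
  (∀ i j → Rim i j → Rim (ρ i) (ρ j)) → (∀ i j → Rim i j → Rim (ρ⁻ i) (ρ⁻ j)) → Iso (Wheel k) (Wheel k)
rimIso k ρ ρ⁻ e e⁻ h h⁻ = record
  { to = lift ρ ; from = lift ρ⁻ ; tofrom = λ { zero → refl ; (suc i) → cong suc (e i) }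
  ; fromto = λ { zero → refl ; (suc i) → cong suc (e⁻ i) } ; adj-to = ad }
  where
  lift : (Fin (3 + k) → Fin (3 + k)) → V (Wheel k) → V (Wheel k)
  lift f zero    = zero
  lift f (suc i) = suc (f i)
  ad : ∀ u v → adj (Wheel k) (lift ρ u) (lift ρ v) ≡ adj (Wheel k) u v
  ad zero zero = refl
  ad zero (suc j) = refl
  ad (suc i) zero = refl
  ad (suc i) (suc j) = T-ext
    (λ x → wheel-i k i j (subst₂ Rim (e⁻ i) (e⁻ j) (h⁻ _ _ (wheel-e k (ρ i) (ρ j) x))))
    (λ x → wheel-i k (ρ i) (ρ j) (h i j (wheel-e k i j x)))

rotate : ∀ k → Iso (Wheel k) (Wheel k)
rotate k = rimIso k next prev next-prev prev-next (λ { i j (inj₁ e) → inj₁ (cong next e) ; i j (inj₂ e) → inj₂ (cong next e) })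
  (λ { i j (inj₁ e) → inj₁ (lem e) ; i j (inj₂ e) → inj₂ (lem e) })
  where
  lem : ∀ {m} {i j : Fin (suc m)} → next i ≡ j → next (prev i) ≡ prev j
  lem {i = i} refl = trans (next-prev i) (sym (prev-next i))

opposite-inject₁ : ∀ {m} (i : Fin m) → opposite (inject₁ i) ≡ suc (opposite i)
opposite-inject₁ {suc m} zero    = refl
opposite-inject₁ {suc m} (suc i) = cong inject₁ (opposite-inject₁ i)

opposite-last : ∀ m → opposite (fromℕ m) ≡ zero
opposite-last zero    = refl
opposite-last (suc m) = cong inject₁ (opposite-last m)

opposite-next : ∀ {m} (i : Fin (suc m)) → next (opposite (next i)) ≡ opposite i
opposite-next {m} i with view i
... | ‵fromℕ     = trans (next-last m) (sym (opposite-last m))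
... | ‵inject₁ j = trans (next-inject₁ (opposite j)) (sym (opposite-inject₁ j))

reflect : ∀ k → Iso (Wheel k) (Wheel k)
reflect k = rimIso k opposite opposite opposite-involutive opposite-involutive h h
  where
  h : ∀ i j → Rim i j → Rim (opposite i) (opposite j)
  h i j (inj₁ refl) = inj₂ (opposite-next i)
  h i j (inj₂ refl) = inj₁ (opposite-next j)

rotate-to : ∀ k m (i : Fin (3 + k)) → toℕ i ≡ m →
  Σ (Iso (Wheel k) (Wheel k)) λ I → Iso.to I zero ≡ zero × Iso.to I (suc zero) ≡ suc i × Iso.to I (suc (suc zero)) ≡ suc (next i)
rotate-to k zero zero e = iso-refl , refl , refl , cong suc (sym (next-inject₁ zero))
rotate-to k (suc m) (suc j) e with rotate-to k m (inject₁ j) (trans (toℕ-inject₁ j) (suc-injective e))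
... | I , e₀ , e₁ , e₂ = iso-trans I (rotate k) , cong (Iso.to (rotate k)) e₀ ,
  trans (cong (Iso.to (rotate k)) e₁) (cong suc (next-inject₁ j)) ,
  trans (cong (Iso.to (rotate k)) e₂) (cong (λ z → suc (next z)) (next-inject₁ j))

-- A triangle in standard position: the hub and the first two rim vertices.
Std : ∀ k (x y z : V (Wheel k)) → Set
Std k x y z = Σ (Iso (Wheel k) (Wheel k)) λ I → Iso.to I x ≡ zero × Iso.to I y ≡ suc zero × Iso.to I z ≡ suc (suc zero)

std-next : ∀ k i j → next i ≡ j → Std k zero (suc i) (suc j)
std-next k i j refl with rotate-to k (toℕ i) i refl
... | I , e₀ , e₁ , e₂ = iso-sym I , back e₀ , back e₁ , back e₂
  where
  back : ∀ {x y} → Iso.to I x ≡ y → Iso.from I y ≡ x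
  back refl = Iso.fromto I _

std-hub : ∀ k i j → Rim i j → Std k zero (suc i) (suc j)
std-hub k i j (inj₁ e) = std-next k i j e
std-hub k i j (inj₂ refl) with std-next k (opposite (next j)) (opposite j) (opposite-next j)
... | I , e₀ , e₁ , e₂ = iso-trans (reflect k) I , e₀ , e₁ , e₂

Triangle : (G : Graph) → V G → V G → V G → Set
Triangle G x y z = Adj G x y × Adj G y z × Adj G z x

W0-complete : ∀ u v → u ≢ v → Adj (Wheel 0) u v
W0-complete u v n = toWitness {a? = all? λ u → all? λ v → ¬? (u ≟ v) →-dec T? (adj (Wheel 0) u v)} _ u v n

rim3 : ∀ (i j : Fin 3) → i ≢ j → Rim i j
rim3 i j n = wheel-e 0 i j (W0-complete (suc i) (suc j) (suc≢ n))

exchangeIso : V (Wheel 0) → Iso (Wheel 0) (Wheel 0)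
exchangeIso x = record { to = exchange x ; from = exchange x ; tofrom = exchange² x ; fromto = exchange² x
  ; adj-to = λ u v → T-ext
      (λ h → W0-complete u v λ e → adj≢ (Wheel 0) {exchange x u} {exchange x v} h (cong (exchange x) e))
      (λ h → W0-complete (exchange x u) (exchange x v) λ e →
        adj≢ (Wheel 0) {u} {v} h (trans (sym (exchange² x u)) (trans (cong (exchange x) e) (exchange² x v)))) }

std-W0 : ∀ x y z → x ≢ y → y ≢ z → x ≢ z → Std 0 x y z
std-W0 x y z n₁ n₂ n₃ = go (exchange x y) (exchange x z) refl refl
  where
  X = exchangeIso x
  x0 : exchange x x ≡ zero
  x0 = if-yes {x = x} refl
  go : ∀ y' z' → exchange x y ≡ y' → exchange x z ≡ z' → Std 0 x y z
  go zero _ e _ = ⊥-elim (n₁ (Iso.to-inj X (trans x0 (sym e))))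
  go (suc _) zero _ e = ⊥-elim (n₃ (Iso.to-inj X (trans x0 (sym e))))
  go (suc i) (suc j) e e' with std-hub 0 i j (rim3 i j λ q → n₂ (Iso.to-inj X (trans e (trans (cong suc q) (sym e')))))
  ... | I , e₀ , e₁ , e₂ = iso-trans X I , trans (cong (Iso.to I) x0) e₀ , trans (cong (Iso.to I) e) e₁ , trans (cong (Iso.to I) e') e₂

next-inj : ∀ {m} {i j : Fin (suc m)} → next i ≡ next j → i ≡ j
next-inj {i = i} {j} e = trans (sym (prev-next i)) (trans (cong prev e) (prev-next j))

-- Cancelling one step of `next` lowers the index by one. At index `zero` three steps lead to the
-- fourth rim vertex, which exists since the rim has length at least four.
next³≢ : ∀ k (i : Fin (4 + k)) → next (next (next i)) ≢ i
next³≢ k i e = lem (toℕ i) i refl e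
  where
  lem : ∀ m (i : Fin (4 + k)) → toℕ i ≡ m → next (next (next i)) ≡ i → ⊥
  lem zero zero _ e with () ← trans (sym (trans (cong (next ∘ next) (next-inject₁ zero)) (trans (cong next (next-inject₁ (suc zero))) (next-inject₁ (suc (suc zero)))))) e
  lem (suc m) (suc j) q e = lem m (inject₁ j) (trans (toℕ-inject₁ j) (suc-injective q))
    (next-inj (trans (cong (next ∘ next ∘ next) (next-inject₁ j)) (trans e (sym (next-inject₁ j)))))

-- Three steps in one direction do not close up; if the directions disagree, two of the three
-- vertices coincide.
no-rim-triangle : ∀ k (i j l : Fin (4 + k)) → i ≢ j → j ≢ l → l ≢ i → Rim i j → Rim j l → Rim l i → ⊥
no-rim-triangle k i j l n₁ n₂ n₃ (inj₁ a) (inj₁ b) (inj₁ c) = next³≢ k i (trans (cong (next ∘ next) a) (trans (cong next b) c))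
no-rim-triangle k i j l n₁ n₂ n₃ (inj₂ a) (inj₂ b) (inj₂ c) = next³≢ k i (trans (cong (next ∘ next) c) (trans (cong next b) a))
no-rim-triangle k i j l n₁ n₂ n₃ (inj₁ a) (inj₁ b) (inj₂ c) = n₂ (trans (sym a) c)
no-rim-triangle k i j l n₁ n₂ n₃ (inj₁ a) (inj₂ b) (inj₁ c) = n₁ (trans (sym c) b)
no-rim-triangle k i j l n₁ n₂ n₃ (inj₂ a) (inj₁ b) (inj₁ c) = n₃ (trans (sym b) a)
no-rim-triangle k i j l n₁ n₂ n₃ (inj₁ a) (inj₂ b) (inj₂ c) = n₃ (sym (next-inj (trans a (sym b))))
no-rim-triangle k i j l n₁ n₂ n₃ (inj₂ a) (inj₁ b) (inj₂ c) = n₁ (next-inj (trans c (sym b)))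
no-rim-triangle k i j l n₁ n₂ n₃ (inj₂ a) (inj₂ b) (inj₁ c) = n₂ (next-inj (trans a (sym c)))

data HasHub {k} : (x y z : V (Wheel (suc k))) → Set where
  hub₁ : ∀ {i j} → Rim i j → HasHub zero (suc i) (suc j)
  hub₂ : ∀ {i j} → Rim i j → HasHub (suc i) zero (suc j)
  hub₃ : ∀ {i j} → Rim i j → HasHub (suc i) (suc j) zero

hasHub : ∀ k {x y z} → Triangle (Wheel (suc k)) x y z → HasHub {k} x y z
hasHub k {zero} {suc i} {suc j} (_ , h , _) = hub₁ (wheel-e (suc k) i j h)
hasHub k {suc i} {zero} {suc j} (_ , _ , h) = hub₂ (wheel-e (suc k) i j (Adj-sym (Wheel (suc k)) {suc j} {suc i} h))
hasHub k {suc i} {suc j} {zero} (h , _) = hub₃ (wheel-e (suc k) i j h)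
hasHub k {zero} {zero} (() , _)
hasHub k {zero} {suc i} {zero} (_ , _ , ())
hasHub k {suc i} {zero} {zero} (_ , () , _)
hasHub k {suc i} {suc j} {suc l} (a , b , c) = ⊥-elim (no-rim-triangle k i j l (ne a) (ne b) (ne c)
    (wheel-e (suc k) i j a) (wheel-e (suc k) j l b) (wheel-e (suc k) l i c))
  where
  ne : ∀ {i j} → Adj (Wheel (suc k)) (suc i) (suc j) → i ≢ j
  ne {i} {j} h e = adj≢ (Wheel (suc k)) {suc i} {suc j} h (cong suc e)

std-triangle : ∀ k x y z → Triangle (Wheel k) x y z → Std k x y z ⊎ Std k y z x ⊎ Std k z x y
std-triangle zero x y z (a , b , c) =
  inj₁ (std-W0 x y z (adj≢ (Wheel 0) {x} a) (adj≢ (Wheel 0) {y} b) (λ e → adj≢ (Wheel 0) {z} c (sym e)))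
std-triangle (suc k) x y z t with hasHub k {x} {y} {z} t
... | hub₁ r = inj₁ (std-hub (suc k) _ _ r)
... | hub₂ r = inj₂ (inj₁ (std-hub (suc k) _ _ ([ inj₂ , inj₁ ]′ r)))
... | hub₃ r = inj₂ (inj₂ (std-hub (suc k) _ _ r))

lastRim : ∀ k → V (Wheel k)
lastRim k = suc (fromℕ (2 + k))

inject₁-inj : ∀ {m} {i j : Fin m} → inject₁ i ≡ inject₁ j → i ≡ j
inject₁-inj {i = i} {j} e = toℕ-injective (trans (sym (toℕ-inject₁ i)) (trans (cong toℕ e) (toℕ-inject₁ j)))

suc≡inject₁ : ∀ {m} (i j : Fin (suc m)) → suc i ≡ inject₁ j → next i ≡ j × i ≢ fromℕ m
suc≡inject₁ {m} i j e with view i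
... | ‵fromℕ = ⊥-elim (<-irrefl (trans (sym (toℕ-inject₁ j)) (trans (cong toℕ (sym e)) (cong suc (toℕ-fromℕ m)))) (toℕ<n j))
... | ‵inject₁ i' = inject₁-inj e , λ q → <-irrefl (trans (sym (toℕ-inject₁ i')) (trans (cong toℕ q) (toℕ-fromℕ m))) (toℕ<n i')

inject₁≡suc : ∀ {m} (i j : Fin (suc m)) → next i ≡ j → i ≢ fromℕ m → suc i ≡ inject₁ j
inject₁≡suc i j e ne with view i
... | ‵fromℕ = ⊥-elim (ne refl)
... | ‵inject₁ i' = cong inject₁ e

-- The closing edge of the rim is the one to be split. The new vertex then becomes the last on the
-- longer rim, and the indices of the old rim vertices stay as they are.
wheel-suc : ∀ k → Iso (sub (Wheel k) (lastRim k) (suc zero) zero) (Wheel (suc k))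
wheel-suc k = record { to = to ; from = from ; tofrom = tf ; fromto = ft ; adj-to = ad }
  where
  W = Wheel k
  W⁺ = Wheel (suc k)
  S = sub W (lastRim k) (suc zero) zero
  to : V S → V W⁺
  to zero          = lastRim (suc k)
  to (suc zero)    = zero
  to (suc (suc i)) = suc (inject₁ i)
  rim : Fin (4 + k) → V S
  rim i with view i
  ... | ‵fromℕ     = zero
  ... | ‵inject₁ j = suc (suc j)
  from : V W⁺ → V S
  from zero    = suc zero
  from (suc i) = rim i
  tf : ∀ x → to (from x) ≡ x
  tf zero = refl
  tf (suc i) with view i
  ... | ‵fromℕ     = refl
  ... | ‵inject₁ j = refl
  ft : ∀ x → from (to x) ≡ x
  ft zero rewrite view-fromℕ (3 + k) = refl
  ft (suc zero) = refl
  ft (suc (suc i)) rewrite view-inject₁ i = refl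
  A≡ : V S → V S → Set
  A≡ x y = adj W⁺ (to x) (to y) ≡ adj S x y
  flip : ∀ x y → A≡ x y → A≡ y x
  flip x y e = trans (adj-sym W⁺ (to y) (to x)) (trans e (adj-sym S x y))
  new-rim : ∀ i → A≡ zero (suc (suc i))
  new-rim i = T-ext fw bw
    where
    fw : Adj W⁺ (lastRim (suc k)) (suc (inject₁ i)) → Adj S zero (suc (suc i))
    fw h with wheel-e (suc k) (fromℕ (3 + k)) (inject₁ i) h
    ... | inj₁ e = mem3-i (inj₂ (inj₁ (cong suc (inject₁-inj (trans (sym e) (next-last (3 + k)))))))
    ... | inj₂ e = mem3-i (inj₁ (cong suc (fsuc-inj (trans (sym (next-inject₁ i)) e))))
    bw : Adj S zero (suc (suc i)) → Adj W⁺ (lastRim (suc k)) (suc (inject₁ i))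
    bw h with mem3-e h
    ... | inj₁ refl = wheel-i (suc k) (fromℕ (3 + k)) (inject₁ (fromℕ (2 + k))) (inj₂ (next-inject₁ (fromℕ (2 + k))))
    ... | inj₂ (inj₁ refl) = wheel-i (suc k) (fromℕ (3 + k)) zero (inj₁ (next-last (3 + k)))
    ... | inj₂ (inj₂ ())
  hub-rim : ∀ i → A≡ (suc zero) (suc (suc i))
  hub-rim i = sym (T→≡ (delEdge-i (adj W) {lastRim k} {suc zero} {zero} {suc i} tt (λ ()) (λ ())))
  rim-rim : ∀ i j → A≡ (suc (suc i)) (suc (suc j))
  rim-rim i j = T-ext fw bw
    where
    one : ∀ i j → next (inject₁ i) ≡ inject₁ j → ∀ {k'} → k' ≡ fromℕ (2 + k) → next i ≡ j × ¬ (i ≡ k')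
    one i j e refl = suc≡inject₁ i j (trans (sym (next-inject₁ i)) e)
    -- As the rim has at least three vertices, the step from the first to the second is not the
    -- deleted closing edge.
    short : ∀ i j → next i ≡ j → i ≡ zero → j ≢ fromℕ (2 + k)
    short i j e refl q with () ← trans (sym (next-inject₁ (zero {1 + k}))) (trans e q)
    fw : Adj W⁺ (suc (inject₁ i)) (suc (inject₁ j)) → Adj S (suc (suc i)) (suc (suc j))
    fw h with wheel-e (suc k) (inject₁ i) (inject₁ j) h
    ... | inj₁ e = let a , b = one i j e refl in delEdge-i (adj W) (wheel-i k i j (inj₁ a))
            (λ (x , _) → b (fsuc-inj x)) (λ (x , y) → short i j a (fsuc-inj x) (fsuc-inj y))
    ... | inj₂ e = let a , b = one j i e refl in delEdge-i (adj W) (wheel-i k i j (inj₂ a))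
            (λ (x , y) → short j i a (fsuc-inj y) (fsuc-inj x)) (λ (_ , y) → b (fsuc-inj y))
    bw : Adj S (suc (suc i)) (suc (suc j)) → Adj W⁺ (suc (inject₁ i)) (suc (inject₁ j))
    bw h with delEdge-e (adj W) {lastRim k} {suc zero} {suc i} {suc j} h
    ... | a , n₁ , n₂ with wheel-e k i j a
    ... | inj₁ e = wheel-i (suc k) _ _ (inj₁ (trans (next-inject₁ i) (inject₁≡suc i j e
            λ { refl → n₁ (refl , cong suc (trans (sym e) (next-last (2 + k)))) })))
    ... | inj₂ e = wheel-i (suc k) _ _ (inj₂ (trans (next-inject₁ j) (inject₁≡suc j i e
            λ { refl → n₂ (cong suc (trans (sym e) (next-last (2 + k))) , refl) })))
  ad : ∀ x y → A≡ x y
  ad zero zero = adj-irr W⁺ (lastRim (suc k))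
  ad (suc zero) (suc zero) = sym (delEdge-irr (adj W) (lastRim k) (suc zero) zero refl)
  ad zero (suc zero) = sym (T→≡ (mem3-i {p = lastRim k} {suc zero} {zero} (inj₂ (inj₂ refl))))
  ad (suc zero) zero = flip zero (suc zero) (ad zero (suc zero))
  ad zero (suc (suc i)) = new-rim i
  ad (suc (suc i)) zero = flip zero (suc (suc i)) (new-rim i)
  ad (suc zero) (suc (suc i)) = hub-rim i
  ad (suc (suc i)) (suc zero) = flip (suc zero) (suc (suc i)) (hub-rim i)
  ad (suc (suc i)) (suc (suc j)) = rim-rim i j

-- Embeddings of wheels and their triangular faces

K4≅W0 : Iso K4 (Wheel 0)
K4≅W0 = record { to = id ; from = id ; tofrom = λ _ → refl ; fromto = λ _ → refl
  ; adj-to = λ u v → T-ext (λ h → not-i {does (u ≟ v)} (adj≢ (Wheel 0) {u} h ∘ ==→))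
      (λ h → W0-complete u v λ e → not-e h (→== e)) }

K4-rt : V K4 → V K4 → V K4
K4-rt zero (suc zero) = suc (suc (suc zero))
K4-rt zero (suc (suc (suc zero))) = suc (suc zero)
K4-rt zero _ = suc zero
K4-rt (suc zero) (suc (suc (suc zero))) = zero
K4-rt (suc zero) zero = suc (suc zero)
K4-rt (suc zero) _ = suc (suc (suc zero))
K4-rt (suc (suc zero)) (suc zero) = zero
K4-rt (suc (suc zero)) zero = suc (suc (suc zero))
K4-rt (suc (suc zero)) _ = suc zero
K4-rt (suc (suc (suc zero))) zero = suc zero
K4-rt (suc (suc (suc zero))) (suc zero) = suc (suc zero)
K4-rt (suc (suc (suc zero))) _ = zero

-- The face of a dart of K4 is named after the vertex off that face.
K4-lab : V K4 → V K4 → V K4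
K4-lab zero (suc zero) = suc (suc (suc zero))
K4-lab zero (suc (suc zero)) = suc zero
K4-lab zero _ = suc (suc zero)
K4-lab (suc zero) zero = suc (suc zero)
K4-lab (suc zero) (suc (suc zero)) = suc (suc (suc zero))
K4-lab (suc zero) _ = zero
K4-lab (suc (suc zero)) zero = suc (suc (suc zero))
K4-lab (suc (suc zero)) (suc zero) = zero
K4-lab (suc (suc zero)) _ = suc zero
K4-lab (suc (suc (suc zero))) zero = suc zero
K4-lab (suc (suc (suc zero))) (suc zero) = suc (suc zero)
K4-lab (suc (suc (suc zero))) _ = zero

pattern 0F = zero
pattern 1F = suc zero
pattern 2F = suc (suc zero)
pattern 3F = suc (suc (suc zero))

K4-conn : ColConn K4
K4-conn c h u v _ _ with u ≟ v
... | yes refl = refl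
... | no ne = h u v tt tt (not-i (ne ∘ ==→))

K4-Deg3 : ∀ h x y z → h ≢ x → h ≢ y → h ≢ z → x ≢ y → y ≢ z → x ≢ z → Deg3 K4 h x y z
K4-Deg3 h x y z a b c n₁ n₂ n₃ = mkD3 (not-i (a ∘ ==→)) (not-i (b ∘ ==→)) (not-i (c ∘ ==→)) n₁ n₂ n₃
  λ w k → toWitness {a? = all? λ h → all? λ x → all? λ y → all? λ z → all? λ w →
    ¬? (h ≟ x) →-dec (¬? (h ≟ y) →-dec (¬? (h ≟ z) →-dec (¬? (x ≟ y) →-dec (¬? (y ≟ z) →-dec (¬? (x ≟ z) →-dec
    (¬? (h ≟ w) →-dec ((w ≟ x) ⊎-dec ((w ≟ y) ⊎-dec (w ≟ z)))))))))} _ h x y z w a b c n₁ n₂ n₃ (adj≢ K4 {h} k)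

K4-LE : LE K4 K4
K4-LE = record
  { ro = mkRot K4 K4-rt LRs ; lab = K4-lab
  ; lab-step = toWitness {a? = all? λ u → all? λ v → T? (adj K4 u v) →-dec (K4-lab v (K4-rt v u) ≟ K4-lab u v)} _
  ; lab-surj = toWitness {a? = all? λ f → any? λ u → any? λ v → T? (adj K4 u v) ×-dec (K4-lab u v ≟ f)} _
  ; conn = K4-conn ; eul = refl
  ; dual→ = toWitness {a? = all? λ a → all? λ b → T? (adj K4 a b) →-dec any? λ u → any? λ v →
      T? (adj K4 u v) ×-dec ((K4-lab u v ≟ a) ×-dec (K4-lab v u ≟ b))} _
  ; dual← = toWitness {a? = all? λ u → all? λ v → T? (adj K4 u v) →-dec T? (adj K4 (K4-lab u v) (K4-lab v u))} _ }
  where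
  LRs : ∀ v → LR (Adj K4 v) (K4-rt v)
  LRs 0F = LR-deg3 (K4-Deg3 0F 1F 3F 2F (λ ()) (λ ()) (λ ()) (λ ()) (λ ()) (λ ())) refl refl refl
  LRs 1F = LR-deg3 (K4-Deg3 1F 0F 2F 3F (λ ()) (λ ()) (λ ()) (λ ()) (λ ()) (λ ())) refl refl refl
  LRs 2F = LR-deg3 (K4-Deg3 2F 0F 3F 1F (λ ()) (λ ()) (λ ()) (λ ()) (λ ()) (λ ())) refl refl refl
  LRs 3F = LR-deg3 (K4-Deg3 3F 0F 1F 2F (λ ()) (λ ()) (λ ()) (λ ()) (λ ()) (λ ())) refl refl refl

iso-adj : ∀ {G H} (I : Iso G H) {u v} → Adj G u v → Adj H (Iso.to I u) (Iso.to I v)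
iso-adj I {u} {v} h = subst T (sym (Iso.adj-to I u v)) h

iso-adj⁻ : ∀ {G H} (I : Iso G H) {u v} → Adj H (Iso.to I u) (Iso.to I v) → Adj G u v
iso-adj⁻ I {u} {v} h = subst T (Iso.adj-to I u v) h

iso-triangle : ∀ {G H} (I : Iso G H) {x y z} → Triangle G x y z → Triangle H (Iso.to I x) (Iso.to I y) (Iso.to I z)
iso-triangle I (a , b , c) = iso-adj I a , iso-adj I b , iso-adj I c

-- A wheel grows by repeated splitting of the rim edge from the last rim vertex p to the first r.
record Chain (k : ℕ) : Set where
  field
    {H Gd} : Graph
    E : LE H Gd
    {p r s p' r'} : V H
    dp : Deg3 H p r s p'
    dr : Deg3 H r p s r'
    tri : TriangleAt E p r s
    X≢Y : LE.lab E p s ≢ LE.lab E s r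
    I : Iso H (Wheel k)
    I-p : Iso.to I p ≡ lastRim k
    I-r : Iso.to I r ≡ suc zero
    I-s : Iso.to I s ≡ zero

chain : ∀ k → Chain k
chain zero = record
  { E = K4-LE ; p = 3F ; r = 1F ; s = 0F ; p' = 2F ; r' = 2F
  ; dp = K4-Deg3 3F 1F 0F 2F (λ ()) (λ ()) (λ ()) (λ ()) (λ ()) (λ ())
  ; dr = K4-Deg3 1F 3F 0F 2F (λ ()) (λ ()) (λ ()) (λ ()) (λ ()) (λ ())
  ; tri = mkTri refl refl refl ; X≢Y = λ () ; I = K4≅W0 ; I-p = refl ; I-r = refl ; I-s = refl }
chain (suc k) = record
  { E = U.up ; p = zero ; r = suc r ; s = suc s ; p' = suc p ; r' = suc r'
  ; dp = deg3-rot Sb.deg-q ; dr = Sb.deg-r ; tri = U.tri°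
  -- The new `X` is the old face `T`, which is separated from `Y` by the edge `r s`.
  ; X≢Y = λ e → LE.loopless E {r} {s} (Deg3.ay dr) (trans (LE.turn E (Deg3.ax dr) (TriangleAt.at-r tri))
      (fsuc-inj (trans (sym U.lab-qs) (trans e (U.lab-oo λ (q , _) → Sb.r≢s (sym q))))))
  ; I = iso-trans (sub-iso I I-p I-r I-s) (wheel-suc k)
  ; I-p = refl ; I-r = trans (cong (λ z → Iso.to (wheel-suc k) (suc z)) I-r) refl
  ; I-s = cong (λ z → Iso.to (wheel-suc k) (suc z)) I-s }
  where
  open Chain (chain k)
  module Sb = Sub dp dr
  module U = SubUp E dp dr tri X≢Y

FaceTriangle : (G : Graph) → V G → V G → V G → Set
FaceTriangle G x y z = Σ Graph λ Gd → Σ (LE G Gd) λ E → Triangle G x y z × TriangleAt E x y z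

face→TriFace : ∀ {G x y z} → FaceTriangle G x y z → TriFace G x y z
face→TriFace (Gd , E , (a , b , c) , mkTri e₁ e₂ e₃) = n Gd , toPlane E , a , b , c , e₁ , e₂ , e₃

face-rot : ∀ {G x y z} → FaceTriangle G x y z → FaceTriangle G y z x
face-rot (Gd , E , (a , b , c) , mkTri e₁ e₂ e₃) = Gd , E , (b , c , a) , mkTri e₂ e₃ e₁

face-iso : ∀ {G H x y z} (I : Iso G H) → FaceTriangle H (Iso.to I x) (Iso.to I y) (Iso.to I z) → FaceTriangle G x y z
face-iso {x = x} {y} {z} I (Gd , E , (a , b , c) , mkTri e₁ e₂ e₃) =
  Gd , transportLE (iso-sym I) iso-refl E , (iso-adj⁻ I a , iso-adj⁻ I b , iso-adj⁻ I c) ,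
  mkTri (trans (cong from e₁) (fromto z)) (trans (cong from e₂) (fromto x)) (trans (cong from e₃) (fromto y))
  where open Iso I

-- In the embedding built by `chain` the hub, the last and the first rim vertex bound a face. An
-- automorphism of the wheel carries them to the standard triangle.
face-std : ∀ k → FaceTriangle (Wheel k) zero (suc zero) (suc (suc zero))
face-std k = face-iso (iso-trans (iso-sym J) (iso-sym I)) (subst₃ (back e₀ I-s) (back e₁ I-p) (back e₂ I-r) base)
  where
  open Chain (chain k)
  hub = std-hub k (fromℕ (2 + k)) zero (inj₁ (next-last (2 + k)))
  J = proj₁ hub
  e₀ = proj₁ (proj₂ hub)
  e₁ = proj₁ (proj₂ (proj₂ hub))
  e₂ = proj₂ (proj₂ (proj₂ hub))
  base : FaceTriangle H s p r
  base = Gd , E , (Adj-sym H (Deg3.ay dp) , Deg3.ax dp , Deg3.ay dr) , mkTri (TriangleAt.at-p tri) (TriangleAt.at-r tri) (TriangleAt.at-s tri)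
  back : ∀ {x y z} → Iso.to J y ≡ z → Iso.to I x ≡ y → x ≡ Iso.from I (Iso.from J z)
  back {x} refl refl = sym (trans (cong (Iso.from I) (Iso.fromto J (Iso.to I x))) (Iso.fromto I x))
  subst₃ : ∀ {x y z x' y' z'} → x ≡ x' → y ≡ y' → z ≡ z' → FaceTriangle H x y z → FaceTriangle H x' y' z'
  subst₃ refl refl refl h = h

std→face : ∀ {k x y z} → Std k x y z → FaceTriangle (Wheel k) x y z
std→face {k} (I , e₀ , e₁ , e₂) = face-iso I (lem e₀ e₁ e₂)
  where
  lem : ∀ {x y z} → x ≡ zero → y ≡ suc zero → z ≡ suc (suc zero) → FaceTriangle (Wheel k) x y z
  lem refl refl refl = face-std k

-- Up to cyclic order every triangle of a wheel can be moved to the standard one, which is a face.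
-- For the pieces of a gluing, triangular faces are therefore the same as triangles.
wheel-TriFace : ∀ {G} → IsWheel G → ∀ {x y z} → Triangle G x y z → TriFace G x y z
wheel-TriFace (k , w) t = face→TriFace (face-iso I
  ([ std→face , [ (λ q → face-rot (face-rot (std→face q))) , (λ q → face-rot (std→face q)) ]′ ]′ (std-triangle k _ _ _ (iso-triangle I t))))
  where I = ≅→iso w

TriFace→triangle : ∀ {G x y z} → TriFace G x y z → Triangle G x y z
TriFace→triangle (_ , _ , a , b , c , _) = a , b , c

-- Gluing

-- A symmetric form of `GlueOf`, in which the sides can be exchanged and replaced by isomorphic
-- ones. The field `sep` says that no edge joins private vertices of different sides.
record Glue (G₁ G₂ G : Graph) (τ : Fin 3 → V G₁) (τ' : Fin 3 → V G₂) : Set where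
  field
    f₁   : V G₁ → V G
    f₂   : V G₂ → V G
    inj₁' : ∀ {x y} → f₁ x ≡ f₁ y → x ≡ y
    inj₂' : ∀ {x y} → f₂ x ≡ f₂ y → x ≡ y
    adj₁ : ∀ x y → adj G (f₁ x) (f₁ y) ≡ adj G₁ x y
    adj₂ : ∀ x y → adj G (f₂ x) (f₂ y) ≡ adj G₂ x y
    cov  : ∀ z → (∃ λ x → z ≡ f₁ x) ⊎ (∃ λ y → z ≡ f₂ y)
    on   : ∀ i → f₁ (τ i) ≡ f₂ (τ' i)
    meet : ∀ x y → f₁ x ≡ f₂ y → ∃ λ i → x ≡ τ i × y ≡ τ' i
    sep  : ∀ x y → Adj G (f₁ x) (f₂ y) → (∃ λ i → x ≡ τ i) ⊎ (∃ λ i → y ≡ τ' i)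

  up₁ : ∀ {x y} → Adj G₁ x y → Adj G (f₁ x) (f₁ y)
  up₁ {x} {y} = subst T (sym (adj₁ x y))
  up₂ : ∀ {x y} → Adj G₂ x y → Adj G (f₂ x) (f₂ y)
  up₂ {x} {y} = subst T (sym (adj₂ x y))
  down₁ : ∀ {x y} → Adj G (f₁ x) (f₁ y) → Adj G₁ x y
  down₁ {x} {y} = subst T (adj₁ x y)
  down₂ : ∀ {x y} → Adj G (f₂ x) (f₂ y) → Adj G₂ x y
  down₂ {x} {y} = subst T (adj₂ x y)

  Cross : V G₁ → V G₂ → Set
  Cross x y = (∃ λ i → x ≡ τ i × Adj G₂ (τ' i) y) ⊎ (∃ λ i → y ≡ τ' i × Adj G₁ x (τ i))

  cross-e : ∀ x y → Adj G (f₁ x) (f₂ y) → Cross x y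
  cross-e x y h with sep x y h
  ... | inj₁ (i , refl) = inj₁ (i , refl , down₂ (subst (λ z → Adj G z (f₂ y)) (on i) h))
  ... | inj₂ (i , refl) = inj₂ (i , refl , down₁ (subst (Adj G (f₁ x)) (sym (on i)) h))

  cross-i : ∀ x y → Cross x y → Adj G (f₁ x) (f₂ y)
  cross-i x y (inj₁ (i , refl , h)) = subst (λ z → Adj G z (f₂ y)) (sym (on i)) (up₂ h)
  cross-i x y (inj₂ (i , refl , h)) = subst (Adj G (f₁ x)) (on i) (up₁ h)

  pull : ∀ {x z} → (∀ i → x ≢ τ i) → Adj G (f₁ x) z → ∃ λ y → z ≡ f₁ y
  pull {x} {z} n h with cov z
  ... | inj₁ p = p
  ... | inj₂ (y , refl) with sep x y h
  ... | inj₁ (i , e) = ⊥-elim (n i e)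
  ... | inj₂ (i , refl) = τ i , sym (on i)

module _ {G₁ G₂ G : Graph} {τ : Fin 3 → V G₁} {τ' : Fin 3 → V G₂} (gl : Glue G₁ G₂ G τ τ') where
  open Glue gl

  glue-swap : Glue G₂ G₁ G τ' τ
  glue-swap = record
    { f₁ = f₂ ; f₂ = f₁ ; inj₁' = inj₂' ; inj₂' = inj₁' ; adj₁ = adj₂ ; adj₂ = adj₁
    ; cov = λ z → [ inj₂ , inj₁ ]′ (cov z) ; on = λ i → sym (on i)
    ; meet = λ x y e → let i , a , b = meet y x (sym e) in i , b , a
    ; sep = λ x y h → [ inj₂ , inj₁ ]′ (sep y x (Adj-sym G h)) }

  glue-reindex : (ρ ρ⁻ : Fin 3 → Fin 3) → (∀ i → ρ (ρ⁻ i) ≡ i) → Glue G₁ G₂ G (τ ∘ ρ) (τ' ∘ ρ)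
  glue-reindex ρ ρ⁻ e = record
    { f₁ = f₁ ; f₂ = f₂ ; inj₁' = inj₁' ; inj₂' = inj₂' ; adj₁ = adj₁ ; adj₂ = adj₂ ; cov = cov ; on = λ i → on (ρ i)
    ; meet = λ x y q → let i , a , b = meet x y q in ρ⁻ i , trans a (cong τ (sym (e i))) , trans b (cong τ' (sym (e i)))
    ; sep = λ x y h → [ (λ (i , a) → inj₁ (ρ⁻ i , trans a (cong τ (sym (e i))))) , (λ (i , a) → inj₂ (ρ⁻ i , trans a (cong τ' (sym (e i))))) ]′ (sep x y h) }

  glue-iso₁ : ∀ {G₁*} (I : Iso G₁* G₁) {τ* : Fin 3 → V G₁*} → (∀ i → τ i ≡ Iso.to I (τ* i)) → Glue G₁* G₂ G τ* τ'
  glue-iso₁ I {τ*} e = record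
    { f₁ = f₁ ∘ I.to ; f₂ = f₂ ; inj₁' = I.to-inj ∘ inj₁' ; inj₂' = inj₂' ; adj₁ = λ x y → trans (adj₁ _ _) (I.adj-to x y) ; adj₂ = adj₂
    ; cov = λ z → [ (λ (x , q) → inj₁ (I.from x , trans q (cong f₁ (sym (I.tofrom x))))) , inj₂ ]′ (cov z)
    ; on = λ i → trans (cong f₁ (sym (e i))) (on i)
    ; meet = λ x y q → let i , a , b = meet (I.to x) y q in i , I.to-inj (trans a (e i)) , b
    ; sep = λ x y h → [ (λ (i , a) → inj₁ (i , I.to-inj (trans a (e i)))) , inj₂ ]′ (sep (I.to x) y h) }
    where module I = Iso I

  glue-out : ∀ {G*} → Iso G G* → Glue G₁ G₂ G* τ τ'
  glue-out {G*} I = record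
    { f₁ = I.to ∘ f₁ ; f₂ = I.to ∘ f₂ ; inj₁' = inj₁' ∘ I.to-inj ; inj₂' = inj₂' ∘ I.to-inj
    ; adj₁ = λ x y → trans (I.adj-to _ _) (adj₁ x y) ; adj₂ = λ x y → trans (I.adj-to _ _) (adj₂ x y)
    ; cov = λ z → [ (λ (x , q) → inj₁ (x , back q)) , (λ (x , q) → inj₂ (x , back q)) ]′ (cov (I.from z))
    ; on = λ i → cong I.to (on i) ; meet = λ x y q → meet x y (I.to-inj q)
    ; sep = λ x y h → sep x y (iso-adj⁻ I h) }
    where
    module I = Iso I
    back : ∀ {z w} → I.from z ≡ w → z ≡ I.to w
    back refl = sym (I.tofrom _)

lift0 : ∀ {m k} → (Fin m → Fin k) → Fin (suc m) → Fin (suc k)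
lift0 f zero    = zero
lift0 f (suc x) = suc (f x)

sub-emb : ∀ {G G'} (f : V G → V G') → (∀ {x y} → f x ≡ f y → x ≡ y) → (∀ x y → adj G' (f x) (f y) ≡ adj G x y) →
  ∀ {t y b t' y' b'} → f t ≡ t' → f y ≡ y' → f b ≡ b' → ∀ u v →
  adj (sub G' t' y' b') (lift0 f u) (lift0 f v) ≡ adj (sub G t y b) u v
sub-emb {G} {G'} f inj ad refl refl refl = go
  where
  spoke : ∀ {x y z} u → mem3 (f x) (f y) (f z) (f u) ≡ mem3 x y z u
  spoke u = T-ext (λ h → mem3-i ([ inj₁ ∘ inj , [ inj₂ ∘ inj₁ ∘ inj , inj₂ ∘ inj₂ ∘ inj ]′ ]′ (mem3-e h)))
    (λ h → mem3-i ([ inj₁ ∘ cong f , [ inj₂ ∘ inj₁ ∘ cong f , inj₂ ∘ inj₂ ∘ cong f ]′ ]′ (mem3-e h)))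
  go : ∀ u v → adj (sub G' _ _ _) (lift0 f u) (lift0 f v) ≡ adj (sub G _ _ _) u v
  go zero zero = refl
  go zero (suc v) = spoke v
  go (suc u) zero = spoke u
  go (suc u) (suc v) = T-ext
    (λ h → let a , n₁ , n₂ = delEdge-e (adj G') h in delEdge-i (adj G) (subst T (ad u v) a)
       (λ { (refl , refl) → n₁ (refl , refl) }) (λ { (refl , refl) → n₂ (refl , refl) }))
    (λ h → let a , n₁ , n₂ = delEdge-e (adj G) h in delEdge-i (adj G') (subst T (sym (ad u v)) a)
       (λ (e , e') → n₁ (inj e , inj e')) (λ (e , e') → n₂ (inj e , inj e')))

lift0-inj : ∀ {m k} {f : Fin m → Fin k} → (∀ {x y} → f x ≡ f y → x ≡ y) → ∀ {x y} → lift0 f x ≡ lift0 f y → x ≡ y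
lift0-inj inj {zero} {zero} _ = refl
lift0-inj inj {suc x} {suc y} e = cong suc (inj (fsuc-inj e))

-- Since `t` is private to its side, so are the new vertex and the deleted edge; the other side
-- remains the same subgraph.
glue-sub : ∀ {G₁ G₂ G τ τ'} (gl : Glue G₁ G₂ G τ τ') {t y b t' y' b'} → Glue.f₁ gl t ≡ t' → Glue.f₁ gl y ≡ y' →
  Glue.f₁ gl b ≡ b' → (∀ i → t ≢ τ i) → Glue (sub G₁ t y b) G₂ (sub G t' y' b') (suc ∘ τ) τ'
glue-sub {G₁} {G₂} {G} {τ} {τ'} gl {t} {y} {b} {t'} {y'} {b'} et ey eb n = record
  { f₁ = lift0 f₁ ; f₂ = suc ∘ f₂ ; inj₁' = lift0-inj inj₁' ; inj₂' = inj₂' ∘ fsuc-inj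
  ; adj₁ = sub-emb f₁ inj₁' adj₁ et ey eb
  ; adj₂ = λ u v → T-ext (λ h → down₂ (proj₁ (delEdge-e (adj G) h)))
      (λ h → delEdge-i (adj G) (up₂ h) (λ (e , _) → nt e) (λ (_ , e) → nt e))
  ; cov = λ { zero → inj₁ (zero , refl) ; (suc z) → [ (λ (x , e) → inj₁ (suc x , cong suc e)) , (λ (x , e) → inj₂ (x , cong suc e)) ]′ (cov z) }
  ; on = λ i → cong suc (on i)
  ; meet = λ { (suc x) u e → let i , a , c = meet x u (fsuc-inj e) in i , cong suc a , c }
  ; sep = sp }
  where
  open Glue gl
  nt : ∀ {u} → f₂ u ≢ t'
  nt e = let i , a , _ = meet t _ (trans et (sym e)) in n i a
  meets : ∀ {x u} → f₁ x ≡ f₂ u → ∃ λ i → u ≡ τ' i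
  meets e = let i , _ , c = meet _ _ e in i , c
  sp : ∀ x u → Adj (sub G t' y' b') (lift0 f₁ x) (suc (f₂ u)) → (∃ λ i → x ≡ suc (τ i)) ⊎ (∃ λ i → u ≡ τ' i)
  sp zero u h with mem3-e h
  ... | inj₁ e = ⊥-elim (nt e)
  ... | inj₂ (inj₁ e) = inj₂ (meets (trans ey (sym e)))
  ... | inj₂ (inj₂ e) = inj₂ (meets (trans eb (sym e)))
  sp (suc x) u h = [ (λ (i , e) → inj₁ (i , cong suc e)) , inj₂ ]′ (sep x u (proj₁ (delEdge-e (adj G) h)))

module _ {G₁ G₂ G G* : Graph} {τ : Fin 3 → V G₁} {τ' : Fin 3 → V G₂} (gl : Glue G₁ G₂ G τ τ') (gl* : Glue G₁ G₂ G* τ τ') where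
  private
    module A = Glue gl
    module B = Glue gl*

  amalgam : V G → V G*
  amalgam z with A.cov z
  ... | inj₁ (x , _) = B.f₁ x
  ... | inj₂ (y , _) = B.f₂ y

  amalgam-f₁ : ∀ x → amalgam (A.f₁ x) ≡ B.f₁ x
  amalgam-f₁ x with A.cov (A.f₁ x)
  ... | inj₁ (x' , e) = cong B.f₁ (sym (A.inj₁' e))
  ... | inj₂ (y , e) with A.meet x y e
  ... | i , refl , refl = sym (B.on i)

  amalgam-f₂ : ∀ y → amalgam (A.f₂ y) ≡ B.f₂ y
  amalgam-f₂ y with A.cov (A.f₂ y)
  ... | inj₂ (y' , e) = cong B.f₂ (sym (A.inj₂' e))
  ... | inj₁ (x , e) with A.meet x y (sym e)
  ... | i , refl , refl = B.on i

  amalgam-adj : ∀ u v → adj G* (amalgam u) (amalgam v) ≡ adj G u v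
  amalgam-adj u v with A.cov u | A.cov v
  ... | inj₁ (x , refl) | inj₁ (y , refl) = trans (B.adj₁ x y) (sym (A.adj₁ x y))
  ... | inj₂ (x , refl) | inj₂ (y , refl) = trans (B.adj₂ x y) (sym (A.adj₂ x y))
  ... | inj₁ (x , refl) | inj₂ (y , refl) = T-ext (A.cross-i x y ∘ B.cross-e x y) (B.cross-i x y ∘ A.cross-e x y)
  ... | inj₂ (x , refl) | inj₁ (y , refl) = T-ext
    (λ h → Adj-sym G (A.cross-i y x (B.cross-e y x (Adj-sym G* h)))) (λ h → Adj-sym G* (B.cross-i y x (A.cross-e y x (Adj-sym G h))))

-- Edges within a side are prescribed by that side, and an edge across must have an end on the
-- triangle (`Cross`). The result of a gluing is thus determined by its sides and the matching of
-- the triangles.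
glue-unique : ∀ {G₁ G₂ G G* τ τ'} → Glue G₁ G₂ G τ τ' → Glue G₁ G₂ G* τ τ' → Iso G G*
glue-unique gl gl* = record
  { to = amalgam gl gl* ; from = amalgam gl* gl ; tofrom = inv gl* gl ; fromto = inv gl gl* ; adj-to = amalgam-adj gl gl* }
  where
  inv : ∀ {G₁ G₂ G G* τ τ'} (gl : Glue G₁ G₂ G τ τ') (gl* : Glue G₁ G₂ G* τ τ') → ∀ z → amalgam gl* gl (amalgam gl gl* z) ≡ z
  inv gl gl* z with Glue.cov gl z
  ... | inj₁ (x , refl) = amalgam-f₁ gl* gl x
  ... | inj₂ (y , refl) = amalgam-f₂ gl* gl y

tri : ∀ {A : Set} → A → A → A → Fin 3 → A
tri u v w 0F = u
tri u v w 1F = v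
tri u v w 2F = w

std : ∀ k → Fin 3 → V (Wheel k)
std k = tri 0F 1F 2F

IsTri : (G : Graph) → (Fin 3 → V G) → Set
IsTri G τ = ∀ i j → i ≢ j → Adj G (τ i) (τ j)

isTri : ∀ {G u v w} → Triangle G u v w → IsTri G (tri u v w)
isTri {G} (a , b , c) 0F 0F n = ⊥-elim (n refl)
isTri {G} (a , b , c) 0F 1F n = a
isTri {G} (a , b , c) 0F 2F n = Adj-sym G c
isTri {G} (a , b , c) 1F 0F n = Adj-sym G a
isTri {G} (a , b , c) 1F 1F n = ⊥-elim (n refl)
isTri {G} (a , b , c) 1F 2F n = b
isTri {G} (a , b , c) 2F 0F n = c
isTri {G} (a , b , c) 2F 1F n = Adj-sym G b
isTri {G} (a , b , c) 2F 2F n = ⊥-elim (n refl)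

tri-inj : ∀ {G τ} → IsTri G τ → ∀ {i j} → τ i ≡ τ j → i ≡ j
tri-inj {G} t {i} {j} e with i ≟ j
... | yes q = q
... | no n = ⊥-elim (adj≢ G (t i j n) e)

stack-glue : ∀ {G u v w} → Triangle G u v w → Glue G (Wheel 0) (stack G u v w) (tri u v w) (std 0)
stack-glue {G} {u} {v} {w} t = record
  { f₁ = suc ; f₂ = f ; inj₁' = fsuc-inj ; inj₂' = λ {x} {y} → f-inj x y ; adj₁ = λ _ _ → refl ; adj₂ = ad
  ; cov = λ { zero → inj₂ (3F , refl) ; (suc x) → inj₁ (x , refl) }
  ; on = λ { 0F → refl ; 1F → refl ; 2F → refl }
  ; meet = λ { x 0F refl → 0F , refl , refl ; x 1F refl → 1F , refl , refl ; x 2F refl → 2F , refl , refl ; x 3F () }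
  ; sep = λ { x 3F h → inj₁ ([ (λ e → 0F , e) , [ (λ e → 1F , e) , (λ e → 2F , e) ]′ ]′ (mem3-e h))
            ; x 0F h → inj₂ (0F , refl) ; x 1F h → inj₂ (1F , refl) ; x 2F h → inj₂ (2F , refl) } }
  where
  S : Graph
  S = stack G u v w
  f : V (Wheel 0) → V S
  f 0F = suc u
  f 1F = suc v
  f 2F = suc w
  f 3F = zero
  edge : ∀ x y → x ≢ y → Adj S (f x) (f y)
  edge 3F 3F n = ⊥-elim (n refl)
  edge 3F 0F n = mem3-i (inj₁ refl)
  edge 3F 1F n = mem3-i (inj₂ (inj₁ refl))
  edge 3F 2F n = mem3-i (inj₂ (inj₂ refl))
  edge 0F 3F n = mem3-i (inj₁ refl)
  edge 1F 3F n = mem3-i (inj₂ (inj₁ refl))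
  edge 2F 3F n = mem3-i (inj₂ (inj₂ refl))
  edge 0F 0F n = ⊥-elim (n refl)
  edge 1F 1F n = ⊥-elim (n refl)
  edge 2F 2F n = ⊥-elim (n refl)
  edge 0F 1F n = isTri {G} t 0F 1F (λ ())
  edge 0F 2F n = isTri {G} t 0F 2F (λ ())
  edge 1F 0F n = isTri {G} t 1F 0F (λ ())
  edge 1F 2F n = isTri {G} t 1F 2F (λ ())
  edge 2F 0F n = isTri {G} t 2F 0F (λ ())
  edge 2F 1F n = isTri {G} t 2F 1F (λ ())
  f-inj : ∀ x y → f x ≡ f y → x ≡ y
  f-inj x y e with x ≟ y
  ... | yes q = q
  ... | no n = ⊥-elim (adj≢ S {f x} {f y} (edge x y n) e)
  ad : ∀ x y → adj S (f x) (f y) ≡ adj (Wheel 0) x y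
  ad x y with x ≟ y
  ... | yes refl = trans (adj-irr S (f x)) (sym (adj-irr (Wheel 0) x))
  ... | no n = trans (T→≡ (edge x y n)) (sym (T→≡ (W0-complete x y n)))

-- In `GlueOf` the edges among the identified vertices are taken from `G₁`. That `G₂` is an induced
-- subgraph too holds because both triples are triangles.
module FromGlueOf {G₁ G₂ H : Graph} {u v w : V G₁} {u' v' w' : V G₂} (g : GlueOf G₁ G₂ H u v w u' v' w')
  (t : Triangle G₁ u v w) (t' : Triangle G₂ u' v' w') where
  open GlueOf g renaming (adj₁ to a₁; adj₂ to a₂)
  private
    module Φ = Inverse φ
    τ : Fin 3 → V G₁
    τ = tri u v w
    τ' : Fin 3 → V G₂
    τ' = tri u' v' w'
    from-inj : ∀ {x y} → Φ.from x ≡ Φ.from y → x ≡ y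
    from-inj e = trans (sym (Φ.inverseˡ refl)) (trans (cong Φ.to e) (Φ.inverseˡ refl))
    inj₁-inj : ∀ {A B : Set} {x y : A} → _≡_ {A = A ⊎ B} (inj₁ x) (inj₁ y) → x ≡ y
    inj₁-inj refl = refl
    data TView : V G₂ → Set where
      corner : ∀ i → TView (τ' i)
      out    : ∀ y (o : Out3 y u' v' w') → TView y
    tview : ∀ y → TView y
    tview y with y ≟ u' | y ≟ v' | y ≟ w'
    ... | yes refl | _ | _ = corner 0F
    ... | no _ | yes refl | _ = corner 1F
    ... | no _ | no _ | yes refl = corner 2F
    ... | no a | no b | no c = out y (a , b , c)
    ι-τ : ∀ i → ι₂ g (τ' i) ≡ ι₁ g (τ i)
    ι-τ 0F with u' ≟ u'
    ... | yes _ = refl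
    ... | no n = ⊥-elim (n refl)
    ι-τ 1F with v' ≟ u' | v' ≟ v'
    ... | yes e | _ = ⊥-elim (adj≢ G₂ (proj₁ t') (sym e))
    ... | no _ | yes _ = refl
    ... | no _ | no n = ⊥-elim (n refl)
    ι-τ 2F with w' ≟ u' | w' ≟ v' | w' ≟ w'
    ... | yes e | _ | _ = ⊥-elim (adj≢ G₂ (proj₂ (proj₂ t')) e)
    ... | no _ | yes e | _ = ⊥-elim (adj≢ G₂ (proj₁ (proj₂ t')) (sym e))
    ... | no _ | no _ | yes _ = refl
    ... | no _ | no _ | no n = ⊥-elim (n refl)
    ι-out : ∀ y o → ι₂ g y ≡ Φ.from (inj₂ (y , o))
    ι-out y (a , b , c) with y ≟ u' | y ≟ v' | y ≟ w'
    ... | yes e | _ | _ = ⊥-elim (a e)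
    ... | no _ | yes e | _ = ⊥-elim (b e)
    ... | no _ | no _ | yes e = ⊥-elim (c e)
    ... | no _ | no _ | no _ = refl
    mixed : ∀ i y (o : Out3 y u' v' w') → adj H (ι₁ g (τ i)) (Φ.from (inj₂ (y , o))) ≡ adj G₂ (τ' i) y
    mixed i y o = T-ext (λ h → pick₃ i (Equivalence.to (adj₁₂ (τ i) (y , o)) h)) (λ h → Equivalence.from (adj₁₂ (τ i) (y , o)) (put i h))
      where
      same : ∀ i j → τ i ≡ τ j → Adj G₂ (τ' j) y → Adj G₂ (τ' i) y
      same i j e h with tri-inj {G₁} {τ} (isTri {G₁} t) {i} {j} e
      ... | refl = h
      pick₃ : ∀ i → (τ i ≡ u × Adj G₂ u' y) ⊎ (τ i ≡ v × Adj G₂ v' y) ⊎ (τ i ≡ w × Adj G₂ w' y) → Adj G₂ (τ' i) y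
      pick₃ i (inj₁ (e , h)) = same i 0F e h
      pick₃ i (inj₂ (inj₁ (e , h))) = same i 1F e h
      pick₃ i (inj₂ (inj₂ (e , h))) = same i 2F e h
      put : ∀ i → Adj G₂ (τ' i) y → (τ i ≡ u × Adj G₂ u' y) ⊎ (τ i ≡ v × Adj G₂ v' y) ⊎ (τ i ≡ w × Adj G₂ w' y)
      put 0F h = inj₁ (refl , h)
      put 1F h = inj₂ (inj₁ (refl , h))
      put 2F h = inj₂ (inj₂ (refl , h))
    at : ∀ x y {a b} → ι₂ g x ≡ a → ι₂ g y ≡ b → adj H a b ≡ adj G₂ x y → adj H (ι₂ g x) (ι₂ g y) ≡ adj G₂ x y
    at x y refl refl e = e
    ad₂ : ∀ x y → adj H (ι₂ g x) (ι₂ g y) ≡ adj G₂ x y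
    ad₂ x y with tview x | tview y
    ... | corner i | corner j = at (τ' i) (τ' j) (ι-τ i) (ι-τ j) (trans (a₁ (τ i) (τ j)) (lem i j))
      where
      lem : ∀ i j → adj G₁ (τ i) (τ j) ≡ adj G₂ (τ' i) (τ' j)
      lem i j with i ≟ j
      ... | yes refl = trans (adj-irr G₁ (τ i)) (sym (adj-irr G₂ (τ' i)))
      ... | no n = trans (T→≡ (isTri {G₁} t i j n)) (sym (T→≡ (isTri {G₂} t' i j n)))
    ... | corner i | out y o = at (τ' i) y (ι-τ i) (ι-out y o) (mixed i y o)
    ... | out x o | corner j = at x (τ' j) (ι-out x o) (ι-τ j) (trans (adj-sym H _ _) (trans (mixed j x o) (adj-sym G₂ _ _)))
    ... | out x o | out y o' = at x y (ι-out x o) (ι-out y o') (a₂ (x , o) (y , o'))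
    mt : ∀ x y → ι₁ g x ≡ ι₂ g y → ∃ λ i → x ≡ τ i × y ≡ τ' i
    mt x y e with tview y
    ... | corner i = i , inj₁-inj (from-inj (trans e (ι-τ i))) , refl
    ... | out y o with () ← from-inj (trans e (ι-out y o))
    sp : ∀ x y → Adj H (ι₁ g x) (ι₂ g y) → (∃ λ i → x ≡ τ i) ⊎ (∃ λ i → y ≡ τ' i)
    sp x y h with tview y
    ... | corner i = inj₂ (i , refl)
    ... | out y o with Equivalence.to (adj₁₂ x (y , o)) (subst (λ z → Adj H (ι₁ g x) z) (ι-out y o) h)
    ... | inj₁ (e , _) = inj₁ (0F , e)
    ... | inj₂ (inj₁ (e , _)) = inj₁ (1F , e)
    ... | inj₂ (inj₂ (e , _)) = inj₁ (2F , e)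
    i₂ : ∀ x y → ι₂ g x ≡ ι₂ g y → x ≡ y
    i₂ x y e with tview x | tview y
    ... | corner i | corner j = cong τ' (tri-inj {G₁} {τ} (isTri {G₁} t) (inj₁-inj (from-inj (trans (sym (ι-τ i)) (trans e (ι-τ j))))))
    ... | corner i | out y o with () ← from-inj (trans (sym (ι-τ i)) (trans e (ι-out y o)))
    i₂ x y e | out x o | corner j with () ← from-inj (trans (sym (ι-out x o)) (trans e (ι-τ j)))
    i₂ x y e | out x o | out y o' with from-inj (trans (sym (ι-out x o)) (trans e (ι-out y o')))
    ... | refl = refl
    cv : ∀ z → (∃ λ x → z ≡ ι₁ g x) ⊎ (∃ λ y → z ≡ ι₂ g y)
    cv z with Φ.to z in e
    ... | inj₁ x = inj₁ (x , trans (sym (Φ.inverseʳ refl)) (cong Φ.from e))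
    ... | inj₂ (y , o) = inj₂ (y , trans (sym (Φ.inverseʳ refl)) (trans (cong Φ.from e) (sym (ι-out y o))))

  toGlue : Glue G₁ G₂ H (tri u v w) (tri u' v' w')
  toGlue = record
    { f₁ = ι₁ g ; f₂ = ι₂ g ; inj₁' = λ e → inj₁-inj (from-inj e) ; inj₂' = λ {x} {y} → i₂ x y ; adj₁ = a₁ ; adj₂ = ad₂
    ; cov = cv ; on = λ i → sym (ι-τ i) ; meet = mt ; sep = sp }

module ToGlueOf {G₁ G₂ G : Graph} {τ : Fin 3 → V G₁} {τ' : Fin 3 → V G₂} (gl : Glue G₁ G₂ G τ τ') where
  open Glue gl
  private
    Out : V G₂ → Set
    Out y = Out3 y (τ' 0F) (τ' 1F) (τ' 2F)
    place : V G₂ → V G₁ ⊎ Σ (V G₂) Out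
    place y with y ≟ τ' 0F | y ≟ τ' 1F | y ≟ τ' 2F
    ... | yes _ | _ | _ = inj₁ (τ 0F)
    ... | no _ | yes _ | _ = inj₁ (τ 1F)
    ... | no _ | no _ | yes _ = inj₁ (τ 2F)
    ... | no a | no b | no c = inj₂ (y , a , b , c)
    to : V G → V G₁ ⊎ Σ (V G₂) Out
    to z with cov z
    ... | inj₁ (x , _) = inj₁ x
    ... | inj₂ (y , _) = place y
    from : V G₁ ⊎ Σ (V G₂) Out → V G
    from (inj₁ x) = f₁ x
    from (inj₂ (y , _)) = f₂ y
    from-place : ∀ y → from (place y) ≡ f₂ y
    from-place y with y ≟ τ' 0F | y ≟ τ' 1F | y ≟ τ' 2F
    ... | yes refl | _ | _ = on 0F
    ... | no _ | yes refl | _ = on 1F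
    ... | no _ | no _ | yes refl = on 2F
    ... | no a | no b | no c = refl
    not-out : ∀ i → ¬ Out (τ' i)
    not-out 0F (a , _) = a refl
    not-out 1F (_ , b , _) = b refl
    not-out 2F (_ , _ , c) = c refl
    ft : ∀ z → from (to z) ≡ z
    ft z with cov z
    ... | inj₁ (x , e) = sym e
    ... | inj₂ (y , e) = trans (from-place y) (sym e)
    from-inj : ∀ a b → from a ≡ from b → a ≡ b
    from-inj (inj₁ x) (inj₁ y) e = cong inj₁ (inj₁' e)
    from-inj (inj₁ x) (inj₂ (y , o)) e with meet x y e
    ... | i , _ , refl = ⊥-elim (not-out i o)
    from-inj (inj₂ (y , o)) (inj₁ x) e with meet x y (sym e)
    ... | i , _ , refl = ⊥-elim (not-out i o)
    from-inj (inj₂ (x , o)) (inj₂ (y , o')) e with inj₂' e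
    ... | refl = refl
    across : ∀ x (y : Σ (V G₂) Out) → Adj G (f₁ x) (f₂ (proj₁ y)) →
      (x ≡ τ 0F × Adj G₂ (τ' 0F) (proj₁ y)) ⊎ (x ≡ τ 1F × Adj G₂ (τ' 1F) (proj₁ y)) ⊎ (x ≡ τ 2F × Adj G₂ (τ' 2F) (proj₁ y))
    across x (y , o) h with cross-e x y h
    ... | inj₂ (i , refl , _) = ⊥-elim (not-out i o)
    ... | inj₁ (0F , k) = inj₁ k
    ... | inj₁ (1F , k) = inj₂ (inj₁ k)
    ... | inj₁ (2F , k) = inj₂ (inj₂ k)

  of : GlueOf G₁ G₂ G (τ 0F) (τ 1F) (τ 2F) (τ' 0F) (τ' 1F) (τ' 2F)
  of = record
    { φ = mk↔ₛ′ to from (λ y → from-inj _ _ (ft (from y))) ft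
    ; adj₁ = adj₁ ; adj₂ = λ (x , _) (y , _) → adj₂ x y
    ; adj₁₂ = λ x y → mk⇔ (across x y)
        [ (λ (e , k) → cross-i x (proj₁ y) (inj₁ (0F , e , k))) , [ (λ (e , k) → cross-i x (proj₁ y) (inj₁ (1F , e , k)))
        , (λ (e , k) → cross-i x (proj₁ y) (inj₁ (2F , e , k))) ]′ ]′ }

  ι₂≡ : ∀ y → ι₂ of y ≡ f₂ y
  ι₂≡ y with y ≟ τ' 0F | y ≟ τ' 1F | y ≟ τ' 2F
  ... | yes refl | _ | _ = on 0F
  ... | no _ | yes refl | _ = on 1F
  ... | no _ | no _ | yes refl = on 2F
  ... | no a | no b | no c = refl

Same : {A : Set} → A → A → A → (Fin 3 → A) → Set
Same x y z τ = SameTriple x y z (τ 0F) (τ 1F) (τ 2F)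

glueIt : ∀ {G₁ G₂ G τ τ' A₁ A₂} (gl : Glue G₁ G₂ G τ τ') → Glued G₁ A₁ → Glued G₂ A₂ →
  A₁ (τ 0F) (τ 1F) (τ 2F) → A₂ (τ' 0F) (τ' 1F) (τ' 2F) →
  Σ (Tri G) λ A → Glued G A ×
    (∀ x y z → A₁ x y z → ¬ Same x y z τ → A (Glue.f₁ gl x) (Glue.f₁ gl y) (Glue.f₁ gl z)) ×
    (∀ x y z → A₂ x y z → ¬ Same x y z τ' → A (Glue.f₂ gl x) (Glue.f₂ gl y) (Glue.f₂ gl z))
glueIt {A₁ = A₁} {A₂} gl g₁ g₂ a₁ a₂ = glueAvail of A₁ A₂ , glue g₁ g₂ a₁ a₂ of ,
  (λ x y z a n → inj₁ (x , y , z , a , n , refl , refl , refl)) ,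
  (λ x y z a n → inj₂ (x , y , z , a , n , sym (ι₂≡ x) , sym (ι₂≡ y) , sym (ι₂≡ z)))
  where open ToGlueOf gl

glued-triangle : ∀ {G A} → Glued G A → ∀ {x y z} → A x y z → Triangle G x y z
glued-triangle (piece w) a = TriFace→triangle a
glued-triangle (glue {G₁} {G₂} g₁ g₂ a₁ a₂ g) a with FromGlueOf.toGlue g (glued-triangle g₁ a₁) (glued-triangle g₂ a₂)
  | a
... | gl | inj₁ (x , y , z , b , _ , refl , refl , refl) = let p , q , r = glued-triangle g₁ b in
  subst T (sym (GlueOf.adj₁ g x y)) p , subst T (sym (GlueOf.adj₁ g y z)) q , subst T (sym (GlueOf.adj₁ g z x)) r
... | gl | inj₂ (x , y , z , b , _ , refl , refl , refl) = let p , q , r = glued-triangle g₂ b in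
  Glue.up₂ gl' p , Glue.up₂ gl' q , Glue.up₂ gl' r
  where gl' = FromGlueOf.toGlue g (glued-triangle g₁ a₁) (glued-triangle g₂ a₂)

-- Splitting a cubic vertex of a gluing

MinDeg3 : Graph → Set
MinDeg3 G = ∀ v a b → ∃ λ c → Adj G v c × c ≢ a × c ≢ b

next²≢ : ∀ k (i : Fin (3 + k)) → next (next i) ≢ i
next²≢ k i e = lem (toℕ i) i refl e
  where
  lem : ∀ m (i : Fin (3 + k)) → toℕ i ≡ m → next (next i) ≡ i → ⊥
  lem zero zero _ e with () ← trans (sym (trans (cong next (next-inject₁ zero)) (next-inject₁ (suc zero)))) e
  lem (suc m) (suc j) q e = lem m (inject₁ j) (trans (toℕ-inject₁ j) (suc-injective q))
    (next-inj (trans (cong (next ∘ next) (next-inject₁ j)) (trans e (sym (next-inject₁ j)))))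

wheel-min : ∀ k → MinDeg3 (Wheel k)
wheel-min k zero a b with other3 {p = 1F} {2F} {3F} (λ ()) (λ ()) (λ ()) a b
... | _ , inj₁ refl , na , nb = 1F , tt , na , nb
... | _ , inj₂ (inj₁ refl) , na , nb = 2F , tt , na , nb
... | _ , inj₂ (inj₂ refl) , na , nb = 3F , tt , na , nb
wheel-min k (suc i) a b with other3 {p = zero} {suc (next i)} {suc (prev i)} (λ ())
  (suc≢ λ e → next²≢ k i (trans (cong next e) (next-prev i))) (λ ()) a b
... | _ , inj₁ refl , na , nb = zero , tt , na , nb
... | _ , inj₂ (inj₁ refl) , na , nb = suc (next i) , wheel-i k i (next i) (inj₁ refl) , na , nb
... | _ , inj₂ (inj₂ refl) , na , nb = suc (prev i) , wheel-i k i (prev i) (inj₂ (next-prev i)) , na , nb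

glued-min : ∀ {G A} → Glued G A → MinDeg3 G
glued-min (piece (k , w)) v a b with wheel-min k (Iso.to (≅→iso w) v) (Iso.to (≅→iso w) a) (Iso.to (≅→iso w) b)
... | c , h , na , nb = Iso.from I c , subst T (sym (trans (sym (Iso.adj-to I v (Iso.from I c))) (cong (adj (Wheel k) (Iso.to I v)) (Iso.tofrom I c)))) h ,
    (λ { refl → na (sym (Iso.tofrom I c)) }) , λ { refl → nb (sym (Iso.tofrom I c)) }
  where I = ≅→iso w
glued-min {G} (glue {G₁} {G₂} g₁ g₂ a₁ a₂ g) v a b = go (Glue.cov gl v)
  where
  gl = FromGlueOf.toGlue g (glued-triangle g₁ a₁) (glued-triangle g₂ a₂)
  open Glue gl
  -- A vertex to be avoided that does not lie on this side imposes no condition; `x` stands in for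
  -- it.
  avoid : ∀ {K : Graph} (f : V K → V G) → V K → V G → V K
  avoid {K} f x z with any? (λ y → f y ≟ z)
  ... | yes (y , _) = y
  ... | no _ = x
  avoid-ok : ∀ {K : Graph} (f : V K → V G) x z c → (∀ {x y} → f x ≡ f y → x ≡ y) → c ≢ avoid {K} f x z → f c ≢ z
  avoid-ok f x z c inj n e with any? (λ y → f y ≟ z)
  ... | yes (y , q) = n (inj (trans e (sym q)))
  ... | no m = m (c , e)
  go : (∃ λ x → v ≡ f₁ x) ⊎ (∃ λ y → v ≡ f₂ y) → ∃ λ c → Adj G v c × c ≢ a × c ≢ b
  go (inj₁ (x , refl)) with glued-min g₁ x (avoid {G₁} f₁ x a) (avoid {G₁} f₁ x b)
  ... | c , h , na , nb = f₁ c , up₁ h , avoid-ok {G₁} f₁ x a c inj₁' na , avoid-ok {G₁} f₁ x b c inj₁' nb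
  go (inj₂ (x , refl)) with glued-min g₂ x (avoid {G₂} f₂ x a) (avoid {G₂} f₂ x b)
  ... | c , h , na , nb = f₂ c , up₂ h , avoid-ok {G₂} f₂ x a c inj₂' na , avoid-ok {G₂} f₂ x b c inj₂' nb

does-e : ∀ {A : Set} (d : Dec A) → T (does d) → A
does-e (yes a) _ = a

does-i : ∀ {A : Set} (d : Dec A) → A → T (does d)
does-i (yes _) _ = tt
does-i (no n)  a = n a

module _ {A : Set} {x y z : A} where
  private
    side : ∀ {a} → a ≡ x ⊎ a ≡ y ⊎ a ≡ z → Fin 3
    side (inj₁ _)        = 0F
    side (inj₂ (inj₁ _)) = 1F
    side (inj₂ (inj₂ _)) = 2F

    side-inj : ∀ {a b} (p : a ≡ x ⊎ a ≡ y ⊎ a ≡ z) (q : b ≡ x ⊎ b ≡ y ⊎ b ≡ z) → side p ≡ side q → a ≡ b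
    side-inj (inj₁ refl) (inj₁ refl) _ = refl
    side-inj (inj₂ (inj₁ refl)) (inj₂ (inj₁ refl)) _ = refl
    side-inj (inj₂ (inj₂ refl)) (inj₂ (inj₂ refl)) _ = refl
    side-inj (inj₁ _) (inj₂ (inj₁ _)) ()
    side-inj (inj₁ _) (inj₂ (inj₂ _)) ()
    side-inj (inj₂ (inj₁ _)) (inj₁ _) ()
    side-inj (inj₂ (inj₁ _)) (inj₂ (inj₂ _)) ()
    side-inj (inj₂ (inj₂ _)) (inj₁ _) ()
    side-inj (inj₂ (inj₂ _)) (inj₂ (inj₁ _)) ()

  four-in-three : (f : Fin 4 → A) → (∀ i → f i ≡ x ⊎ f i ≡ y ⊎ f i ≡ z) → (∀ i j → f i ≡ f j → i ≡ j) → ⊥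
  four-in-three f h inj with pigeonhole {3} {4} ≤-refl (λ i → side (h i))
  ... | i , j , lt , e = <-irrefl (cong toℕ (inj i j (side-inj (h i) (h j) e))) lt

hub-not-cubic : ∀ k {x y z} → ¬ Deg3 (Wheel (suc k)) zero x y z
hub-not-cubic k d = four-in-three (λ i → suc (i ↑ˡ k)) (λ i → Deg3.all d (suc (i ↑ˡ k)) tt)
  λ i j e → ↑ˡ-injective k i j (fsuc-inj e)

-- The triangles `b t x` and `b t y` both contain the hub once the rim has length at least four. The
-- hub is not `t`, which is cubic; if it were not `b` either, it would be both `x` and `y`.
std-cubic : ∀ k {t b x y} → Deg3 (Wheel k) t b x y → Adj (Wheel k) b x → Adj (Wheel k) b y → Std k b t y
std-cubic zero {t} {b} {x} {y} d bx by = std-W0 b t y (λ e → adj≢ (Wheel 0) {t} {b} (Deg3.ax d) (sym e))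
  (adj≢ (Wheel 0) {t} {y} (Deg3.az d)) (adj≢ (Wheel 0) {b} {y} by)
std-cubic (suc k) {t} {b} {x} {y} d bx by = go (hasHub k {b} {t} {y} (bt , Deg3.az d , Adj-sym W {b} {y} by))
    (hasHub k {b} {t} {x} (bt , Deg3.ay d , Adj-sym W {b} {x} bx)) d
  where
  W = Wheel (suc k)
  bt : Adj W b t
  bt = Adj-sym W {t} {b} (Deg3.ax d)
  go : ∀ {t b x y} → HasHub {k} b t y → HasHub {k} b t x → Deg3 W t b x y → Std (suc k) b t y
  go (hub₁ r) _ _ = std-hub (suc k) _ _ r
  go (hub₂ r) _ d = ⊥-elim (hub-not-cubic k d)
  go (hub₃ r) (hub₃ _) d = ⊥-elim (Deg3.y≢z d refl)

iso-Deg3 : ∀ {G H} (I : Iso G H) {h x y z} → Deg3 G h x y z → Deg3 H (Iso.to I h) (Iso.to I x) (Iso.to I y) (Iso.to I z)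
iso-Deg3 {G} {H} I {h} (mkD3 ax ay az n₁ n₂ n₃ all) = mkD3 (iso-adj I ax) (iso-adj I ay) (iso-adj I az)
  (n₁ ∘ to-inj) (n₂ ∘ to-inj) (n₃ ∘ to-inj)
  λ w k → [ inj₁ ∘ back , [ inj₂ ∘ inj₁ ∘ back , inj₂ ∘ inj₂ ∘ back ]′ ]′
    (all (from w) (iso-adj⁻ I (subst (Adj H (to h)) (sym (tofrom w)) k)))
  where
  open Iso I
  back : ∀ {w x} → from w ≡ x → w ≡ to x
  back refl = sym (tofrom _)

-- The triple `b`, `t`, `y` and the triple of hub, last and first rim vertex are both in standard
-- position. An automorphism matches them, and `wheel-suc` applies.
split-wheel : ∀ {G k} (w : G ≅ Wheel k) {t b x y} → Deg3 G t b x y → Adj G b x → Adj G b y →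
  ∀ {G*} → Iso G* (sub G t y b) → IsWheel G*
split-wheel {G} {k} w d bx by J = suc k , iso→≅ (iso-trans J (iso-trans (sub-iso θ et ey eb) (wheel-suc k)))
  where
  I = ≅→iso w
  s = std-cubic k (iso-Deg3 I d) (iso-adj I bx) (iso-adj I by)
  s₀ = std-hub k (fromℕ (2 + k)) zero (inj₁ (next-last (2 + k)))
  θ : Iso G (Wheel k)
  θ = iso-trans I (iso-trans (proj₁ s) (iso-sym (proj₁ s₀)))
  back : ∀ {x z} → Iso.to (proj₁ s₀) x ≡ z → Iso.from (proj₁ s₀) z ≡ x
  back refl = Iso.fromto (proj₁ s₀) _
  eb = trans (cong (Iso.from (proj₁ s₀)) (proj₁ (proj₂ s))) (back (proj₁ (proj₂ s₀)))
  et = trans (cong (Iso.from (proj₁ s₀)) (proj₁ (proj₂ (proj₂ s)))) (back (proj₁ (proj₂ (proj₂ s₀))))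
  ey = trans (cong (Iso.from (proj₁ s₀)) (proj₂ (proj₂ (proj₂ s)))) (back (proj₂ (proj₂ (proj₂ s₀))))

Touch : ∀ {m} → Fin m → Fin (suc m) → Set
Touch t x = x ≡ zero ⊎ x ≡ suc t

-- Splitting a cubic vertex t between its neighbours x and y, towards b, keeps the graph glued
-- from wheels: t lies in a single piece, a wheel with hub b, and that wheel grows by one.
record SplitGlued {G' : Graph} (A' : Tri G') {G : Graph} {t y b : V G'} (I : Iso G (sub G' t y b)) : Set₁ where
  constructor splitGlued
  field
    A     : Tri G
    glued : Glued G A
    old   : ∀ u v w → A' u v w → u ≢ t → v ≢ t → w ≢ t → A (Iso.from I (suc u)) (Iso.from I (suc v)) (Iso.from I (suc w))
    new   : ∀ u v w → Triangle G u v w → Touch t (Iso.to I u) ⊎ Touch t (Iso.to I v) ⊎ Touch t (Iso.to I w) → A u v w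

Splits : (G' : Graph) → Tri G' → Set₁
Splits G' A' = ∀ {t b x y} → Deg3 G' t b x y → Adj G' b x → Adj G' b y → ∀ {G} (I : Iso G (sub G' t y b)) → SplitGlued A' I

-- All neighbours of a private vertex lie on its side, so `t` is cubic there too and the splitting
-- of `G₁` applies. The shared triangle does not contain `t₁`; it stays available, and the sides can
-- be glued as before.
split-side : ∀ {G₁ G₂ G' τ τ' A₁ A₂} {A' : Tri G'} (gl : Glue G₁ G₂ G' τ τ') → Splits G₁ A₁ → Glued G₂ A₂ →
  A₁ (τ 0F) (τ 1F) (τ 2F) → A₂ (τ' 0F) (τ' 1F) (τ' 2F) →
  (∀ {x y z} → A' x y z →
    (∃ λ u → ∃₂ λ v w → A₁ u v w × ¬ Same u v w τ × x ≡ Glue.f₁ gl u × y ≡ Glue.f₁ gl v × z ≡ Glue.f₁ gl w) ⊎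
    (∃ λ u → ∃₂ λ v w → A₂ u v w × ¬ Same u v w τ' × x ≡ Glue.f₂ gl u × y ≡ Glue.f₂ gl v × z ≡ Glue.f₂ gl w)) →
  ∀ {t₁ t b x y} → t ≡ Glue.f₁ gl t₁ → (∀ i → t₁ ≢ τ i) → Deg3 G' t b x y → Adj G' b x → Adj G' b y →
  ∀ {G} (I : Iso G (sub G' t y b)) → SplitGlued A' I
split-side {G₁} {G₂} {G'} {τ} {τ'} {A₁} {A₂} {A'} gl S₁ g₂ a₁ a₂ avail {t₁} {t} {b} {x} {y} refl nt d bx by {G} I
  with Glue.pull gl nt (Deg3.ax d) | Glue.pull gl nt (Deg3.ay d) | Glue.pull gl nt (Deg3.az d)
... | b₁ , refl | x₁ , refl | y₁ , refl = splitGlued (proj₁ R) (proj₁ (proj₂ R)) old new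
  where
  open Glue gl
  d₁ : Deg3 G₁ t₁ b₁ x₁ y₁
  d₁ = mkD3 (down₁ (Deg3.ax d)) (down₁ (Deg3.ay d)) (down₁ (Deg3.az d))
    (Deg3.x≢y d ∘ cong f₁) (Deg3.y≢z d ∘ cong f₁) (Deg3.x≢z d ∘ cong f₁)
    λ w h → [ inj₁ ∘ inj₁' , [ inj₂ ∘ inj₁ ∘ inj₁' , inj₂ ∘ inj₂ ∘ inj₁' ]′ ]′ (Deg3.all d (f₁ w) (up₁ h))
  open SplitGlued (S₁ d₁ (down₁ bx) (down₁ by) iso-refl) renaming (A to A₁°; glued to g₁°; old to old₁; new to new₁)
  gl⁺ : Glue (sub G₁ t₁ y₁ b₁) G₂ (sub G' (f₁ t₁) (f₁ y₁) (f₁ b₁)) (suc ∘ τ) τ'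
  gl⁺ = glue-sub gl refl refl refl nt
  gl° : Glue (sub G₁ t₁ y₁ b₁) G₂ G (suc ∘ τ) τ'
  gl° = glue-out gl⁺ (iso-sym I)
  module O = Glue gl°
  R = glueIt gl° g₁° g₂ (old₁ _ _ _ a₁ (nt 0F ∘ sym) (nt 1F ∘ sym) (nt 2F ∘ sym)) a₂
  ι : V G' → V G
  ι u = Iso.from I (suc u)
  unsuc : ∀ {u v w} → ¬ Same u v w τ → ¬ Same (suc u) (suc v) (suc w) (suc ∘ τ)
  unsuc n (a , b , c) = n (un a , un b , un c)
    where
    un : ∀ {m} {u x y z : Fin m} → suc u ≡ suc x ⊎ suc u ≡ suc y ⊎ Fin.suc u ≡ suc z → u ≡ x ⊎ u ≡ y ⊎ u ≡ z
    un = [ inj₁ ∘ fsuc-inj , [ inj₂ ∘ inj₁ ∘ fsuc-inj , inj₂ ∘ inj₂ ∘ fsuc-inj ]′ ]′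
  old : ∀ u v w → A' u v w → u ≢ t → v ≢ t → w ≢ t → proj₁ R (ι u) (ι v) (ι w)
  old u v w a n₁ n₂ n₃ with avail a
  ... | inj₁ (u₁ , v₁ , w₁ , a₁' , ns , refl , refl , refl) = proj₁ (proj₂ (proj₂ R)) (suc u₁) (suc v₁) (suc w₁)
          (old₁ _ _ _ a₁' (n₁ ∘ cong f₁) (n₂ ∘ cong f₁) (n₃ ∘ cong f₁)) (unsuc ns)
  ... | inj₂ (u₂ , v₂ , w₂ , a₂' , ns , refl , refl , refl) = proj₂ (proj₂ (proj₂ R)) u₂ v₂ w₂ a₂' ns

  touch₁ : ∀ {u} → Touch t (Iso.to I u) → ∃ λ z → u ≡ O.f₁ z × Touch t₁ z
  touch₁ {u} (inj₁ e) = zero , trans (sym (Iso.fromto I u)) (cong (Iso.from I) e) , inj₁ refl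
  touch₁ {u} (inj₂ e) = suc t₁ , trans (sym (Iso.fromto I u)) (cong (Iso.from I) e) , inj₂ refl
  free : ∀ {z} → Touch t₁ z → ∀ i → z ≢ suc (τ i)
  free (inj₁ refl) i ()
  free (inj₂ refl) i e = nt i (fsuc-inj e)
  not-same : ∀ {z} → Touch t₁ z → ¬ (z ≡ suc (τ 0F) ⊎ z ≡ suc (τ 1F) ⊎ z ≡ suc (τ 2F))
  not-same h = [ free h 0F , [ free h 1F , free h 2F ]′ ]′
  new : ∀ u v w → Triangle G u v w → Touch t (Iso.to I u) ⊎ Touch t (Iso.to I v) ⊎ Touch t (Iso.to I w) → proj₁ R u v w
  new u v w (p , q , r) (inj₁ h) with touch₁ h
  ... | u₁ , refl , h₁ with O.pull (free h₁) p | O.pull (free h₁) (Adj-sym G r)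
  ... | v₁ , refl | w₁ , refl = proj₁ (proj₂ (proj₂ R)) u₁ v₁ w₁ (new₁ u₁ v₁ w₁ (O.down₁ p , O.down₁ q , O.down₁ r) (inj₁ h₁))
          λ (s , _) → not-same h₁ s
  new u v w (p , q , r) (inj₂ (inj₁ h)) with touch₁ h
  ... | v₁ , refl , h₁ with O.pull (free h₁) (Adj-sym G p) | O.pull (free h₁) q
  ... | u₁ , refl | w₁ , refl = proj₁ (proj₂ (proj₂ R)) u₁ v₁ w₁ (new₁ u₁ v₁ w₁ (O.down₁ p , O.down₁ q , O.down₁ r) (inj₂ (inj₁ h₁)))
          λ (_ , s , _) → not-same h₁ s
  new u v w (p , q , r) (inj₂ (inj₂ h)) with touch₁ h
  ... | w₁ , refl , h₁ with O.pull (free h₁) r | O.pull (free h₁) (Adj-sym G q)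
  ... | u₁ , refl | v₁ , refl = proj₁ (proj₂ (proj₂ R)) u₁ v₁ w₁ (new₁ u₁ v₁ w₁ (O.down₁ p , O.down₁ q , O.down₁ r) (inj₂ (inj₂ h₁)))
          λ (_ , _ , s) → not-same h₁ s

-- A vertex shared by both sides of a gluing keeps a private neighbour on each side.
shared-not-cubic : ∀ {G₁ G₂ G τ τ'} (gl : Glue G₁ G₂ G τ τ') → IsTri G₁ τ → MinDeg3 G₁ → MinDeg3 G₂ →
  ∀ i {x y z} → ¬ Deg3 G (Glue.f₁ gl (τ i)) x y z
shared-not-cubic {G₁} {G₂} {G} {τ} {τ'} gl t m₁ m₂ i {x} {y} {z} d = go (rest i)
  where
  open Glue gl
  rest : ∀ i → ∃₂ λ j k → i ≢ j × i ≢ k × j ≢ k × (∀ l → l ≡ i ⊎ l ≡ j ⊎ l ≡ k)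
  rest 0F = 1F , 2F , (λ ()) , (λ ()) , (λ ()) , λ { 0F → inj₁ refl ; 1F → inj₂ (inj₁ refl) ; 2F → inj₂ (inj₂ refl) }
  rest 1F = 0F , 2F , (λ ()) , (λ ()) , (λ ()) , λ { 1F → inj₁ refl ; 0F → inj₂ (inj₁ refl) ; 2F → inj₂ (inj₂ refl) }
  rest 2F = 0F , 1F , (λ ()) , (λ ()) , (λ ()) , λ { 2F → inj₁ refl ; 0F → inj₂ (inj₁ refl) ; 1F → inj₂ (inj₂ refl) }
  go : (∃₂ λ j k → i ≢ j × i ≢ k × j ≢ k × (∀ l → l ≡ i ⊎ l ≡ j ⊎ l ≡ k)) → ⊥
  go (j , k , n₁ , n₂ , n₃ , al) with m₁ (τ i) (τ j) (τ k) | m₂ (τ' i) (τ' j) (τ' k)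
  ... | c₁ , h₁ , a₁ , b₁ | c₂ , h₂ , a₂ , b₂ = four-in-three f (λ l → Deg3.all d (f l) (adjacent l)) inj
    where
    f : Fin 4 → V G
    f 0F = f₁ (τ j)
    f 1F = f₁ (τ k)
    f 2F = f₁ c₁
    f 3F = f₂ c₂
    adjacent : ∀ l → Adj G (f₁ (τ i)) (f l)
    adjacent 0F = up₁ (t i j n₁)
    adjacent 1F = up₁ (t i k n₂)
    adjacent 2F = up₁ h₁
    adjacent 3F = subst (λ u → Adj G u (f₂ c₂)) (sym (on i)) (up₂ h₂)
    c₂-off : ∀ l → f₁ (τ l) ≢ f₂ c₂
    c₂-off l e with al l
    ... | inj₁ refl = adj≢ G₂ h₂ (inj₂' (trans (sym (on i)) e))
    ... | inj₂ (inj₁ refl) = a₂ (inj₂' (trans (sym e) (on j)))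
    ... | inj₂ (inj₂ refl) = b₂ (inj₂' (trans (sym e) (on k)))
    c₁₂ : f₁ c₁ ≢ f₂ c₂
    c₁₂ e with meet c₁ c₂ e
    ... | l , refl , refl = c₂-off l (on l)
    inj : ∀ a b → f a ≡ f b → a ≡ b
    inj 0F 0F _ = refl
    inj 1F 1F _ = refl
    inj 2F 2F _ = refl
    inj 3F 3F _ = refl
    inj 0F 1F e = ⊥-elim (n₃ (tri-inj {G₁} {τ} t (inj₁' e)))
    inj 1F 0F e = ⊥-elim (n₃ (tri-inj {G₁} {τ} t (inj₁' (sym e))))
    inj 0F 2F e = ⊥-elim (a₁ (inj₁' (sym e)))
    inj 2F 0F e = ⊥-elim (a₁ (inj₁' e))
    inj 1F 2F e = ⊥-elim (b₁ (inj₁' (sym e)))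
    inj 2F 1F e = ⊥-elim (b₁ (inj₁' e))
    inj 0F 3F e = ⊥-elim (c₂-off j e)
    inj 3F 0F e = ⊥-elim (c₂-off j (sym e))
    inj 1F 3F e = ⊥-elim (c₂-off k e)
    inj 3F 1F e = ⊥-elim (c₂-off k (sym e))
    inj 2F 3F e = ⊥-elim (c₁₂ e)
    inj 3F 2F e = ⊥-elim (c₁₂ (sym e))

split-glued : ∀ {G' A'} → Glued G' A' → Splits G' A'
split-glued {G'} (piece (k , w)) {t} {b} {x} {y} d bx by {G} I = splitGlued (TriFace G) (piece W)
  (λ u v z a n₁ n₂ n₃ → let p , q , r = TriFace→triangle a in
     wheel-TriFace W (up p n₁ n₂ , up q n₂ n₃ , up r n₃ n₁))
  (λ u v z t _ → wheel-TriFace W t)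
  where
  W : IsWheel G
  W = split-wheel w d bx by I
  up : ∀ {u v} → Adj G' u v → u ≢ t → v ≢ t → Adj G (Iso.from I (suc u)) (Iso.from I (suc v))
  up {u} {v} h n₁ n₂ = subst T (sym (Iso.adj-from I (suc u) (suc v))) (delEdge-i (adj G') h (n₁ ∘ proj₁) (n₂ ∘ proj₂))
split-glued (glue {G₁} {G₂} {G'} {A₁} {A₂} {u} {v} {w} {u'} {v'} {w'} g₁ g₂ a₁ a₂ g) {t} {b} {x} {y} d bx by I = go (Glue.cov gl t)
  where
  gl = FromGlueOf.toGlue g (glued-triangle g₁ a₁) (glued-triangle g₂ a₂)
  open Glue gl
  τ = tri u v w
  τ' = tri u' v' w'
  t₁ : IsTri G₁ τ
  t₁ = isTri {G₁} (glued-triangle g₁ a₁)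
  shared : ∀ i → t ≢ f₁ (τ i)
  shared i refl = shared-not-cubic gl t₁ (glued-min g₁) (glued-min g₂) i d
  go : (∃ λ x → t ≡ f₁ x) ⊎ (∃ λ y → t ≡ f₂ y) → SplitGlued (glueAvail g A₁ A₂) I
  go (inj₁ (s , e)) = split-side gl (split-glued g₁) g₂ a₁ a₂ id {t₁ = s} e (λ { i refl → shared i e }) d bx by I
  go (inj₂ (s , e)) = split-side (glue-swap gl) (split-glued g₂) g₁ a₂ a₁ [ inj₂ , inj₁ ]′ {t₁ = s} e
    (λ { i refl → shared i (trans e (sym (on i))) }) d bx by I

-- Regrouping a gluing

record Induced (G : Graph) (P : V G → Bool) : Set where
  field
    K     : Graph
    emb   : V K → V G
    emb-inj : ∀ {x y} → emb x ≡ emb y → x ≡ y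
    emb-adj : ∀ x y → adj G (emb x) (emb y) ≡ adj K x y
    emb-P : ∀ x → T (P (emb x))
    idx   : ∀ z → T (P z) → ∃ λ x → emb x ≡ z

record Enum {n : ℕ} (P : Fin n → Bool) : Set where
  field
    m     : ℕ
    e     : Fin m → Fin n
    e-inj : ∀ {x y} → e x ≡ e y → x ≡ y
    e-P   : ∀ x → T (P (e x))
    e-idx : ∀ z → T (P z) → ∃ λ x → e x ≡ z

enum : ∀ {n} (P : Fin n → Bool) → Enum P
enum {zero} P = record { m = 0 ; e = λ () ; e-inj = λ {} ; e-P = λ () ; e-idx = λ () }
enum {suc n} P with P zero in eq | enum (P ∘ suc)
... | true | E = record { m = suc m ; e = lift0 e ; e-inj = lift0-inj e-inj
    ; e-P = λ { zero → subst T (sym eq) tt ; (suc x) → e-P x }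
    ; e-idx = λ { zero _ → zero , refl ; (suc z) h → let x , q = e-idx z h in suc x , cong suc q } }
  where open Enum E
... | false | E = record { m = m ; e = suc ∘ e ; e-inj = λ q → e-inj (fsuc-inj q) ; e-P = e-P
    ; e-idx = λ { zero h → ⊥-elim (subst T eq h) ; (suc z) h → let x , q = e-idx z h in x , cong suc q } }
  where open Enum E

induced : (G : Graph) (P : V G → Bool) → Induced G P
induced G P = record
  { K = record { n = m ; adj = λ x y → adj G (e x) (e y) ; adj-sym = λ x y → adj-sym G _ _ ; adj-irr = λ x → adj-irr G _ }
  ; emb = e ; emb-inj = e-inj ; emb-adj = λ _ _ → refl ; emb-P = e-P ; idx = e-idx }
  where open Enum (enum P)

-- (Ga + Gb) is glued to G₁ along a triangle of Ga; regroup as (G₁ + Ga) + Gb.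
module Assoc {G₁ Ga Gb G₂ G : Graph} {τ : Fin 3 → V G₁} {τ' : Fin 3 → V G₂} {σa : Fin 3 → V Ga} {σb : Fin 3 → V Gb}
  (gl : Glue G₁ G₂ G τ τ') (gl₂ : Glue Ga Gb G₂ σa σb) {t : Fin 3 → V Ga} (te : ∀ i → τ' i ≡ Glue.f₁ gl₂ (t i)) where
  private
    module L = Glue gl
    module R = Glue gl₂
    In : V G → Set
    In z = (∃ λ x → L.f₁ x ≡ z) ⊎ (∃ λ y → L.f₂ (R.f₁ y) ≡ z)
    In? : ∀ z → Dec (In z)
    In? z = any? (λ x → L.f₁ x ≟ z) ⊎-dec any? (λ y → L.f₂ (R.f₁ y) ≟ z)
    P : V G → Bool
    P z = does (In? z)
    P-e : ∀ {z} → T (P z) → In z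
    P-e {z} = does-e (In? z)
    P-i : ∀ {z} → In z → T (P z)
    P-i {z} = does-i (In? z)
  open Induced (induced G P) public
  private
    a₁ : V G₁ → V K
    a₁ x = proj₁ (idx (L.f₁ x) (P-i (inj₁ (x , refl))))
    a₁-e : ∀ x → emb (a₁ x) ≡ L.f₁ x
    a₁-e x = proj₂ (idx (L.f₁ x) (P-i (inj₁ (x , refl))))
    aa : V Ga → V K
    aa y = proj₁ (idx (L.f₂ (R.f₁ y)) (P-i (inj₂ (y , refl))))
    aa-e : ∀ y → emb (aa y) ≡ L.f₂ (R.f₁ y)
    aa-e y = proj₂ (idx (L.f₂ (R.f₁ y)) (P-i (inj₂ (y , refl))))

  inner : Glue G₁ Ga K τ t
  inner = record
    { f₁ = a₁ ; f₂ = aa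
    ; inj₁' = λ {x} {y} q → L.inj₁' (trans (sym (a₁-e x)) (trans (cong emb q) (a₁-e y)))
    ; inj₂' = λ {x} {y} q → R.inj₁' (L.inj₂' (trans (sym (aa-e x)) (trans (cong emb q) (aa-e y))))
    ; adj₁ = λ x y → trans (sym (emb-adj _ _)) (trans (cong₂ (adj G) (a₁-e x) (a₁-e y)) (L.adj₁ x y))
    ; adj₂ = λ x y → trans (sym (emb-adj _ _)) (trans (cong₂ (adj G) (aa-e x) (aa-e y)) (trans (L.adj₂ _ _) (R.adj₁ x y)))
    ; cov = λ z → [ (λ (x , q) → inj₁ (x , emb-inj (trans (sym q) (sym (a₁-e x))))) ,
                    (λ (y , q) → inj₂ (y , emb-inj (trans (sym q) (sym (aa-e y))))) ]′ (P-e (emb-P z))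
    ; on = λ i → emb-inj (trans (a₁-e (τ i)) (trans (L.on i) (trans (cong L.f₂ (te i)) (sym (aa-e (t i))))))
    ; meet = λ x y q → let i , u , v = L.meet x (R.f₁ y) (trans (sym (a₁-e x)) (trans (cong emb q) (aa-e y))) in
        i , u , R.inj₁' (trans v (te i))
    ; sep = λ x y h → [ inj₁ , (λ (i , q) → inj₂ (i , R.inj₁' (trans q (te i)))) ]′
        (L.sep x (R.f₁ y) (subst₂ (Adj G) (a₁-e x) (aa-e y) (subst T (sym (emb-adj _ _)) h))) }

  outer : Glue K Gb G (aa ∘ σa) σb
  outer = record
    { f₁ = emb ; f₂ = L.f₂ ∘ R.f₂ ; inj₁' = emb-inj ; inj₂' = R.inj₂' ∘ L.inj₂'
    ; adj₁ = emb-adj ; adj₂ = λ x y → trans (L.adj₂ _ _) (R.adj₂ x y)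
    ; cov = cv ; on = λ i → trans (aa-e (σa i)) (cong L.f₂ (R.on i)) ; meet = mt ; sep = sp }
    where
    cv : ∀ z → (∃ λ x → z ≡ emb x) ⊎ (∃ λ y → z ≡ L.f₂ (R.f₂ y))
    cv z with L.cov z
    ... | inj₁ (x , refl) = inj₁ (a₁ x , sym (a₁-e x))
    ... | inj₂ (u , refl) with R.cov u
    ... | inj₁ (y , refl) = inj₁ (aa y , sym (aa-e y))
    ... | inj₂ (y , refl) = inj₂ (y , refl)
    mt : ∀ x y → emb x ≡ L.f₂ (R.f₂ y) → ∃ λ i → x ≡ aa (σa i) × y ≡ σb i
    mt x y q with P-e (emb-P x)
    ... | inj₂ (u , q') with R.meet u y (L.inj₂' (trans q' q))
    ... | i , refl , v = i , emb-inj (trans (sym q') (sym (aa-e u))) , v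
    -- A vertex common to `G₁` and `Gb` lies on the triangle `t` of `Ga`, hence also on the triangle
    -- between `Ga` and `Gb`.
    mt x y q | inj₁ (u , q') with L.meet u (R.f₂ y) (trans q' q)
    ... | i , _ , v with R.meet (t i) y (trans (sym (te i)) (sym v))
    ... | j , e , w = j , emb-inj (trans q (trans (cong L.f₂ (trans v (trans (te i) (cong R.f₁ e)))) (sym (aa-e (σa j))))) , w
    sp : ∀ x y → Adj G (emb x) (L.f₂ (R.f₂ y)) → (∃ λ i → x ≡ aa (σa i)) ⊎ (∃ λ i → y ≡ σb i)
    sp x y h with P-e (emb-P x)
    ... | inj₂ (u , q) = [ (λ (i , e) → inj₁ (i , emb-inj (trans (sym q) (trans (cong (L.f₂ ∘ R.f₁) e) (sym (aa-e (σa i))))))) , inj₂ ]′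
            (R.sep u y (L.down₂ (subst (λ z → Adj G z _) (sym q) h)))
    ... | inj₁ (u , q) with L.sep u (R.f₂ y) (subst (λ z → Adj G z _) (sym q) h)
    ... | inj₂ (i , e) with R.meet (t i) y (trans (sym (te i)) (sym e))
    ... | j , _ , w = inj₂ (j , w)
    sp x y h | inj₁ (u , q) | inj₁ (i , refl) with trans (sym q) (trans (L.on i) (cong L.f₂ (te i)))
    ... | q' = [ (λ (j , e) → inj₁ (j , emb-inj (trans q' (trans (cong (L.f₂ ∘ R.f₁) e) (sym (aa-e (σa j))))))) , inj₂ ]′
            (R.sep (t i) y (L.down₂ (subst (λ z → Adj G z _) q' h)))

  emb-f₁ : ∀ x → emb (Glue.f₁ inner x) ≡ Glue.f₁ gl x
  emb-f₁ = a₁-e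

  emb-f₂ : ∀ y → emb (Glue.f₂ inner y) ≡ Glue.f₂ gl (Glue.f₁ gl₂ y)
  emb-f₂ = aa-e

-- From gluings to reductions

-- The faces around a cubic vertex are the places where a tetrahedron can be stacked on the dual by
-- an inverse (D3a).
record Cov {H G : Graph} (E : LE H G) (u v w : V G) : Set where
  constructor mkCov
  field
    {h a b c} : V H
    d  : Deg3 H h a b c
    ea : LE.lab E h a ≡ u
    eb : LE.lab E h b ≡ v
    ec : LE.lab E h c ≡ w

cov-rot : ∀ {H G} {E : LE H G} {u v w} → Cov E u v w → Cov E v w u
cov-rot (mkCov d ea eb ec) = mkCov (deg3-rot d) eb ec ea

cov-swap : ∀ {H G} {E : LE H G} {u v w} → Cov E u v w → Cov E u w v
cov-swap (mkCov d ea eb ec) = mkCov (deg3-swap d) ea ec eb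

-- Any two of three edges at a vertex are consecutive, so any two faces there share an edge.
cov-triangle : ∀ {H G} {E : LE H G} {u v w} → Cov E u v w → Triangle G u v w
cov-triangle {H} {G} {E} (mkCov {h} d refl refl refl) = pair d , pair (deg3-rot d) , pair (deg3-rot (deg3-rot d))
  where
  open LE E
  pair : ∀ {a b c} → Deg3 H h a b c → Adj G (lab h a) (lab h b)
  pair {a} {b} {c} d with rot3-cases ro d
  ... | inj₁ e = subst (Adj G (lab h a)) (sym (turn (Deg3.ax d) e)) (dual← h a (Deg3.ax d))
  ... | inj₂ e = subst (λ z → Adj G z (lab h b)) (sym (turn (Deg3.ay d) (proj₂ (rot3 ro (deg3-swap d) e))))
          (Adj-sym G (dual← h b (Deg3.ay d)))

cov-mirror : ∀ {H G} {E : LE H G} {u v w} → Cov E u v w → Cov (mirror E) u v w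
cov-mirror {H} {G} {E} (mkCov {h} {a} {b} {c} d refl refl refl) = mkCov d' (ev (Deg3.ax d)) (ev (Deg3.ay d)) (ev (Deg3.az d))
  where
  open LE E
  m : V H → V H
  m = LE.rt (mirror E) h
  ev : ∀ {x} → Adj H h x → lab (m x) h ≡ lab h x
  ev k = let l , e = rt-mirror E k in sym (turn l e)
  inj : ∀ {x y} → Adj H h x → Adj H h y → m x ≡ m y → x ≡ y
  inj k l e = trans (sym (proj₂ (rt-mirror E k))) (trans (cong (rt h) e) (proj₂ (rt-mirror E l)))
  d' : Deg3 H h (m a) (m b) (m c)
  d' = mkD3 (proj₁ (rt-mirror E (Deg3.ax d))) (proj₁ (rt-mirror E (Deg3.ay d))) (proj₁ (rt-mirror E (Deg3.az d)))
    (Deg3.x≢y d ∘ inj (Deg3.ax d) (Deg3.ay d)) (Deg3.y≢z d ∘ inj (Deg3.ay d) (Deg3.az d)) (Deg3.x≢z d ∘ inj (Deg3.ax d) (Deg3.az d))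
    λ w k → [ inj₁ ∘ back k , [ inj₂ ∘ inj₁ ∘ back k , inj₂ ∘ inj₂ ∘ back k ]′ ]′ (Deg3.all d (rt h w) (σ-adj ro h w k))
    where
    back : ∀ {w x} → Adj H h w → rt h w ≡ x → w ≡ m x
    back k refl = sym (mirror-rt E k)

record Oriented {H G : Graph} (E₀ : LE H G) (u v w : V G) : Set where
  field
    E   : LE H G
    cov : Cov E u v w
    ccw : LE.rt E (Cov.h cov) (Cov.a cov) ≡ Cov.c cov
    all : ∀ {x y z} → Cov E₀ x y z → Cov E x y z

orient : ∀ {H G} (E₀ : LE H G) {u v w} → Cov E₀ u v w → Oriented E₀ u v w
orient E₀ c@(mkCov {h} d refl refl refl) with rot3-cases (LE.ro E₀) d
... | inj₂ e = record { E = E₀ ; cov = c ; ccw = e ; all = id }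
... | inj₁ e = record { E = mirror E₀ ; cov = cov-mirror c
    ; ccw = cong m (trans (cong m (sym (proj₂ (rot3 (LE.ro E₀) d e)))) (mirror-rt E₀ (Deg3.az d))) ; all = cov-mirror }
  where m = LE.rt (mirror E₀) h

cov-pairs : ∀ {H G} {E : LE H G} {o u v w} → Cov E o u v → Cov E o v w → Cov E o u w →
  ∀ {y z} → y ≢ z → y ≡ u ⊎ y ≡ v ⊎ y ≡ w → z ≡ u ⊎ z ≡ v ⊎ z ≡ w → Cov E o y z
cov-pairs uv vw uw n (inj₁ refl) (inj₁ refl) = ⊥-elim (n refl)
cov-pairs uv vw uw n (inj₁ refl) (inj₂ (inj₁ refl)) = uv
cov-pairs uv vw uw n (inj₁ refl) (inj₂ (inj₂ refl)) = uw
cov-pairs uv vw uw n (inj₂ (inj₁ refl)) (inj₁ refl) = cov-swap uv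
cov-pairs uv vw uw n (inj₂ (inj₁ refl)) (inj₂ (inj₁ refl)) = ⊥-elim (n refl)
cov-pairs uv vw uw n (inj₂ (inj₁ refl)) (inj₂ (inj₂ refl)) = vw
cov-pairs uv vw uw n (inj₂ (inj₂ refl)) (inj₁ refl) = cov-swap uw
cov-pairs uv vw uw n (inj₂ (inj₂ refl)) (inj₂ (inj₁ refl)) = cov-swap vw
cov-pairs uv vw uw n (inj₂ (inj₂ refl)) (inj₂ (inj₂ refl)) = ⊥-elim (n refl)

-- The last rim triangle prs added to a growing wheel: a face f of H, across whose sides lie the
-- hub and the first rim vertex of the wheel.
record State {H G : Graph} (E : LE H G) (f hub first : V G) : Set where
  field
    {p r s p' r'} : V H
    dp  : Deg3 H p r s p'
    dr  : Deg3 H r p s r'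
    at  : TriangleAt E p r s
    X≢Y : LE.lab E p s ≢ LE.lab E s r
    l-f : LE.lab E p r ≡ f
    l-h : LE.lab E r p ≡ hub
    l-y : LE.lab E s r ≡ first

-- The vertex with faces `u`, `v`, `w` is blown up, hence the exception in `old`. Its three corners
-- provide the triangles at the apex `zero`.
record Stacked {H G : Graph} (E₀ : LE H G) (u v w : V G) : Set where
  field
    {H°}  : Graph
    E     : LE H° (stack G u v w)
    d3    : D3Reducible H°
    state : State E zero (suc u) (suc v)
    old   : ∀ {x y z} → Cov E₀ x y z → ¬ SameTriple x y z u v w → Cov E (suc x) (suc y) (suc z)
    new   : ∀ {y z} → Triangle (stack G u v w) zero y z → Cov E zero y z

stackStep : ∀ {H G} (E₀ : LE H G) → D3Reducible H → ∀ {u v w} → Cov E₀ u v w → Stacked E₀ u v w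
stackStep {H} {G} E₀ red {u} {v} {w} c₀ with orient E₀ c₀
... | record { E = E ; cov = mkCov {t} {a} {b} {c} d refl refl refl ; ccw = ccw ; all = all } = record
  { E = U.up ; d3 = step (inj₁ (toD3a d)) red
  ; state = record
      { dp = Bl.deg-p ; dr = Bl.deg-q ; at = U.tri°
      ; X≢Y = λ e → adj≢ G (proj₁ (proj₂ (cov-triangle {E = E} (mkCov d refl refl refl)))) (sym (fsuc-inj (trans (sym U.lab-pr) e)))
      ; l-f = U.lab-pq ; l-h = U.lab-qp ; l-y = refl }
  ; old = λ k ns → old (all k) ns ; new = new }
  where
  module U = BlowUp E d ccw
  module Bl = Blow d
  open LE E using (lab)
  old : ∀ {x y z} → Cov E x y z → ¬ SameTriple x y z (lab t a) (lab t b) (lab t c) → Cov U.up (suc x) (suc y) (suc z)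
  old (mkCov {h} {a'} {b'} {c'} d' refl refl refl) ns with same? h t
  ... | inj₂ n = mkCov (Bl.deg-old n d') (ev a') (ev b') (ev c')
    where
    ev : ∀ x → U.lab° (Bl.pt h) (Bl.κ h x) ≡ suc (lab h x)
    ev x = trans (U.lab-from n (Bl.κ h x)) (cong (λ z → suc (lab h z)) (Bl.κ⁻-κ h x))
  ... | inj₁ refl = ⊥-elim (ns (m (Deg3.ax d') , m (Deg3.ay d') , m (Deg3.az d')))
    where
    m : ∀ {x} → Adj H t x → lab t x ≡ lab t a ⊎ lab t x ≡ lab t b ⊎ lab t x ≡ lab t c
    m k = [ inj₁ ∘ cong (lab t) , [ inj₂ ∘ inj₁ ∘ cong (lab t) , inj₂ ∘ inj₂ ∘ cong (lab t) ]′ ]′ (Deg3.all d _ k)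
  C : V U.G° → V U.G° → Set
  C = Cov U.up zero
  uv : C (suc (lab t a)) (suc (lab t b))
  uv = mkCov (deg3-swap (deg3-rot Bl.deg-q)) refl U.lab-qp (U.lab-into Bl.b≢t zero)
  vw : C (suc (lab t b)) (suc (lab t c))
  vw = mkCov (deg3-swap (deg3-rot Bl.deg-r)) U.lab-rp refl (U.lab-into Bl.c≢t (suc zero))
  uw : C (suc (lab t a)) (suc (lab t c))
  uw = mkCov (deg3-swap Bl.deg-p) U.lab-pq refl U.lab-pr
  nbr : ∀ {y} → Adj U.G° zero y → y ≡ suc (lab t a) ⊎ y ≡ suc (lab t b) ⊎ y ≡ suc (lab t c)
  nbr {suc y} k = [ inj₁ ∘ cong suc , [ inj₂ ∘ inj₁ ∘ cong suc , inj₂ ∘ inj₂ ∘ cong suc ]′ ]′ (mem3-e k)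
  new : ∀ {y z} → Triangle U.G° zero y z → C y z
  new {y} {z} (p , q , r) = cov-pairs {E = U.up} uv vw uw (adj≢ U.G° {y} {z} q) (nbr {y} p) (nbr {z} (Adj-sym U.G° {z} {zero} r))

record Subbed {H G : Graph} (E₀ : LE H G) (t y b : V G) : Set where
  field
    {H°}  : Graph
    E     : LE H° (sub G t y b)
    d3    : D3Reducible H°
    state : State E zero (suc b) (suc y)
    old   : ∀ {u v w} → Cov E₀ u v w → u ≢ t → v ≢ t → w ≢ t → Cov E (suc u) (suc v) (suc w)
    new   : ∀ u v w → Triangle (sub G t y b) u v w → Touch t u ⊎ Touch t v ⊎ Touch t w → Cov E u v w

-- The split face `T` lies at each of `p`, `r` and `s`, so a cubic vertex away from `T` is left
-- alone. Listing the neighbours of `zero` and `T` shows that the triangles containing one of them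
-- are `zero T B`, `zero Y B` and `T B X`, the faces at `q`, `r` and `p`.
subStep : ∀ {H G} (E₀ : LE H G) → D3Reducible H → ∀ {t y b} → State E₀ t b y → Subbed E₀ t y b
subStep {H} {G} E₀ red record { p = p ; r = r ; s = s ; p' = p' ; r' = r' ; dp = dp ; dr = dr ; at = tri@(mkTri at-r at-s at-p) ; X≢Y = X≢Y ; l-f = refl ; l-h = refl ; l-y = refl } = record
  { E = U.up ; d3 = step (inj₂ (toD3b dp dr)) red
  ; state = record
      { dp = deg3-rot Sb.deg-q ; dr = Sb.deg-r ; at = U.tri°
      ; X≢Y = λ e → T≢Y (fsuc-inj (trans (sym U.lab-qs) (trans e lab-sr)))
      ; l-f = U.lab-qr ; l-h = U.lab-rq ; l-y = lab-sr }
  ; old = old ; new = new }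
  where
  module Sb = Sub dp dr
  module U = SubUp E₀ dp dr tri X≢Y
  open LE E₀
  Tf Bf Xf Yf : V G
  Tf = lab p r
  Bf = lab r p
  Xf = lab p s
  Yf = lab s r
  Gs : Graph
  Gs = sub G Tf Yf Bf
  T-rs : lab r s ≡ Tf
  T-rs = turn (Deg3.ax dr) at-r
  T-sp : lab s p ≡ Tf
  T-sp = trans (turn (Adj-sym H (Deg3.ay dr)) at-s) T-rs
  T≢Y : Tf ≢ Yf
  T≢Y e = loopless {r} {s} (Deg3.ay dr) (trans T-rs e)
  lab-sr : U.lab° (suc s) (suc r) ≡ suc Yf
  lab-sr = U.lab-oo λ (q , _) → Sb.r≢s (sym q)
  has : ∀ {u v w h f} (c : Cov E₀ u v w) → Cov.h c ≡ h → ∀ {x} → Adj H h x → lab h x ≡ f → u ≢ f → v ≢ f → w ≢ f → ⊥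
  has (mkCov d refl refl refl) refl k e n₁ n₂ n₃ with Deg3.all d _ k
  ... | inj₁ refl = n₁ e
  ... | inj₂ (inj₁ refl) = n₂ e
  ... | inj₂ (inj₂ refl) = n₃ e
  old : ∀ {u v w} → Cov E₀ u v w → u ≢ Tf → v ≢ Tf → w ≢ Tf → Cov U.up (suc u) (suc v) (suc w)
  old c@(mkCov {h} d refl refl refl) n₁ n₂ n₃ =
    mkCov (Sb.deg-old h≢p h≢r h≢s d) (U.lab-oo (h≢r ∘ proj₁)) (U.lab-oo (h≢r ∘ proj₁)) (U.lab-oo (h≢r ∘ proj₁))
    where
    h≢p : h ≢ p
    h≢p e = has c e (Deg3.ax dp) refl n₁ n₂ n₃
    h≢r : h ≢ r
    h≢r e = has c e (Deg3.ay dr) T-rs n₁ n₂ n₃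
    h≢s : h ≢ s
    h≢s e = has c e (Adj-sym H (Deg3.ay dp)) T-sp n₁ n₂ n₃
  rot-p : rt p r ≡ p'
  rot-p = proj₁ (rot3 ro (deg3-rot (deg3-rot (deg3-swap dp))) at-p)
  rot-r : rt r s ≡ r'
  rot-r = proj₁ (rot3 ro dr at-r)
  C : V Gs → V Gs → V Gs → Set
  C = Cov U.up
  zTB : C zero (suc Tf) (suc Bf)
  zTB = mkCov (deg3-rot Sb.deg-q) U.lab-qr U.lab-qs U.lab-qp
  zYB : C zero (suc Yf) (suc Bf)
  zYB = mkCov (deg3-rot Sb.deg-r) U.lab-rs (trans (U.lab-oo λ (_ , q) → Deg3.y≢z dr (sym q)) (cong suc (turn (Deg3.ay dr) rot-r))) U.lab-rq
  TBX : C (suc Tf) (suc Bf) (suc Xf)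
  TBX = mkCov (deg3-swap Sb.deg-p) U.lab-pq (trans (U.lab-oo (Sb.p≢r ∘ proj₁)) (cong suc (turn (Deg3.ax dp) rot-p)))
    (U.lab-oo (Sb.p≢r ∘ proj₁))
  nbr0 : ∀ {u} → Adj Gs zero u → u ≡ suc Tf ⊎ u ≡ suc Yf ⊎ u ≡ suc Bf
  nbr0 {suc u} k = [ inj₁ ∘ cong suc , [ inj₂ ∘ inj₁ ∘ cong suc , inj₂ ∘ inj₂ ∘ cong suc ]′ ]′ (mem3-e k)
  nbrT : ∀ {u} → Adj Gs (suc Tf) u → u ≡ zero ⊎ u ≡ suc Bf ⊎ u ≡ suc Xf
  nbrT {zero} k = inj₁ refl
  nbrT {suc u} k with delEdge-e (adj G) k
  ... | a , n , _ with dual→ Tf u a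
  ... | x , y , l , e , refl with face3-darts E₀ (Deg3.ax dp) (Deg3.ay dr) (Adj-sym H (Deg3.ay dp)) at-r at-s at-p l e
  ... | inj₁ (refl , refl) = inj₂ (inj₁ refl)
  ... | inj₂ (inj₁ (refl , refl)) = ⊥-elim (n (refl , refl))
  ... | inj₂ (inj₂ (refl , refl)) = inj₂ (inj₂ refl)
  ¬TY : ¬ Adj Gs (suc Tf) (suc Yf)
  ¬TY k = proj₁ (proj₂ (delEdge-e (adj G) k)) (refl , refl)
  at0 : ∀ {u v} → Triangle Gs zero u v → C zero u v
  at0 {u} {v} (a , b , c) with nbr0 {u} a | nbr0 {v} (Adj-sym Gs {v} {zero} c)
  ... | inj₁ refl | inj₁ refl = ⊥-elim (adj≢ Gs {u} {u} b refl)
  ... | inj₁ refl | inj₂ (inj₁ refl) = ⊥-elim (¬TY b)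
  ... | inj₁ refl | inj₂ (inj₂ refl) = zTB
  ... | inj₂ (inj₁ refl) | inj₁ refl = ⊥-elim (¬TY (Adj-sym Gs {suc Yf} {suc Tf} b))
  ... | inj₂ (inj₁ refl) | inj₂ (inj₁ refl) = ⊥-elim (adj≢ Gs {u} {u} b refl)
  ... | inj₂ (inj₁ refl) | inj₂ (inj₂ refl) = zYB
  ... | inj₂ (inj₂ refl) | inj₁ refl = cov-swap {E = U.up} zTB
  ... | inj₂ (inj₂ refl) | inj₂ (inj₁ refl) = cov-swap {E = U.up} zYB
  ... | inj₂ (inj₂ refl) | inj₂ (inj₂ refl) = ⊥-elim (adj≢ Gs {u} {u} b refl)
  rot2 : ∀ {u v w} → C u v w → C w u v
  rot2 c = cov-rot {E = U.up} (cov-rot {E = U.up} c)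
  atT : ∀ {u v} → Triangle Gs (suc Tf) u v → C (suc Tf) u v
  atT {u} {v} (a , b , c) with nbrT {u} a | nbrT {v} (Adj-sym Gs {v} {suc Tf} c)
  ... | inj₁ refl | _ = rot2 (at0 {v} {suc Tf} (b , c , a))
  ... | inj₂ _ | inj₁ refl = cov-rot {E = U.up} (at0 {suc Tf} {u} (c , a , b))
  ... | inj₂ (inj₁ refl) | inj₂ (inj₁ refl) = ⊥-elim (adj≢ Gs {u} {u} b refl)
  ... | inj₂ (inj₁ refl) | inj₂ (inj₂ refl) = TBX
  ... | inj₂ (inj₂ refl) | inj₂ (inj₁ refl) = cov-swap {E = U.up} TBX
  ... | inj₂ (inj₂ refl) | inj₂ (inj₂ refl) = ⊥-elim (adj≢ Gs {u} {u} b refl)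
  first : ∀ {u v w} → Triangle Gs u v w → Touch Tf u → C u v w
  first {u} {v} {w} t (inj₁ refl) = at0 {v} {w} t
  first {u} {v} {w} t (inj₂ refl) = atT {v} {w} t
  new : ∀ u v w → Triangle Gs u v w → Touch Tf u ⊎ Touch Tf v ⊎ Touch Tf w → C u v w
  new u v w t (inj₁ h) = first {u} {v} {w} t h
  new u v w (a , b , c) (inj₂ (inj₁ h)) = rot2 (first {v} {w} {u} (b , c , a) h)
  new u v w (a , b , c) (inj₂ (inj₂ h)) = cov-rot {E = U.up} (first {w} {u} {v} (c , a , b) h)

-- The growth of a wheel by subStep from k = 0 on: f embeds the current wheel, ext lists further
-- triples whose dual vertices must survive, and Ex says whether the standard triangle has been
-- used up; Q is an extra invariant.
module Growing (I : Set) (Ex : Set)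
  (Q : ∀ k (G : Graph) → (V (Wheel k) → V G) → (I → Fin 3 → V G) → Set)
  (Q-step : ∀ {k G f ext t y b} → Q k G f ext → f (lastRim k) ≡ t → f 1F ≡ y → f zero ≡ b →
    Q (suc k) (sub G t y b) (lift0 f ∘ Iso.from (wheel-suc k)) (λ i → suc ∘ ext i)) where

  record Growth (k : ℕ) : Set where
    field
      {H G} : Graph
      f     : V (Wheel k) → V G
      ext   : I → Fin 3 → V G
      q     : Q k G f ext
      f-inj : ∀ {x y} → f x ≡ f y → x ≡ y
      f-adj : ∀ x y → adj G (f x) (f y) ≡ adj (Wheel k) x y
      ext-last : ∀ i j → ext i j ≢ f (lastRim k)
      E     : LE H G
      d3    : D3Reducible H
      state : State E (f (lastRim k)) (f zero) (f 1F)
      cov-ext : ∀ i → Cov E (ext i 0F) (ext i 1F) (ext i 2F)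
      cov-W : ∀ x y z → Triangle (Wheel k) x y z → ¬ (Ex × Same x y z (std k)) → Cov E (f x) (f y) (f z)

  growStep : ∀ {k} → Growth k → Growth (suc k)
  growStep {k} S = record
    { f = f° ; ext = λ i → suc ∘ ext i ; q = Q-step q refl refl refl
    ; f-inj = λ e → Iso.to-inj (iso-sym W⁺) (lift0-inj f-inj e)
    ; f-adj = λ x y → trans (sub-emb {Wheel k} {G} f f-inj f-adj refl refl refl (Iso.from W⁺ x) (Iso.from W⁺ y)) (Iso.adj-from W⁺ x y)
    ; ext-last = λ i j e → ¬0 (trans e f-last) ; E = N.E ; d3 = N.d3
    ; state = subst₃ (sym f-last) refl (cong (lift0 f) (sym (Iso.fromto W⁺ (suc 1F)))) N.state
    ; cov-ext = λ i → N.old (cov-ext i) (ext-last i 0F) (ext-last i 1F) (ext-last i 2F)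
    ; cov-W = cw }
    where
    open Growth S
    module N = Subbed (subStep E d3 state)
    W⁺ = wheel-suc k
    W = Wheel k
    Sw = sub W (lastRim k) 1F zero
    Gs = sub G (f (lastRim k)) (f 1F) (f zero)
    f° : V (Wheel (suc k)) → V Gs
    f° = lift0 f ∘ Iso.from W⁺
    f-last : f° (lastRim (suc k)) ≡ zero
    f-last = cong (lift0 f) (Iso.fromto W⁺ zero)
    ¬0 : ∀ {m} {x : Fin m} → Fin.suc x ≢ zero
    ¬0 ()
    subst₃ : ∀ {a b c a' b' c'} → a ≡ a' → b ≡ b' → c ≡ c' → State N.E a b c → State N.E a' b' c'
    subst₃ refl refl refl h = h
    tv : ∀ x → Touch (lastRim k) x ⊎ ∃ λ x' → x ≡ suc x' × x' ≢ lastRim k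
    tv zero = inj₁ (inj₁ refl)
    tv (suc x) with x ≟ lastRim k
    ... | yes refl = inj₁ (inj₂ refl)
    ... | no ne = inj₂ (x , refl , ne)
    touch : ∀ {x} → Touch (lastRim k) x → Touch (f (lastRim k)) (lift0 f x)
    touch (inj₁ refl) = inj₁ refl
    touch (inj₂ refl) = inj₂ refl
    up : ∀ {x y} → Adj Sw x y → Adj Gs (lift0 f x) (lift0 f y)
    up {x} {y} = subst T (sym (sub-emb f f-inj f-adj refl refl refl x y))
    old-edge : ∀ {x y} → Adj Sw (suc x) (suc y) → Adj W x y
    old-edge {x} {y} h = proj₁ (delEdge-e (adj W) {lastRim k} {1F} {x} {y} h)
    back : ∀ {x x'} → Iso.from W⁺ x ≡ suc x' → x' ≡ 0F ⊎ x' ≡ 1F ⊎ x' ≡ 2F → x ≡ 0F ⊎ x ≡ 1F ⊎ x ≡ 2F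
    back {x} e (inj₁ refl) = inj₁ (trans (sym (Iso.tofrom W⁺ x)) (cong (Iso.to W⁺) e))
    back {x} e (inj₂ (inj₁ refl)) = inj₂ (inj₁ (trans (sym (Iso.tofrom W⁺ x)) (cong (Iso.to W⁺) e)))
    back {x} e (inj₂ (inj₂ refl)) = inj₂ (inj₂ (trans (sym (Iso.tofrom W⁺ x)) (cong (Iso.to W⁺) e)))
    go : ∀ x y z → Triangle Sw x y z →
      ¬ (Ex × ∃ λ x' → ∃₂ λ y' z' → x ≡ suc x' × y ≡ suc y' × z ≡ suc z' × Same x' y' z' (std k)) →
      Cov N.E (lift0 f x) (lift0 f y) (lift0 f z)
    go x y z (a , b , c) ns with tv x | tv y | tv z
    ... | inj₁ h | _ | _ = N.new _ _ _ (up {x} {y} a , up {y} {z} b , up {z} {x} c) (inj₁ (touch h))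
    ... | inj₂ _ | inj₁ h | _ = N.new _ _ _ (up {x} {y} a , up {y} {z} b , up {z} {x} c) (inj₂ (inj₁ (touch h)))
    ... | inj₂ _ | inj₂ _ | inj₁ h = N.new _ _ _ (up {x} {y} a , up {y} {z} b , up {z} {x} c) (inj₂ (inj₂ (touch h)))
    ... | inj₂ (x' , refl , n₁) | inj₂ (y' , refl , n₂) | inj₂ (z' , refl , n₃) =
      N.old (cov-W x' y' z' (old-edge {x'} {y'} a , old-edge {y'} {z'} b , old-edge {z'} {x'} c)
              λ (e , s) → ns (e , x' , y' , z' , refl , refl , refl , s))
        (n₁ ∘ f-inj) (n₂ ∘ f-inj) (n₃ ∘ f-inj)
    cw : ∀ x y z → Triangle (Wheel (suc k)) x y z → ¬ (Ex × Same x y z (std (suc k))) → Cov N.E (f° x) (f° y) (f° z)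
    cw x y z t ns = go _ _ _ (iso-triangle (iso-sym W⁺) {x} {y} {z} t)
      λ { (e , x' , y' , z' , p , q , r , a , b , c) → ns (e , back p a , back q b , back r c) }

  grow : Growth 0 → ∀ k → Growth k
  grow S zero    = S
  grow S (suc k) = growStep (grow S k)

record Dualable (G : Graph) (B : Tri G) : Set where
  field
    {H} : Graph
    E   : LE H G
    d3  : D3Reducible H
    cov : ∀ {x y z} → B x y z → Cov E x y z

cov-iso : ∀ {H G G'} {E : LE H G} (J : Iso G G') {u v w} → Cov E u v w →
  Cov (transportLE iso-refl J E) (Iso.to J u) (Iso.to J v) (Iso.to J w)
cov-iso J (mkCov d refl refl refl) = mkCov d refl refl refl

cov-≡ : ∀ {H G} {E : LE H G} {u v w u' v' w'} → u ≡ u' → v ≡ v' → w ≡ w' → Cov E u v w → Cov E u' v' w'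
cov-≡ refl refl refl c = c

W0-LE : LE K4 (Wheel 0)
W0-LE = transportLE iso-refl K4≅W0 K4-LE

private
  c123 : Cov W0-LE 1F 2F 3F
  c123 = mkCov (K4-Deg3 0F 2F 3F 1F (λ ()) (λ ()) (λ ()) (λ ()) (λ ()) (λ ())) refl refl refl
  c023 : Cov W0-LE 0F 2F 3F
  c023 = mkCov (K4-Deg3 1F 3F 0F 2F (λ ()) (λ ()) (λ ()) (λ ()) (λ ()) (λ ())) refl refl refl
  c013 : Cov W0-LE 0F 1F 3F
  c013 = mkCov (K4-Deg3 2F 1F 3F 0F (λ ()) (λ ()) (λ ()) (λ ()) (λ ()) (λ ())) refl refl refl
  c012 : Cov W0-LE 0F 1F 2F
  c012 = mkCov (K4-Deg3 3F 2F 0F 1F (λ ()) (λ ()) (λ ()) (λ ()) (λ ()) (λ ())) refl refl refl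

  mid : ∀ {u v w} → Cov W0-LE u v w → Cov W0-LE v u w
  mid c = cov-swap {E = W0-LE} (cov-rot {E = W0-LE} c)

  last : ∀ {u v w} → Cov W0-LE u v w → Cov W0-LE w u v
  last c = cov-rot {E = W0-LE} (cov-rot {E = W0-LE} c)

  other₀ : ∀ (y : Fin 4) → 0F ≢ y → y ≡ 1F ⊎ y ≡ 2F ⊎ y ≡ 3F
  other₀ 0F n = ⊥-elim (n refl)
  other₀ 1F _ = inj₁ refl
  other₀ 2F _ = inj₂ (inj₁ refl)
  other₀ 3F _ = inj₂ (inj₂ refl)
  other₁ : ∀ (y : Fin 4) → 1F ≢ y → y ≡ 0F ⊎ y ≡ 2F ⊎ y ≡ 3F
  other₁ 1F n = ⊥-elim (n refl)
  other₁ 0F _ = inj₁ refl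
  other₁ 2F _ = inj₂ (inj₁ refl)
  other₁ 3F _ = inj₂ (inj₂ refl)
  other₂ : ∀ (y : Fin 4) → 2F ≢ y → y ≡ 0F ⊎ y ≡ 1F ⊎ y ≡ 3F
  other₂ 2F n = ⊥-elim (n refl)
  other₂ 0F _ = inj₁ refl
  other₂ 1F _ = inj₂ (inj₁ refl)
  other₂ 3F _ = inj₂ (inj₂ refl)
  other₃ : ∀ (y : Fin 4) → 3F ≢ y → y ≡ 0F ⊎ y ≡ 1F ⊎ y ≡ 2F
  other₃ 3F n = ⊥-elim (n refl)
  other₃ 0F _ = inj₁ refl
  other₃ 1F _ = inj₂ (inj₁ refl)
  other₃ 2F _ = inj₂ (inj₂ refl)

K4-cov : ∀ x y z → x ≢ y → y ≢ z → x ≢ z → Cov W0-LE x y z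
K4-cov 0F y z a b c = cov-pairs {E = W0-LE} c012 c023 c013 b (other₀ y a) (other₀ z c)
K4-cov 1F y z a b c = cov-pairs {E = W0-LE} (mid c012) c123 (mid c013) b (other₁ y a) (other₁ z c)
K4-cov 2F y z a b c = cov-pairs {E = W0-LE} (last c012) (mid c123) (mid c023) b (other₂ y a) (other₂ z c)
K4-cov 3F y z a b c = cov-pairs {E = W0-LE} (last c013) (last c123) (last c023) b (other₃ y a) (other₃ z c)

private
  IsoQ : ∀ k (G : Graph) → (V (Wheel k) → V G) → (⊥ → Fin 3 → V G) → Set
  IsoQ k G f _ = Σ (Iso (Wheel k) G) λ J → ∀ x → Iso.to J x ≡ f x

  IsoQ-step : ∀ {k G f ext t y b} → IsoQ k G f ext → f (lastRim k) ≡ t → f 1F ≡ y → f zero ≡ b →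
    IsoQ (suc k) (sub G t y b) (lift0 f ∘ Iso.from (wheel-suc k)) (λ i → suc ∘ ext i)
  IsoQ-step {k} {G} {f} (J , e) e₁ e₂ e₃ = iso-trans (iso-sym (wheel-suc k)) J⁺ , λ x → lem (Iso.from (wheel-suc k) x)
    where
    J⁺ = sub-iso J (trans (e _) e₁) (trans (e _) e₂) (trans (e _) e₃)
    lem : ∀ u → Iso.to J⁺ u ≡ lift0 f u
    lem zero    = refl
    lem (suc u) = cong suc (e u)

-- For a single wheel nothing exists besides the growing wheel and no triangle is used up, so the
-- index type and the exception are both empty.
module Pure = Growing ⊥ ⊥ IsoQ (λ {k} {G} {f} {ext} → IsoQ-step {k} {G} {f} {ext})

wheel-dualable : ∀ {G} → IsWheel G → Dualable G (Triangle G)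
wheel-dualable {G} (k , w) = record
  { E = transportLE iso-refl J E ; d3 = d3
  ; cov = λ {x} {y} {z} t → cov-≡ (val x) (val y) (val z) (cov-iso J (cov-W _ _ _ (iso-triangle I t) proj₁)) }
  where
  I = ≅→iso w
  base : Pure.Growth 0
  base = record
    { f = id ; ext = λ () ; q = iso-refl , (λ _ → refl) ; f-inj = id ; f-adj = λ _ _ → refl ; ext-last = λ ()
    ; E = W0-LE ; d3 = done (iso→≅ iso-refl)
    ; state = record
        { p = 1F ; r = 2F ; s = 0F ; p' = 3F ; r' = 3F
        ; dp = K4-Deg3 1F 2F 0F 3F (λ ()) (λ ()) (λ ()) (λ ()) (λ ()) (λ ())
        ; dr = K4-Deg3 2F 1F 0F 3F (λ ()) (λ ()) (λ ()) (λ ()) (λ ()) (λ ())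
        ; at = mkTri refl refl refl ; X≢Y = λ () ; l-f = refl ; l-h = refl ; l-y = refl }
    ; cov-ext = λ () ; cov-W = λ x y z (a , b , c) _ → K4-cov x y z (adj≢ (Wheel 0) {x} {y} a) (adj≢ (Wheel 0) {y} {z} b) (adj≢ (Wheel 0) {z} {x} c ∘ sym) }
  open Pure.Growth (Pure.grow base k) renaming (G to Gk)
  J : Iso Gk G
  J = iso-trans (iso-sym (proj₁ q)) (iso-sym I)
  val : ∀ x → Iso.to J (f (Iso.to I x)) ≡ x
  val x = trans (cong (Iso.from I) (trans (cong (Iso.from (proj₁ q)) (sym (proj₂ q _))) (Iso.fromto (proj₁ q) _))) (Iso.fromto I x)

same→in : ∀ {A : Set} {τ : Fin 3 → A} {x} → x ≡ τ 0F ⊎ x ≡ τ 1F ⊎ x ≡ τ 2F → ∃ λ i → x ≡ τ i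
same→in (inj₁ e) = 0F , e
same→in (inj₂ (inj₁ e)) = 1F , e
same→in (inj₂ (inj₂ e)) = 2F , e

in→same : ∀ {A : Set} {τ : Fin 3 → A} {x} → (∃ λ i → x ≡ τ i) → x ≡ τ 0F ⊎ x ≡ τ 1F ⊎ x ≡ τ 2F
in→same (0F , e) = inj₁ e
in→same (1F , e) = inj₂ (inj₁ e)
in→same (2F , e) = inj₂ (inj₂ e)

same-map : ∀ {A B : Set} {τ : Fin 3 → A} {τ' : Fin 3 → B} {x y z x' y' z'} →
  (∀ i → x ≡ τ i → ∃ λ j → x' ≡ τ' j) → (∀ i → y ≡ τ i → ∃ λ j → y' ≡ τ' j) → (∀ i → z ≡ τ i → ∃ λ j → z' ≡ τ' j) →
  Same x y z τ → Same x' y' z' τ'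
same-map {τ = τ} {τ'} f g h (a , b , c) = in→same {τ = τ'} (uncurry f (same→in {τ = τ} a)) ,
  in→same {τ = τ'} (uncurry g (same→in {τ = τ} b)) , in→same {τ = τ'} (uncurry h (same→in {τ = τ} c))

-- The triangles that remain available after a gluing.
Av : ∀ {G₁ G₂ G τ τ'} → Glue G₁ G₂ G τ τ' → Tri G₁ → Tri G₂ → Tri G
Av {τ = τ} {τ'} gl A₁ A₂ x y z =
  (∃ λ u → ∃₂ λ v w → A₁ u v w × ¬ Same u v w τ × x ≡ Glue.f₁ gl u × y ≡ Glue.f₁ gl v × z ≡ Glue.f₁ gl w) ⊎
  (∃ λ u → ∃₂ λ v w → A₂ u v w × ¬ Same u v w τ' × x ≡ Glue.f₂ gl u × y ≡ Glue.f₂ gl v × z ≡ Glue.f₂ gl w)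

-- Attaches a wheel to a covered triangle: `stackStep` adds a tetrahedron, which then grows. The
-- type `I` collects the covered triples of `G₁` other than the glued one, and `Q` maintains that
-- the current graph is `G₁` glued to the current wheel.
module Leaf {G₁ H₁ : Graph} (E₁ : LE H₁ G₁) (red : D3Reducible H₁) {u v w : V G₁} (c₀ : Cov E₁ u v w) where
  private
    τ : Fin 3 → V G₁
    τ = tri u v w
    I : Set
    I = Σ (Fin 3 → V G₁) λ ρ → Cov E₁ (ρ 0F) (ρ 1F) (ρ 2F) × ¬ Same (ρ 0F) (ρ 1F) (ρ 2F) τ
    Q : ∀ k (G : Graph) → (V (Wheel k) → V G) → (I → Fin 3 → V G) → Set
    Q k G f ext = Σ (Glue G₁ (Wheel k) G τ (std k)) λ gl → (∀ x → Glue.f₂ gl x ≡ f x) × (∀ i j → ext i j ≡ Glue.f₁ gl (proj₁ i j))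
    Q-step : ∀ {k G f ext t y b} → Q k G f ext → f (lastRim k) ≡ t → f 1F ≡ y → f zero ≡ b →
      Q (suc k) (sub G t y b) (lift0 f ∘ Iso.from (wheel-suc k)) (λ i → suc ∘ ext i)
    Q-step {k} {G} {f} (gl , e , ex) e₁ e₂ e₃ = glue-swap g₂ , (λ x → lem (Iso.from (wheel-suc k) x)) , λ i j → cong suc (ex i j)
      where
      -- The glued triangle consists of the hub and the first two rim vertices, so the split vertex
      -- is private to the wheel.
      off : ∀ i → lastRim k ≢ std k i
      off 0F ()
      off 1F ()
      off 2F ()
      g₁ = glue-sub (glue-swap gl) (trans (e _) e₁) (trans (e _) e₂) (trans (e _) e₃) off
      g₂ = glue-iso₁ g₁ (iso-sym (wheel-suc k)) {std (suc k)}
        λ { 0F → refl ; 1F → sym (Iso.fromto (wheel-suc k) (suc 1F)) ; 2F → sym (Iso.fromto (wheel-suc k) (suc 2F)) }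
      lem : ∀ x → lift0 (Glue.f₂ gl) x ≡ lift0 f x
      lem zero = refl
      lem (suc x) = cong suc (e x)
    module Gr = Growing I ⊤ Q (λ {k} {G} {f} {ext} → Q-step {k} {G} {f} {ext})
    module St = Stacked (stackStep E₁ red c₀)
    gl₀ : Glue G₁ (Wheel 0) (stack G₁ u v w) τ (std 0)
    gl₀ = stack-glue (cov-triangle {E = E₁} c₀)
    base : Gr.Growth 0
    base = record
      { f = Glue.f₂ gl₀ ; ext = λ i → suc ∘ proj₁ i ; q = gl₀ , (λ _ → refl) , (λ _ _ → refl)
      ; f-inj = Glue.inj₂' gl₀ ; f-adj = Glue.adj₂ gl₀ ; ext-last = λ _ _ ()
      ; E = St.E ; d3 = St.d3 ; state = St.state
      ; cov-ext = λ (ρ , c , ns) → St.old c ns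
      ; cov-W = cw }
      where
      f = Glue.f₂ gl₀
      up : ∀ {x y} → Adj (Wheel 0) x y → Adj (stack G₁ u v w) (f x) (f y)
      up {x} {y} = Glue.up₂ gl₀ {x} {y}
      old? : ∀ x → x ≡ 3F ⊎ (x ≡ 0F ⊎ x ≡ 1F ⊎ x ≡ 2F)
      old? 0F = inj₂ (inj₁ refl)
      old? 1F = inj₂ (inj₂ (inj₁ refl))
      old? 2F = inj₂ (inj₂ (inj₂ refl))
      old? 3F = inj₁ refl
      cw : ∀ x y z → Triangle (Wheel 0) x y z → ¬ (⊤ × Same x y z (std 0)) → Cov St.E (f x) (f y) (f z)
      cw x y z (a , b , c) ns with old? x | old? y | old? z
      ... | inj₁ refl | _ | _ = St.new {f y} {f z} (up {3F} {y} a , up {y} {z} b , up {z} {3F} c)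
      ... | inj₂ _ | inj₁ refl | _ = cov-rot {E = St.E} (cov-rot {E = St.E} (St.new {f z} {f x} (up {3F} {z} b , up {z} {x} c , up {x} {3F} a)))
      ... | inj₂ _ | inj₂ _ | inj₁ refl = cov-rot {E = St.E} (St.new {f x} {f y} (up {3F} {x} c , up {x} {y} a , up {y} {3F} b))
      ... | inj₂ p | inj₂ q | inj₂ r = ⊥-elim (ns (tt , p , q , r))

  leaf : ∀ k {G} (gl : Glue G₁ (Wheel k) G τ (std k)) (B : Tri G₁) → (∀ {x y z} → B x y z → Cov E₁ x y z) →
    Dualable G (Av gl B (Triangle (Wheel k)))
  leaf k {G} gl B covB = record { E = transportLE iso-refl J E ; d3 = d3 ; cov = cv }
    where
    open Gr.Growth (Gr.grow base k) renaming (G to Gk)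
    J : Iso Gk G
    J = glue-unique (proj₁ q) gl
    v₁ : ∀ x → Iso.to J (Glue.f₁ (proj₁ q) x) ≡ Glue.f₁ gl x
    v₁ = amalgam-f₁ (proj₁ q) gl
    v₂ : ∀ x → Iso.to J (f x) ≡ Glue.f₂ gl x
    v₂ x = trans (cong (Iso.to J) (sym (proj₁ (proj₂ q) x))) (amalgam-f₂ (proj₁ q) gl x)
    cv : ∀ {x y z} → Av gl B (Triangle (Wheel k)) x y z → Cov (transportLE iso-refl J E) x y z
    cv (inj₁ (a , b , c , h , ns , refl , refl , refl)) = cov-≡ (ve 0F) (ve 1F) (ve 2F) (cov-iso J (cov-ext i))
      where
      i : I
      i = tri a b c , covB h , ns
      ve : ∀ j → Iso.to J (ext i j) ≡ Glue.f₁ gl (tri a b c j)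
      ve j = trans (cong (Iso.to J) (proj₂ (proj₂ q) i j)) (v₁ _)
    cv (inj₂ (a , b , c , h , ns , refl , refl , refl)) =
      cov-≡ (v₂ a) (v₂ b) (v₂ c) (cov-iso J (cov-W a b c h λ (_ , s) → ns s))

dualable-⊆ : ∀ {G B B'} → (∀ {x y z} → B' x y z → B x y z) → Dualable G B → Dualable G B'
dualable-⊆ i D = record { E = E ; d3 = d3 ; cov = cov ∘ i }
  where open Dualable D

-- The quantification over `G₁` is essential for regrouping, where one part of `G₂` is first added
-- to `G₁` and the other part is then glued to the result.
Gluable : (G₂ : Graph) → Tri G₂ → Set₁
Gluable G₂ A₂ = ∀ {G₁ B₁ G τ τ'} → Dualable G₁ B₁ → B₁ (τ 0F) (τ 1F) (τ 2F) → A₂ (τ' 0F) (τ' 1F) (τ' 2F) →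
  (gl : Glue G₁ G₂ G τ τ') → Dualable G (Av gl B₁ A₂)

wheel-gluable : ∀ {G₂} → IsWheel G₂ → Gluable G₂ (Triangle G₂)
wheel-gluable {G₂} (k , w) {G₁} {B₁} {G} {τ} {τ'} D b₁ t gl = go (std-triangle k _ _ _ (iso-triangle I t))
  where
  I = ≅→iso w
  open Dualable D
  place : ∀ (ρ ρ⁻ : Fin 3 → Fin 3) → (∀ i → ρ (ρ⁻ i) ≡ i) → Cov E (τ (ρ 0F)) (τ (ρ 1F)) (τ (ρ 2F)) →
    Std k (Iso.to I (τ' (ρ 0F))) (Iso.to I (τ' (ρ 1F))) (Iso.to I (τ' (ρ 2F))) → Dualable G (Av gl B₁ (Triangle G₂))
  place ρ ρ⁻ e c (S , e₀ , e₁ , e₂) = dualable-⊆ inc (Leaf.leaf E d3 c k gl* B₁ cov)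
    where
    J : Iso (Wheel k) G₂
    J = iso-sym (iso-trans I S)
    back : ∀ {x y} → Iso.to S (Iso.to I x) ≡ y → x ≡ Iso.to J y
    back refl = sym (Iso.tofrom J _)
    eτ' : ∀ i → τ' (ρ i) ≡ Iso.to J (std k i)
    eτ' 0F = back e₀
    eτ' 1F = back e₁
    eτ' 2F = back e₂
    gl₁ : Glue G₁ (Wheel k) G (τ ∘ ρ) (std k)
    gl₁ = glue-swap (glue-iso₁ (glue-swap (glue-reindex gl ρ ρ⁻ e)) J eτ')
    fix : ∀ i → tri (τ (ρ 0F)) (τ (ρ 1F)) (τ (ρ 2F)) i ≡ τ (ρ i)
    fix 0F = refl
    fix 1F = refl
    fix 2F = refl
    gl* : Glue G₁ (Wheel k) G (tri (τ (ρ 0F)) (τ (ρ 1F)) (τ (ρ 2F))) (std k)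
    gl* = glue-iso₁ gl₁ iso-refl (sym ∘ fix)
    inc : ∀ {x y z} → Av gl B₁ (Triangle G₂) x y z → Av gl* B₁ (Triangle (Wheel k)) x y z
    inc (inj₁ (a , b , c , h , ns , refl , refl , refl)) = inj₁ (a , b , c , h , (λ s → ns (same-map {τ = tri (τ (ρ 0F)) (τ (ρ 1F)) (τ (ρ 2F))} {τ} m m m s)) , refl , refl , refl)
      where
      m : ∀ {x} i → x ≡ tri (τ (ρ 0F)) (τ (ρ 1F)) (τ (ρ 2F)) i → ∃ λ j → x ≡ τ j
      m i q = ρ i , trans q (fix i)
    inc (inj₂ (a , b , c , h , ns , refl , refl , refl)) = inj₂ (Iso.from J a , Iso.from J b , Iso.from J c ,
        iso-triangle (iso-sym J) h , (λ s → ns (same-map {τ = std k} {τ'} m m m s)) , r a , r b , r c)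
      where
      r : ∀ a → Glue.f₂ gl a ≡ Glue.f₂ gl (Iso.to J (Iso.from J a))
      r a = cong (Glue.f₂ gl) (sym (Iso.tofrom J a))
      m : ∀ {x} i → Iso.from J x ≡ std k i → ∃ λ j → x ≡ τ' j
      m {x} i q = ρ i , trans (sym (Iso.tofrom J x)) (trans (cong (Iso.to J) q) (sym (eτ' i)))
  r₁ r₂ : Fin 3 → Fin 3
  r₁ = tri 1F 2F 0F
  r₂ = tri 2F 0F 1F
  go : _ → Dualable G (Av gl B₁ (Triangle G₂))
  go (inj₁ s) = place id id (λ _ → refl) (cov b₁) s
  go (inj₂ (inj₁ s)) = place r₁ r₂ (λ { 0F → refl ; 1F → refl ; 2F → refl }) (cov-rot {E = E} (cov b₁)) s
  go (inj₂ (inj₂ s)) = place r₂ r₁ (λ { 0F → refl ; 1F → refl ; 2F → refl }) (cov-rot {E = E} (cov-rot {E = E} (cov b₁))) s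

-- Both triples have three positions, and an injection from three positions to three is onto.
same-flip : ∀ {A : Set} {τ σ : Fin 3 → A} → (∀ {i j} → τ i ≡ τ j → i ≡ j) →
  Same (τ 0F) (τ 1F) (τ 2F) σ → Same (σ 0F) (σ 1F) (σ 2F) τ
same-flip {A} {τ} {σ} inj (a , b , c) = in→same {τ = τ} (hit 0F) , in→same {τ = τ} (hit 1F) , in→same {τ = τ} (hit 2F)
  where
  pos : ∀ i → ∃ λ j → τ i ≡ σ j
  pos 0F = same→in {τ = σ} a
  pos 1F = same→in {τ = σ} b
  pos 2F = same→in {τ = σ} c
  p-inj : ∀ {i j} → proj₁ (pos i) ≡ proj₁ (pos j) → i ≡ j
  p-inj {i} {j} e = inj (trans (proj₂ (pos i)) (trans (cong σ e) (sym (proj₂ (pos j)))))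
  hit : ∀ l → ∃ λ j → σ l ≡ τ j
  hit l with any? (λ j → proj₁ (pos j) ≟ l)
  ... | yes (j , e) = j , sym (trans (proj₂ (pos j)) (cong σ e))
  ... | no n with pigeonhole {2} {3} ≤-refl (λ j → punchOut {i = l} {proj₁ (pos j)} λ e → n (j , sym e))
  ... | i , j , lt , e = ⊥-elim (<-irrefl (cong toℕ (p-inj (punchOut-injective {i = l} _ _ e))) lt)

-- The triangle glued to `G₁` belongs to `Ga`, so `Ga` is attached first and `Gb` follows along the
-- triangle that joined the two. The latter is not the glued one and thus is still available after
-- the first step.
regroup : ∀ {Ga Gb G₂ G₁ G Aa Ab B₁ τ τ' σa σb} {A₂ : Tri G₂} → Gluable Ga Aa → Gluable Gb Ab →
  (gl₂ : Glue Ga Gb G₂ σa σb) → (∀ {x y z} → A₂ x y z → Av gl₂ Aa Ab x y z) → (∀ {x y z} → Aa x y z → Triangle Ga x y z) →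
  Aa (σa 0F) (σa 1F) (σa 2F) → Ab (σb 0F) (σb 1F) (σb 2F) →
  Dualable G₁ B₁ → B₁ (τ 0F) (τ 1F) (τ 2F) → (gl : Glue G₁ G₂ G τ τ') →
  (∃ λ u → ∃₂ λ v w → Aa u v w × ¬ Same u v w σa × τ' 0F ≡ Glue.f₁ gl₂ u × τ' 1F ≡ Glue.f₁ gl₂ v × τ' 2F ≡ Glue.f₁ gl₂ w) →
  Dualable G (Av gl B₁ A₂)
regroup {Ga} {Gb} {G₂} {G₁} {G} {Aa} {Ab} {B₁} {τ} {τ'} {σa} {σb} {A₂} ga gb gl₂ split tri-a aσ bσ D b₁ gl (u , v , w , at , ns , e₀ , e₁ , e₂) =
  dualable-⊆ inc (gb {τ = Glue.f₂ S.inner ∘ σa} {τ' = σb} DK (inj₂ (_ , _ , _ , aσ , ns' , refl , refl , refl)) bσ S.outer)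
  where
  t : Fin 3 → V Ga
  t = tri u v w
  te : ∀ i → τ' i ≡ Glue.f₁ gl₂ (t i)
  te 0F = e₀
  te 1F = e₁
  te 2F = e₂
  module S = Assoc gl gl₂ {t} te
  DK : Dualable S.K (Av S.inner B₁ Aa)
  DK = ga D b₁ at S.inner
  ns' : ¬ Same (σa 0F) (σa 1F) (σa 2F) t
  ns' s = ns (same-flip {τ = σa} {t} (tri-inj {Ga} {σa} triσ) s)
    where
    triσ : IsTri Ga σa
    triσ i j n = subst₂ (Adj Ga) (fix i) (fix j) (isTri {Ga} (tri-a aσ) i j n)
      where
      fix : ∀ i → tri (σa 0F) (σa 1F) (σa 2F) i ≡ σa i
      fix 0F = refl
      fix 1F = refl
      fix 2F = refl
  k₁ : ∀ x → Glue.f₁ gl x ≡ S.emb (Glue.f₁ S.inner x)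
  k₁ x = sym (S.emb-f₁ x)
  k₂ : ∀ y → Glue.f₂ gl (Glue.f₁ gl₂ y) ≡ S.emb (Glue.f₂ S.inner y)
  k₂ y = sym (S.emb-f₂ y)
  inc : ∀ {x y z} → Av gl B₁ A₂ x y z → Av S.outer (Av S.inner B₁ Aa) Ab x y z
  inc (inj₁ (a , b , c , h , n , refl , refl , refl)) = inj₁ (_ , _ , _ , inj₁ (a , b , c , h , n , refl , refl , refl) ,
      (λ s → n (same-map {τ = Glue.f₂ S.inner ∘ σa} {τ} m m m s)) , k₁ a , k₁ b , k₁ c)
    where
    m : ∀ {x} i → Glue.f₁ S.inner x ≡ Glue.f₂ S.inner (σa i) → ∃ λ j → x ≡ τ j
    m {x} i q = let j , e , _ = Glue.meet S.inner x (σa i) q in j , e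
  inc (inj₂ (x , y , z , h , n , refl , refl , refl)) with split h
  ... | inj₁ (a , b , c , h' , n' , refl , refl , refl) = inj₁ (_ , _ , _ ,
      inj₂ (a , b , c , h' , (λ s → n (same-map {τ = t} {τ'} m m m s)) , refl , refl , refl) ,
      (λ s → n' (same-map {τ = Glue.f₂ S.inner ∘ σa} {σa} m' m' m' s)) , k₂ a , k₂ b , k₂ c)
    where
    m : ∀ {x} i → x ≡ t i → ∃ λ j → Glue.f₁ gl₂ x ≡ τ' j
    m 0F refl = 0F , sym e₀
    m 1F refl = 1F , sym e₁
    m 2F refl = 2F , sym e₂
    m' : ∀ {x} i → Glue.f₂ S.inner x ≡ Glue.f₂ S.inner (σa i) → ∃ λ j → x ≡ σa j
    m' i q = i , Glue.inj₂' S.inner q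
  ... | inj₂ (a , b , c , h' , n' , refl , refl , refl) = inj₂ (a , b , c , h' , n' , refl , refl , refl)

av-swap : ∀ {G₁ G₂ G τ τ' A₁ A₂} (gl : Glue G₁ G₂ G τ τ') {x y z} → Av gl A₁ A₂ x y z → Av (glue-swap gl) A₂ A₁ x y z
av-swap gl = [ inj₂ , inj₁ ]′

glued-gluable : ∀ {G A} → Glued G A → Gluable G A
glued-gluable (piece w) {τ = τ} {τ'} D b₁ t gl = dualable-⊆ inc (wheel-gluable w D b₁ (TriFace→triangle t) gl)
  where
  inc : ∀ {x y z} → Av gl _ _ x y z → Av gl _ _ x y z
  inc (inj₁ h) = inj₁ h
  inc (inj₂ (a , b , c , h , r)) = inj₂ (a , b , c , TriFace→triangle h , r)
glued-gluable (glue {A₁ = A₁} {A₂} g₁ g₂ a₁ a₂ g) D b₁ (inj₁ h) gl =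
  regroup (glued-gluable g₁) (glued-gluable g₂) gl₂ id (glued-triangle g₁) a₁ a₂ D b₁ gl h
  where gl₂ = FromGlueOf.toGlue g (glued-triangle g₁ a₁) (glued-triangle g₂ a₂)
glued-gluable (glue {A₁ = A₁} {A₂} g₁ g₂ a₁ a₂ g) D b₁ (inj₂ h) gl =
  regroup (glued-gluable g₂) (glued-gluable g₁) (glue-swap gl₂) (av-swap gl₂) (glued-triangle g₂) a₂ a₁ D b₁ gl h
  where gl₂ = FromGlueOf.toGlue g (glued-triangle g₁ a₁) (glued-triangle g₂ a₂)

glued-dualable : ∀ {G A} → Glued G A → Dualable G A
glued-dualable (piece w) = dualable-⊆ TriFace→triangle (wheel-dualable w)
glued-dualable (glue g₁ g₂ a₁ a₂ g) = glued-gluable g₂ (glued-dualable g₁) a₁ a₂ gl₂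
  where gl₂ = FromGlueOf.toGlue g (glued-triangle g₁ a₁) (glued-triangle g₂ a₂)

-- From reductions to gluings

HasFace : ∀ {H G} → LE H G → V H → V G → Set
HasFace {H} E h f = ∃ λ x → Adj H h x × LE.lab E h x ≡ f

record Good {H G : Graph} (E : LE H G) (A : Tri G) : Set where
  field
    avail    : ∀ {x y z} → Cov E x y z → A x y z
    distinct : ∀ {h a b c h' a' b' c'} → Deg3 H h a b c → Deg3 H h' a' b' c' →
      (∀ {f} → HasFace E h f → HasFace E h' f) → h ≡ h'

deg3-faces : ∀ {H G} (E : LE H G) {h a b c} → Deg3 H h a b c → ∀ {f} → HasFace E h f →
  f ≡ LE.lab E h a ⊎ f ≡ LE.lab E h b ⊎ f ≡ LE.lab E h c
deg3-faces E d (x , k , refl) with Deg3.all d x k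
... | inj₁ refl = inj₁ refl
... | inj₂ (inj₁ refl) = inj₂ (inj₁ refl)
... | inj₂ (inj₂ refl) = inj₂ (inj₂ refl)

-- At a vertex of degree three the three faces are distinct, so inclusion is symmetric.
faces-flip : ∀ {H G} (E : LE H G) {h a b c h' a' b' c'} → Deg3 H h a b c → Deg3 H h' a' b' c' →
  (∀ {f} → HasFace E h f → HasFace E h' f) → ∀ {f} → HasFace E h' f → HasFace E h f
faces-flip {H} {G} E {h} {a} {b} {c} {h'} {a'} {b'} {c'} d d' inc {f} k = back (sel (deg3-faces E d' k))
  where
  open LE E
  τ υ : Fin 3 → V G
  τ = tri (lab h a) (lab h b) (lab h c)
  υ = tri (lab h' a') (lab h' b') (lab h' c')
  s : Same (τ 0F) (τ 1F) (τ 2F) υ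
  s = deg3-faces E d' (inc (a , Deg3.ax d , refl)) , deg3-faces E d' (inc (b , Deg3.ay d , refl)) , deg3-faces E d' (inc (c , Deg3.az d , refl))
  s' : Same (υ 0F) (υ 1F) (υ 2F) τ
  s' = same-flip {τ = τ} {υ} (tri-inj {G} {τ} (isTri {G} (cov-triangle {E = E} (mkCov d refl refl refl)))) s
  sel : f ≡ υ 0F ⊎ f ≡ υ 1F ⊎ f ≡ υ 2F → f ≡ τ 0F ⊎ f ≡ τ 1F ⊎ f ≡ τ 2F
  sel (inj₁ refl) = proj₁ s'
  sel (inj₂ (inj₁ refl)) = proj₁ (proj₂ s')
  sel (inj₂ (inj₂ refl)) = proj₂ (proj₂ s')
  back : f ≡ τ 0F ⊎ f ≡ τ 1F ⊎ f ≡ τ 2F → HasFace E h f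
  back (inj₁ refl) = a , Deg3.ax d , refl
  back (inj₂ (inj₁ refl)) = b , Deg3.ay d , refl
  back (inj₂ (inj₂ refl)) = c , Deg3.az d , refl

good-mirror : ∀ {H G} {E : LE H G} {A} → Good (mirror E) A → Good E A
good-mirror {H} {G} {E} g = record { avail = avail ∘ cov-mirror {E = E}
  ; distinct = λ d d' inc → distinct d d' (λ k → fw (inc (bw k))) }
  where
  open Good g
  open LE E
  fw : ∀ {h f} → HasFace E h f → HasFace (mirror E) h f
  fw {h} (x , k , refl) = let l , e = rt-mirror E k in _ , l , sym (turn l e)
  bw : ∀ {h f} → HasFace (mirror E) h f → HasFace E h f
  bw {h} (x , k , refl) = rt h x , σ-adj ro h x k , turn k refl

Fwd : Graph → Set₁
Fwd H = ∀ {G} (E : LE H G) → Σ (Tri G) λ A → Glued G A × Good E A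

module BlowStep {H : Graph} {t a b c : V H} (d : Deg3 H t a b c) (ih : Fwd H) where
  open Blow d
  private
    module D = Deg3 d

  module Base {m : ℕ} {A : Fin (suc m) → Fin (suc m) → Bool} {sy : ∀ x y → A x y ≡ A y x} {irr : ∀ x → A x x ≡ false} where
    module BD = BlowDown d {m} {A} {sy} {irr}
    open BD using (G)
    module _ (E : LE B G) (pr-q : LE.rt E (pt t) (suc zero) ≡ zero) (inner : LE.lab E (pt t) zero ≡ zero) where
      private
        G' : Graph
        G' = BD.G' E pr-q inner
        E' : LE H G'
        E' = BD.down E pr-q inner
        open LE E using (lab)
        lab' : V H → V H → V G'
        lab' = LE.lab E'
        IH : Σ (Tri G') λ A' → Glued G' A' × Good E' A'
        IH = ih E'
        A' : Tri G'
        A' = proj₁ IH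
        module Gd = Good (proj₂ (proj₂ IH))
        u v w : V G'
        u = lab' t a
        v = lab' t b
        w = lab' t c
        ct : Cov E' u v w
        ct = mkCov d refl refl refl
        triG' : Triangle G' u v w
        triG' = cov-triangle {E = E'} ct
        gl : Glue G' (Wheel 0) G (tri u v w) (std 0)
        gl = glue-out (stack-glue triG') (iso-sym (BD.stacked E pr-q inner))
        W : IsWheel (Wheel 0)
        W = 0 , iso→≅ iso-refl
        R = glueIt gl (proj₁ (proj₂ IH)) (piece W) (Gd.avail ct)
              (wheel-TriFace W {0F} {1F} {2F} (tt , tt , tt))
        AG : Tri G
        AG = proj₁ R

        old-lab : ∀ {h x} → h ≢ t → Adj B (pt h) x → lab (pt h) x ≡ suc (lab' h (κ⁻ x))
        old-lab = BD.lab-old E pr-q inner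

        zero-face : ∀ i → HasFace E (cor i) zero
        zero-face 0F = zero , Deg3.ax deg-p , inner
        zero-face 1F = suc zero , tt , BD.inner-q E pr-q inner
        zero-face 2F = pt t , Adj-sym B {pt t} {suc zero} (Deg3.ay deg-p) , BD.inner-r E pr-q inner

        no-zero : ∀ {h} → h ≢ t → ¬ HasFace E (pt h) zero
        no-zero n (x , k , e) with () ← trans (sym e) (old-lab n k)

        -- The apex is private to the tetrahedron. All of the triangle therefore lies in the
        -- tetrahedron, and it is not the triangle used for the gluing.
        tetra : ∀ {x y z} → Triangle G x y z → x ≡ zero ⊎ y ≡ zero ⊎ z ≡ zero → AG x y z
        tetra {x} {y} {z} (p , q , r) h = fin (side x h₁) (side y h₂) (side z h₃)
          where
          open Glue gl
          side : ∀ x → (x ≡ zero ⊎ Adj G zero x) → ∃ λ s → x ≡ f₂ s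
          side x (inj₁ refl) = 3F , refl
          side x (inj₂ k) = let s , e = Glue.pull (glue-swap gl) {3F} (λ { 0F () ; 1F () ; 2F () }) k in s , e
          h₁ : x ≡ zero ⊎ Adj G zero x
          h₁ = [ inj₁ , [ (λ { refl → inj₂ (Adj-sym G p) }) , (λ { refl → inj₂ r }) ]′ ]′ h
          h₂ : y ≡ zero ⊎ Adj G zero y
          h₂ = [ (λ { refl → inj₂ p }) , [ inj₁ , (λ { refl → inj₂ (Adj-sym G q) }) ]′ ]′ h
          h₃ : z ≡ zero ⊎ Adj G zero z
          h₃ = [ (λ { refl → inj₂ (Adj-sym G r) }) , [ (λ { refl → inj₂ q }) , inj₁ ]′ ]′ h
          fin : (∃ λ s → x ≡ f₂ s) → (∃ λ s → y ≡ f₂ s) → (∃ λ s → z ≡ f₂ s) → AG x y z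
          fin (x' , refl) (y' , refl) (z' , refl) = proj₂ (proj₂ (proj₂ R)) x' y' z'
            (wheel-TriFace W {x'} {y'} {z'} (down₂ {x'} {y'} p , down₂ {y'} {z'} q , down₂ {z'} {x'} r))
            λ (s₁ , s₂ , s₃) → [ bad s₁ , [ bad s₂ , bad s₃ ]′ ]′ h
            where
            bad : ∀ {s} → s ≡ 0F ⊎ s ≡ 1F ⊎ s ≡ 2F → f₂ s ≢ zero
            bad (inj₁ refl) ()
            bad (inj₂ (inj₁ refl)) ()
            bad (inj₂ (inj₂ refl)) ()

        corner-touch : ∀ i {x y z x' y' z'} → Deg3 B (cor i) x y z → lab (cor i) x ≡ x' → lab (cor i) y ≡ y' → lab (cor i) z ≡ z' →
          x' ≡ zero ⊎ y' ≡ zero ⊎ z' ≡ zero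
        corner-touch i d' refl refl refl with deg3-faces E d' (zero-face i)
        ... | inj₁ e = inj₁ (sym e)
        ... | inj₂ (inj₁ e) = inj₂ (inj₁ (sym e))
        ... | inj₂ (inj₂ e) = inj₂ (inj₂ (sym e))

        down-face : ∀ {h f} → h ≢ t → HasFace E (pt h) f → ∃ λ f' → f ≡ suc f' × HasFace E' h f'
        down-face {h} n (x , k , refl) = lab' h (κ⁻ x) , old-lab n k , κ⁻ x , κ⁻-adj n {x} k , refl
        up-face : ∀ {h f} → h ≢ t → HasFace E' h f → HasFace E (pt h) (suc f)
        up-face {h} n (x , k , refl) = κ h x , κ-adj n k , trans (old-lab n (κ-adj n k)) (cong (λ z → suc (lab' h z)) (κ⁻-κ h x))

        avail : ∀ {x y z} → Cov E x y z → AG x y z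
        avail cv@(mkCov {h} {a'} {b'} {c'} d' refl refl refl) = go (cview h) d'
          where
          go : ∀ {h a' b' c'} → CView h → (d' : Deg3 B h a' b' c') → AG (lab h a') (lab h b') (lab h c')
          go (corner i) d' = tetra (cov-triangle {E = E} (mkCov d' refl refl refl)) (corner-touch i d' refl refl refl)
          go {h} {a'} {b'} {c'} (old s n) d' = cov≡ (sym (old-lab n (Deg3.ax d'))) (sym (old-lab n (Deg3.ay d'))) (sym (old-lab n (Deg3.az d')))
              (proj₁ (proj₂ (proj₂ R)) _ _ _ (Gd.avail (mkCov ds refl refl refl)) ns)
            where
            ds : Deg3 H s (κ⁻ a') (κ⁻ b') (κ⁻ c')
            ds = deg-old⁻ n d'
            cov≡ : ∀ {x y z x' y' z'} → x ≡ x' → y ≡ y' → z ≡ z' → AG x y z → AG x' y' z'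
            cov≡ refl refl refl q = q
            -- A surviving vertex with the faces of `t` would lose its triangle to the gluing; the
            -- clause `distinct` for `H` excludes this.
            ns : ¬ Same (lab' s (κ⁻ a')) (lab' s (κ⁻ b')) (lab' s (κ⁻ c')) (tri u v w)
            ns (s₁ , s₂ , s₃) = n (Gd.distinct ds d inc)
              where
              at-t : ∀ {f} → f ≡ u ⊎ f ≡ v ⊎ f ≡ w → HasFace E' t f
              at-t (inj₁ refl) = a , D.ax , refl
              at-t (inj₂ (inj₁ refl)) = b , D.ay , refl
              at-t (inj₂ (inj₂ refl)) = c , D.az , refl
              inc : ∀ {f} → HasFace E' s f → HasFace E' t f
              inc k with deg3-faces E' ds k
              ... | inj₁ refl = at-t s₁
              ... | inj₂ (inj₁ refl) = at-t s₂
              ... | inj₂ (inj₂ refl) = at-t s₃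

        u≢v : u ≢ v
        u≢v = adj≢ G' (proj₁ triG')
        v≢w : v ≢ w
        v≢w = adj≢ G' (proj₁ (proj₂ triG'))
        w≢u : w ≢ u
        w≢u = adj≢ G' (proj₂ (proj₂ triG'))
        p-faces : ∀ {f} → HasFace E (pt t) f → f ≡ zero ⊎ f ≡ suc w ⊎ f ≡ suc u
        p-faces k with deg3-faces E deg-p k
        ... | inj₁ e = inj₁ (trans e inner)
        ... | inj₂ (inj₁ e) = inj₂ (inj₁ (trans e (BD.lab-pr E pr-q inner)))
        ... | inj₂ (inj₂ e) = inj₂ (inj₂ (trans e (BD.lab-pa E pr-q inner)))
        q-faces : ∀ {f} → HasFace E zero f → f ≡ suc u ⊎ f ≡ zero ⊎ f ≡ suc v
        q-faces k with deg3-faces E deg-q k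
        ... | inj₁ e = inj₁ (trans e (BD.lab-qp E pr-q inner))
        ... | inj₂ (inj₁ e) = inj₂ (inj₁ (trans e (BD.inner-q E pr-q inner)))
        ... | inj₂ (inj₂ e) = inj₂ (inj₂ (trans e (BD.lab-qb E pr-q inner)))
        r-faces : ∀ {f} → HasFace E (suc zero) f → f ≡ suc v ⊎ f ≡ zero ⊎ f ≡ suc w
        r-faces k with deg3-faces E deg-r k
        ... | inj₁ e = inj₁ (trans e (BD.lab-rq E pr-q inner))
        ... | inj₂ (inj₁ e) = inj₂ (inj₁ (trans e (BD.inner-r E pr-q inner)))
        ... | inj₂ (inj₂ e) = inj₂ (inj₂ (trans e (BD.lab-rc E pr-q inner)))
        none3 : ∀ {x y z} → z ≢ x → z ≢ y → ¬ (Fin.suc z ≡ zero ⊎ suc z ≡ suc x ⊎ Fin.suc {m} z ≡ suc y)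
        none3 n₁ n₂ = [ (λ ()) , [ n₁ ∘ fsuc-inj , n₂ ∘ fsuc-inj ]′ ]′
        mid0 : ∀ {x y : Fin (suc m)} {f} → f ≡ x ⊎ f ≡ zero ⊎ f ≡ y → f ≡ zero ⊎ f ≡ x ⊎ f ≡ y
        mid0 = [ inj₂ ∘ inj₁ , [ inj₁ , inj₂ ∘ inj₂ ]′ ]′
        face-pu : HasFace E (pt t) (suc u)
        face-pu = pt a , pa , BD.lab-pa E pr-q inner
        face-pw : HasFace E (pt t) (suc w)
        face-pw = suc zero , Deg3.ay deg-p , BD.lab-pr E pr-q inner
        face-qu : HasFace E zero (suc u)
        face-qu = pt t , Deg3.ax deg-q , BD.lab-qp E pr-q inner
        face-qv : HasFace E zero (suc v)
        face-qv = pt b , Deg3.az deg-q , BD.lab-qb E pr-q inner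
        face-rv : HasFace E (suc zero) (suc v)
        face-rv = zero , tt , BD.lab-rq E pr-q inner
        face-rw : HasFace E (suc zero) (suc w)
        face-rw = pt c , Deg3.az deg-r , BD.lab-rc E pr-q inner

        -- Besides `zero`, the corners see the faces `w u`, `u v` and `v w`, so each of them misses
        -- a different one.
        corners : ∀ i j → (∀ {f} → HasFace E (cor i) f → HasFace E (cor j) f) → i ≡ j
        corners 0F 0F _ = refl
        corners 1F 1F _ = refl
        corners 2F 2F _ = refl
        corners 0F 1F inc = ⊥-elim (none3 w≢u (v≢w ∘ sym) (mid0 (q-faces (inc face-pw))))
        corners 0F 2F inc = ⊥-elim (none3 u≢v (w≢u ∘ sym) (mid0 (r-faces (inc face-pu))))
        corners 1F 0F inc = ⊥-elim (none3 v≢w (u≢v ∘ sym) (p-faces (inc face-qv)))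
        corners 1F 2F inc = ⊥-elim (none3 u≢v (w≢u ∘ sym) (mid0 (r-faces (inc face-qu))))
        corners 2F 0F inc = ⊥-elim (none3 v≢w (u≢v ∘ sym) (p-faces (inc face-rv)))
        corners 2F 1F inc = ⊥-elim (none3 w≢u (v≢w ∘ sym) (mid0 (q-faces (inc face-rw))))

        distinct : ∀ {h a b c h' a' b' c'} → CView h → CView h' → Deg3 B h a b c → Deg3 B h' a' b' c' →
          (∀ {f} → HasFace E h f → HasFace E h' f) → h ≡ h'
        distinct (corner i) (corner j) d₁ d₂ inc = cong cor (corners i j inc)
        distinct (corner i) (old s n) d₁ d₂ inc = ⊥-elim (no-zero n (inc (zero-face i)))
        distinct (old s n) (corner j) d₁ d₂ inc = ⊥-elim (no-zero n (faces-flip E d₁ d₂ inc (zero-face j)))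
        distinct (old s n) (old s' n') d₁ d₂ inc = cong pt (Gd.distinct (deg-old⁻ n d₁) (deg-old⁻ n' d₂) (λ k → lower (down-face n' (inc (up-face n k)))))
          where
          lower : ∀ {f} → (∃ λ f' → Fin.suc f ≡ suc f' × HasFace E' s' f') → HasFace E' s' f
          lower (_ , refl , k) = k

      result : Σ (Tri G) λ AG → Glued G AG × Good E AG
      result = AG , proj₁ (proj₂ R) , record { avail = avail ; distinct = λ {h} {a} {b} {c} {h'} → distinct (cview h) (cview h') }

glued-iso : ∀ {G G* A} → Glued G A → (J : Iso G G*) →
  Σ (Tri G*) λ A* → Glued G* A* × (∀ x y z → A x y z → A* (Iso.to J x) (Iso.to J y) (Iso.to J z))
glued-iso {G} {G*} (piece (k , w)) J = TriFace G* , piece W , λ x y z h → wheel-TriFace W (iso-triangle J (TriFace→triangle h))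
  where
  W : IsWheel G*
  W = k , iso→≅ (iso-trans (iso-sym J) (≅→iso w))
glued-iso {G} {G*} (glue {A₁ = A₁} {A₂} g₁ g₂ a₁ a₂ g) J with glueIt (glue-out gl J) g₁ g₂ a₁ a₂
  where gl = FromGlueOf.toGlue g (glued-triangle g₁ a₁) (glued-triangle g₂ a₂)
... | A , gd , i₁ , i₂ = A , gd , inc
  where
  inc : ∀ x y z → glueAvail g A₁ A₂ x y z → A (Iso.to J x) (Iso.to J y) (Iso.to J z)
  inc x y z (inj₁ (a , b , c , h , ns , refl , refl , refl)) = i₁ a b c h ns
  inc x y z (inj₂ (a , b , c , h , ns , refl , refl , refl)) = i₂ a b c h ns

good-out : ∀ {H G G°} (E : LE H G) (J : Iso G G°) {A° : Tri G°} {A : Tri G} → Good (transportLE iso-refl J E) A° →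
  (∀ x y z → A° x y z → A (Iso.from J x) (Iso.from J y) (Iso.from J z)) → Good E A
good-out {H} {G} E J {A°} {A} g inc = record
  { avail = λ {x} {y} {z} c → back (inc _ _ _ (Good.avail g (cov-iso J c)))
  ; distinct = λ d d' i → Good.distinct g d d' λ (x , k , e) → let y , l , q = i (x , k , from-eq e) in y , l , trans (cong to q) (tofrom _) }
  where
  open Iso J
  from-eq : ∀ {a b} → to a ≡ b → a ≡ from b
  from-eq refl = sym (fromto _)
  back : ∀ {x y z} → A (from (to x)) (from (to y)) (from (to z)) → A x y z
  back {x} {y} {z} h rewrite fromto x | fromto y | fromto z = h

fwd-iso : ∀ {H H'} → Iso H H' → Fwd H' → Fwd H
fwd-iso {H} {H'} I fw {G} E with fw (transportLE I iso-refl E)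
... | A , gd , g = A , gd , record { avail = λ c → Good.avail g (cov-up c)
    ; distinct = λ d d' i → to-inj (Good.distinct g (iso-Deg3 I d) (iso-Deg3 I d') λ k → hf-up (i (hf-down k))) }
  where
  open Iso I
  E° = transportLE I iso-refl E
  ev : ∀ h a → LE.lab E° (to h) (to a) ≡ LE.lab E h a
  ev h a = cong₂ (LE.lab E) (fromto h) (fromto a)
  cov-up : ∀ {x y z} → Cov E x y z → Cov E° x y z
  cov-up (mkCov {h} {a} {b} {c} d refl refl refl) = mkCov (iso-Deg3 I d) (ev h a) (ev h b) (ev h c)
  hf-up : ∀ {h f} → HasFace E h f → HasFace E° (to h) f
  hf-up {h} (x , k , refl) = to x , iso-adj I k , ev h x
  hf-down : ∀ {h f} → HasFace E° (to h) f → HasFace E h f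
  hf-down {h} (x , k , refl) = from x , iso-adj⁻ I (subst (Adj H' (to h)) (sym (tofrom x)) k) , cong (λ z → LE.lab E z (from x)) (sym (fromto h))

-- It suffices to treat embeddings in which a chosen face is called zero.
fwd-relabel : ∀ {H G} (E : LE H G) (u v : V H) →
  (∀ {m a sy irr} → let G° = record { n = suc m ; adj = a ; adj-sym = sy ; adj-irr = irr } in (E° : LE H G°) →
    (∀ x y → LE.rt E° x y ≡ LE.rt E x y) → LE.lab E° u v ≡ zero → Σ (Tri G°) λ A → Glued G° A × Good E° A) →
  Σ (Tri G) λ A → Glued G A × Good E A
fwd-relabel {H} {G} E u v k =
  let A° , gd° , good° = k {m} {a} {sy} {irr} (transportLE iso-refl iso E) (λ _ _ → refl) to-f
      A , gd , inc = glued-iso gd° (iso-sym iso)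
  in A , gd , good-out E iso good° inc
  where open Pointed (relabel G (LE.lab E u v))

blow-fwd : ∀ {H t a b c} (d : Deg3 H t a b c) → Fwd H → Fwd (blow H t a b c)
blow-fwd {H} {t} {a} d ih {G} E₀ = go (rot3-cases (LE.ro E₀) dp)
  where
  open Blow d
  dp : Deg3 B (pt t) (suc zero) zero (pt a)
  dp = deg3-swap (deg3-rot deg-p)
  oriented : (E : LE B G) → LE.rt E (pt t) (suc zero) ≡ zero → Σ (Tri G) λ A → Glued G A × Good E A
  oriented E e = fwd-relabel E (pt t) zero λ {m} {A} {sy} {irr} E° er inner →
    BlowStep.Base.result d ih {m} {A} {sy} {irr} E° (trans (er (pt t) (suc zero)) e) inner
  go : _ → Σ (Tri G) λ A → Glued G A × Good E₀ A
  go (inj₁ e) = oriented E₀ e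
  go (inj₂ e) = let A , gd , g = oriented (mirror E₀) (trans (cong (LE.rt (mirror E₀) (pt t)) (sym (proj₂ (rot3 (LE.ro E₀) (deg3-swap dp) e))))
                      (mirror-rt E₀ {pt t} {zero} (Deg3.ay dp)))
                in A , gd , good-mirror {E = E₀} g

deg3-relist : ∀ {G h x y z u v w} → Deg3 G h x y z → Adj G h u → Adj G h v → Adj G h w → u ≢ v → v ≢ w → u ≢ w → Deg3 G h u v w
deg3-relist d = deg3-with3 (Deg3→deg d)

-- If `X` and `Y` were equal, `p` and `r` would have the same faces, which the invariant for `H`
-- forbids. Hence the merged face `T` is a cubic vertex of `G'` with neighbours `B`, `X`, `Y`, where
-- `B` is adjacent to the other two, and `split-glued` applies to it.
module SubStep {H : Graph} {p r s p' r' : V H} (dp : Deg3 H p r s p') (dr : Deg3 H r p s r') (C : Conn3 H) (ih : Fwd H)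
  {m : ℕ} {A : Fin (suc m) → Fin (suc m) → Bool} {sy : ∀ x y → A x y ≡ A y x} {irr : ∀ x → A x x ≡ false} where
  open Sub dp dr
  private
    module SD = SubDown dp dr C {m} {A} {sy} {irr}
    module P = Deg3 dp
    module R = Deg3 dr
  G : Graph
  G = SD.G

  module _ (E : LE S G) (qs-r : LE.rt E zero (suc s) ≡ suc r) (inner : LE.lab E zero (suc r) ≡ zero) where
    private
      open LE E using (lab)
      module LS = LE E
      G' : Graph
      G' = SD.G' E qs-r inner
      E' : LE H G'
      E' = SD.down E qs-r inner
      module L' = LE E'
      lab' : V H → V H → V G'
      lab' = L'.lab
      IH : Σ (Tri G') λ A' → Glued G' A' × Good E' A'
      IH = ih E'
      module Gd = Good (proj₂ (proj₂ IH))
      Tf Bf Xf Yf : V G'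
      Tf = SD.Tf E qs-r inner
      Bf = lab' r p
      Xf = lab' p s
      Yf = lab' s r
      at' : TriangleAt E' p r s
      at' = SD.tri E qs-r inner
      open TriangleAt at'
      T≡ : lab' p r ≡ Tf
      T≡ = SD.T≡ E qs-r inner
      pp'-B : lab' p p' ≡ Bf
      pp'-B = L'.turn P.ax (proj₁ (rot3 L'.ro (deg3-rot (deg3-rot (deg3-swap dp))) at-p))
      rr'-Y : lab' r r' ≡ Yf
      rr'-Y = L'.turn R.ay (proj₁ (rot3 L'.ro dr at-r))
      rs-T : lab' r s ≡ Tf
      rs-T = trans (L'.turn R.ax at-r) T≡
      cp : Cov E' Tf Xf Bf
      cp = mkCov dp T≡ refl pp'-B
      cr : Cov E' Bf Tf Yf
      cr = mkCov dr refl rs-T rr'-Y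
      tp : Triangle G' Tf Xf Bf
      tp = cov-triangle {E = E'} cp
      tr : Triangle G' Bf Tf Yf
      tr = cov-triangle {E = E'} cr
      p-faces : ∀ {f} → HasFace E' p f → f ≡ Tf ⊎ f ≡ Xf ⊎ f ≡ Bf
      p-faces k = [ (λ e → inj₁ (trans e T≡)) , [ inj₂ ∘ inj₁ , (λ e → inj₂ (inj₂ (trans e pp'-B))) ]′ ]′ (deg3-faces E' dp k)
      X≢Y : Xf ≢ Yf
      X≢Y e = p≢r (Gd.distinct dp dr inc)
        where
        inc : ∀ {f} → HasFace E' p f → HasFace E' r f
        inc k with p-faces k
        ... | inj₁ refl = s , R.ay , rs-T
        ... | inj₂ (inj₁ q) = r' , R.az , trans rr'-Y (sym (trans q e))
        ... | inj₂ (inj₂ refl) = p , R.ax , refl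
      B≢Y : Bf ≢ Yf
      B≢Y = SD.B≢Y E qs-r inner
      T≢Y : Tf ≢ Yf
      T≢Y = SD.T≢Y E qs-r inner
      T≢X : Tf ≢ Xf
      T≢X = adj≢ G' (proj₁ tp)
      X≢B : Xf ≢ Bf
      X≢B = adj≢ G' (proj₁ (proj₂ tp))
      B≢T : Bf ≢ Tf
      B≢T = adj≢ G' (proj₂ (proj₂ tp))
      T-darts : ∀ {u v} → Adj H u v → lab' u v ≡ Tf → (u ≡ p × v ≡ r) ⊎ (u ≡ r × v ≡ s) ⊎ (u ≡ s × v ≡ p)
      T-darts k e = face3-darts E' P.ax R.ay (Adj-sym H P.ay) at-r at-s at-p k (trans e (sym T≡))
      degT : Deg3 G' Tf Bf Xf Yf
      degT = mkD3 (Adj-sym G' (proj₂ (proj₂ tp))) (proj₁ tp) (proj₁ (proj₂ tr)) (X≢B ∘ sym) X≢Y B≢Y al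
        where
        al : ∀ w → Adj G' Tf w → w ≡ Bf ⊎ w ≡ Xf ⊎ w ≡ Yf
        al w k with L'.dual→ Tf w k
        ... | u , v , l , e , refl with T-darts l e
        ... | inj₁ (refl , refl) = inj₁ refl
        ... | inj₂ (inj₁ (refl , refl)) = inj₂ (inj₂ refl)
        ... | inj₂ (inj₂ (refl , refl)) = inj₂ (inj₁ refl)
      I : Iso G (sub G' Tf Yf Bf)
      I = SD.split E qs-r inner X≢Y
      SG : SplitGlued (proj₁ IH) I
      SG = split-glued (proj₁ (proj₂ IH)) degT (Adj-sym G' (proj₁ (proj₂ tp))) (Adj-sym G' (proj₂ (proj₂ tr))) I
      module SG = SplitGlued SG

      data Kind : V S → Set where
        isq : Kind zero
        isp : Kind (suc p)
        isr : Kind (suc r)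
        iss : Kind (suc s)
        old : ∀ h → h ≢ p → h ≢ r → h ≢ s → Kind (suc h)
      kind : ∀ h → Kind h
      kind zero = isq
      kind (suc h) with h ≟ p | h ≟ r | h ≟ s
      ... | yes refl | _ | _ = isp
      ... | no _ | yes refl | _ = isr
      ... | no _ | no _ | yes refl = iss
      ... | no a | no b | no c = old h a b c

      lab-old : ∀ {h x} → h ≢ p → h ≢ r → h ≢ s → Adj S (suc h) (suc x) → lab (suc h) (suc x) ≡ suc (lab' h x)
      lab-old a b c k = SD.lab-oo E qs-r inner k (b ∘ proj₁)

      down-face : ∀ {h f} → h ≢ p → h ≢ r → h ≢ s → HasFace E (suc h) f → ∃ λ f' → f ≡ suc f' × HasFace E' h f'
      down-face {h} a b c (x , k , refl) with nbr-old a b c x k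
      ... | x' , refl , k' = lab' h x' , lab-old a b c k , x' , k' , refl
      up-face : ∀ {h f} → h ≢ p → h ≢ r → h ≢ s → HasFace E' h f → HasFace E (suc h) (suc f)
      up-face {h} a b c (x , k , refl) = suc x , l , lab-old a b c l
        where
        l : Adj S (suc h) (suc x)
        l = old-i k (a ∘ proj₁) (b ∘ proj₁)
      no-T : ∀ {h} → h ≢ p → h ≢ r → h ≢ s → ¬ HasFace E' h Tf
      no-T a b c (x , k , e) = [ a ∘ proj₁ , [ b ∘ proj₁ , c ∘ proj₁ ]′ ]′ (T-darts k e)

      q-T : HasFace E zero (suc Tf)
      q-T = suc s , Deg3.az deg-q , SD.lab-qs E qs-r inner
      q-0 : HasFace E zero zero
      q-0 = suc r , Deg3.ay deg-q , inner
      p-T : HasFace E (suc p) (suc Tf)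
      p-T = zero , Deg3.ax deg-p , SD.lab-pq E qs-r inner
      p-X : HasFace E (suc p) (suc Xf)
      p-X = suc s , Deg3.ay deg-p , SD.lab-ps E qs-r inner
      r-0 : HasFace E (suc r) zero
      r-0 = suc s , Deg3.ay deg-r , SD.inner-r E qs-r inner
      r-Y : HasFace E (suc r) (suc Yf)
      r-Y = suc r' , Deg3.az deg-r , SD.lab-rr' E qs-r inner
      s-0 : HasFace E (suc s) zero
      s-0 = zero , mem3-i (inj₂ (inj₂ refl)) , SD.inner-s E qs-r inner

      touching : ∀ {h} → Kind h → (∃ λ f → HasFace E h f × Touch Tf f) ⊎ ∃ λ h' → h ≡ suc h' × h' ≢ p × h' ≢ r × h' ≢ s
      touching isq = inj₁ (zero , q-0 , inj₁ refl)
      touching isp = inj₁ (suc Tf , p-T , inj₂ refl)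
      touching isr = inj₁ (zero , r-0 , inj₁ refl)
      touching iss = inj₁ (zero , s-0 , inj₁ refl)
      touching (old h a b c) = inj₂ (h , refl , a , b , c)

      avail : ∀ {x y z} → Cov E x y z → SG.A x y z
      avail (mkCov {h} {a} {b} {c} d refl refl refl) with touching (kind h)
      ... | inj₁ (f , k , t) = SG.new _ _ _ (cov-triangle {E = E} (mkCov d refl refl refl)) (sel (deg3-faces E d k) t)
        where
        sel : ∀ {f} → f ≡ lab h a ⊎ f ≡ lab h b ⊎ f ≡ lab h c → Touch Tf f → Touch Tf (lab h a) ⊎ Touch Tf (lab h b) ⊎ Touch Tf (lab h c)
        sel (inj₁ refl) t = inj₁ t
        sel (inj₂ (inj₁ refl)) t = inj₂ (inj₁ t)
        sel (inj₂ (inj₂ refl)) t = inj₂ (inj₂ t)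
      ... | inj₂ (h' , refl , n₁ , n₂ , n₃) with deg-old⁻ n₁ n₂ n₃ d
      ... | a' , b' , c' , refl , refl , refl , d' = A≡ (ev (Deg3.ax d)) (ev (Deg3.ay d)) (ev (Deg3.az d))
              (SG.old _ _ _ (Gd.avail (mkCov d' refl refl refl)) (nt (Deg3.ax d')) (nt (Deg3.ay d')) (nt (Deg3.az d')))
        where
        A≡ : ∀ {x y z x' y' z'} → x ≡ x' → y ≡ y' → z ≡ z' → SG.A x' y' z' → SG.A x y z
        A≡ refl refl refl q = q
        ev : ∀ {x} → Adj S (suc h') (suc x) → lab (suc h') (suc x) ≡ suc (lab' h' x)
        ev = lab-old n₁ n₂ n₃
        nt : ∀ {x} → Adj H h' x → lab' h' x ≢ Tf
        nt k e = no-T n₁ n₂ n₃ (_ , k , e)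

      -- With only `r`, `q` and `p` around it, turning at `s` would lead from the dart `p s` to the
      -- dart `s r`, and their faces are `X` and `Y`.
      s-not-cubic : ∀ {x y z} → ¬ Deg3 S (suc s) x y z
      s-not-cubic d = X≢Y (fsuc-inj (trans (sym (SD.lab-ps E qs-r inner))
          (trans (sym (LS.turn {suc s} {suc p} {suc r} sp (proj₂ (rot3 LS.ro ds rt-sr)))) (SD.lab-sr E qs-r inner))))
        where
        sp : Adj S (suc s) (suc p)
        sp = Adj-sym S {suc p} {suc s} (Deg3.ay deg-p)
        ds : Deg3 S (suc s) (suc r) zero (suc p)
        ds = deg3-relist d (Adj-sym S {suc r} {suc s} (Deg3.ay deg-r)) (mem3-i (inj₂ (inj₂ refl))) sp (λ ()) (λ ()) (suc≢ (p≢r ∘ sym))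
        rt-sr : LE.rt E (suc s) (suc r) ≡ zero
        rt-sr = SD.rt-sr E qs-r inner

      q-faces : ∀ {f} → HasFace E zero f → f ≡ suc Bf ⊎ f ≡ zero ⊎ f ≡ suc Tf
      q-faces k = [ (λ e → inj₁ (trans e (SD.lab-qp E qs-r inner))) , [ (λ e → inj₂ (inj₁ (trans e inner))) ,
        (λ e → inj₂ (inj₂ (trans e (SD.lab-qs E qs-r inner)))) ]′ ]′ (deg3-faces E deg-q k)
      r-faces : ∀ {f} → HasFace E (suc r) f → f ≡ suc Bf ⊎ f ≡ zero ⊎ f ≡ suc Yf
      r-faces k = [ (λ e → inj₁ (trans e (SD.lab-rq E qs-r inner))) , [ (λ e → inj₂ (inj₁ (trans e (SD.inner-r E qs-r inner)))) ,
        (λ e → inj₂ (inj₂ (trans e (SD.lab-rr' E qs-r inner)))) ]′ ]′ (deg3-faces E deg-r k)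
      p-nonzero : ¬ HasFace E (suc p) zero
      p-nonzero k with deg3-faces E deg-p k
      ... | inj₁ e with () ← trans e (SD.lab-pq E qs-r inner)
      ... | inj₂ (inj₁ e) with () ← trans e (SD.lab-ps E qs-r inner)
      ... | inj₂ (inj₂ e) with () ← trans e (SD.lab-pp' E qs-r inner)
      apart : ∀ {x y z} → z ≢ x → z ≢ y → ¬ (Fin.suc {m} z ≡ suc x ⊎ Fin.suc {m} z ≡ zero ⊎ Fin.suc {m} z ≡ suc y)
      apart n₁ n₂ = [ n₁ ∘ fsuc-inj , [ (λ ()) , n₂ ∘ fsuc-inj ]′ ]′
      no-old : ∀ {h h' a b c a' b' c'} → Kind h → Deg3 S h a b c → h' ≢ p → h' ≢ r → h' ≢ s → Deg3 S (suc h') a' b' c' →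
        (∃ λ f → HasFace E h f × Touch Tf f) → ¬ (∀ {f} → HasFace E h f → HasFace E (suc h') f)
      no-old _ _ n₁ n₂ n₃ _ (f , k , t) inc with down-face n₁ n₂ n₃ (inc k) | t
      ... | f' , refl , k' | inj₂ refl = no-T n₁ n₂ n₃ k'
      ... | f' , refl , k' | inj₁ ()

      -- The faces are `B`, `zero`, `T` at `q`, then `B`, `zero`, `Y` at `r` and `T`, `X`, `B` at
      -- `p`, while an old vertex sees neither `zero` nor `T`.
      distinct : ∀ {h a b c h' a' b' c'} → Kind h → Kind h' → Deg3 S h a b c → Deg3 S h' a' b' c' →
        (∀ {f} → HasFace E h f → HasFace E h' f) → h ≡ h'
      distinct iss _ d _ _ = ⊥-elim (s-not-cubic d)
      distinct _ iss _ d _ = ⊥-elim (s-not-cubic d)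
      distinct isq isq _ _ _ = refl
      distinct isp isp _ _ _ = refl
      distinct isr isr _ _ _ = refl
      distinct isq isp _ _ inc = ⊥-elim (p-nonzero (inc q-0))
      distinct isr isp _ _ inc = ⊥-elim (p-nonzero (inc r-0))
      distinct isp isq _ _ inc = ⊥-elim (apart X≢B (T≢X ∘ sym) (q-faces (inc p-X)))
      distinct isr isq _ _ inc = ⊥-elim (apart (B≢Y ∘ sym) (T≢Y ∘ sym) (q-faces (inc r-Y)))
      distinct isp isr _ _ inc = ⊥-elim (apart (B≢T ∘ sym) T≢Y (r-faces (inc p-T)))
      distinct isq isr _ _ inc = ⊥-elim (apart (B≢T ∘ sym) T≢Y (r-faces (inc q-T)))
      distinct isq (old h a b c) d d' inc = ⊥-elim (no-old isq d a b c d' (zero , q-0 , inj₁ refl) inc)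
      distinct isp (old h a b c) d d' inc = ⊥-elim (no-old isp d a b c d' (suc Tf , p-T , inj₂ refl) inc)
      distinct isr (old h a b c) d d' inc = ⊥-elim (no-old isr d a b c d' (zero , r-0 , inj₁ refl) inc)
      distinct (old h a b c) isq d d' inc = ⊥-elim (no-old isq d' a b c d (zero , q-0 , inj₁ refl) (faces-flip E d d' inc))
      distinct (old h a b c) isp d d' inc = ⊥-elim (no-old isp d' a b c d (suc Tf , p-T , inj₂ refl) (faces-flip E d d' inc))
      distinct (old h a b c) isr d d' inc = ⊥-elim (no-old isr d' a b c d (zero , r-0 , inj₁ refl) (faces-flip E d d' inc))
      distinct (old h a b c) (old h' a' b' c') d d' inc with deg-old⁻ a b c d | deg-old⁻ a' b' c' d'
      ... | _ , _ , _ , _ , _ , _ , d₁ | _ , _ , _ , _ , _ , _ , d₂ =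
        cong suc (Gd.distinct d₁ d₂ λ k → lower (down-face a' b' c' (inc (up-face a b c k))))
        where
        lower : ∀ {f} → (∃ λ f' → Fin.suc f ≡ suc f' × HasFace E' h' f') → HasFace E' h' f
        lower (_ , refl , k) = k

    result : Σ (Tri G) λ AG → Glued G AG × Good E AG
    result = SG.A , SG.glued , record { avail = avail ; distinct = λ {h} {a} {b} {c} {h'} → distinct (kind h) (kind h') }

sub-fwd : ∀ {H p r s p' r'} (dp : Deg3 H p r s p') (dr : Deg3 H r p s r') → Conn3 H → Fwd H → Fwd (sub H p r s)
sub-fwd {H} {p} {r} {s} dp dr C ih {G} E₀ = go (rot3-cases (LE.ro E₀) dq)
  where
  open Sub dp dr
  dq : Deg3 S zero (suc s) (suc r) (suc p)
  dq = deg3-swap (deg3-rot (deg3-rot deg-q))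
  oriented : (E : LE S G) → LE.rt E zero (suc s) ≡ suc r → Σ (Tri G) λ A → Glued G A × Good E A
  oriented E e = fwd-relabel E zero (suc r) λ {m} {A} {sy} {irr} E° er inner →
    SubStep.result dp dr C ih {m} {A} {sy} {irr} E° (trans (er zero (suc s)) e) inner
  go : _ → Σ (Tri G) λ A → Glued G A × Good E₀ A
  go (inj₁ e) = oriented E₀ e
  go (inj₂ e) = let A , gd , g = oriented (mirror E₀) (trans (cong (LE.rt (mirror E₀) zero) (sym (proj₂ (rot3 (LE.ro E₀) (deg3-swap dq) e))))
                      (mirror-rt E₀ {zero} {suc r} (Deg3.ay dq)))
                in A , gd , good-mirror {E = E₀} g

module K4Fwd {G : Graph} (E : LE K4 G) (e₀ : LE.rt E 0F 1F ≡ 3F) where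
  open LE E
  private
    D : ∀ h x y z → h ≢ x → h ≢ y → h ≢ z → x ≢ y → y ≢ z → x ≢ z → Deg3 K4 h x y z
    D = K4-Deg3
    d0 : Deg3 K4 0F 1F 3F 2F
    d0 = D 0F 1F 3F 2F (λ ()) (λ ()) (λ ()) (λ ()) (λ ()) (λ ())
    d1 : Deg3 K4 1F 0F 2F 3F
    d1 = D 1F 0F 2F 3F (λ ()) (λ ()) (λ ()) (λ ()) (λ ()) (λ ())
    d2 : Deg3 K4 2F 0F 3F 1F
    d2 = D 2F 0F 3F 1F (λ ()) (λ ()) (λ ()) (λ ()) (λ ()) (λ ())
    d3 : Deg3 K4 3F 0F 1F 2F
    d3 = D 3F 0F 1F 2F (λ ()) (λ ()) (λ ()) (λ ()) (λ ()) (λ ())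
    r0 = rot3 ro d0 e₀
    -- Every triangle at 0 is a face, which determines the other three rotations.
    f013 : rt 3F 0F ≡ 1F × rt 1F 3F ≡ 0F
    f013 = face-of-cubic-triangle E {0F} {1F} {3F} d0 (deg3-swap d1) d3 e₀
    f032 : rt 2F 0F ≡ 3F × rt 3F 2F ≡ 0F
    f032 = face-of-cubic-triangle E {0F} {3F} {2F} (deg3-rot d0) (deg3-swap d3) d2 (proj₁ r0)
    f021 : rt 1F 0F ≡ 2F × rt 2F 1F ≡ 0F
    f021 = face-of-cubic-triangle E {0F} {2F} {1F} (deg3-rot (deg3-rot d0)) (deg3-swap d2) d1 (proj₂ r0)
    r2 = rot3 ro d2 (proj₁ f032)

    -- The face `L i` is the one that misses the vertex `i`, in accordance with `K4-lab`. Cubic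
    -- vertices are thus told apart by the face they do not see.
    L : V K4 → V G
    L 0F = lab 1F 3F
    L 1F = lab 0F 2F
    L 2F = lab 1F 0F
    L 3F = lab 0F 1F

    lab-L : ∀ u v → Adj K4 u v → lab u v ≡ L (K4-lab u v)
    lab-L 0F 0F ()
    lab-L 1F 1F ()
    lab-L 2F 2F ()
    lab-L 3F 3F ()
    lab-L 0F 1F _ = refl
    lab-L 1F 2F _ = turn {1F} {0F} tt (proj₁ f021)
    lab-L 2F 0F _ = trans (turn {2F} {1F} tt (proj₂ f021)) (lab-L 1F 2F tt)
    lab-L 0F 2F _ = refl
    lab-L 2F 3F _ = turn {2F} {0F} tt (proj₁ f032)
    lab-L 3F 0F _ = trans (turn {3F} {2F} tt (proj₂ f032)) (lab-L 2F 3F tt)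
    lab-L 1F 0F _ = refl
    lab-L 0F 3F _ = turn {0F} {1F} tt e₀
    lab-L 3F 1F _ = trans (turn {3F} {0F} tt (proj₁ f013)) (lab-L 0F 3F tt)
    lab-L 1F 3F _ = refl
    lab-L 3F 2F _ = turn {3F} {1F} tt (proj₁ (rot3 ro d3 (proj₁ f013)))
    lab-L 2F 1F _ = trans (turn {2F} {3F} tt (proj₁ r2)) (lab-L 3F 2F tt)

    L-adj : ∀ i j → i ≢ j → Adj G (L i) (L j)
    L-adj i j n with LE.dual→ K4-LE i j (not-i (n ∘ ==→))
    ... | u , v , k , refl , refl = subst₂ (Adj G) (lab-L u v k) (lab-L v u (Adj-sym K4 {u} {v} k)) (dual← u v k)
    L-inj : ∀ {i j} → L i ≡ L j → i ≡ j
    L-inj {i} {j} e with i ≟ j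
    ... | yes q = q
    ... | no n = ⊥-elim (adj≢ G (L-adj i j n) e)
    from : V G → V K4
    from f = let u , v , _ = lab-surj f in K4-lab u v
    tofrom : ∀ f → L (from f) ≡ f
    tofrom f with lab-surj f
    ... | u , v , k , e = trans (sym (lab-L u v k)) e
    I : Iso K4 G
    I = record { to = L ; from = from ; tofrom = tofrom ; fromto = λ x → L-inj (tofrom (L x))
      ; adj-to = λ u v → T-ext (λ h → not-i (λ e → adj≢ G h (cong L (==→ {x = u} {v} e)))) (λ h → L-adj u v (adj≢ K4 {u} {v} h)) }
    W : IsWheel G
    W = 0 , iso→≅ (iso-trans (iso-sym I) K4≅W0)

    own : ∀ h x → Adj K4 h x → K4-lab h x ≢ h
    own = toWitness {a? = all? λ h → all? λ x → T? (adj K4 h x) →-dec ¬? (K4-lab h x ≟ h)} _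
    others : ∀ h h' → h ≢ h' → ∃ λ x → Adj K4 h x × K4-lab h x ≡ h'
    others = toWitness {a? = all? λ h → all? λ h' → ¬? (h ≟ h') →-dec any? λ x → T? (adj K4 h x) ×-dec (K4-lab h x ≟ h')} _
    distinct : ∀ h h' → (∀ {f} → HasFace E h f → HasFace E h' f) → h ≡ h'
    distinct h h' inc with h ≟ h'
    ... | yes e = e
    ... | no n with others h h' n
    ... | x , k , e with inc (x , k , lab-L h x k)
    ... | y , l , q = ⊥-elim (own h' y l (trans (L-inj (trans (sym (lab-L h' y l)) q)) e))

  result : Σ (Tri G) λ A → Glued G A × Good E A
  result = TriFace G , piece W , record { avail = λ c → wheel-TriFace W (cov-triangle {E = E} c) ; distinct = λ {h} {_} {_} {_} {h'} _ _ → distinct h h' }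

K4-fwd : Fwd K4
K4-fwd {G} E = go (rot3-cases (LE.ro E) d0)
  where
  d0 : Deg3 K4 0F 1F 3F 2F
  d0 = K4-Deg3 0F 1F 3F 2F (λ ()) (λ ()) (λ ()) (λ ()) (λ ()) (λ ())
  go : LE.rt E 0F 1F ≡ 3F ⊎ LE.rt E 0F 1F ≡ 2F → Σ (Tri G) λ A → Glued G A × Good E A
  go (inj₁ e) = K4Fwd.result E e
  go (inj₂ e) = let A , gd , g = K4Fwd.result (mirror E) (trans (cong (LE.rt (mirror E) 0F) (sym (proj₂ (rot3 (LE.ro E) (deg3-swap d0) e))))
                      (mirror-rt E {0F} {3F} tt))
                in A , gd , good-mirror {E = E} g

forward : ∀ {H} → D3Reducible H → Fwd H
forward (done i) = fwd-iso (≅→iso i) K4-fwd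
forward (step (inj₁ a) d) = fwd-iso (FromD3a.iso a) (blow-fwd (FromD3a.deg-t a) (forward d))
forward (step (inj₂ b) d) = fwd-iso (FromD3b.iso b) (sub-fwd (FromD3b.dp b) (FromD3b.dr b) (conn3-D3 d) (forward d))

some-dart : ∀ {H} → D3Reducible H → Dart H
some-dart (done i) = (from 0F , from 1F) , subst T (sym (Iso.adj-from (≅→iso i) 0F 1F)) tt
  where open Iso (≅→iso i)
some-dart (step (inj₁ a) _) = (D3a.p a , D3a.q a) , D3a.pq a
some-dart (step (inj₂ b) _) = (D3b.p b , D3b.q b) , D3b.pq b

theorem9 : (G : Graph) →
    (Σ Graph λ H → D3Reducible H × IsDual G H) ⇔ GluedFromWheels G
theorem9 G = mk⇔
  (λ (H , red , dual) → let A , gd , _ = forward red (fromIsDual (some-dart red) dual) in A , gd)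
  (λ (A , gd) → let open Dualable (glued-dualable gd) in H , d3 , toIsDual E)
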